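{- There is a deterministic polynomial-time labeling scheme for $f$-vertex-fault-tolerant connectivity queries that outputs labels of length $O(f^7\log^{13} n)$ bits. That is, given an $n$-vertex graph $G=(V,E)$ and an integer $f\ge 1$, the algorithm deterministically computes in polynomial time a labeling function $L:V\to\{0,1\}^{O(f^7\log^{13} n)}$ such that, for every $s,t\in V$ and $F\subseteq V$ with $|F|\le f$, one can determine from $L(s)$, $L(t)$ and $\{L(v)\mid v\in F\}$ alone whether $s$ and $t$ are connected in $G-F$.
   Context: $G$ is an undirected graph with $n$ vertices, assumed connected without loss of generality. $G-F$ is the subgraph of $G$ induced by $V\setminus F$. A labeling scheme consists of a labeling algorithm which, given $G$ and $f$, assigns a bit string $L(v)$ to every vertex, and a query algorithm, not depending on $G$, which sees only the labels of the vertices in $\{s,t\}\cup F$. The length is the maximum number of bits of a label. -}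

module Defs where

open import Data.Bool using (Bool; true; false; T)
open import Data.Digit using (toDigits)
open import Data.Fin using (Fin)
open import Data.Fin.Properties using (2↔Bool)
open import Data.Fin.Subset using (Subset; _∈_; _∉_; ∁)
open import Data.List using (List; []; _∷_; _++_; map; concatMap; tabulate; takeWhileᵇ)
import Data.List.Membership.Propositional as List
open import Data.Maybe using (Maybe; just; nothing)
open import Data.Nat using (ℕ; zero; suc)
open import Data.Product using (_×_; _,_; ∃; ∃-syntax; proj₁)
open import Data.Vec using (Vec; _∷_; replicate; head; zipWith)
import Data.Vec as Vec
open import Function using (_∘_; _⇔_; Inverse)
open import Relation.Binary.Construct.Closure.ReflexiveTransitive using (Star)
open import Relation.Binary.PropositionalEquality using (_≡_)

record Graph (n : ℕ) : Set where
  field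
    adj    : Fin n → Fin n → Bool
    irrefl : ∀ u → adj u u ≡ false
    sym    : ∀ u v → adj u v ≡ adj v u

open Graph public

-- Edges of the subgraph induced by the vertex set U.
InducedEdge : ∀ {n} → Graph n → Subset n → Fin n → Fin n → Set
InducedEdge G U u v = u ∈ U × v ∈ U × T (adj G u v)

-- s and t are connected in G - F.  Both must be vertices of G - F, so the
-- relation is false as soon as s or t belongs to F.
ConnectedAvoiding : ∀ {n} → Graph n → Subset n → Fin n → Fin n → Set
ConnectedAvoiding G F s t =
  s ∈ ∁ F × t ∈ ∁ F × Star (InducedEdge G (∁ F)) s t

-- Deterministic multi-tape Turing machines.  The tape alphabet is fixed; larger
-- finite alphabets can be coded in it with constant-factor slowdown.

data Symbol : Set where
  blank sep : Symbol
  bit       : Bool → Symbol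

data Move : Set where
  left stay right : Move

-- A two-way infinite tape: the cells left of the head (nearest first), the
-- scanned cell, and the cells right of the head.  Unlisted cells are blank.
record Tape : Set where
  constructor tape
  field
    before  : List Symbol
    scanned : Symbol
    after   : List Symbol

open Tape public

write : Symbol → Tape → Tape
write a (tape ls _ rs) = tape ls a rs

move : Move → Tape → Tape
move stay  t                    = t
move left  (tape []       a rs) = tape [] blank (a ∷ rs)
move left  (tape (l ∷ ls) a rs) = tape ls l (a ∷ rs)
move right (tape ls a [])       = tape (a ∷ ls) blank []
move right (tape ls a (r ∷ rs)) = tape (a ∷ ls) r rs

record Machine : Set where
  field
    states    : ℕ
    workTapes : ℕ
    start     : Fin states
    -- nothing means halt
    δ         : Fin states → Vec Symbol (suc workTapes) →
                Maybe (Fin states × Vec (Symbol × Move) (suc workTapes))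

module _ (M : Machine) where
  open Machine M

  Config : Set
  Config = Fin states × Vec Tape (suc workTapes)

  step : Config → Maybe Config
  step (q , ts) with δ q (Vec.map scanned ts)
  ... | nothing         = nothing
  ... | just (q′ , acts) =
    just (q′ , zipWith (λ (a , m) t → move m (write a t)) acts ts)

  blankTape : Tape
  blankTape = tape [] blank []

  inputTape : List Symbol → Tape
  inputTape []       = blankTape
  inputTape (a ∷ as) = tape [] a as

  -- The first tape carries the input and, on halting, the output.
  initial : List Symbol → Config
  initial x = start , inputTape x ∷ replicate workTapes blankTape

  nonBlank : Symbol → Bool
  nonBlank blank = false
  nonBlank _     = true

  -- The output is read from the head rightwards up to the first blank.
  output : Config → List Symbol
  output (_ , ts) = takeWhileᵇ nonBlank (scanned (head ts) ∷ after (head ts))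

  -- nothing means that c does not reach a halting configuration in at most k steps
  run : ℕ → Config → Maybe (List Symbol)
  run k c with step c
  run k       c | nothing = just (output c)
  run zero    c | just _  = nothing
  run (suc k) c | just c′ = run k c′

-- M, started on x, halts after at most k steps with output y.
Computes : Machine → (k : ℕ) (x y : List Symbol) → Set
Computes M k x y = run M k (initial M x) ≡ just y

Label : Set
Label = List Bool

encodeWord : List Bool → List Symbol
encodeWord w = map bit w ++ sep ∷ []

encodeWords : List (List Bool) → List Symbol
encodeWords = concatMap encodeWord

binary : ℕ → List Bool
binary m = map (Inverse.to 2↔Bool) (proj₁ (toDigits 2 m))

-- The rows of the adjacency matrix, followed by f in binary
-- (least significant digit first).
encodeInstance : ∀ {n} → Graph n → ℕ → List Symbol
encodeInstance G f =
  encodeWords (tabulate (λ u → tabulate (adj G u)) ++ binary f ∷ [])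

encodeLabeling : ∀ {n} → (Fin n → Label) → List Symbol
encodeLabeling L = encodeWords (tabulate L)

encodeQuery : (ls lt : Label) → List Label → List Symbol
encodeQuery ls lt lF = encodeWords (ls ∷ lt ∷ lF)

-- The list xs presents the set { L v | v ∈ F }, in any order and with any
-- multiplicities: which label belongs to which fault is not revealed.
Presents : ∀ {n} → List Label → (Fin n → Label) → Subset n → Set
Presents xs L F = ∀ l → (l List.∈ xs) ⇔ (∃[ v ] (v ∈ F × L v ≡ l))

{-# OPTIONS --safe #-}
module Submission where

-- The graph is decomposed in about log n rounds.  In every round each component C loses a path P such that all components of
-- C - P have at most |C| / 2 vertices (a path separator, found by depth-first search).  So every vertex lies on one path, every
-- edge joins vertices whose components are nested, and a component without faults and query vertices only matters through the
-- set of its neighbours.  For two vertices joined by an edge or through such a component, one of them is found through a dyadic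
-- interval (hub) of the path of the other; the members of a hub on one path are linked by chords between consecutive members.
-- Which hubs and components are affected is not known in advance, but since only few are, some modulus of size
-- O(f (log n)²) separates a given hub, component and target from all of them.  Hence for each modulus and residues there is one
-- set of chords to be treated, and a query only has to find out which parts of the paths are joined by chords.
--
-- A label contains the position of its vertex v in this decomposition, representatives of hubs, and for every set of chords the
-- first power sums, modulo a prime, of the chords that pass over v.  Suppose that two graphs agree in the labels of the faults and
-- query vertices, and let χ be the indicator of the component of s in the first graph minus the faults.  It is constant between
-- the faults of a path, so by partial summation the power sums of the chords of the second graph whose ends are separated by χ,
-- with signs, vanish modulo the prime.  If they are few, there are none, by Vandermonde; that there are few is guaranteed by
-- passing to nets of nets of the set of chords.  So s and t are connected in the second graph only if they are in the first.
--
-- Therefore a query can be answered by searching for any graph with the given labels.  Everything is computed by a language of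
-- arithmetic expressions with bounded loops, which is compiled to Turing machines running in polynomial time.

-- The graph found by a search may differ from the true one, so the labels alone have to determine
-- the answer. Hence everything is stated for two graphs with equal labels: the cut lives in the
-- first, the chords in the second. The cut is carried over by coordinates (path and position); it
-- changes only behind a fault, and there the stored power sums can be compared.
--
-- Few power sums determine only sparse sets of chords, while a cut may cross many. The nets repair
-- this: each keeps every `g`-th chord of every dyadic strip and has at most half of the chords, so
-- some level is crossed while the next one is not. On that level every cell between the faults
-- holds at most `g` crossing chords.
--
-- Targets have a colour as well as hubs and links, because a member of a hub that is itself a fault
-- would join parts that are not connected.
--
-- The size comes from `M ^ 4` groups (a modulus of size `O(f log² n)` and three residues),
-- `O(log n)` levels, `O(f² log² n)` power sums and `O(log n)` bits for each: `O(f⁶ log¹² n)`, with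
-- one power of `f` and of `log n` to spare.

open import Data.Nat
open import Data.Nat.Properties
open import Data.Product using (_×_; _,_; proj₁; proj₂; ∃-syntax)
open import Relation.Binary.PropositionalEquality hiding ([_])

-- While programs on three stacks, and their compilation to Turing machines

module WhilePrograms where

  open import Defs hiding (sym)
  open import Data.Bool using (Bool; true; false)
  open import Data.Fin using (Fin; zero; suc; _↑ˡ_; _↑ʳ_; splitAt)
  open import Data.Fin.Properties using (splitAt-↑ˡ; splitAt-↑ʳ)
  open import Data.List using (List; []; _∷_; _++_; replicate; takeWhileᵇ)
  open import Data.Maybe using (Maybe; just; nothing; maybe)
  open import Data.List.Properties using (++-identityʳ)
  open import Data.Sum using (_⊎_; inj₁; inj₂)
  open import Data.Vec using (Vec; []; _∷_; lookup; updateAt; zipWith)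
  import Data.Vec as Vec

  Stk : Set
  Stk = List Symbol

  -- In compiled expressions stack 0 holds the environment, stack 1 the results, and stack 2 words
  -- in transit.
  St : Set
  St = Vec Stk 3

  pattern ⟪_,_,_⟫ a b c = a ∷ b ∷ c ∷ []

  hd : Stk → Symbol
  hd []      = blank
  hd (a ∷ _) = a

  tl : Stk → Stk
  tl []       = []
  tl (_ ∷ as) = as

  data Prog : Set where
    push : Fin 3 → Symbol → Prog
    pop  : Fin 3 → Prog
    nop  : Prog
    _▹_  : Prog → Prog → Prog
    ifp  : Fin 3 → (Symbol → Bool) → Prog → Prog → Prog
    while : Fin 3 → (Symbol → Bool) → Prog → Prog

  infixr 5 _▹_

  infix 4 _⊢_⇒_∣_
  -- The last index is the exact number of machine steps. A push takes two, since the head first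
  -- moves left and then writes; sequencing is free, because the last step of the first program
  -- jumps to the entry of the second.
  data _⊢_⇒_∣_ : Prog → St → St → ℕ → Set where
    push : ∀ {i a s} → push i a ⊢ s ⇒ updateAt s i (a ∷_) ∣ 2
    pop  : ∀ {i s} → pop i ⊢ s ⇒ updateAt s i tl ∣ 1
    nop  : ∀ {s} → nop ⊢ s ⇒ s ∣ 1
    _▹_  : ∀ {p q s s′ s″ t t′} → p ⊢ s ⇒ s′ ∣ t → q ⊢ s′ ⇒ s″ ∣ t′ → p ▹ q ⊢ s ⇒ s″ ∣ t + t′
    ifT  : ∀ {i P p q s s′ t} → P (hd (lookup s i)) ≡ true  → p ⊢ s ⇒ s′ ∣ t → ifp i P p q ⊢ s ⇒ s′ ∣ suc t
    ifF  : ∀ {i P p q s s′ t} → P (hd (lookup s i)) ≡ false → q ⊢ s ⇒ s′ ∣ t → ifp i P p q ⊢ s ⇒ s′ ∣ suc t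
    whT  : ∀ {i P p s s′ s″ t t′} → P (hd (lookup s i)) ≡ true → p ⊢ s ⇒ s′ ∣ t →
           while i P p ⊢ s′ ⇒ s″ ∣ t′ → while i P p ⊢ s ⇒ s″ ∣ suc (t + t′)
    whF  : ∀ {i P p s} → P (hd (lookup s i)) ≡ false → while i P p ⊢ s ⇒ s ∣ 1

  -- Compilation to Turing machines

  -- A transition that leaves the fragment (`nothing`) still acts on the tapes, so that leaving
  -- costs no step of its own.
  Sys : ℕ → Set
  Sys n = Fin n → Vec Symbol 3 → Maybe (Fin n) × Vec (Symbol × Move) 3

  keep : Vec Symbol 3 → Vec (Symbol × Move) 3
  keep = Vec.map (_, stay)

  sz : Prog → ℕ
  sz (push _ _) = 2
  sz (pop _) = 1
  sz nop = 1
  sz (p ▹ q) = sz p + sz q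
  sz (ifp _ _ p q) = suc (sz p + sz q)
  sz (while _ _ p) = suc (sz p)

  entry : (p : Prog) → Fin (sz p)
  entry (push _ _) = zero
  entry (pop _) = zero
  entry nop = zero
  entry (p ▹ q) = entry p ↑ˡ sz q
  entry (ifp _ _ p q) = zero
  entry (while _ _ p) = zero

  goto : ∀ {m n} → (Fin m → Fin n) → Maybe (Fin n) → Maybe (Fin m) × Vec (Symbol × Move) 3 →
         Maybe (Fin n) × Vec (Symbol × Move) 3
  goto φ k (just i , a)  = just (φ i) , a
  goto φ k (nothing , a) = k , a

  tr : (p : Prog) → Sys (sz p)
  trSeq : (p q : Prog) → Fin (sz p) ⊎ Fin (sz q) → Vec Symbol 3 → Maybe (Fin (sz p + sz q)) × Vec (Symbol × Move) 3
  trIf : (p q : Prog) → Fin (sz p) ⊎ Fin (sz q) → Vec Symbol 3 → Maybe (Fin (suc (sz p + sz q))) × Vec (Symbol × Move) 3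

  trSeq p q (inj₁ i) σ = goto (_↑ˡ sz q) (just (sz p ↑ʳ entry q)) (tr p i σ)
  trSeq p q (inj₂ i) σ = goto (sz p ↑ʳ_) nothing (tr q i σ)

  trIf p q (inj₁ i) σ = goto (λ j → suc (j ↑ˡ sz q)) nothing (tr p i σ)
  trIf p q (inj₂ i) σ = goto (λ j → suc (sz p ↑ʳ j)) nothing (tr q i σ)

  tr (push i a) zero       σ = just (suc zero) , updateAt (keep σ) i (λ (c , _) → c , left)
  tr (push i a) (suc zero) σ = nothing , updateAt (keep σ) i (λ _ → a , stay)
  tr (pop i) zero σ = nothing , updateAt (keep σ) i (λ _ → blank , right)
  tr nop zero σ = nothing , keep σ
  tr (p ▹ q) i σ = trSeq p q (splitAt (sz p) i) σ
  tr (ifp i P p q) zero σ with P (lookup σ i)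
  ... | true  = just (suc (entry p ↑ˡ sz q)) , keep σ
  ... | false = just (suc (sz p ↑ʳ entry q)) , keep σ
  tr (ifp i P p q) (suc j) σ = trIf p q (splitAt (sz p) j) σ
  tr (while i P p) zero σ with P (lookup σ i)
  ... | true  = just (suc (entry p)) , keep σ
  ... | false = nothing , keep σ
  tr (while i P p) (suc j) σ = goto suc (just zero) (tr p j σ)

  act : Vec (Symbol × Move) 3 → Vec Tape 3 → Vec Tape 3
  act = zipWith (λ (a , m) t → move m (write a t))

  data Steps {n} (δ : Sys n) : Fin n → Vec Tape 3 → ℕ → Vec Tape 3 → Set where
    last : ∀ {i T a} → δ i (Vec.map scanned T) ≡ (nothing , a) → Steps δ i T 1 (act a T)
    more : ∀ {i j T T′ a t} → δ i (Vec.map scanned T) ≡ (just j , a) → Steps δ j (act a T) t T′ → Steps δ i T (suc t) T′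

  module _ {m n} {δ : Sys m} {ε : Sys n} (φ : Fin m → Fin n) (k : Maybe (Fin n))
           (h : ∀ i σ → ε (φ i) σ ≡ goto φ k (δ i σ)) where

    embedNothing : k ≡ nothing → ∀ {i T t T′} → Steps δ i T t T′ → Steps ε (φ i) T t T′
    embedNothing refl {i} {T} (last e)   = last (trans (h i _) (cong (goto φ _) e))
    embedNothing refl {i} {T} (more e r) = more (trans (h i _) (cong (goto φ _) e)) (embedNothing refl r)

    embedJust : ∀ {j} → k ≡ just j → ∀ {i T t T′ t′ T″} → Steps δ i T t T′ → Steps ε j T′ t′ T″ →
                Steps ε (φ i) T (t + t′) T″
    embedJust refl {i} (last e)   r′ = more (trans (h i _) (cong (goto φ _) e)) r′
    embedJust refl {i} (more e r) r′ = more (trans (h i _) (cong (goto φ _) e)) (embedJust refl r r′)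

  -- The top of the stack is under the head and the stack extends to the right. A pop leaves a blank
  -- behind and may also run past the bottom, so a stack is represented only up to blanks on both
  -- sides.
  Rep : Stk → Tape → Set
  Rep xs t = ∃[ k ] ∃[ m ] (before t ≡ replicate k blank × scanned t ∷ after t ≡ xs ++ replicate m blank)

  record Reps (s : St) (T : Vec Tape 3) : Set where
    constructor reps
    field rep : ∀ i → Rep (lookup s i) (lookup T i)

  open Reps

  Rep-scanned : ∀ xs t → Rep xs t → scanned t ≡ hd xs
  Rep-scanned [] _ (_ , suc m , _ , refl) = refl
  Rep-scanned (x ∷ xs) _ (_ , _ , _ , refl) = refl

  Rep-push : ∀ {xs t} a → Rep xs t → Rep (a ∷ xs) (write a (move left (write (scanned t) t)))
  Rep-push {t = tape [] _ _} a (k , m , p , q) = 0 , m , refl , cong (a ∷_) q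
  Rep-push {t = tape (b ∷ bs) _ _} a (suc k , m , refl , q) = k , m , refl , cong (a ∷_) q

  Rep-pop : ∀ {xs t} → Rep xs t → Rep (tl xs) (move right (write blank t))
  Rep-pop {[]} {tape ls _ []} (k , suc m , refl , q) = suc k , 1 , refl , refl
  Rep-pop {[]} {tape ls _ (r ∷ rs)} (k , suc (suc m) , refl , refl) = suc k , suc m , refl , refl
  Rep-pop {x ∷ []} {tape ls _ []} (k , zero , refl , refl) = suc k , 1 , refl , refl
  Rep-pop {x ∷ []} {tape ls _ (r ∷ rs)} (k , suc m , refl , refl) = suc k , suc m , refl , refl
  Rep-pop {x ∷ y ∷ xs} {tape ls _ (r ∷ rs)} (k , m , refl , refl) = suc k , m , refl , refl

  act-keep : ∀ T → act (keep (Vec.map scanned T)) T ≡ T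
  act-keep (t ∷ u ∷ v ∷ []) = refl

  scanned-Reps : ∀ {s T} i → Reps s T → lookup (Vec.map scanned T) i ≡ hd (lookup s i)
  scanned-Reps {s} {t ∷ u ∷ v ∷ []} zero r = Rep-scanned _ t (rep r zero)
  scanned-Reps {s} {t ∷ u ∷ v ∷ []} (suc zero) r = Rep-scanned _ u (rep r (suc zero))
  scanned-Reps {s} {t ∷ u ∷ v ∷ []} (suc (suc zero)) r = Rep-scanned _ v (rep r (suc (suc zero)))

  pattern 0F = zero
  pattern 1F = suc zero
  pattern 2F = suc (suc zero)

  simulate : ∀ {p s s′ t T} → p ⊢ s ⇒ s′ ∣ t → Reps s T → ∃[ T′ ] (Steps (tr p) (entry p) T t T′ × Reps s′ T′)
  simulate {T = t ∷ u ∷ v ∷ []} (push {0F} {a} {x ∷ y ∷ z ∷ []}) r =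
    _ , more refl (last refl) , reps λ { 0F → Rep-push a (rep r 0F) ; 1F → rep r 1F ; 2F → rep r 2F }
  simulate {T = t ∷ u ∷ v ∷ []} (push {1F} {a} {x ∷ y ∷ z ∷ []}) r =
    _ , more refl (last refl) , reps λ { 1F → Rep-push a (rep r 1F) ; 0F → rep r 0F ; 2F → rep r 2F }
  simulate {T = t ∷ u ∷ v ∷ []} (push {2F} {a} {x ∷ y ∷ z ∷ []}) r =
    _ , more refl (last refl) , reps λ { 2F → Rep-push a (rep r 2F) ; 0F → rep r 0F ; 1F → rep r 1F }
  simulate {T = t ∷ u ∷ v ∷ []} (pop {0F} {x ∷ y ∷ z ∷ []}) r =
    _ , last refl , reps λ { 0F → Rep-pop (rep r 0F) ; 1F → rep r 1F ; 2F → rep r 2F }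
  simulate {T = t ∷ u ∷ v ∷ []} (pop {1F} {x ∷ y ∷ z ∷ []}) r =
    _ , last refl , reps λ { 1F → Rep-pop (rep r 1F) ; 0F → rep r 0F ; 2F → rep r 2F }
  simulate {T = t ∷ u ∷ v ∷ []} (pop {2F} {x ∷ y ∷ z ∷ []}) r =
    _ , last refl , reps λ { 2F → Rep-pop (rep r 2F) ; 0F → rep r 0F ; 1F → rep r 1F }
  simulate {T = T} nop r = _ , last refl , subst (Reps _) (sym (act-keep T)) r
  simulate (_▹_ {p} {q} d d′) r with simulate d r
  ... | T′ , st , r′ with simulate d′ r′
  ... | T″ , st′ , r″ = T″ ,
    embedJust (_↑ˡ sz q) _ (λ i σ → cong (λ w → trSeq p q w σ) (splitAt-↑ˡ (sz p) i (sz q))) refl st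
      (embedNothing (sz p ↑ʳ_) _ (λ i σ → cong (λ w → trSeq p q w σ) (splitAt-↑ʳ (sz p) (sz q) i)) refl st′) , r″
  simulate {T = T} (ifT {i} {P} {p} {q} {s} e d) r with simulate d r
  ... | T′ , st , r′ = T′ , more test st′ , r′
    where
    test : tr (ifp i P p q) zero (Vec.map scanned T) ≡ (just (suc (entry p ↑ˡ sz q)) , keep (Vec.map scanned T))
    test rewrite scanned-Reps i r | e = refl
    st′ = subst (λ w → Steps _ _ w _ _) (sym (act-keep T))
      (embedNothing (λ j → suc (j ↑ˡ sz q)) _ (λ j σ → cong (λ w → trIf p q w σ) (splitAt-↑ˡ (sz p) j (sz q))) refl st)
  simulate {T = T} (ifF {i} {P} {p} {q} {s} e d) r with simulate d r
  ... | T′ , st , r′ = T′ , more test st′ , r′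
    where
    test : tr (ifp i P p q) zero (Vec.map scanned T) ≡ (just (suc (sz p ↑ʳ entry q)) , keep (Vec.map scanned T))
    test rewrite scanned-Reps i r | e = refl
    st′ = subst (λ w → Steps _ _ w _ _) (sym (act-keep T))
      (embedNothing (λ j → suc (sz p ↑ʳ j)) _ (λ j σ → cong (λ w → trIf p q w σ) (splitAt-↑ʳ (sz p) (sz q) j)) refl st)
  simulate {T = T} (whT {i} {P} {p} e d d′) r with simulate d r
  ... | T′ , st , r′ with simulate d′ r′
  ... | T″ , st″ , r″ = T″ , more test st‴ , r″
    where
    test : tr (while i P p) zero (Vec.map scanned T) ≡ (just (suc (entry p)) , keep (Vec.map scanned T))
    test rewrite scanned-Reps i r | e = refl
    st‴ = subst (λ w → Steps _ _ w _ _) (sym (act-keep T)) (embedJust suc _ (λ j σ → refl) refl st st″)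
  simulate {T = T} (whF {i} {P} {p} {s} e) r = act (keep (Vec.map scanned T)) T , last test , subst (Reps s) (sym (act-keep T)) r
    where
    test : tr (while i P p) zero (Vec.map scanned T) ≡ (nothing , keep (Vec.map scanned T))
    test rewrite scanned-Reps i r | e = refl

  -- State `zero` is added as the halting state to which all exits lead.
  machineδ : (p : Prog) → Fin (suc (sz p)) → Vec Symbol 3 → Maybe (Fin (suc (sz p)) × Vec (Symbol × Move) 3)
  machineδ p zero    σ = nothing
  machineδ p (suc i) σ = just (maybe suc zero (proj₁ (tr p i σ)) , proj₂ (tr p i σ))

  machine : Prog → Machine
  machine p = record { states = suc (sz p) ; workTapes = 2 ; start = suc (entry p) ; δ = machineδ p }

  run-Steps : ∀ p {i T t T′} k → Steps (tr p) i T t T′ → t ≤ k →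
              run (machine p) k (suc i , T) ≡ just (output (machine p) (zero , T′))
  run-Steps p {i} {T} (suc k) (last e) (s≤s _) rewrite e with k
  ... | zero  = refl
  ... | suc _ = refl
  run-Steps p (suc k) (more e st) (s≤s t≤k) rewrite e = run-Steps p k st t≤k

  noBlank : Symbol → Bool
  noBlank blank = false
  noBlank _     = true

  data NonBlank : Stk → Set where
    []  : NonBlank []
    _∷_ : ∀ {a as} → noBlank a ≡ true → NonBlank as → NonBlank (a ∷ as)

  output-Rep : ∀ p {q T xs} → NonBlank xs → Rep xs (Vec.head T) → output (machine p) (q , T) ≡ xs
  output-Rep p {q} {T} {xs} nb (k , m , _ , e) = trans (cong (takeWhileᵇ (nonBlank (machine p))) e) (go xs m nb)
    where
    go : ∀ xs m → NonBlank xs → takeWhileᵇ (nonBlank (machine p)) (xs ++ replicate m blank) ≡ xs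
    go [] zero _ = refl
    go [] (suc m) _ = refl
    go (sep ∷ xs) m (_ ∷ nb) = cong (sep ∷_) (go xs m nb)
    go (bit b ∷ xs) m (_ ∷ nb) = cong (bit b ∷_) (go xs m nb)

  initial-Reps : ∀ p xs → Reps ⟪ xs , [] , [] ⟫ (proj₂ (initial (machine p) xs))
  initial-Reps p []       = reps λ { 0F → 0 , 1 , refl , refl ; 1F → 0 , 1 , refl , refl ; 2F → 0 , 1 , refl , refl }
  initial-Reps p (x ∷ xs) = reps λ { 0F → 0 , 0 , refl , cong (x ∷_) (sym (++-identityʳ xs))
                                   ; 1F → 0 , 1 , refl , refl ; 2F → 0 , 1 , refl , refl }

  computes : ∀ {p xs ys s t k} → p ⊢ ⟪ xs , [] , [] ⟫ ⇒ s ∣ t → lookup s zero ≡ ys → NonBlank ys → t ≤ k →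
             Computes (machine p) k xs ys
  computes {p} {xs} {ys} {s} {t} {k} d e nb t≤k with simulate d (initial-Reps p xs)
  ... | T′@(u ∷ _) , st , r =
    trans (run-Steps p k st t≤k) (cong just (output-Rep p {zero} {T′} nb (subst (λ w → Rep w u) e (rep r zero))))

-- Polynomial bounds, encodings on stacks, and the moving and copying of words

module Macros where

  open import Defs hiding (sym)
  open WhilePrograms
  open import Data.Bool using (Bool; true; false)
  open import Data.Fin using (Fin; zero; suc)
  open import Data.List using (List; []; _∷_; length)
  open import Data.Unit using (⊤)
  open import Data.Vec using ([]; _∷_; lookup)

  -- Bounded sums, tabulation and iteration

  Σ< : ℕ → (ℕ → ℕ) → ℕ
  Σ< zero    f = 0
  Σ< (suc n) f = Σ< n f + f n

  -- The index runs downwards, as it does in a loop on a unary counter; prepending then yields the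
  -- entries in increasing order.
  tabOnto : ℕ → (ℕ → ℕ) → List ℕ → List ℕ
  tabOnto zero    f l = l
  tabOnto (suc n) f l = tabOnto n f (f n ∷ l)

  tab : ℕ → (ℕ → ℕ) → List ℕ
  tab n f = tabOnto n f []

  infixl 10 _!_
  _!_ : List ℕ → ℕ → ℕ
  []      ! _     = 0
  (v ∷ l) ! zero  = v
  (v ∷ l) ! suc i = l ! i

  it : ∀ {A : Set} → ℕ → (A → A) → A → A
  it zero    s a = a
  it (suc t) s a = it t s (s a)

  ifz : ∀ {A : Set} → ℕ → A → A → A
  ifz zero    a b = a
  ifz (suc _) a b = b

  -- Polynomial bounds

  data Poly : Set where
    con : ℕ → Poly
    idn : Poly
    _⊕_ _⊗_ _⊚_ : Poly → Poly → Poly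

  infixl 6 _⊕_
  infixl 7 _⊗_
  infixl 8 _⊚_

  ev : Poly → ℕ → ℕ
  ev (con c) N = c
  ev idn     N = N
  ev (P ⊕ Q) N = ev P N + ev Q N
  ev (P ⊗ Q) N = ev P N * ev Q N
  ev (P ⊚ Q) N = ev P (ev Q N)

  ev-mono : ∀ P {M N} → M ≤ N → ev P M ≤ ev P N
  ev-mono (con c) le = ≤-refl
  ev-mono idn le = le
  ev-mono (P ⊕ Q) le = +-mono-≤ (ev-mono P le) (ev-mono Q le)
  ev-mono (P ⊗ Q) le = *-mono-≤ (ev-mono P le) (ev-mono Q le)
  ev-mono (P ⊚ Q) le = ev-mono P (ev-mono Q le)

  -- An exponent for the base `2 + N`. The additional successors pay for the doubling in a sum and
  -- for the `2 +` of the inner base in a composition; with `suc c` for a constant, every degree is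
  -- positive.
  degree : Poly → ℕ
  degree (con c) = suc c
  degree idn     = 1
  degree (P ⊕ Q) = suc (degree P + degree Q)
  degree (P ⊗ Q) = degree P + degree Q
  degree (P ⊚ Q) = suc (degree Q) * degree P

  private
    n<2^n : ∀ n → n < 2 ^ n
    n<2^n zero = s≤s z≤n
    n<2^n (suc n) = begin-strict
      1 + n         <⟨ +-mono-≤-< (>-nonZero⁻¹ (2 ^ n) {{m^n≢0 2 n}}) (n<2^n n) ⟩
      2 ^ n + 2 ^ n ≡⟨ cong (2 ^ n +_) (sym (+-identityʳ _)) ⟩
      2 ^ suc n     ∎
      where open ≤-Reasoning

    module _ (N : ℕ) where
      pow-mono : ∀ {c d} → c ≤ d → (2 + N) ^ c ≤ (2 + N) ^ d
      pow-mono = ^-monoʳ-≤ (2 + N)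

      double : ∀ c → (2 + N) ^ c + (2 + N) ^ c ≤ (2 + N) ^ suc c
      double c = begin
        x + x         ≡⟨ cong (x +_) (sym (+-identityʳ x)) ⟩
        2 * x         ≤⟨ *-monoˡ-≤ x (m≤m+n 2 N) ⟩
        (2 + N) * x   ∎
        where open ≤-Reasoning
              x = (2 + N) ^ c

  ev≤pow : ∀ P N → ev P N ≤ (2 + N) ^ degree P
  ev≤pow (con c) N = ≤-trans (<⇒≤ (n<2^n c)) (≤-trans (^-monoˡ-≤ c (m≤m+n 2 N)) (pow-mono N (n≤1+n c)))
  ev≤pow idn N = ≤-trans (m≤n+m N 2) (≤-reflexive (sym (*-identityʳ (2 + N))))
  ev≤pow (P ⊕ Q) N = ≤-trans (+-mono-≤ (≤-trans (ev≤pow P N) (pow-mono N (m≤m+n (degree P) (degree Q))))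
                                       (≤-trans (ev≤pow Q N) (pow-mono N (m≤n+m (degree Q) (degree P)))))
                             (double N (degree P + degree Q))
  ev≤pow (P ⊗ Q) N = ≤-trans (*-mono-≤ (ev≤pow P N) (ev≤pow Q N)) (≤-reflexive (sym (^-distribˡ-+-* (2 + N) (degree P) (degree Q))))
  ev≤pow (P ⊚ Q) N = begin
    ev P (ev Q N)                          ≤⟨ ev-mono P (ev≤pow Q N) ⟩
    ev P x                                 ≤⟨ ev≤pow P x ⟩
    (2 + x) ^ degree P                     ≤⟨ ^-monoˡ-≤ (degree P) 2+x≤ ⟩
    ((2 + N) ^ suc (degree Q)) ^ degree P  ≡⟨ ^-*-assoc (2 + N) (suc (degree Q)) (degree P) ⟩
    (2 + N) ^ (suc (degree Q) * degree P)  ∎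
    where
    open ≤-Reasoning
    x = (2 + N) ^ degree Q
    1≤degree : ∀ P → 1 ≤ degree P
    1≤degree (con c) = s≤s z≤n
    1≤degree idn = s≤s z≤n
    1≤degree (P ⊕ Q) = s≤s z≤n
    1≤degree (P ⊗ Q) = ≤-trans (1≤degree P) (m≤m+n _ _)
    1≤degree (P ⊚ Q) = ≤-trans (1≤degree P) (m≤m+n _ _)
    2≤x : 2 ≤ x
    2≤x = ≤-trans (m≤m+n 2 N) (≤-trans (≤-reflexive (sym (*-identityʳ (2 + N)))) (pow-mono N (1≤degree Q)))
    2+x≤ : 2 + x ≤ (2 + N) ^ suc (degree Q)
    2+x≤ = ≤-trans (+-monoˡ-≤ x 2≤x) (double N (degree Q))

  -- Encoding of values and environments on stacks

  data Kind : Set where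
    nat arr : Kind

  ⟦_⟧ : Kind → Set
  ⟦ nat ⟧ = ℕ
  ⟦ arr ⟧ = List ℕ

  Ctx : Set
  Ctx = List Kind

  Env : Ctx → Set
  Env []      = ⊤
  Env (k ∷ Γ) = ⟦ k ⟧ × Env Γ

  ones : ℕ → List Bool → List Bool
  ones zero    w = w
  ones (suc n) w = true ∷ ones n w

  -- Numbers are unary, so the size of an environment bounds the values in it and thereby the number
  -- of rounds of every loop.
  word : ∀ k → ⟦ k ⟧ → List Bool
  word nat n       = ones n []
  word arr []      = []
  word arr (v ∷ l) = ones v (false ∷ word arr l)

  bits : List Bool → Stk → Stk
  bits []      s = s
  bits (b ∷ w) s = bit b ∷ bits w s

  put : List Bool → Stk → Stk
  put w s = bits w (sep ∷ s)

  enc : ∀ Γ → Env Γ → Stk → Stk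
  enc []      _       e = e
  enc (k ∷ Γ) (v , γ) e = put (word k v) (enc Γ γ e)

  size : ∀ k → ⟦ k ⟧ → ℕ
  size k v = length (word k v)

  sizeE : ∀ Γ → Env Γ → ℕ
  sizeE []      _       = 0
  sizeE (k ∷ Γ) (v , γ) = suc (size k v) + sizeE Γ γ

  onto : List Bool → Stk → Stk
  onto []      s = s
  onto (b ∷ w) s = onto w (bit b ∷ s)

  revOnto : List Bool → List Bool → List Bool
  revOnto []      v = v
  revOnto (b ∷ w) v = revOnto w (b ∷ v)

  -- A transfer to another stack reverses the word, and a second transfer restores it; this lemma
  -- and `rev-onto` let two transfers act as one move.
  onto-rev : ∀ w v s → onto (revOnto w v) s ≡ onto v (bits w s)
  onto-rev []      v s = refl
  onto-rev (b ∷ w) v s = onto-rev w (b ∷ v) s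

  rev-onto : ∀ w v s → onto w (bits v s) ≡ bits (revOnto w v) s
  rev-onto []      v s = refl
  rev-onto (b ∷ w) v s = rev-onto w (b ∷ v) s

  length-rev : ∀ w v → length (revOnto w v) ≡ length w + length v
  length-rev []      v = refl
  length-rev (b ∷ w) v = trans (length-rev w (b ∷ v)) (+-suc _ _)

  bits-ones : ∀ n w s → bits (ones n w) s ≡ bits (ones n []) (bits w s)
  bits-ones zero    w s = refl
  bits-ones (suc n) w s = cong (bit true ∷_) (bits-ones n w s)

  ones-+ : ∀ m n s → bits (ones m []) (bits (ones n []) s) ≡ bits (ones (m + n) []) s
  ones-+ zero    n s = refl
  ones-+ (suc m) n s = cong (bit true ∷_) (ones-+ m n s)

  ones-snoc : ∀ n s → bits (ones n []) (bit true ∷ s) ≡ bit true ∷ bits (ones n []) s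
  ones-snoc zero    s = refl
  ones-snoc (suc n) s = cong (bit true ∷_) (ones-snoc n s)

  onto-ones : ∀ n s → onto (ones n []) s ≡ bits (ones n []) s
  onto-ones zero    s = refl
  onto-ones (suc n) s = trans (onto-ones n (bit true ∷ s)) (ones-snoc n s)

  length-ones : ∀ n w → length (ones n w) ≡ n + length w
  length-ones zero    w = refl
  length-ones (suc n) w = cong suc (length-ones n w)

  size-nat : ∀ n → size nat n ≡ n
  size-nat n = trans (length-ones n []) (+-identityʳ n)

  -- Programs with an upper bound on their running time

  infix 4 _⊢_⇛_≤_
  record _⊢_⇛_≤_ (p : Prog) (s s′ : St) (B : ℕ) : Set where
    constructor runs
    field
      {time} : ℕ
      deriv  : p ⊢ s ⇒ s′ ∣ time
      bound  : time ≤ B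

  infixr 5 _▸_
  _▸_ : ∀ {p q s s′ s″ A B} → p ⊢ s ⇛ s′ ≤ A → q ⊢ s′ ⇛ s″ ≤ B → p ▹ q ⊢ s ⇛ s″ ≤ A + B
  runs d le ▸ runs d′ le′ = runs (d ▹ d′) (+-mono-≤ le le′)

  relax : ∀ {p s s′ A B} → A ≤ B → p ⊢ s ⇛ s′ ≤ A → p ⊢ s ⇛ s′ ≤ B
  relax le′ (runs d le) = runs d (≤-trans le le′)

  to : ∀ {p s s′ s″ B} → s′ ≡ s″ → p ⊢ s ⇛ s′ ≤ B → p ⊢ s ⇛ s″ ≤ B
  to refl d = d

  from : ∀ {p s s′ s″ B} → s′ ≡ s → p ⊢ s ⇛ s″ ≤ B → p ⊢ s′ ⇛ s″ ≤ B
  from refl d = d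

  pushB : ∀ {i a s} → push i a ⊢ s ⇛ _ ≤ 2
  pushB {i} {a} {s} = runs (push {i} {a} {s}) ≤-refl

  popB : ∀ {i s} → pop i ⊢ s ⇛ _ ≤ 1
  popB {i} {s} = runs (pop {i} {s}) ≤-refl

  nopB : ∀ {s} → nop ⊢ s ⇛ s ≤ 1
  nopB = runs nop ≤-refl

  ifTB : ∀ {i P p q s s′ B} → P (hd (lookup s i)) ≡ true → p ⊢ s ⇛ s′ ≤ B → ifp i P p q ⊢ s ⇛ s′ ≤ suc B
  ifTB e (runs d le) = runs (ifT e d) (s≤s le)

  ifFB : ∀ {i P p q s s′ B} → P (hd (lookup s i)) ≡ false → q ⊢ s ⇛ s′ ≤ B → ifp i P p q ⊢ s ⇛ s′ ≤ suc B
  ifFB e (runs d le) = runs (ifF e d) (s≤s le)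

  whTB : ∀ {i P p s s′ s″ A B} → P (hd (lookup s i)) ≡ true → p ⊢ s ⇛ s′ ≤ A → while i P p ⊢ s′ ⇛ s″ ≤ B →
         while i P p ⊢ s ⇛ s″ ≤ suc (A + B)
  whTB e (runs d le) (runs d′ le′) = runs (whT e d d′) (s≤s (+-mono-≤ le le′))

  whFB : ∀ {i P p s} → P (hd (lookup s i)) ≡ false → while i P p ⊢ s ⇛ s ≤ 1
  whFB e = runs (whF e) ≤-refl

  isBit isOne : Symbol → Bool
  isBit (bit _) = true
  isBit _       = false
  isOne (bit b) = b
  isOne _       = false

  NoBit : Stk → Set
  NoBit s = isBit (hd s) ≡ false

  lin : ℕ → ℕ
  lin n = suc (n * 5)

  transfer : Fin 3 → Fin 3 → Prog
  transfer i j = while i isBit (ifp i isOne (pop i ▹ push j (bit true)) (pop i ▹ push j (bit false)))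

  transferER : ∀ w {e r y} → NoBit e → transfer 0F 2F ⊢ ⟪ bits w e , r , y ⟫ ⇛ ⟪ e , r , onto w y ⟫ ≤ lin (length w)
  transferER [] nb = whFB nb
  transferER (true ∷ w) nb = whTB refl (ifTB refl (popB ▸ pushB)) (transferER w nb)
  transferER (false ∷ w) nb = whTB refl (ifFB refl (popB ▸ pushB)) (transferER w nb)

  transferRX : ∀ w {e r y} → NoBit r → transfer 1F 2F ⊢ ⟪ e , bits w r , y ⟫ ⇛ ⟪ e , r , onto w y ⟫ ≤ lin (length w)
  transferRX [] nb = whFB nb
  transferRX (true ∷ w) nb = whTB refl (ifTB refl (popB ▸ pushB)) (transferRX w nb)
  transferRX (false ∷ w) nb = whTB refl (ifFB refl (popB ▸ pushB)) (transferRX w nb)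

  transferXE′ : ∀ w {e r y} → NoBit y → transfer 2F 0F ⊢ ⟪ e , r , bits w y ⟫ ⇛ ⟪ onto w e , r , y ⟫ ≤ lin (length w)
  transferXE′ [] nb = whFB nb
  transferXE′ (true ∷ w) nb = whTB refl (ifTB refl (popB ▸ pushB)) (transferXE′ w nb)
  transferXE′ (false ∷ w) nb = whTB refl (ifFB refl (popB ▸ pushB)) (transferXE′ w nb)

  transferXR′ : ∀ w {e r y} → NoBit y → transfer 2F 1F ⊢ ⟪ e , r , bits w y ⟫ ⇛ ⟪ e , onto w r , y ⟫ ≤ lin (length w)
  transferXR′ [] nb = whFB nb
  transferXR′ (true ∷ w) nb = whTB refl (ifTB refl (popB ▸ pushB)) (transferXR′ w nb)
  transferXR′ (false ∷ w) nb = whTB refl (ifFB refl (popB ▸ pushB)) (transferXR′ w nb)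

  length-rev′ : ∀ w → length (revOnto w []) ≡ length w
  length-rev′ w = trans (length-rev w []) (+-identityʳ _)

  transferXE : ∀ w {e r y} → NoBit y → transfer 2F 0F ⊢ ⟪ e , r , onto w y ⟫ ⇛ ⟪ bits w e , r , y ⟫ ≤ lin (length w)
  transferXE w {e} {r} {y} nb rewrite rev-onto w [] y | sym (onto-rev w [] e) | sym (length-rev′ w) = transferXE′ (revOnto w []) nb

  transferXR : ∀ w {e r y} → NoBit y → transfer 2F 1F ⊢ ⟪ e , r , onto w y ⟫ ⇛ ⟪ e , bits w r , y ⟫ ≤ lin (length w)
  transferXR w {e} {r} {y} nb rewrite rev-onto w [] y | sym (onto-rev w [] r) | sym (length-rev′ w) = transferXR′ (revOnto w []) nb

  dup : Prog
  dup = while 2F isBit (ifp 2F isOne (pop 2F ▹ push 0F (bit true) ▹ push 1F (bit true))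
                                     (pop 2F ▹ push 0F (bit false) ▹ push 1F (bit false)))

  lin2 : ℕ → ℕ
  lin2 n = suc (n * 7)

  dup′ : ∀ w {e r y} → NoBit y → dup ⊢ ⟪ e , r , bits w y ⟫ ⇛ ⟪ onto w e , onto w r , y ⟫ ≤ lin2 (length w)
  dup′ [] nb = whFB nb
  dup′ (true ∷ w) nb = whTB refl (ifTB refl (popB ▸ pushB ▸ pushB)) (dup′ w nb)
  dup′ (false ∷ w) nb = whTB refl (ifFB refl (popB ▸ pushB ▸ pushB)) (dup′ w nb)

  dupB : ∀ w {e r y} → NoBit y → dup ⊢ ⟪ e , r , onto w y ⟫ ⇛ ⟪ bits w e , bits w r , y ⟫ ≤ lin2 (length w)
  dupB w {e} {r} {y} nb rewrite rev-onto w [] y | sym (onto-rev w [] r) | sym (onto-rev w [] e) | sym (length-rev′ w) = dup′ (revOnto w []) nb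

  clear : Fin 3 → Prog
  clear i = while i isBit (pop i)

  lin1 : ℕ → ℕ
  lin1 n = suc (n * 2)

  clearE : ∀ w {e r y} → NoBit e → clear 0F ⊢ ⟪ bits w e , r , y ⟫ ⇛ ⟪ e , r , y ⟫ ≤ lin1 (length w)
  clearE [] nb = whFB nb
  clearE (b ∷ w) nb = whTB refl popB (clearE w nb)

  clearR : ∀ w {e r y} → NoBit r → clear 1F ⊢ ⟪ e , bits w r , y ⟫ ⇛ ⟪ e , r , y ⟫ ≤ lin1 (length w)
  clearR [] nb = whFB nb
  clearR (b ∷ w) nb = whTB refl popB (clearR w nb)

  drop : Fin 3 → Prog
  drop i = clear i ▹ pop i

  dropE : ∀ w {e r y} → drop 0F ⊢ ⟪ put w e , r , y ⟫ ⇛ ⟪ e , r , y ⟫ ≤ lin1 (length w) + 1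
  dropE w = clearE w refl ▸ popB

  dropR : ∀ w {e r y} → drop 1F ⊢ ⟪ e , put w r , y ⟫ ⇛ ⟪ e , r , y ⟫ ≤ lin1 (length w) + 1
  dropR w = clearR w refl ▸ popB

  copy : Prog
  copy = push 1F sep ▹ transfer 0F 2F ▹ dup

  copyB : ∀ w {e r y} → NoBit y → copy ⊢ ⟪ put w e , r , y ⟫ ⇛ ⟪ put w e , put w r , y ⟫ ≤ 2 + (lin (length w) + lin2 (length w))
  copyB w nb = pushB ▸ transferER w refl ▸ dupB w nb

  move-RE : Prog
  move-RE = transfer 1F 2F ▹ pop 1F ▹ push 0F sep ▹ transfer 2F 0F

  move-REB : ∀ w {e r} → move-RE ⊢ ⟪ e , put w r , [] ⟫ ⇛ ⟪ put w e , r , [] ⟫ ≤ lin (length w) + (1 + (2 + lin (length w)))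
  move-REB w = transferRX w refl ▸ popB ▸ pushB ▸ transferXE w refl

  -- The top value is put aside on the scratch stack and sealed by a separator, so that the variable
  -- below it becomes the top one.
  skip-in skip-out : Prog
  skip-in  = transfer 0F 2F ▹ pop 0F ▹ push 2F sep
  skip-out = pop 2F ▹ push 0F sep ▹ transfer 2F 0F

  skip-inB : ∀ w {e r y} → skip-in ⊢ ⟪ put w e , r , y ⟫ ⇛ ⟪ e , r , sep ∷ onto w y ⟫ ≤ lin (length w) + (1 + 2)
  skip-inB w = transferER w refl ▸ popB ▸ pushB

  skip-outB : ∀ w {e r y} → NoBit y → skip-out ⊢ ⟪ e , r , sep ∷ onto w y ⟫ ⇛ ⟪ put w e , r , y ⟫ ≤ 1 + (2 + lin (length w))
  skip-outB w nb = popB ▸ pushB ▸ transferXE w nb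

-- A language of arithmetic expressions with polynomial running time

module Expressions where

  open import Defs hiding (sym)
  open WhilePrograms
  open Macros
  open import Data.Bool using (true; false)
  open import Data.Fin using (zero; suc)
  open import Data.List using (List; []; _∷_; length)
  open import Data.Unit using (tt)
  open import Data.Vec using ([]; _∷_)

  -- A first-order expression language, indexed by its semantics; every expression runs in polynomial time

  infix 4 _∋_
  data _∋_ : Ctx → Kind → Set where
    vz : ∀ {Γ k} → (k ∷ Γ) ∋ k
    vs : ∀ {Γ k k′} → Γ ∋ k → (k′ ∷ Γ) ∋ k

  look : ∀ {Γ k} → Γ ∋ k → Env Γ → ⟦ k ⟧
  look vz    (v , γ) = v
  look (vs i) (v , γ) = look i γ

  data Exp (Γ : Ctx) : (k : Kind) → (Env Γ → ⟦ k ⟧) → Set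
  data Args (Γ : Ctx) : (Δ : Ctx) → (Env Γ → Env Δ) → Set

  data Exp Γ where
    var  : ∀ {k} (i : Γ ∋ k) → Exp Γ k (look i)
    zer  : Exp Γ nat (λ _ → 0)
    inc  : ∀ {f} → Exp Γ nat f → Exp Γ nat (λ γ → suc (f γ))
    add  : ∀ {f g} → Exp Γ nat f → Exp Γ nat g → Exp Γ nat (λ γ → f γ + g γ)
    sub  : ∀ {f g} → Exp Γ nat f → Exp Γ nat g → Exp Γ nat (λ γ → f γ ∸ g γ)
    cond : ∀ {k c f g} → Exp Γ nat c → Exp Γ k f → Exp Γ k g → Exp Γ k (λ γ → ifz (c γ) (f γ) (g γ))
    sum  : ∀ {n f} → Exp Γ nat n → Exp (nat ∷ Γ) nat f → Exp Γ nat (λ γ → Σ< (n γ) (λ i → f (i , γ)))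
    tabu : ∀ {n f} → Exp Γ nat n → Exp (nat ∷ Γ) nat f → Exp Γ arr (λ γ → tab (n γ) (λ i → f (i , γ)))
    get  : ∀ {a i} → Exp Γ arr a → Exp Γ nat i → Exp Γ nat (λ γ → a γ ! i γ)
    len  : ∀ {a} → Exp Γ arr a → Exp Γ nat (λ γ → length (a γ))
    -- the expression for the size bound b is never executed
    iter : ∀ {n a f b} → Exp Γ nat n → Exp Γ arr a → Exp (arr ∷ Γ) arr f → Exp Γ nat b →
           (∀ γ t → t ≤ n γ → size arr (it t (λ l → f (l , γ)) (a γ)) ≤ b γ) →
           Exp Γ arr (λ γ → it (n γ) (λ l → f (l , γ)) (a γ))
    app  : ∀ {Δ k f σ} → Exp Δ k f → Args Γ Δ σ → Exp Γ k (λ γ → f (σ γ))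
    conv : ∀ {k f g} → Exp Γ k f → (∀ γ → f γ ≡ g γ) → Exp Γ k g

  data Args Γ where
    []  : Args Γ [] (λ _ → tt)
    _∷_ : ∀ {k Δ f σ} → Exp Γ k f → Args Γ Δ σ → Args Γ (k ∷ Δ) (λ γ → f γ , σ γ)

  infixr 5 _∷_

  addR consR cellR takeR lenR : Prog
  addR  = transfer 1F 2F ▹ pop 1F ▹ transfer 2F 1F
  consR = transfer 1F 2F ▹ pop 1F ▹ push 1F (bit false) ▹ transfer 2F 1F
  cellR = while 1F isOne (pop 1F) ▹ ifp 1F isBit (pop 1F) nop
  takeR = while 1F isOne (pop 1F ▹ push 2F (bit true)) ▹ clear 1F ▹ transfer 2F 1F
  lenR  = while 1F isBit (ifp 1F isOne (pop 1F) (pop 1F ▹ push 2F (bit true))) ▹ transfer 2F 1F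

  drops : Ctx → Prog
  drops []      = nop
  drops (k ∷ Γ) = drop 0F ▹ drops Γ

  progVar : ∀ {Γ k} → Γ ∋ k → Prog
  progVar vz    = copy
  progVar (vs i) = skip-in ▹ progVar i ▹ skip-out

  prog : ∀ {Γ k f} → Exp Γ k f → Prog
  progs : ∀ {Γ Δ σ} → Args Γ Δ σ → Prog
  prog (var i) = progVar i
  prog zer = push 1F sep
  prog (inc e) = prog e ▹ push 1F (bit true)
  prog (add e e′) = prog e′ ▹ prog e ▹ addR
  prog (sub e e′) = prog e ▹ prog e′ ▹ transfer 1F 2F ▹ pop 1F ▹ while 2F isBit (pop 2F ▹ ifp 1F isOne (pop 1F) nop)
  prog (cond c e e′) = prog c ▹ ifp 1F isOne (drop 1F ▹ prog e′) (pop 1F ▹ prog e)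
  -- The counter lies on top of the environment. It is decremented before the body runs, so that the
  -- body finds there its index, which takes the values from `n - 1` down to 0.
  prog (sum n e) = push 1F sep ▹ prog n ▹ move-RE ▹ while 0F isOne (pop 0F ▹ prog e ▹ addR) ▹ pop 0F
  prog (tabu n e) = push 1F sep ▹ prog n ▹ move-RE ▹ while 0F isOne (pop 0F ▹ prog e ▹ consR) ▹ pop 0F
  prog (get a i) = prog a ▹ prog i ▹ transfer 1F 2F ▹ pop 1F ▹ while 2F isBit (pop 2F ▹ cellR) ▹ takeR
  prog (len a) = prog a ▹ lenR
  -- Here the counter stays on the result stack, since the top of the environment is occupied by the
  -- state of the iteration.
  prog (iter n a e _ _) = prog n ▹ prog a ▹ move-RE ▹ while 1F isOne (pop 1F ▹ prog e ▹ drop 0F ▹ move-RE) ▹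
                          pop 1F ▹ copy ▹ drop 0F
  prog (app {Δ} e as) = progs as ▹ prog e ▹ drops Δ
  prog (conv e _) = prog e
  progs [] = nop
  progs (e ∷ as) = prog e ▹ progs as ▹ move-RE

  linP lin1P lin2P moveP : Poly → Poly
  linP P  = con 1 ⊕ P ⊗ con 5
  lin1P P = con 1 ⊕ P ⊗ con 2
  lin2P P = con 1 ⊕ P ⊗ con 7
  moveP P = linP P ⊕ (con 1 ⊕ (con 2 ⊕ linP P))

  varT : ∀ {Γ k} → Γ ∋ k → Poly
  varT vz    = con 2 ⊕ (linP idn ⊕ lin2P idn)
  varT (vs i) = (linP idn ⊕ (con 1 ⊕ con 2)) ⊕ (varT i ⊕ (con 1 ⊕ (con 2 ⊕ linP idn)))

  -- An iteration may square the size of its state in every round. This is the only case in which no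
  -- polynomial can be derived from the parts, and the annotation `b` supplies it.
  V : ∀ {Γ k f} → Exp Γ k f → Poly
  VA : ∀ {Γ Δ σ} → Args Γ Δ σ → Poly
  V (var i) = idn
  V zer = con 0
  V (inc e) = con 1 ⊕ V e
  V (add e e′) = V e ⊕ V e′
  V (sub e e′) = V e
  V (cond c e e′) = V e ⊕ V e′
  V (sum n e) = V n ⊗ (V e ⊚ (V n ⊕ idn))
  V (tabu n e) = V n ⊗ (con 1 ⊕ V e ⊚ (V n ⊕ idn))
  V (get a i) = V a
  V (len a) = V a
  V (iter n a e b _) = V b
  V (app e as) = V e ⊚ VA as
  V (conv e _) = V e
  VA [] = con 0
  VA (e ∷ as) = (con 1 ⊕ V e) ⊕ VA as

  T : ∀ {Γ k f} → Exp Γ k f → Poly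
  TA : ∀ {Γ Δ σ} → Args Γ Δ σ → Poly
  T (var i) = varT i
  T zer = con 2
  T (inc e) = T e ⊕ con 2
  T (add e e′) = T e′ ⊕ (T e ⊕ (linP (V e) ⊕ (con 1 ⊕ linP (V e))))
  T (sub e e′) = T e ⊕ (T e′ ⊕ (linP (V e′) ⊕ (con 1 ⊕ (con 1 ⊕ V e′ ⊗ con 4))))
  T (cond c e e′) = T c ⊕ (con 1 ⊕ ((lin1P (V c) ⊕ con 1) ⊕ T e′ ⊕ (con 1 ⊕ T e)))
  T (sum n e) = con 2 ⊕ (T n ⊕ (moveP (V n) ⊕ ((con 1 ⊕ V n ⊗ (con 1 ⊕ (con 1 ⊕ (T e ⊚ W ⊕ (linP U ⊕ (con 1 ⊕ linP U)))))) ⊕ con 1)))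
    where W = V n ⊕ idn
          U = V e ⊚ W
  T (tabu n e) = con 2 ⊕ (T n ⊕ (moveP (V n) ⊕ ((con 1 ⊕ V n ⊗ (con 1 ⊕ (con 1 ⊕ (T e ⊚ W ⊕ (linP U ⊕ (con 1 ⊕ (con 2 ⊕ linP U))))))) ⊕ con 1)))
    where W = V n ⊕ idn
          U = V e ⊚ W
  T (get a i) = T a ⊕ (T i ⊕ (linP (V i) ⊕ (con 1 ⊕ ((con 1 ⊕ V i ⊗ (con 1 ⊕ (con 1 ⊕ (lin1P (V a) ⊕ con 2)))) ⊕
                ((con 1 ⊕ V a ⊗ con 4) ⊕ (lin1P (V a) ⊕ linP (V a)))))))
  T (len a) = T a ⊕ ((con 1 ⊕ V a ⊗ con 5) ⊕ linP (V a))
  T (iter n a e b _) = T n ⊕ (T a ⊕ (moveP (V b) ⊕ ((con 1 ⊕ V n ⊗ (con 1 ⊕ (con 1 ⊕ (T e ⊚ (con 1 ⊕ V b ⊕ idn) ⊕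
                       ((lin1P (V b) ⊕ con 1) ⊕ moveP (V b)))))) ⊕
                       (con 1 ⊕ ((con 2 ⊕ (linP (V b) ⊕ lin2P (V b))) ⊕ (lin1P (V b) ⊕ con 1))))))
  T (app e as) = TA as ⊕ (T e ⊚ VA as ⊕ (con 1 ⊕ VA as ⊗ con 2))
  T (conv e _) = T e
  TA [] = con 1
  TA (e ∷ as) = T e ⊕ (TA as ⊕ moveP (V e))

  lin-mono : ∀ {m n} → m ≤ n → lin m ≤ lin n
  lin-mono le = s≤s (*-monoˡ-≤ 5 le)

  lin1-mono : ∀ {m n} → m ≤ n → lin1 m ≤ lin1 n
  lin1-mono le = s≤s (*-monoˡ-≤ 2 le)

  lin2-mono : ∀ {m n} → m ≤ n → lin2 m ≤ lin2 n
  lin2-mono le = s≤s (*-monoˡ-≤ 7 le)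

  move-mono : ∀ {m n} → m ≤ n → lin m + (1 + (2 + lin m)) ≤ lin n + (1 + (2 + lin n))
  move-mono le = +-mono-≤ (lin-mono le) (s≤s (s≤s (s≤s (lin-mono le))))

  Σ<-bound : ∀ n f D → (∀ i → i < n → f i ≤ D) → Σ< n f ≤ n * D
  Σ<-bound zero    f D h = z≤n
  Σ<-bound (suc n) f D h = ≤-trans (+-mono-≤ (Σ<-bound n f D (λ i i<n → h i (m<n⇒m<1+n i<n))) (h n ≤-refl))
                                   (≤-reflexive (+-comm (n * D) D))

  size-cons : ∀ v l → size arr (v ∷ l) ≡ suc v + size arr l
  size-cons v l = trans (length-ones v _) (+-suc v _)

  size-tabOnto : ∀ n f D l → (∀ i → i < n → f i ≤ D) → size arr (tabOnto n f l) ≤ n * suc D + size arr l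
  size-tabOnto zero    f D l h = ≤-refl
  size-tabOnto (suc n) f D l h = begin
    size arr (tabOnto n f (f n ∷ l))  ≤⟨ size-tabOnto n f D (f n ∷ l) (λ i i<n → h i (m<n⇒m<1+n i<n)) ⟩
    n * suc D + size arr (f n ∷ l)    ≡⟨ cong (n * suc D +_) (size-cons (f n) l) ⟩
    n * suc D + (suc (f n) + size arr l) ≤⟨ +-monoʳ-≤ (n * suc D) (+-monoˡ-≤ (size arr l) (s≤s (h n ≤-refl))) ⟩
    n * suc D + (suc D + size arr l)  ≡⟨ sym (+-assoc (n * suc D) (suc D) _) ⟩
    (n * suc D + suc D) + size arr l  ≡⟨ cong (_+ size arr l) (+-comm (n * suc D) (suc D)) ⟩
    suc n * suc D + size arr l        ∎
    where open ≤-Reasoning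

  size-tab : ∀ n f D → (∀ i → i < n → f i ≤ D) → size arr (tab n f) ≤ n * suc D
  size-tab n f D h = ≤-trans (size-tabOnto n f D [] h) (≤-reflexive (+-identityʳ _))

  length≤size : ∀ l → length l ≤ size arr l
  length≤size [] = z≤n
  length≤size (v ∷ l) = ≤-trans (s≤s (≤-trans (length≤size l) (m≤n+m _ v))) (≤-reflexive (sym (size-cons v l)))

  !≤size : ∀ l i → l ! i ≤ size arr l
  !≤size [] i = z≤n
  !≤size (v ∷ l) zero = ≤-trans (≤-trans (n≤1+n v) (m≤m+n _ _)) (≤-reflexive (sym (size-cons v l)))
  !≤size (v ∷ l) (suc i) = ≤-trans (≤-trans (!≤size l i) (m≤n+m _ (suc v))) (≤-reflexive (sym (size-cons v l)))

  look-size : ∀ {Γ k} (i : Γ ∋ k) γ → size k (look i γ) ≤ sizeE Γ γ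
  look-size {k ∷ Γ} vz    (v , γ) = ≤-trans (n≤1+n _) (m≤m+n _ _)
  look-size {k ∷ Γ} (vs i) (v , γ) = ≤-trans (look-size i γ) (m≤n+m _ (suc (size k v)))

  val : ∀ {Γ k f} (e : Exp Γ k f) γ → size k (f γ) ≤ ev (V e) (sizeE Γ γ)
  vals : ∀ {Γ Δ σ} (as : Args Γ Δ σ) γ → sizeE Δ (σ γ) ≤ ev (VA as) (sizeE Γ γ)

  valN : ∀ {Γ f} (e : Exp Γ nat f) γ → f γ ≤ ev (V e) (sizeE Γ γ)
  valN {f = f} e γ = ≤-trans (≤-reflexive (sym (size-nat (f γ)))) (val e γ)

  val-under : ∀ {Γ n f} (e : Exp Γ nat n) (e′ : Exp (nat ∷ Γ) nat f) γ i → i < n γ →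
              f (i , γ) ≤ ev (V e′) (ev (V e) (sizeE Γ γ) + sizeE Γ γ)
  val-under {Γ} e e′ γ i i<n = ≤-trans (valN e′ (i , γ)) (ev-mono (V e′)
    (+-monoˡ-≤ (sizeE Γ γ) (≤-trans (≤-reflexive (cong suc (size-nat i))) (≤-trans i<n (valN e γ)))))

  val (var i) γ = look-size i γ
  val zer γ = z≤n
  val (inc e) γ = s≤s (val e γ)
  val (add {f} {g} e e′) γ = ≤-trans (≤-reflexive (size-nat (f γ + g γ))) (+-mono-≤ (valN e γ) (valN e′ γ))
  val (sub {f} {g} e e′) γ = ≤-trans (≤-reflexive (size-nat (f γ ∸ g γ))) (≤-trans (m∸n≤m (f γ) (g γ)) (valN e γ))
  val (cond {c = c} e e′ e″) γ with c γ
  ... | zero  = ≤-trans (val e′ γ) (m≤m+n _ _)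
  ... | suc _ = ≤-trans (val e″ γ) (m≤n+m _ _)
  val {Γ} (sum {n} {f} e e′) γ = ≤-trans (≤-reflexive (size-nat (Σ< (n γ) _)))
    (≤-trans (Σ<-bound (n γ) _ (ev (V e′) (ev (V e) (sizeE Γ γ) + sizeE Γ γ)) (val-under e e′ γ)) (*-monoˡ-≤ _ (valN e γ)))
  val {Γ} (tabu {n} {f} e e′) γ = ≤-trans (size-tab (n γ) _ (ev (V e′) (ev (V e) (sizeE Γ γ) + sizeE Γ γ)) (val-under e e′ γ)) (*-monoˡ-≤ _ (valN e γ))
  val (get {a} {i} e e′) γ = ≤-trans (≤-reflexive (size-nat (a γ ! i γ))) (≤-trans (!≤size (a γ) (i γ)) (val e γ))
  val (len {a} e) γ = ≤-trans (≤-reflexive (size-nat (length (a γ)))) (≤-trans (length≤size (a γ)) (val e γ))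
  val (iter {n} e e′ e″ b h) γ = ≤-trans (h γ (n γ) ≤-refl) (valN b γ)
  val (app {σ = σ} e as) γ = ≤-trans (val e (σ γ)) (ev-mono (V e) (vals as γ))
  val (conv {k = k} e h) γ = ≤-trans (≤-reflexive (cong (size k) (sym (h γ)))) (val e γ)
  vals [] γ = z≤n
  vals (e ∷ as) γ = +-mono-≤ (s≤s (val e γ)) (vals as γ)

  addRB : ∀ v v′ {e r} → addR ⊢ ⟪ e , put (ones v []) (put (ones v′ []) r) , [] ⟫ ⇛ ⟪ e , put (ones (v + v′) []) r , [] ⟫
          ≤ lin v + (1 + lin v)
  addRB v v′ {e} {r} = to (cong (λ q → ⟪ e , q , [] ⟫) (ones-+ v v′ (sep ∷ r)))
    (relax (≤-reflexive (cong (λ q → lin q + (1 + lin q)) (size-nat v)))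
      (transferRX (ones v []) refl ▸ popB ▸ transferXR (ones v []) refl))

  consRB : ∀ v l {e r} → consR ⊢ ⟪ e , put (ones v []) (put (word arr l) r) , [] ⟫ ⇛ ⟪ e , put (word arr (v ∷ l)) r , [] ⟫
           ≤ lin v + (1 + (2 + lin v))
  consRB v l {e} {r} = to (cong (λ q → ⟪ e , q , [] ⟫) (sym (bits-ones v (false ∷ word arr l) (sep ∷ r))))
    (relax (≤-reflexive (cong (λ q → lin q + (1 + (2 + lin q))) (size-nat v)))
      (transferRX (ones v []) refl ▸ popB ▸ pushB ▸ transferXR (ones v []) refl))

  subLoop : ∀ v v′ {e r} → while 2F isBit (pop 2F ▹ ifp 1F isOne (pop 1F) nop) ⊢
            ⟪ e , put (ones v []) r , bits (ones v′ []) [] ⟫ ⇛ ⟪ e , put (ones (v ∸ v′) []) r , [] ⟫ ≤ suc (v′ * 4)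
  subLoop v zero = whFB refl
  subLoop zero (suc v′) {e} {r} = whTB refl (popB ▸ ifFB refl nopB)
    (to (cong (λ q → ⟪ e , put (ones q []) r , [] ⟫) (0∸n≡0 v′)) (subLoop zero v′))
  subLoop (suc v) (suc v′) = whTB refl (popB ▸ ifTB refl popB) (subLoop v v′)

  dropCells : ℕ → List ℕ → List ℕ
  dropCells zero    l       = l
  dropCells (suc i) []      = []
  dropCells (suc i) (v ∷ l) = dropCells i l

  dropCells-! : ∀ i l → dropCells i l ! 0 ≡ l ! i
  dropCells-! zero l = refl
  dropCells-! (suc i) [] = refl
  dropCells-! (suc i) (v ∷ l) = dropCells-! i l

  size-dropCells : ∀ i l → size arr (dropCells i l) ≤ size arr l
  size-dropCells zero l = ≤-refl
  size-dropCells (suc i) [] = ≤-refl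
  size-dropCells (suc i) (v ∷ l) = ≤-trans (size-dropCells i l) (≤-trans (m≤n+m _ (suc v)) (≤-reflexive (sym (size-cons v l))))

  popOnes : ∀ v {e r y} → isOne (hd r) ≡ false →
            while 1F isOne (pop 1F) ⊢ ⟪ e , bits (ones v []) r , y ⟫ ⇛ ⟪ e , r , y ⟫ ≤ lin1 v
  popOnes zero h = whFB h
  popOnes (suc v) h = whTB refl popB (popOnes v h)

  cellRB : ∀ l {e r y} → cellR ⊢ ⟪ e , put (word arr l) r , y ⟫ ⇛ ⟪ e , put (word arr (dropCells 1 l)) r , y ⟫ ≤ lin1 (size arr l) + 2
  cellRB [] = whFB refl ▸ ifFB refl nopB
  cellRB (v ∷ l) {e} {r} {y} = from (cong (λ q → ⟪ e , q , y ⟫) (bits-ones v _ _))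
    (relax (+-monoˡ-≤ 2 (lin1-mono (≤-trans (≤-trans (n≤1+n v) (m≤m+n _ _)) (≤-reflexive (sym (size-cons v l))))))
    (popOnes v refl ▸ ifTB refl popB))

  getLoop : ∀ i l S {e r} → size arr l ≤ S → while 2F isBit (pop 2F ▹ cellR) ⊢
            ⟪ e , put (word arr l) r , bits (ones i []) [] ⟫ ⇛ ⟪ e , put (word arr (dropCells i l)) r , [] ⟫ ≤ suc (i * suc (1 + (lin1 S + 2)))
  getLoop zero l S le = whFB refl
  getLoop (suc i) l S {e} {r} le = to (cong (λ q → ⟪ e , put (word arr q) r , [] ⟫) (drop-drop i l))
    (relax (≤-reflexive (arith i (suc (1 + (lin1 S + 2)))))
      (whTB refl (relax (s≤s (+-monoˡ-≤ 2 (lin1-mono le))) (popB ▸ cellRB l)) (getLoop i (dropCells 1 l) S (≤-trans (size-dropCells 1 l) le))))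
    where
    drop-drop : ∀ i l → dropCells i (dropCells 1 l) ≡ dropCells (suc i) l
    drop-drop zero [] = refl
    drop-drop (suc i) [] = refl
    drop-drop i (v ∷ l) = refl
    arith : ∀ i D → D + suc (i * D) ≡ suc (suc i * D)
    arith i D = +-suc D (i * D)

  takeOnes : ∀ v {e r y} → isOne (hd r) ≡ false →
             while 1F isOne (pop 1F ▹ push 2F (bit true)) ⊢ ⟪ e , bits (ones v []) r , y ⟫ ⇛ ⟪ e , r , onto (ones v []) y ⟫ ≤ suc (v * 4)
  takeOnes zero h = whFB h
  takeOnes (suc v) h = whTB refl (popB ▸ pushB) (takeOnes v h)

  takeRB : ∀ l {e r} → takeR ⊢ ⟪ e , put (word arr l) r , [] ⟫ ⇛ ⟪ e , put (ones (l ! 0) []) r , [] ⟫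
           ≤ suc (size arr l * 4) + (lin1 (size arr l) + lin (size arr l))
  takeRB [] = takeOnes 0 refl ▸ clearR [] refl ▸ transferXR [] refl
  takeRB (v ∷ l) {e} {r} = from (cong (λ q → ⟪ e , q , [] ⟫) (bits-ones v _ _))
    (relax (+-mono-≤ (s≤s (*-monoˡ-≤ 4 v≤)) (+-mono-≤ (lin1-mono w≤) (lin-mono (≤-trans (≤-reflexive (size-nat v)) v≤))))
      (takeOnes v refl ▸ clearR (false ∷ word arr l) refl ▸ transferXR (ones v []) refl))
    where
    v≤ : v ≤ size arr (v ∷ l)
    v≤ = ≤-trans (≤-trans (n≤1+n v) (m≤m+n _ _)) (≤-reflexive (sym (size-cons v l)))
    w≤ : suc (size arr l) ≤ size arr (v ∷ l)
    w≤ = ≤-trans (s≤s (m≤n+m _ v)) (≤-reflexive (sym (size-cons v l)))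

  lenLoop : ∀ l {e r y} → while 1F isBit (ifp 1F isOne (pop 1F) (pop 1F ▹ push 2F (bit true))) ⊢
            ⟪ e , put (word arr l) r , y ⟫ ⇛ ⟪ e , sep ∷ r , onto (ones (length l) []) y ⟫ ≤ suc (size arr l * 5)
  lenLoop-ones : ∀ v l {e r y} → while 1F isBit (ifp 1F isOne (pop 1F) (pop 1F ▹ push 2F (bit true))) ⊢
            ⟪ e , put (ones v (false ∷ word arr l)) r , y ⟫ ⇛ ⟪ e , sep ∷ r , onto (ones (length l) []) (bit true ∷ y) ⟫
            ≤ suc (length (ones v (false ∷ word arr l)) * 5)
  lenLoop-ones zero l = whTB refl (ifFB refl (popB ▸ pushB)) (lenLoop l)
  lenLoop-ones (suc v) l = relax (s≤s (s≤s (s≤s (m≤n+m _ 2)))) (whTB refl (ifTB refl popB) (lenLoop-ones v l))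
  lenLoop [] = whFB refl
  lenLoop (v ∷ l) = lenLoop-ones v l

  dropsB : ∀ Γ γ {e r} → drops Γ ⊢ ⟪ enc Γ γ e , r , [] ⟫ ⇛ ⟪ e , r , [] ⟫ ≤ 1 + sizeE Γ γ * 2
  dropsB [] γ = nopB
  dropsB (k ∷ Γ) (v , γ) = relax (≤-reflexive eq) (dropE (word k v) ▸ dropsB Γ γ)
    where
    eq : lin1 (size k v) + 1 + (1 + sizeE Γ γ * 2) ≡ 1 + (suc (size k v) + sizeE Γ γ) * 2
    eq = solve 2 (λ a b → ((κ 1 :+ a :* κ 2) :+ κ 1) :+ (κ 1 :+ b :* κ 2) := κ 1 :+ ((κ 1 :+ a) :+ b) :* κ 2)
           refl (size k v) (sizeE Γ γ)
      where open import Data.Nat.Solver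
            open +-*-Solver using (solve; _:+_; _:*_; _:=_) renaming (con to κ)

  varB : ∀ {Γ k} (i : Γ ∋ k) γ {e r y} → NoBit y →
         progVar i ⊢ ⟪ enc Γ γ e , r , y ⟫ ⇛ ⟪ enc Γ γ e , put (word k (look i γ)) r , y ⟫ ≤ ev (varT i) (sizeE Γ γ)
  varB {k ∷ Γ} vz (v , γ) nb = relax (+-monoʳ-≤ 2 (+-mono-≤ (lin-mono le) (lin2-mono le))) (copyB (word k v) nb)
    where le : size k v ≤ suc (size k v) + sizeE Γ γ
          le = ≤-trans (n≤1+n _) (m≤m+n _ _)
  varB {k ∷ Γ} (vs i) (v , γ) nb =
    relax (+-mono-≤ (+-monoˡ-≤ 3 (lin-mono le)) (+-mono-≤ (ev-mono (varT i) (m≤n+m _ (suc (size k v)))) (+-monoʳ-≤ 3 (lin-mono le))))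
      (skip-inB (word k v) ▸ varB i γ refl ▸ skip-outB (word k v) nb)
    where le : size k v ≤ suc (size k v) + sizeE Γ γ
          le = ≤-trans (n≤1+n _) (m≤m+n _ _)

  -- A loop on a unary counter: the D's of the iterations add up
  counter : ∀ i D → 1 + (D + suc (i * suc D)) ≡ 1 + (1 + i) * suc D
  counter i D = cong (1 +_) (+-suc D (i * suc D))

  correct : ∀ {Γ k f} (e : Exp Γ k f) γ {s r} →
            prog e ⊢ ⟪ enc Γ γ s , r , [] ⟫ ⇛ ⟪ enc Γ γ s , put (word k (f γ)) r , [] ⟫ ≤ ev (T e) (sizeE Γ γ)
  corrects : ∀ {Γ Δ σ} (as : Args Γ Δ σ) γ {s r} →
             progs as ⊢ ⟪ enc Γ γ s , r , [] ⟫ ⇛ ⟪ enc Δ (σ γ) (enc Γ γ s) , r , [] ⟫ ≤ ev (TA as) (sizeE Γ γ)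

  module SumLoop {Γ n f} (e : Exp Γ nat n) (e′ : Exp (nat ∷ Γ) nat f) (γ : Env Γ) where
    N = sizeE Γ γ
    M = ev (V e) N + N
    U = ev (V e′) M

    env≤ : ∀ {i} → i < n γ → sizeE (nat ∷ Γ) (i , γ) ≤ M
    env≤ {i} i<n = +-monoˡ-≤ N (≤-trans (≤-reflexive (cong suc (size-nat i))) (≤-trans i<n (valN e γ)))

    loop+ : ∀ i acc {s r} → i ≤ n γ → while 0F isOne (pop 0F ▹ prog e′ ▹ addR) ⊢
            ⟪ put (ones i []) (enc Γ γ s) , put (ones acc []) r , [] ⟫ ⇛
            ⟪ sep ∷ enc Γ γ s , put (ones (Σ< i (λ j → f (j , γ)) + acc) []) r , [] ⟫
            ≤ suc (i * suc (1 + (ev (T e′) M + (lin U + (1 + lin U)))))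
    loop+ zero acc le = whFB refl
    loop+ (suc i) acc {s} {r} le =
      to (cong (λ q → ⟪ sep ∷ enc Γ γ s , put (ones q []) r , [] ⟫) (sym (+-assoc (Σ< i (λ j → f (j , γ))) (f (i , γ)) acc)))
      (relax (≤-reflexive (counter i (1 + (ev (T e′) M + (lin U + (1 + lin U))))))
        (whTB refl (popB ▸ relax (ev-mono (T e′) (env≤ le)) (correct e′ (i , γ)) ▸
                    relax (+-mono-≤ (lin-mono u≤) (s≤s (lin-mono u≤))) (addRB (f (i , γ)) acc))
              (loop+ i (f (i , γ) + acc) (<⇒≤ le))))
      where u≤ : f (i , γ) ≤ U
            u≤ = val-under e e′ γ i le

    loop∷ : ∀ i l {s r} → i ≤ n γ → while 0F isOne (pop 0F ▹ prog e′ ▹ consR) ⊢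
            ⟪ put (ones i []) (enc Γ γ s) , put (word arr l) r , [] ⟫ ⇛
            ⟪ sep ∷ enc Γ γ s , put (word arr (tabOnto i (λ j → f (j , γ)) l)) r , [] ⟫
            ≤ suc (i * suc (1 + (ev (T e′) M + (lin U + (1 + (2 + lin U))))))
    loop∷ zero l le = whFB refl
    loop∷ (suc i) l le =
      relax (≤-reflexive (counter i (1 + (ev (T e′) M + (lin U + (1 + (2 + lin U)))))))
        (whTB refl (popB ▸ relax (ev-mono (T e′) (env≤ le)) (correct e′ (i , γ)) ▸
                    relax (+-mono-≤ (lin-mono u≤) (s≤s (s≤s (s≤s (lin-mono u≤))))) (consRB (f (i , γ)) l))
              (loop∷ i (f (i , γ) ∷ l) (<⇒≤ le)))
      where u≤ : f (i , γ) ≤ U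
            u≤ = val-under e e′ γ i le

  iterLoop : ∀ {Γ f} (e : Exp (arr ∷ Γ) arr f) (γ : Env Γ) B t l {s r} →
             (∀ t′ → t′ ≤ t → size arr (it t′ (λ l → f (l , γ)) l) ≤ B) →
             while 1F isOne (pop 1F ▹ prog e ▹ drop 0F ▹ move-RE) ⊢
             ⟪ put (word arr l) (enc Γ γ s) , put (ones t []) r , [] ⟫ ⇛
             ⟪ put (word arr (it t (λ l → f (l , γ)) l)) (enc Γ γ s) , sep ∷ r , [] ⟫
             ≤ suc (t * suc (1 + (ev (T e) (1 + B + sizeE Γ γ) + ((lin1 B + 1) + (lin B + (1 + (2 + lin B)))))))
  iterLoop e γ B zero l h = whFB refl
  iterLoop {Γ} {f} e γ B (suc t) l h =
    relax (≤-reflexive (counter t (1 + (ev (T e) (1 + B + sizeE Γ γ) + ((lin1 B + 1) + (lin B + (1 + (2 + lin B))))))))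
      (whTB refl
        (popB ▸ relax (ev-mono (T e) (+-monoˡ-≤ (sizeE Γ γ) (s≤s l≤))) (correct e (l , γ)) ▸
         relax (+-monoˡ-≤ 1 (lin1-mono l≤)) (dropE (word arr l)) ▸
         relax (move-mono (h 1 (s≤s z≤n))) (move-REB (word arr (f (l , γ)))))
        (iterLoop e γ B t (f (l , γ)) (λ t′ le → h (suc t′) (s≤s le))))
    where l≤ : size arr l ≤ B
          l≤ = h 0 z≤n

  correct (var i) γ = varB i γ refl
  correct zer γ = pushB
  correct (inc e) γ = correct e γ ▸ pushB
  correct {Γ} (add {f} {g} e e′) γ =
    correct e′ γ ▸ correct e γ ▸ relax (+-mono-≤ (lin-mono (valN e γ)) (s≤s (lin-mono (valN e γ)))) (addRB (f γ) (g γ))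
  correct {Γ} (sub {f} {g} e e′) γ {s} {r} =
    correct e γ ▸ correct e′ γ ▸ relax (lin-mono (val e′ γ)) (transferRX (ones (g γ) []) refl) ▸ popB ▸
    from (cong (λ q → ⟪ enc Γ γ s , put (ones (f γ) []) r , q ⟫) (onto-ones (g γ) []))
      (relax (s≤s (*-monoˡ-≤ 4 (valN e′ γ))) (subLoop (f γ) (g γ)))
  correct {Γ} (cond {k} {c} {f} {g} e e′ e″) γ {s} {r} = correct e γ ▸ branch
    where
    L = lin1 (ev (V e) (sizeE Γ γ)) + 1
    A = ev (T e″) (sizeE Γ γ)
    B = ev (T e′) (sizeE Γ γ)
    branch : ifp 1F isOne (drop 1F ▹ prog e″) (pop 1F ▹ prog e′) ⊢
             ⟪ enc Γ γ s , put (ones (c γ) []) r , [] ⟫ ⇛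
             ⟪ enc Γ γ s , put (word k (ifz (c γ) (f γ) (g γ))) r , [] ⟫ ≤ suc (L + A + (1 + B))
    branch with c γ in eq
    ... | zero  = ifFB refl (relax (m≤n+m _ (L + A)) (popB ▸ correct e′ γ))
    ... | suc m = ifTB refl (relax (≤-trans (+-monoˡ-≤ A (+-monoˡ-≤ 1 (lin1-mono (≤-trans (≤-reflexive (cong (size nat) (sym eq))) (val e γ))))) (m≤m+n _ _))
                                   (dropR (true ∷ ones m []) ▸ correct e″ γ))
  correct {Γ} (sum {n} {f} e e′) γ {s} {r} = pushB ▸ correct e γ ▸ relax (move-mono (val e γ)) (move-REB (ones (n γ) [])) ▸
    relax (s≤s (*-monoˡ-≤ _ (valN e γ)))
      (to (cong (λ q → ⟪ sep ∷ enc Γ γ s , put (ones q []) r , [] ⟫) (+-identityʳ (Σ< (n γ) (λ j → f (j , γ))))) (loop+ (n γ) 0 ≤-refl)) ▸ popB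
    where open SumLoop e e′ γ
  correct (tabu {n} e e′) γ = pushB ▸ correct e γ ▸ relax (move-mono (val e γ)) (move-REB (ones (n γ) [])) ▸
    relax (s≤s (*-monoˡ-≤ _ (valN e γ))) (loop∷ (n γ) [] ≤-refl) ▸ popB
    where open SumLoop e e′ γ
  correct {Γ} (get {a} {i} e e′) γ {s} {r} =
    to (cong (λ q → ⟪ enc Γ γ s , put (ones q []) r , [] ⟫) (dropCells-! (i γ) (a γ)))
    (correct e γ ▸ correct e′ γ ▸ relax (lin-mono (val e′ γ)) (transferRX (ones (i γ) []) refl) ▸ popB ▸
     from (cong (λ q → ⟪ enc Γ γ s , put (word arr (a γ)) r , q ⟫) (onto-ones (i γ) []))
       (relax (s≤s (*-monoˡ-≤ _ (valN e′ γ))) (getLoop (i γ) (a γ) _ (val e γ))) ▸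
     relax (+-mono-≤ (s≤s (*-monoˡ-≤ 4 le)) (+-mono-≤ (lin1-mono le) (lin-mono le))) (takeRB (dropCells (i γ) (a γ))))
    where le = ≤-trans (size-dropCells (i γ) (a γ)) (val e γ)
  correct (len {a} e) γ = correct e γ ▸ relax (s≤s (*-monoˡ-≤ 5 (val e γ))) (lenLoop (a γ)) ▸
    relax (lin-mono (≤-trans (≤-reflexive (size-nat _)) (≤-trans (length≤size (a γ)) (val e γ)))) (transferXR (ones (length (a γ)) []) refl)
  correct {Γ} (iter {n} {a} {f} e e′ e″ b h) γ = correct e γ ▸ correct e′ γ ▸ relax (move-mono (B≤ 0 z≤n)) (move-REB (word arr (a γ))) ▸
    relax (s≤s (*-monoˡ-≤ _ (valN e γ))) (iterLoop e″ γ _ (n γ) (a γ) B≤) ▸ popB ▸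
    relax (+-monoʳ-≤ 2 (+-mono-≤ (lin-mono last≤) (lin2-mono last≤))) (copyB (word arr (it (n γ) _ (a γ))) refl) ▸
    relax (+-monoˡ-≤ 1 (lin1-mono last≤)) (dropE (word arr (it (n γ) _ (a γ))))
    where
    B≤ : ∀ t → t ≤ n γ → size arr (it t (λ l → f (l , γ)) (a γ)) ≤ ev (V b) (sizeE Γ γ)
    B≤ t le = ≤-trans (h γ t le) (valN b γ)
    last≤ = B≤ (n γ) ≤-refl
  correct (app {Δ} {σ = σ} e as) γ = corrects as γ ▸ relax (ev-mono (T e) (vals as γ)) (correct e (σ γ)) ▸
    relax (s≤s (*-monoˡ-≤ 2 (vals as γ))) (dropsB Δ (σ γ))
  correct {Γ} (conv {k} e h) γ {s} {r} = to (cong (λ q → ⟪ enc Γ γ s , put (word k q) r , [] ⟫) (h γ)) (correct e γ)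
  corrects [] γ = nopB
  corrects (_∷_ {k} {f = f} e as) γ = correct e γ ▸ corrects as γ ▸ relax (move-mono (val e γ)) (move-REB (word k (f γ)))

-- Arithmetic by bounded sums: predicates, search, division, dyadic shifts

module Arithmetic where

  open Macros using (Σ<; tab; tabOnto; _!_; it; ifz)
  open import Data.Empty using (⊥-elim)
  open import Data.List using ([]; _∷_; length)
  open import Data.Sum using (_⊎_; inj₁; inj₂)
  open import Relation.Nullary using (¬_; yes; no)

  -- Arithmetic predicates, represented by natural numbers that are positive when the predicate holds

  sg isz : ℕ → ℕ
  sg x  = ifz x 0 1
  isz x = ifz x 1 0

  le lt eq : ℕ → ℕ → ℕ
  le x y = isz (x ∸ y)
  lt x y = le (suc x) y
  eq x y = isz ((x ∸ y) + (y ∸ x))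

  0<-dec : ∀ x → (x ≡ 0) ⊎ (0 < x)
  0<-dec zero    = inj₁ refl
  0<-dec (suc x) = inj₂ (s≤s z≤n)

  0<⇒≢0 : ∀ {x} → 0 < x → ¬ (x ≡ 0)
  0<⇒≢0 (s≤s _) ()

  isz⁺ : ∀ {x} → x ≡ 0 → 0 < isz x
  isz⁺ refl = s≤s z≤n

  isz⁻ : ∀ {x} → 0 < isz x → x ≡ 0
  isz⁻ {zero} _ = refl

  sg⁺ : ∀ {x} → 0 < x → sg x ≡ 1
  sg⁺ {suc x} _ = refl

  sg⁻ : ∀ {x} → 0 < sg x → 0 < x
  sg⁻ {suc x} _ = s≤s z≤n

  sg≤1 : ∀ x → sg x ≤ 1
  sg≤1 zero    = z≤n
  sg≤1 (suc x) = s≤s z≤n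

  isz≤1 : ∀ x → isz x ≤ 1
  isz≤1 zero    = s≤s z≤n
  isz≤1 (suc x) = z≤n

  le⁺ : ∀ {x y} → x ≤ y → 0 < le x y
  le⁺ h = isz⁺ (m≤n⇒m∸n≡0 h)

  le⁻ : ∀ {x y} → 0 < le x y → x ≤ y
  le⁻ {x} h = m∸n≡0⇒m≤n (isz⁻ h)

  eq⁺ : ∀ {x y} → x ≡ y → 0 < eq x y
  eq⁺ {x} refl = isz⁺ (cong₂ _+_ (n∸n≡0 x) (n∸n≡0 x))

  eq⁻ : ∀ {x y} → 0 < eq x y → x ≡ y
  eq⁻ {x} {y} h = ≤-antisym (m∸n≡0⇒m≤n (m+n≡0⇒m≡0 _ (isz⁻ h))) (m∸n≡0⇒m≤n (m+n≡0⇒n≡0 (x ∸ y) (isz⁻ h)))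

  le-val : ∀ {x y} → x ≤ y → le x y ≡ 1
  le-val {x} {y} h rewrite m≤n⇒m∸n≡0 h = refl

  le-val0 : ∀ {x y} → y < x → le x y ≡ 0
  le-val0 {x} {y} h with 0<-dec (le x y)
  ... | inj₁ e = e
  ... | inj₂ h′ = ⊥-elim (<⇒≱ h (le⁻ h′))

  eq-val : ∀ {x y} → x ≡ y → eq x y ≡ 1
  eq-val {x} refl rewrite n∸n≡0 x = refl

  eq-val0 : ∀ {x y} → ¬ (x ≡ y) → eq x y ≡ 0
  eq-val0 {x} {y} h with 0<-dec (eq x y)
  ... | inj₁ e = e
  ... | inj₂ h′ = ⊥-elim (h (eq⁻ h′))

  infixr 7 _&_
  _&_ : ∀ {x y} → 0 < x → 0 < y → 0 < x * y
  s≤s _ & s≤s _ = s≤s z≤n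

  fst⁺ : ∀ {x y} → 0 < x * y → 0 < x
  fst⁺ {suc x} _ = s≤s z≤n

  snd⁺ : ∀ x {y} → 0 < x * y → 0 < y
  snd⁺ x {suc y} _ = s≤s z≤n
  snd⁺ x {zero} h = ⊥-elim (0<⇒≢0 h (*-zeroʳ x))

  unand : ∀ x {y} → 0 < x * y → 0 < x × 0 < y
  unand x h = fst⁺ h , snd⁺ x h

  +⁻ : ∀ x {y} → 0 < x + y → 0 < x ⊎ 0 < y
  +⁻ zero    h = inj₂ h
  +⁻ (suc x) h = inj₁ (s≤s z≤n)

  +⁺ˡ : ∀ {x} y → 0 < x → 0 < x + y
  +⁺ˡ y h = ≤-trans h (m≤m+n _ y)

  +⁺ʳ : ∀ x {y} → 0 < y → 0 < x + y
  +⁺ʳ x h = ≤-trans h (m≤n+m _ x)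

  -- Finite sums

  Σ-cong : ∀ n {f g} → (∀ i → i < n → f i ≡ g i) → Σ< n f ≡ Σ< n g
  Σ-cong zero    h = refl
  Σ-cong (suc n) h = cong₂ _+_ (Σ-cong n (λ i l → h i (m<n⇒m<1+n l))) (h n ≤-refl)

  Σ⁺ : ∀ {n f} i → i < n → 0 < f i → 0 < Σ< n f
  Σ⁺ {suc n} {f} i (s≤s i≤n) h with m≤n⇒m<n∨m≡n i≤n
  ... | inj₁ i<n  = +⁺ˡ (f n) (Σ⁺ i i<n h)
  ... | inj₂ refl = +⁺ʳ (Σ< n f) h

  Σ⁻ : ∀ n {f} → 0 < Σ< n f → ∃[ i ] (i < n × 0 < f i)
  Σ⁻ (suc n) {f} h with +⁻ (Σ< n f) h
  ... | inj₁ h′ = let i , l , p = Σ⁻ n h′ in i , m<n⇒m<1+n l , p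
  ... | inj₂ h′ = n , ≤-refl , h′

  Σ≡0 : ∀ n {f} → (∀ i → i < n → f i ≡ 0) → Σ< n f ≡ 0
  Σ≡0 zero    h = refl
  Σ≡0 (suc n) h = cong₂ _+_ (Σ≡0 n (λ i l → h i (m<n⇒m<1+n l))) (h n ≤-refl)

  Σ≡0⁻ : ∀ n {f} → Σ< n f ≡ 0 → ∀ i → i < n → f i ≡ 0
  Σ≡0⁻ n {f} e i l with 0<-dec (f i)
  ... | inj₁ e′ = e′
  ... | inj₂ h  = ⊥-elim (0<⇒≢0 (Σ⁺ i l h) e)

  Σ-mono : ∀ n {f g} → (∀ i → i < n → f i ≤ g i) → Σ< n f ≤ Σ< n g
  Σ-mono zero    h = z≤n
  Σ-mono (suc n) h = +-mono-≤ (Σ-mono n (λ i l → h i (m<n⇒m<1+n l))) (h n ≤-refl)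

  Σ-mono< : ∀ n {f g} → (∀ i → i < n → f i ≤ g i) → ∀ i → i < n → f i < g i → Σ< n f < Σ< n g
  Σ-mono< (suc n) h i (s≤s i≤n) lt′ with m≤n⇒m<n∨m≡n i≤n
  ... | inj₁ i<n  = +-mono-<-≤ (Σ-mono< n (λ i l → h i (m<n⇒m<1+n l)) i i<n lt′) (h n ≤-refl)
  ... | inj₂ refl = +-mono-≤-< (Σ-mono n (λ i l → h i (m<n⇒m<1+n l))) lt′

  Σ-mono-range : ∀ {m n} f → m ≤ n → Σ< m f ≤ Σ< n f
  Σ-mono-range {n = zero} f z≤n = z≤n
  Σ-mono-range {m} {suc n} f m≤1+n with m≤n⇒m<n∨m≡n m≤1+n
  ... | inj₁ (s≤s m≤n) = ≤-trans (Σ-mono-range f m≤n) (m≤m+n _ _)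
  ... | inj₂ refl = ≤-refl

  Σ-const : ∀ n c → Σ< n (λ _ → c) ≡ n * c
  Σ-const zero    c = refl
  Σ-const (suc n) c = trans (cong (_+ c) (Σ-const n c)) (+-comm (n * c) c)

  +-interchange : ∀ a b c d → (a + b) + (c + d) ≡ (a + c) + (b + d)
  +-interchange a b c d = trans (+-assoc a b (c + d)) (trans (cong (a +_) (trans (sym (+-assoc b c d)) (trans (cong (_+ d) (+-comm b c)) (+-assoc c b d)))) (sym (+-assoc a c (b + d))))

  Σ-+ : ∀ n f g → Σ< n (λ i → f i + g i) ≡ Σ< n f + Σ< n g
  Σ-+ zero    f g = refl
  Σ-+ (suc n) f g = trans (cong (_+ (f n + g n)) (Σ-+ n f g)) (+-interchange (Σ< n f) (Σ< n g) (f n) (g n))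

  Σ-swap : ∀ m n (f : ℕ → ℕ → ℕ) → Σ< m (λ i → Σ< n (f i)) ≡ Σ< n (λ j → Σ< m (λ i → f i j))
  Σ-swap zero    n f = sym (Σ≡0 n (λ _ _ → refl))
  Σ-swap (suc m) n f = trans (cong (_+ Σ< n (f m)) (Σ-swap m n f)) (sym (Σ-+ n (λ j → Σ< m (λ i → f i j)) (f m)))

  Σ-*ˡ : ∀ n c f → Σ< n (λ i → c * f i) ≡ c * Σ< n f
  Σ-*ˡ zero    c f = sym (*-zeroʳ c)
  Σ-*ˡ (suc n) c f = trans (cong (_+ c * f n) (Σ-*ˡ n c f)) (sym (*-distribˡ-+ c (Σ< n f) (f n)))

  Σ-point : ∀ n i f → i < n → f i ≤ Σ< n f
  Σ-point (suc n) i f (s≤s i≤n) with m≤n⇒m<n∨m≡n i≤n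
  ... | inj₁ i<n  = ≤-trans (Σ-point n i f i<n) (m≤m+n _ _)
  ... | inj₂ refl = m≤n+m _ _

  Σ-split : ∀ m d f → Σ< (m + d) f ≡ Σ< m f + Σ< d (λ i → f (m + i))
  Σ-split m zero    f = trans (cong (λ k → Σ< k f) (+-identityʳ m)) (sym (+-identityʳ _))
  Σ-split m (suc d) f rewrite +-suc m d = trans (cong (_+ f (m + d)) (Σ-split m d f)) (+-assoc (Σ< m f) _ _)

  Σ-initial : ∀ n q f → q ≤ n → (∀ i → i < q → f i ≡ 1) → (∀ i → q ≤ i → f i ≡ 0) → Σ< n f ≡ q
  Σ-initial n q f le′ h1 h0 with m≤n⇒∃[o]m+o≡n le′
  ... | d , refl = trans (Σ-split q d f) (trans (cong₂ _+_ (trans (Σ-cong q h1) (trans (Σ-const q 1) (*-identityʳ q)))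
                      (Σ≡0 d (λ i _ → h0 (q + i) (m≤m+n q i)))) (+-identityʳ q))

  -- Tabulated lists and iteration

  tabOnto-! : ∀ n f l i → i < n → tabOnto n f l ! i ≡ f i
  tabOnto-shift : ∀ n f l i → tabOnto n f l ! (n + i) ≡ l ! i
  tabOnto-shift zero    f l i = refl
  tabOnto-shift (suc n) f l i = trans (cong (tabOnto n f (f n ∷ l) !_) (sym (+-suc n i))) (tabOnto-shift n f (f n ∷ l) (suc i))
  tabOnto-! (suc n) f l i (s≤s i≤n) with m≤n⇒m<n∨m≡n i≤n
  ... | inj₁ i<n  = tabOnto-! n f (f n ∷ l) i i<n
  ... | inj₂ refl = trans (cong (tabOnto n f (f n ∷ l) !_) (sym (+-identityʳ n))) (tabOnto-shift n f (f n ∷ l) 0)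

  tab-! : ∀ {n} f {i} → i < n → tab n f ! i ≡ f i
  tab-! {n} f {i} l = tabOnto-! n f [] i l

  tab-!≥ : ∀ {n} f {i} → n ≤ i → tab n f ! i ≡ 0
  tab-!≥ {n} f {i} l with m≤n⇒∃[o]m+o≡n l
  ... | o , refl = tabOnto-shift n f [] o

  tab-pos : ∀ n f {x} → 0 < tab n f ! x → x < n × 0 < f x
  tab-pos n f {x} h with x <? n
  ... | yes l = l , subst (0 <_) (tab-! f l) h
  ... | no ¬l = ⊥-elim (0<⇒≢0 h (tab-!≥ f (≮⇒≥ ¬l)))

  tab-pos⁺ : ∀ n f {x} → x < n → 0 < f x → 0 < tab n f ! x
  tab-pos⁺ n f l h = subst (0 <_) (sym (tab-! f l)) h

  tab-≤ : ∀ n f B → (∀ i → i < n → f i ≤ B) → ∀ i → tab n f ! i ≤ B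
  tab-≤ n f B h i with i <? n
  ... | yes l = ≤-trans (≤-reflexive (tab-! f l)) (h i l)
  ... | no ¬l = ≤-trans (≤-reflexive (tab-!≥ f (≮⇒≥ ¬l))) z≤n

  tabOnto-cong : ∀ n {f g} l → (∀ i → i < n → f i ≡ g i) → tabOnto n f l ≡ tabOnto n g l
  tabOnto-cong zero    l h = refl
  tabOnto-cong (suc n) {f} {g} l h =
    trans (tabOnto-cong n (f n ∷ l) (λ i l → h i (m<n⇒m<1+n l))) (cong (λ q → tabOnto n g (q ∷ l)) (h n ≤-refl))

  tab-cong : ∀ n {f g} → (∀ i → i < n → f i ≡ g i) → tab n f ≡ tab n g
  tab-cong n = tabOnto-cong n []

  length-tabOnto : ∀ n f l → length (tabOnto n f l) ≡ n + length l
  length-tabOnto zero    f l = refl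
  length-tabOnto (suc n) f l = trans (length-tabOnto n f (f n ∷ l)) (+-suc n _)

  length-tab : ∀ n f → length (tab n f) ≡ n
  length-tab n f = trans (length-tabOnto n f []) (+-identityʳ n)

  it-suc : ∀ {A : Set} t (s : A → A) a → it (suc t) s a ≡ s (it t s a)
  it-suc zero    s a = refl
  it-suc (suc t) s a = it-suc t s (s a)

  it-inv : ∀ {A : Set} (P : A → Set) {s : A → A} → (∀ a → P a → P (s a)) → ∀ t a → P a → P (it t s a)
  it-inv P h zero    a p = p
  it-inv P h (suc t) a p = it-inv P h t _ (h a p)

  -- A process that decreases a measure until it stops has stopped after that many steps.
  it-stop : ∀ {A : Set} (P Stop : A → Set) (μ : A → ℕ) {s : A → A} →
            (∀ a → P a → Stop a ⊎ (P (s a) × μ (s a) < μ a)) → (∀ a → P a → Stop a → P (s a) × Stop (s a)) →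
            ∀ t a → P a → μ a ≤ t → P (it t s a) × Stop (it t s a)
  it-stop {A} P Stop μ {s} dec stay = go
    where
    stopped : ∀ t a → P a → Stop a → P (it t s a) × Stop (it t s a)
    stopped zero a p q = p , q
    stopped (suc t) a p q = let p′ , q′ = stay a p q in stopped t (s a) p′ q′
    go : ∀ t a → P a → μ a ≤ t → P (it t s a) × Stop (it t s a)
    go t a p l with dec a p
    ... | inj₁ q = stopped t a p q
    go zero a p l | inj₂ (p′ , d) = ⊥-elim (<⇒≱ d (≤-trans l z≤n))
    go (suc t) a p l | inj₂ (p′ , d) = go t (s a) p′ (≤-pred (≤-trans d l))

  -- Search for the least witness; the value is n when there is none

  least : ℕ → (ℕ → ℕ) → ℕ
  least n P = Σ< n (λ i → isz (Σ< (suc i) P))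

  least-none : ∀ n P → Σ< n P ≡ 0 → least n P ≡ n
  least-none n P e = trans (Σ-cong n (λ i l → cong isz (Σ≡0 (suc i) (λ j j≤i → Σ≡0⁻ n e j (≤-trans j≤i l)))))
                           (trans (Σ-const n 1) (*-identityʳ n))

  least≤ : ∀ n P → least n P ≤ n
  least≤ n P = ≤-trans (Σ-mono n (λ i _ → isz≤1 (Σ< (suc i) P))) (≤-reflexive (trans (Σ-const n 1) (*-identityʳ n)))

  least-prop : ∀ n P i → i < n → 0 < P i → 0 < P (least n P) × least n P ≤ i
  least-prop (suc n) P i (s≤s i≤n) h with 0<-dec (Σ< n P)
  ... | inj₂ h′ with Σ⁻ n h′
  ...   | i′ , l′ , p′ = subst (λ q → 0 < P q × q ≤ i) (sym eqn) (proj₁ ih , goal)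
    where
    ih = least-prop n P i′ l′ p′
    eqn : least (suc n) P ≡ least n P
    eqn with Σ< n P + P n in e
    ... | suc _ = +-identityʳ _
    ... | zero  = ⊥-elim (0<⇒≢0 (+⁺ˡ (P n) h′) e)
    goal : least n P ≤ i
    goal with m≤n⇒m<n∨m≡n i≤n
    ... | inj₁ i<n  = proj₂ (least-prop n P i i<n h)
    ... | inj₂ refl = least≤ n P
  least-prop (suc n) P i (s≤s i≤n) h | inj₁ e with m≤n⇒m<n∨m≡n i≤n
  ... | inj₁ i<n  = ⊥-elim (0<⇒≢0 h (Σ≡0⁻ n e i i<n))
  ... | inj₂ refl = subst (λ q → 0 < P q × q ≤ n) (sym eqn) (h , ≤-refl)
    where
    eqn : least (suc n) P ≡ n
    eqn with Σ< n P + P n in e′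
    ... | suc _ = trans (+-identityʳ _) (least-none n P e)
    ... | zero  = ⊥-elim (0<⇒≢0 (+⁺ʳ (Σ< n P) h) e′)

  least-< : ∀ n P i → i < n → 0 < P i → least n P < n
  least-< n P i l h = ≤-trans (s≤s (proj₂ (least-prop n P i l h))) l

  least-wit : ∀ n P → least n P < n → 0 < P (least n P)
  least-wit n P l with 0<-dec (Σ< n P)
  ... | inj₁ e = ⊥-elim (<-irrefl (least-none n P e) l)
  ... | inj₂ h = let i , l′ , p = Σ⁻ n h in proj₁ (least-prop n P i l′ p)

  least-cong : ∀ n {P Q} → (∀ i → i < n → 0 < P i → 0 < Q i) → (∀ i → i < n → 0 < Q i → 0 < P i) → least n P ≡ least n Q
  least-cong n {P} {Q} h k = Σ-cong n (λ i l → cz i (λ p → let j , j≤i , q = Σ⁻ (suc i) p in Σ⁺ j j≤i (h j (≤-trans j≤i l) q))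
                                                 (λ p → let j , j≤i , q = Σ⁻ (suc i) p in Σ⁺ j j≤i (k j (≤-trans j≤i l) q)))
    where
    cz : ∀ i → (0 < Σ< (suc i) P → 0 < Σ< (suc i) Q) → (0 < Σ< (suc i) Q → 0 < Σ< (suc i) P) →
         isz (Σ< (suc i) P) ≡ isz (Σ< (suc i) Q)
    cz i f g with Σ< (suc i) P | Σ< (suc i) Q
    ... | zero  | zero  = refl
    ... | suc _ | suc _ = refl
    ... | zero  | suc _ = ⊥-elim (0<⇒≢0 (g (s≤s z≤n)) refl)
    ... | suc _ | zero  = ⊥-elim (0<⇒≢0 (f (s≤s z≤n)) refl)

  -- Division by counting; quo x 0 = x and rem x 0 = 0

  opaque
    quo rem : ℕ → ℕ → ℕ
    quo x d = Σ< x (λ i → le (suc i * d) x)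
    rem x d = ifz d 0 (x ∸ quo x d * d)

    quo-def : ∀ x d → quo x d ≡ Σ< x (λ i → le (suc i * d) x)
    quo-def x d = refl

    rem-def : ∀ x d → rem x d ≡ ifz d 0 (x ∸ quo x d * d)
    rem-def x d = refl

  quo-unique : ∀ q r d → r < d → quo (q * d + r) d ≡ q
  quo-unique q r d r<d = trans (quo-def _ d) (Σ-initial (q * d + r) q _ (≤-trans (m≤m*n q d {{>-nonZero (≤-<-trans z≤n r<d)}}) (m≤m+n _ r))
    (λ i i<q → le-val (≤-trans (*-monoˡ-≤ d i<q) (m≤m+n _ r)))
    (λ i q≤i → le-val0 (≤-trans (+-monoʳ-< (q * d) r<d) (≤-trans (≤-reflexive (+-comm (q * d) d)) (*-monoˡ-≤ d (s≤s q≤i))))))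

  rem-unique : ∀ q r d → r < d → rem (q * d + r) d ≡ r
  rem-unique q r d@(suc _) r<d = trans (rem-def _ d) (trans (cong (λ k → q * d + r ∸ k * d) (quo-unique q r d r<d)) (m+n∸m≡n (q * d) r))

  rem≤ : ∀ x d → rem x d ≤ x
  rem≤ x zero    = ≤-trans (≤-reflexive (rem-def x 0)) z≤n
  rem≤ x (suc d) = ≤-trans (≤-reflexive (rem-def x (suc d))) (m∸n≤m x (quo x (suc d) * suc d))

  rem-0 : ∀ d → rem 0 d ≡ 0
  rem-0 d = n≤0⇒n≡0 (rem≤ 0 d)

  divMod : ∀ x d → 0 < d → ∃[ q ] ∃[ r ] (r < d × x ≡ q * d + r)
  divMod zero d 0<d = 0 , 0 , 0<d , refl
  divMod (suc x) d 0<d with divMod x d 0<d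
  ... | q , r , r<d , refl with m≤n⇒m<n∨m≡n r<d
  ...   | inj₁ l = q , suc r , l , sym (+-suc (q * d) r)
  ...   | inj₂ refl = suc q , 0 , s≤s z≤n , trans (cong suc (+-comm (q * suc r) r)) (sym (+-identityʳ _))

  quo-rem : ∀ x d → 0 < d → x ≡ quo x d * d + rem x d
  quo-rem x d 0<d with divMod x d 0<d
  ... | q , r , r<d , refl rewrite rem-unique q r d r<d | quo-unique q r d r<d = refl

  rem-< : ∀ x d → 0 < d → rem x d < d
  rem-< x d 0<d with divMod x d 0<d
  ... | q , r , r<d , refl rewrite rem-unique q r d r<d = r<d

  rem≤d : ∀ x d → rem x d ≤ d
  rem≤d x zero    = ≤-reflexive (rem-def x 0)
  rem≤d x (suc d) = <⇒≤ (rem-< x (suc d) (s≤s z≤n))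

  quo-< : ∀ x d m → 0 < d → x < m * d → quo x d < m
  quo-< x d m 0<d l with quo x d <? m
  ... | yes h = h
  ... | no ¬h = ⊥-elim (<⇒≱ l (≤-trans (*-monoˡ-≤ d (≮⇒≥ ¬h)) (≤-trans (m≤m+n _ (rem x d)) (≤-reflexive (sym (quo-rem x d 0<d))))))

  quo-mono : ∀ {x y} d → x ≤ y → quo x d ≤ quo y d
  quo-mono {x} {y} d l = subst₂ _≤_ (sym (quo-def x d)) (sym (quo-def y d)) (≤-trans (Σ-mono x (λ i _ → mono i)) (Σ-mono-range _ l))
    where
    mono : ∀ i → le (suc i * d) x ≤ le (suc i * d) y
    mono i with 0<-dec (le (suc i * d) x)
    ... | inj₁ e = ≤-trans (≤-reflexive e) z≤n
    ... | inj₂ h = ≤-trans (isz≤1 _) (≤-reflexive (sym (le-val (≤-trans (le⁻ {suc i * d} h) l))))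

  -- Halving; shr x a is ⌊ x / 2ᵃ ⌋

  half : ℕ → ℕ
  half x = quo x 2

  shr : ℕ → ℕ → ℕ
  shr x a = it a half x

  shr-suc : ∀ x a → shr x (suc a) ≡ half (shr x a)
  shr-suc x a = it-suc a half x

  shr-mono : ∀ a {x y} → x ≤ y → shr x a ≤ shr y a
  shr-mono zero    l = l
  shr-mono (suc a) l = shr-mono a (quo-mono 2 l)

  half-< : ∀ x → 0 < x → half x < x
  half-< (suc x) _ = quo-< (suc x) 2 (suc x) (s≤s z≤n) (m<m*n (suc x) 2 ≤-refl)

  shr-0 : ∀ a → shr 0 a ≡ 0
  shr-0 zero = refl
  shr-0 (suc a) = trans (cong (λ t → shr t a) (quo-def 0 2)) (shr-0 a)

  shr≤ : ∀ x a → shr x a ≤ x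
  shr≤ x zero = ≤-refl
  shr≤ zero (suc a) = ≤-reflexive (shr-0 (suc a))
  shr≤ (suc x) (suc a) = ≤-trans (shr≤ (half (suc x)) a) (<⇒≤ (half-< (suc x) (s≤s z≤n)))

  shr≡0 : ∀ a x → x ≤ a → shr x a ≡ 0
  shr≡0 zero    zero    l = refl
  shr≡0 (suc a) zero    l = shr-0 (suc a)
  shr≡0 (suc a) (suc x) l = shr≡0 a (half (suc x)) (≤-pred (≤-trans (half-< (suc x) (s≤s z≤n)) l))

  shr≡0⇒<2^ : ∀ a x → shr x a ≡ 0 → x < 2 ^ a
  shr≡0⇒<2^ zero    x refl = s≤s z≤n
  shr≡0⇒<2^ (suc a) x e = begin-strict
    x                        ≡⟨ quo-rem x 2 (s≤s z≤n) ⟩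
    half x * 2 + rem x 2     <⟨ +-monoʳ-< (half x * 2) (rem-< x 2 (s≤s z≤n)) ⟩
    half x * 2 + 2           ≡⟨ +-comm (half x * 2) 2 ⟩
    suc (half x) * 2         ≤⟨ *-monoˡ-≤ 2 (shr≡0⇒<2^ a (half x) e) ⟩
    2 ^ a * 2                ≡⟨ *-comm (2 ^ a) 2 ⟩
    2 ^ suc a                ∎
    where open ≤-Reasoning

  <2^⇒shr≡0 : ∀ a x → x < 2 ^ a → shr x a ≡ 0
  <2^⇒shr≡0 zero    zero    l = refl
  <2^⇒shr≡0 zero    (suc x) (s≤s ())
  <2^⇒shr≡0 (suc a) x       l = <2^⇒shr≡0 a (half x) (quo-< x 2 (2 ^ a) (s≤s z≤n) (≤-trans l (≤-reflexive (*-comm 2 (2 ^ a)))))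

  -- The length of the binary expansion: `⌊log₂ x⌋ + 1` for positive `x`, and 0 for 0.
  blog : ℕ → ℕ
  blog x = least (suc x) (λ i → isz (shr x i))

  shr-blog : ∀ x → shr x (blog x) ≡ 0
  shr-blog x = isz⁻ (proj₁ (least-prop (suc x) (λ i → isz (shr x i)) x ≤-refl (isz⁺ (shr≡0 x x ≤-refl))))

  <2^blog : ∀ x → x < 2 ^ blog x
  <2^blog x = shr≡0⇒<2^ (blog x) x (shr-blog x)

  blog-min : ∀ x a → x < 2 ^ a → blog x ≤ a
  blog-min x a l with a ≤? x
  ... | yes a≤x = proj₂ (least-prop (suc x) (λ i → isz (shr x i)) a (s≤s a≤x) (isz⁺ (<2^⇒shr≡0 a x l)))
  ... | no ¬a≤x = ≤-trans (proj₂ (least-prop (suc x) (λ i → isz (shr x i)) x ≤-refl (isz⁺ (shr≡0 x x ≤-refl)))) (<⇒≤ (≰⇒> ¬a≤x))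

  shr-ext : ∀ w x y → shr x w ≡ 0 → shr y w ≡ 0 → (∀ i → i < w → rem (shr x i) 2 ≡ rem (shr y i) 2) → x ≡ y
  shr-ext zero    x y refl refl h = refl
  shr-ext (suc w) x y ex ey h = begin
    x                     ≡⟨ quo-rem x 2 (s≤s z≤n) ⟩
    half x * 2 + rem x 2  ≡⟨ cong₂ (λ a b → a * 2 + b) (shr-ext w (half x) (half y) ex ey (λ i l → h (suc i) (s≤s l))) (h 0 (s≤s z≤n)) ⟩
    half y * 2 + rem y 2  ≡⟨ sym (quo-rem y 2 (s≤s z≤n)) ⟩
    y                     ∎
    where open ≡-Reasoning

  -- The index of the dyadic interval that has the same parent.
  sib : ℕ → ℕ
  sib k = ifz (rem k 2) (suc k) (k ∸ 1)

  half-sib : ∀ k k′ → half k ≡ half k′ → ¬ (k ≡ k′) → k′ ≡ sib k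
  half-sib k k′ e ne with divMod k 2 (s≤s z≤n) | divMod k′ 2 (s≤s z≤n)
  ... | q , r , r<2 , refl | q′ , r′ , r′<2 , refl =
    go r r′ r<2 r′<2 (trans (sym (quo-unique q r 2 r<2)) (trans e (quo-unique q′ r′ 2 r′<2))) ne
    where
    sib-val : ∀ r → r < 2 → sib (q * 2 + r) ≡ ifz r (suc (q * 2 + r)) ((q * 2 + r) ∸ 1)
    sib-val r l = cong (λ t → ifz t (suc (q * 2 + r)) ((q * 2 + r) ∸ 1)) (rem-unique q r 2 l)
    go : ∀ r r′ → r < 2 → r′ < 2 → q ≡ q′ → ¬ (q * 2 + r ≡ q′ * 2 + r′) → q′ * 2 + r′ ≡ sib (q * 2 + r)
    go 0 0 _ _ refl ne = ⊥-elim (ne refl)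
    go 0 1 _ _ refl ne = trans (+-suc (q * 2) 0) (sym (sib-val 0 (s≤s z≤n)))
    go 1 0 _ _ refl ne = trans (trans (+-identityʳ (q * 2)) (sym (cong (_∸ 1) (+-comm (q * 2) 1)))) (sym (sib-val 1 (s≤s (s≤s z≤n))))
    go 1 1 _ _ refl ne = ⊥-elim (ne refl)
    go (suc (suc _)) _ (s≤s (s≤s ())) _ _ _
    go _ (suc (suc _)) _ (s≤s (s≤s ())) _ _

-- Common multiples, a deterministic choice of primes, and Vandermonde systems modulo a prime

module NumberTheory where

  open Macros using (Σ<; tab; tabOnto; _!_; it; ifz)
  open Arithmetic
  open import Data.Empty using (⊥; ⊥-elim)
  import Data.Integer as ℤ
  import Data.Integer.Properties as ℤₚ
  open import Data.Integer using (ℤ)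
  import Data.Integer.Divisibility.Signed as ℤ∣
  open ℤ∣ using () renaming (_∣_ to _∣ℤ_)
  import Data.Integer.Tactic.RingSolver as ℤ-Solver
  open import Data.Nat.Divisibility
  open import Data.Nat.Induction using (<-wellFounded)
  open import Data.Nat.Primality using (Prime; prime?; euclidsLemma; prime⇒nonTrivial; ¬prime⇒composite; prime)
  open import Data.Nat.Tactic.RingSolver using (solve-∀)
  open import Data.Sum using (inj₁; inj₂)
  open import Induction.WellFounded using (Acc; acc)
  open import Relation.Nullary using (¬_; yes; no)
  open import Relation.Nullary.Decidable using (_×-dec_)

  -- Common multiples of 1, …, n are exponentially large

  bin : ℕ → ℕ → ℕ
  bin n       zero    = 1
  bin zero    (suc k) = 0
  bin (suc n) (suc k) = bin n k + bin n (suc k)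

  bin-absorb : ∀ n k → suc k * bin (suc n) (suc k) ≡ suc n * bin n k
  bin-absorb zero    zero    = refl
  bin-absorb zero    (suc k) = *-zeroʳ (suc (suc k))
  bin-absorb (suc n) zero    = begin
    1 * (1 + bin (suc n) 1)      ≡⟨ solve₁ (bin (suc n) 1) ⟩
    1 + 1 * bin (suc n) 1        ≡⟨ cong (1 +_) (bin-absorb n 0) ⟩
    1 + suc n * 1                ≡⟨ cong suc (*-identityʳ (suc n)) ⟩
    suc (suc n)                  ≡⟨ sym (*-identityʳ _) ⟩
    suc (suc n) * 1              ∎
    where open ≡-Reasoning
          solve₁ : ∀ a → 1 * (1 + a) ≡ 1 + 1 * a
          solve₁ = solve-∀
  bin-absorb (suc n) (suc k) = begin
    suc (suc k) * (b₁ + b₂)                  ≡⟨ l₁ k b₁ b₂ ⟩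
    suc k * b₁ + b₁ + suc (suc k) * b₂       ≡⟨ cong₂ (λ x y → x + b₁ + y) (bin-absorb n k) (bin-absorb n (suc k)) ⟩
    suc n * bin n k + b₁ + suc n * bin n (suc k)  ≡⟨ l₂ n (bin n k) (bin n (suc k)) ⟩
    suc (suc n) * b₁                         ∎
    where
    open ≡-Reasoning
    b₁ = bin (suc n) (suc k)
    b₂ = bin (suc n) (suc (suc k))
    l₁ : ∀ k x y → suc (suc k) * (x + y) ≡ suc k * x + x + suc (suc k) * y
    l₁ = solve-∀
    l₂ : ∀ n x y → suc n * x + (x + y) + suc n * y ≡ suc (suc n) * (x + y)
    l₂ = solve-∀

  bin-shift : ∀ n k → suc n * bin (suc n) k ≡ k * bin (suc n) k + suc n * bin n k
  bin-shift n zero    = refl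
  bin-shift n (suc k) = begin
    suc n * (bin n k + bin n (suc k))                      ≡⟨ *-distribˡ-+ (suc n) (bin n k) _ ⟩
    suc n * bin n k + suc n * bin n (suc k)                ≡⟨ cong (_+ suc n * bin n (suc k)) (sym (bin-absorb n k)) ⟩
    suc k * bin (suc n) (suc k) + suc n * bin n (suc k)    ∎
    where open ≡-Reasoning

  bin-zero : ∀ n k → n < k → bin n k ≡ 0
  bin-zero zero    (suc k) _ = refl
  bin-zero (suc n) (suc k) (s≤s l) = cong₂ _+_ (bin-zero n k l) (bin-zero n (suc k) (m<n⇒m<1+n l))

  bin-sum : ∀ n → Σ< (suc n) (bin n) ≡ 2 ^ n
  bin-sum zero    = refl
  bin-sum (suc n) = begin
    Σ< (suc (suc n)) (bin (suc n))                       ≡⟨ pascal (suc n) ⟩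
    Σ< (suc (suc n)) (bin n) + Σ< (suc n) (bin n)        ≡⟨ cong (λ x → Σ< (suc n) (bin n) + x + Σ< (suc n) (bin n)) (bin-zero n (suc n) ≤-refl) ⟩
    Σ< (suc n) (bin n) + 0 + Σ< (suc n) (bin n)          ≡⟨ cong (λ x → x + 0 + x) (bin-sum n) ⟩
    2 ^ n + 0 + 2 ^ n                                    ≡⟨ l (2 ^ n) ⟩
    2 ^ suc n                                            ∎
    where
    open ≡-Reasoning
    pascal : ∀ m → Σ< (suc m) (bin (suc n)) ≡ Σ< (suc m) (bin n) + Σ< m (bin n)
    pascal zero    = refl
    pascal (suc m) = trans (cong (_+ (bin n m + bin n (suc m))) (pascal m)) (l′ (Σ< (suc m) (bin n)) (Σ< m (bin n)) (bin n m) (bin n (suc m)))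
      where l′ : ∀ a b c d → a + b + (c + d) ≡ a + d + (b + c)
            l′ = solve-∀
    l : ∀ a → a + 0 + a ≡ 2 * a
    l = solve-∀

  module _ (d M : ℕ) (mult : ∀ m → 1 ≤ m → m ≤ M → m ∣ d) where

    -- the entries of Leibniz' harmonic triangle, multiplied by d, are integers
    leibniz : ∀ k n → suc n ≤ M → k ≤ n → suc n * bin n k ∣ d
    leibniz zero    n       l _ = subst (_∣ d) (sym (*-identityʳ (suc n))) (mult (suc n) (s≤s z≤n) l)
    leibniz (suc k) (suc n) l (s≤s k≤n) with leibniz k n (<⇒≤ l) k≤n | leibniz k (suc n) l (m≤n⇒m≤1+n k≤n)
    -- The rule of the harmonic triangle, in which an entry is the difference of the entry above it
    -- and its left neighbour: `x` and `y` are these two, multiplied by `d`.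
    ... | divides x ex | divides y ey = divides (x ∸ y) (*-cancelˡ-≡ d ((x ∸ y) * (N * γ)) (suc k) main)
      where
      open ≡-Reasoning
      N = suc (suc n)
      β = bin (suc n) k
      γ = bin (suc n) (suc k)
      c = suc n * bin n k
      yc : suc k * d + y * (N * c) ≡ N * d
      yc = +-cancelʳ-≡ (k * d) _ _ (begin
        suc k * d + y * (N * c) + k * d              ≡⟨ cong (λ t → suc k * d + y * (N * c) + k * t) ey ⟩
        suc k * d + y * (N * c) + k * (y * (N * β))  ≡⟨ l₁ (suc k * d) y N c k β ⟩
        suc k * d + y * N * (k * β + c)              ≡⟨ cong (λ t → suc k * d + y * N * t) (sym (bin-shift n k)) ⟩
        suc k * d + y * N * (suc n * β)              ≡⟨ l₂ (suc k * d) y N n β ⟩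
        suc k * d + suc n * (y * (N * β))            ≡⟨ cong (λ t → suc k * d + suc n * t) (sym ey) ⟩
        suc k * d + suc n * d                        ≡⟨ l₃ k n d ⟩
        N * d + k * d                                ∎)
        where
        l₁ : ∀ a y N c k β → a + y * (N * c) + k * (y * (N * β)) ≡ a + y * N * (k * β + c)
        l₁ = solve-∀
        l₂ : ∀ a y N n β → a + y * N * (suc n * β) ≡ a + suc n * (y * (N * β))
        l₂ = solve-∀
        l₃ : ∀ k n d → suc k * d + suc n * d ≡ suc (suc n) * d + k * d
        l₃ = solve-∀
      main : suc k * d ≡ suc k * ((x ∸ y) * (N * γ))
      main = begin
        suc k * d                              ≡⟨ sym (m+n∸n≡m (suc k * d) (y * (N * c))) ⟩
        suc k * d + y * (N * c) ∸ y * (N * c)  ≡⟨ cong (_∸ y * (N * c)) yc ⟩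
        N * d ∸ y * (N * c)                    ≡⟨ cong (λ t → N * t ∸ y * (N * c)) ex ⟩
        N * (x * c) ∸ y * (N * c)              ≡⟨ cong (_∸ y * (N * c)) (l₄ N x c) ⟩
        x * (N * c) ∸ y * (N * c)              ≡⟨ sym (*-distribʳ-∸ (N * c) x y) ⟩
        (x ∸ y) * (N * c)                      ≡⟨ cong (λ t → (x ∸ y) * (N * t)) (sym (bin-absorb n k)) ⟩
        (x ∸ y) * (N * (suc k * γ))            ≡⟨ l₅ (x ∸ y) N (suc k) γ ⟩
        suc k * ((x ∸ y) * (N * γ))            ∎
        where
        l₄ : ∀ N x c → N * (x * c) ≡ x * (N * c)
        l₄ = solve-∀
        l₅ : ∀ a b c d → a * (b * (c * d)) ≡ c * (a * (b * d))
        l₅ = solve-∀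

  -- All `n + 1` numbers `(n + 1) * bin n k` divide `d`, hence are at most `d`, and they add up to
  -- `(n + 1) * 2 ^ n`.
  common-multiple : ∀ n d → 0 < d → (∀ m → 1 ≤ m → m ≤ suc n → m ∣ d) → 2 ^ n ≤ d
  common-multiple n d 0<d mult = *-cancelˡ-≤ (suc n) (begin
    suc n * 2 ^ n                           ≡⟨ cong (suc n *_) (sym (bin-sum n)) ⟩
    suc n * Σ< (suc n) (bin n)              ≡⟨ sym (Σ-*ˡ (suc n) (suc n) (bin n)) ⟩
    Σ< (suc n) (λ k → suc n * bin n k)      ≤⟨ Σ-mono (suc n) (λ k l → ∣⇒≤ {{>-nonZero 0<d}} (leibniz d (suc n) mult k n ≤-refl (≤-pred l))) ⟩
    Σ< (suc n) (λ _ → d)                    ≡⟨ Σ-const (suc n) d ⟩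
    suc n * d                               ∎)
    where open ≤-Reasoning

  -- A polynomially bounded prime above any given number

  private
    n<c^n : ∀ c n → 2 ≤ c → n < c ^ n
    n<c^n c zero    l = s≤s z≤n
    n<c^n c (suc n) l = begin-strict
      suc n           ≤⟨ n<c^n c n l ⟩
      c ^ n           <⟨ m<m*n (c ^ n) c {{m^n≢0 c n {{>-nonZero (<⇒≤ l)}}}} l ⟩
      c ^ n * c       ≡⟨ *-comm (c ^ n) c ⟩
      c ^ suc n       ∎
      where open ≤-Reasoning

    max-power : ∀ c M → 2 ≤ c → 1 ≤ M → ∃[ e ] (c ^ e ≤ M × (∀ a → c ^ a ≤ M → a ≤ e))
    max-power c M 2≤c 1≤M = let e , p , q = go M in e , p , λ a l → q a (<⇒≤ (<-≤-trans (n<c^n c a 2≤c) l)) l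
      where
      go : ∀ k → ∃[ e ] (c ^ e ≤ M × (∀ a → a ≤ k → c ^ a ≤ M → a ≤ e))
      go zero = 0 , 1≤M , λ { zero _ _ → z≤n }
      go (suc k) with c ^ suc k ≤? M
      ... | yes l = suc k , l , λ a l′ _ → l′
      ... | no ¬l with go k
      ...   | e , p , q = e , p , λ a l′ m → q a (≤-pred (≤∧≢⇒< l′ (λ { refl → ¬l m }))) m

    strip : ∀ c m → 2 ≤ c → 0 < m → Acc _<_ m → ∃[ a ] ∃[ m′ ] (m ≡ c ^ a * m′ × 0 < m′ × ¬ (c ∣ m′))
    strip c m 2≤c 0<m (acc rs) with c ∣? m
    ... | no ¬d = 0 , m , sym (+-identityʳ m) , 0<m , ¬d
    ... | yes (divides q refl) with 0<-dec q
    ...   | inj₁ refl = ⊥-elim (0<⇒≢0 0<m refl)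
    ...   | inj₂ 0<q with strip c q 2≤c 0<q (rs (m<m*n q c {{>-nonZero 0<q}} 2≤c))
    ...     | a , m′ , e , p , ¬d = suc a , m′ , trans (cong (_* c) e) (l c (c ^ a) m′) , p , ¬d
      where l : ∀ c x y → x * y * c ≡ c * x * y
            l = solve-∀

    prime-factor : ∀ m → 2 ≤ m → Acc _<_ m → ∃[ p ] (Prime p × p ∣ m)
    prime-factor m l (acc rs) with prime? m
    ... | yes p = m , p , ∣-refl
    ... | no ¬p with ¬prime⇒composite {{n>1⇒nonTrivial l}} ¬p
    ...   | hasNonTrivialDivisor {d} {{nt}} d<m d∣m with prime-factor d (nonTrivial⇒n>1 d {{nt}}) (rs d<m)
    ...     | q , pq , q∣d = q , pq , ∣-trans q∣d d∣m

    -- The product of the largest powers `c ^ e ≤ M` over all `c` from 2 to `N + 1`. Composite `c`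
    -- are included: they do no harm to divisibility, and there are still only `N` factors.
    smooth-multiple : ∀ N M → 1 ≤ M → ∃[ d ] (0 < d × d ≤ M ^ N × (∀ m → 0 < m → m ≤ M → (∀ p → Prime p → p ∣ m → p ≤ suc N) → m ∣ d))
    smooth-multiple zero M 1≤M = 1 , s≤s z≤n , ≤-refl , div
      where
      div : ∀ m → 0 < m → m ≤ M → (∀ p → Prime p → p ∣ m → p ≤ 1) → m ∣ 1
      div 1 _ _ _ = ∣-refl
      div m@(suc (suc _)) _ _ h with prime-factor m (s≤s (s≤s z≤n)) (<-wellFounded m)
      ... | p , pp , p∣m = ⊥-elim (<⇒≱ (nonTrivial⇒n>1 p {{prime⇒nonTrivial pp}}) (h p pp p∣m))
    smooth-multiple (suc N) M 1≤M with smooth-multiple N M 1≤M | max-power (suc (suc N)) M (s≤s (s≤s z≤n)) 1≤M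
    ... | d , 0<d , d≤ , div | e , ce≤ , emax = c ^ e * d , (m^n>0 c e & 0<d) , *-mono-≤ ce≤ d≤ , div′
      where
      c = suc (suc N)
      div′ : ∀ m → 0 < m → m ≤ M → (∀ p → Prime p → p ∣ m → p ≤ c) → m ∣ c ^ e * d
      div′ m 0<m m≤M h with strip c m (s≤s (s≤s z≤n)) 0<m (<-wellFounded m)
      ... | a , m′ , refl , 0<m′ , ¬d = *-pres-∣
        (m≤n⇒m^o∣n^o a e (emax a (≤-trans (m≤m*n (c ^ a) m′ {{>-nonZero 0<m′}}) m≤M)))
        (div m′ 0<m′ (≤-trans (m≤n*m m′ (c ^ a) {{m^n≢0 c a}}) m≤M)
          (λ p pp p∣m′ → ≤-pred (≤∧≢⇒< (h p pp (∣n⇒∣m*n (c ^ a) p∣m′)) (λ { refl → ¬d p∣m′ }))))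
        where
        m≤n⇒m^o∣n^o : ∀ a e → a ≤ e → c ^ a ∣ c ^ e
        m≤n⇒m^o∣n^o a e l with m≤n⇒∃[o]m+o≡n l
        ... | o , refl = subst (c ^ a ∣_) (sym (^-distribˡ-+-* c a o)) (∣m⇒∣m*n (c ^ o) ∣-refl)

    square≤2^ : ∀ x → (4 + x) * (4 + x) ≤ 2 ^ (4 + x)
    square≤2^ zero = ≤-refl
    square≤2^ (suc x) = begin
      (5 + x) * (5 + x)                ≤⟨ m≤m+n _ (x * x + 6 * x + 7) ⟩
      (5 + x) * (5 + x) + (x * x + 6 * x + 7) ≡⟨ l x ⟩
      2 * ((4 + x) * (4 + x))          ≤⟨ *-monoʳ-≤ 2 (square≤2^ x) ⟩
      2 ^ (5 + x)                      ∎
      where open ≤-Reasoning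
            l : ∀ x → (5 + x) * (5 + x) + (x * x + 6 * x + 7) ≡ 2 * ((4 + x) * (4 + x))
            l = solve-∀

  -- If every prime up to `M = (4 + N)²` were at most `N + 1`, the numbers up to `M` would have a
  -- common multiple below `M ^ N + 1`, whereas common multiples are at least `2 ^ (M - 1)`.
  prime-above : ∀ N → ∃[ p ] (p < suc ((4 + N) * (4 + N)) × suc N < p × Prime p)
  prime-above N with anyUpTo? (λ p → (suc N <? p) ×-dec (prime? p)) (suc ((4 + N) * (4 + N)))
  ... | yes (p , l , m , q) = p , l , m , q
  ... | no none = ⊥-elim (<⇒≱ small (≤-trans large d≤))
    where
    M = (4 + N) * (4 + N)
    S = smooth-multiple N M (s≤s z≤n)
    d = proj₁ S
    d≤ = proj₁ (proj₂ (proj₂ S))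
    -- This is `M - 1`, written so that `suc K` computes to `M`.
    K = 3 + N + (3 + N) * (4 + N)
    large : 2 ^ K ≤ d
    large = common-multiple K d (proj₁ (proj₂ S)) (λ m 1≤m m≤M → proj₂ (proj₂ (proj₂ S)) m 1≤m m≤M
      (λ p pp p∣m → ≮⇒≥ (λ l → none (p , s≤s (≤-trans (∣⇒≤ {{>-nonZero 1≤m}} p∣m) m≤M) , l , pp))))
    small : M ^ N < 2 ^ K
    small = begin-strict
      M ^ N               ≤⟨ ^-monoˡ-≤ N (square≤2^ N) ⟩
      (2 ^ (4 + N)) ^ N   ≡⟨ ^-*-assoc 2 (4 + N) N ⟩
      2 ^ ((4 + N) * N)   <⟨ ^-monoʳ-< 2 (s≤s (s≤s z≤n)) (≤-trans (s≤s (m≤m+n ((4 + N) * N) (14 + N * 4))) (≤-reflexive (l N))) ⟩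
      2 ^ K               ∎
      where open ≤-Reasoning
            l : ∀ N → suc ((4 + N) * N + (14 + N * 4)) ≡ 3 + N + (3 + N) * (4 + N)
            l = solve-∀

  -- Vandermonde

  Σℤ : ℕ → (ℕ → ℤ) → ℤ
  Σℤ zero    f = ℤ.+ 0
  Σℤ (suc n) f = Σℤ n f ℤ.+ f n

  Σℤ-cong : ∀ n {f g} → (∀ i → i < n → f i ≡ g i) → Σℤ n f ≡ Σℤ n g
  Σℤ-cong zero    h = refl
  Σℤ-cong (suc n) h = cong₂ ℤ._+_ (Σℤ-cong n (λ i l → h i (m<n⇒m<1+n l))) (h n ≤-refl)

  Σℤ-0 : ∀ n {f} → (∀ i → i < n → f i ≡ ℤ.+ 0) → Σℤ n f ≡ ℤ.+ 0
  Σℤ-0 zero    h = refl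
  Σℤ-0 (suc n) h = cong₂ ℤ._+_ (Σℤ-0 n (λ i l → h i (m<n⇒m<1+n l))) (h n ≤-refl)

  Σℤ-+ : ∀ n f g → Σℤ n (λ i → f i ℤ.+ g i) ≡ Σℤ n f ℤ.+ Σℤ n g
  Σℤ-+ zero    f g = refl
  Σℤ-+ (suc n) f g = trans (cong (ℤ._+ (f n ℤ.+ g n)) (Σℤ-+ n f g)) (l (Σℤ n f) (Σℤ n g) (f n) (g n))
    where l : ∀ a b c d → (a ℤ.+ b) ℤ.+ (c ℤ.+ d) ≡ (a ℤ.+ c) ℤ.+ (b ℤ.+ d)
          l = ℤ-Solver.solve-∀

  Σℤ-*ˡ : ∀ n c f → Σℤ n (λ i → c ℤ.* f i) ≡ c ℤ.* Σℤ n f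
  Σℤ-*ˡ zero    c f = sym (ℤₚ.*-zeroʳ c)
  Σℤ-*ˡ (suc n) c f = trans (cong (ℤ._+ c ℤ.* f n) (Σℤ-*ˡ n c f)) (sym (ℤₚ.*-distribˡ-+ c (Σℤ n f) (f n)))

  Σℤ-∣ : ∀ n {p} f → (∀ i → i < n → p ∣ℤ f i) → p ∣ℤ Σℤ n f
  Σℤ-∣ zero    f h = ℤ∣.divides (ℤ.+ 0) refl
  Σℤ-∣ (suc n) f h = ℤ∣.∣m∣n⇒∣m+n (Σℤ-∣ n f (λ i l → h i (m<n⇒m<1+n l))) (h n ≤-refl)

  Σℤ-swap : ∀ m n (f : ℕ → ℕ → ℤ) → Σℤ m (λ i → Σℤ n (f i)) ≡ Σℤ n (λ j → Σℤ m (λ i → f i j))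
  Σℤ-swap zero    n f = sym (Σℤ-0 n (λ _ _ → refl))
  Σℤ-swap (suc m) n f = trans (cong (ℤ._+ Σℤ n (f m)) (Σℤ-swap m n f)) (sym (Σℤ-+ n (λ j → Σℤ m (λ i → f i j)) (f m)))

  Σℤ-others : ∀ n {p} f e → e < n → (∀ i → i < n → ¬ (i ≡ e) → p ∣ℤ f i) → p ∣ℤ Σℤ n f → p ∣ℤ f e
  Σℤ-others (suc n) f e (s≤s e≤n) h d with m≤n⇒m<n∨m≡n e≤n
  ... | inj₁ e<n  = Σℤ-others n f e e<n (λ i l → h i (m<n⇒m<1+n l)) (ℤ∣.∣m+n∣n⇒∣m {m = Σℤ n f} d (h n ≤-refl (λ { refl → <-irrefl refl e<n })))
  ... | inj₂ refl = ℤ∣.∣m+n∣m⇒∣n d (Σℤ-∣ n f (λ i l → h i (m<n⇒m<1+n l) (λ { refl → <-irrefl refl l })))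

  nz : ℤ → ℕ
  nz z = sg ℤ.∣ z ∣

  nz-zero : ∀ z → nz z ≡ 0 → z ≡ ℤ.+ 0
  nz-zero (ℤ.+ 0) _ = refl

  module _ {p N : ℕ} (pp : Prime p) (N≤p : N ≤ p) where

    diff-∤ : ∀ {a b} → a < N → b < N → ¬ (a ≡ b) → ¬ (p ∣ ℤ.∣ ℤ.+ a ℤ.- ℤ.+ b ∣)
    diff-∤ {a} {b} a<N b<N ne d with ≤-total a b
    ... | inj₁ a≤b = small (subst (p ∣_) (trans (cong ℤ.∣_∣ (ℤₚ.m-n≡m⊖n a b)) (ℤₚ.∣⊖∣-≤ a≤b)) d) (m>n⇒m∸n≢0 (≤∧≢⇒< a≤b ne)) (≤-<-trans (m∸n≤m b a) (<-≤-trans b<N N≤p))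
      where small : ∀ {x} → p ∣ x → ¬ (x ≡ 0) → x < p → ⊥
            small {zero} _ ne _ = ne refl
            small {suc x} d _ l = <⇒≱ l (∣⇒≤ d)
    ... | inj₂ b≤a = small (subst (p ∣_) (trans (cong ℤ.∣_∣ (trans (ℤₚ.m-n≡m⊖n a b) (ℤₚ.⊖-≥ b≤a))) refl) d) (m>n⇒m∸n≢0 (≤∧≢⇒< b≤a (λ e → ne (sym e)))) (≤-<-trans (m∸n≤m a b) (<-≤-trans a<N N≤p))
      where small : ∀ {x} → p ∣ x → ¬ (x ≡ 0) → x < p → ⊥
            small {zero} _ ne _ = ne refl
            small {suc x} d _ l = <⇒≱ l (∣⇒≤ d)

    cancel : ∀ x y → ¬ (p ∣ ℤ.∣ y ∣) → ℤ.+ p ∣ℤ x ℤ.* y → ℤ.+ p ∣ℤ x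
    cancel x y ¬d d with euclidsLemma ℤ.∣ x ∣ ℤ.∣ y ∣ pp (subst (p ∣_) (ℤₚ.abs-* x y) (ℤ∣.∣⇒∣ᵤ d))
    ... | inj₁ q = ℤ∣.∣ᵤ⇒∣ q
    ... | inj₂ q = ⊥-elim (¬d q)

    -- Induction on the size of the support. Multiplication by `e - e₀` removes `e₀` from it, and
    -- moment `j` of the new coefficients combines moments `j` and `j + 1` of the old ones. The
    -- other differences are not divisible by `p`, as `N ≤ p`; the coefficient at `e₀` is then left
    -- to moment 0.
    vandermonde : ∀ k (c : ℕ → ℤ) → Σ< N (λ e → nz (c e)) ≤ k →
                  (∀ j → j < k → ℤ.+ p ∣ℤ Σℤ N (λ e → c e ℤ.* ℤ.+ (e ^ j))) → ∀ e → e < N → ℤ.+ p ∣ℤ c e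
    vandermonde k c supp mom e e<N with 0<-dec (Σ< N (λ e → nz (c e)))
    ... | inj₁ z = subst (ℤ.+ p ∣ℤ_) (sym (nz-zero (c e) (Σ≡0⁻ N z e e<N))) (ℤ∣.divides (ℤ.+ 0) refl)
    vandermonde zero c supp mom e e<N | inj₂ h = ⊥-elim (<⇒≱ h supp)
    vandermonde (suc k) c supp mom e e<N | inj₂ h with Σ⁻ N h
    ... | e₀ , e₀<N , q = all e e<N
      where
      c′ : ℕ → ℤ
      c′ e = c e ℤ.* (ℤ.+ e ℤ.- ℤ.+ e₀)
      nz≤ : ∀ x y → nz (x ℤ.* y) ≤ nz x
      nz≤ (ℤ.+ 0) y = ≤-refl
      nz≤ (ℤ.+ suc _) y = sg≤1 _
      nz≤ (ℤ.-[1+ _ ]) y = sg≤1 _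
      c′e₀ : c′ e₀ ≡ ℤ.+ 0
      c′e₀ = trans (cong (c e₀ ℤ.*_) (ℤₚ.+-inverseʳ (ℤ.+ e₀))) (ℤₚ.*-zeroʳ (c e₀))
      supp′ : Σ< N (λ e → nz (c′ e)) ≤ k
      supp′ = ≤-pred (≤-trans (Σ-mono< N (λ i _ → nz≤ (c i) _) e₀ e₀<N (subst (_< nz (c e₀)) (sym (cong nz c′e₀)) q)) supp)
      mom′ : ∀ j → j < k → ℤ.+ p ∣ℤ Σℤ N (λ e → c′ e ℤ.* ℤ.+ (e ^ j))
      mom′ j l = subst (ℤ.+ p ∣ℤ_) (sym eqn) (ℤ∣.∣m∣n⇒∣m+n (mom (suc j) (s≤s l)) (ℤ∣.∣n⇒∣m*n (ℤ.- ℤ.+ e₀) (mom j (m<n⇒m<1+n l))))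
        where
        term : ∀ e → c′ e ℤ.* ℤ.+ (e ^ j) ≡ c e ℤ.* ℤ.+ (e ^ suc j) ℤ.+ (ℤ.- ℤ.+ e₀) ℤ.* (c e ℤ.* ℤ.+ (e ^ j))
        term e = trans (lem (c e) (ℤ.+ e) (ℤ.+ e₀) (ℤ.+ (e ^ j))) (cong (λ t → c e ℤ.* t ℤ.+ (ℤ.- ℤ.+ e₀) ℤ.* (c e ℤ.* ℤ.+ (e ^ j))) (sym (ℤₚ.pos-* e (e ^ j))))
          where lem : ∀ c e f x → (c ℤ.* (e ℤ.- f)) ℤ.* x ≡ c ℤ.* (e ℤ.* x) ℤ.+ (ℤ.- f) ℤ.* (c ℤ.* x)
                lem = ℤ-Solver.solve-∀
        eqn : Σℤ N (λ e → c′ e ℤ.* ℤ.+ (e ^ j)) ≡ Σℤ N (λ e → c e ℤ.* ℤ.+ (e ^ suc j)) ℤ.+ (ℤ.- ℤ.+ e₀) ℤ.* Σℤ N (λ e → c e ℤ.* ℤ.+ (e ^ j))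
        eqn = trans (Σℤ-cong N (λ e _ → term e)) (trans (Σℤ-+ N _ _) (cong (λ t → Σℤ N (λ e → c e ℤ.* ℤ.+ (e ^ suc j)) ℤ.+ t) (Σℤ-*ˡ N (ℤ.- ℤ.+ e₀) _)))
      others : ∀ e → e < N → ¬ (e ≡ e₀) → ℤ.+ p ∣ℤ c e
      others e l ne = cancel (c e) _ (diff-∤ l e₀<N ne) (vandermonde k c′ supp′ mom′ e l)
      all : ∀ e → e < N → ℤ.+ p ∣ℤ c e
      all e l with e ≟ e₀
      ... | no ne = others e l ne
      ... | yes refl = Σℤ-others N c e₀ e₀<N others (subst (ℤ.+ p ∣ℤ_) (Σℤ-cong N (λ e _ → ℤₚ.*-identityʳ (c e))) (mom 0 (s≤s z≤n)))

-- Reachability, path separators by depth-first search, and the decomposition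

module Hierarchy where

  open Macros using (Σ<; tab; tabOnto; _!_; it; ifz)
  open Arithmetic
  open import Data.Empty using (⊥-elim)
  open import Data.List using (List)
  open import Data.Sum using (_⊎_; inj₁; inj₂; [_,_]′)
  open import Relation.Nullary using (¬_; yes; no)

  -- Reachability

  data Walk (n : ℕ) (adj : ℕ → ℕ → ℕ) (P : ℕ → Set) (v : ℕ) : ℕ → Set where
    here : Walk n adj P v v
    _▻_  : ∀ {x y} → Walk n adj P v y → y < n × x < n × 0 < adj y x × P x → Walk n adj P v x

  infixl 5 _▻_

  Walk-map : ∀ {n adj P Q v x} → (∀ y → y < n → P y → Q y) → Walk n adj P v x → Walk n adj Q v x
  Walk-map h here = here
  Walk-map h (w ▻ (a , b , c , d)) = Walk-map h w ▻ (a , b , c , h _ b d)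

  Walk-trans : ∀ {n adj P v x y} → Walk n adj P v x → Walk n adj P x y → Walk n adj P v y
  Walk-trans w here = w
  Walk-trans w (w′ ▻ e) = Walk-trans w w′ ▻ e

  Walk-end : ∀ {n adj P v x} → P v → Walk n adj P v x → P x
  Walk-end p here = p
  Walk-end p (_ ▻ (_ , _ , _ , q)) = q

  Walk-sym : ∀ {n adj P v x} → (∀ x y → adj x y ≡ adj y x) → P v → Walk n adj P v x → Walk n adj P x v
  Walk-sym s p here = here
  Walk-sym {adj = adj} s p (w ▻ (a , b , c , d)) = Walk-trans (here ▻ (b , a , subst (0 <_) (s _ _) c , Walk-end p w)) (Walk-sym s p w)

  Σ-update : ∀ n f g i → i < n → (∀ j → j < n → ¬ (j ≡ i) → f j ≡ g j) → Σ< n f + g i ≡ Σ< n g + f i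
  Σ-update (suc n) f g i (s≤s i≤n) h with m≤n⇒m<n∨m≡n i≤n
  ... | inj₁ i<n rewrite h n ≤-refl (λ { refl → <-irrefl refl i<n }) =
    trans (swap₃ (Σ< n f) (g n) (g i)) (trans (cong (_+ g n) (Σ-update n f g i i<n (λ j l → h j (m<n⇒m<1+n l)))) (swap₃ (Σ< n g) (f i) (g n)))
    where swap₃ : ∀ a b c → a + b + c ≡ a + c + b
          swap₃ a b c = trans (+-assoc a b c) (trans (cong (a +_) (+-comm b c)) (sym (+-assoc a c b)))
  ... | inj₂ refl rewrite Σ-cong n (λ j l → h j (m<n⇒m<1+n l) (λ { refl → <-irrefl refl l })) =
    trans (+-assoc (Σ< n g) (f n) (g n)) (trans (cong (Σ< n g +_) (+-comm (f n) (g n))) (sym (+-assoc (Σ< n g) (g n) (f n))))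

  count : ℕ → List ℕ → ℕ
  count n R = Σ< n (R !_)

  count-mono : ∀ n (R S : List ℕ) → (∀ x → x < n → R ! x ≤ 1) → (∀ x → x < n → 0 < R ! x → 0 < S ! x) → count n R ≤ count n S
  count-mono n R S r h = Σ-mono n pt
    where
    pt : ∀ x → x < n → R ! x ≤ S ! x
    pt x l with 0<-dec (R ! x)
    ... | inj₁ e = ≤-trans (≤-reflexive e) z≤n
    ... | inj₂ p = ≤-trans (r x l) (h x l p)

  count-mono< : ∀ n (R S : List ℕ) → (∀ x → x < n → R ! x ≤ 1) → (∀ x → x < n → 0 < R ! x → 0 < S ! x) →
                ∀ d → d < n → R ! d ≡ 0 → 0 < S ! d → count n R < count n S
  count-mono< n R S r h d d<n e q = Σ-mono< n pt d d<n (subst (_< S ! d) (sym e) q)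
    where
    pt : ∀ x → x < n → R ! x ≤ S ! x
    pt x l with 0<-dec (R ! x)
    ... | inj₁ e = ≤-trans (≤-reflexive e) z≤n
    ... | inj₂ p = ≤-trans (r x l) (h x l p)

  count≤n : ∀ n (R : List ℕ) → (∀ x → x < n → R ! x ≤ 1) → count n R ≤ n
  count≤n n R r = ≤-trans (Σ-mono n r) (≤-reflexive (trans (Σ-const n 1) (*-identityʳ n)))

  -- A is an n × n matrix; its symmetrisation is the adjacency relation
  module _ (n : ℕ) (A : List ℕ) where

    adjm : ℕ → ℕ → ℕ
    adjm u v = A ! (u * n + v) + A ! (v * n + u)

    adjm-sym : ∀ u v → adjm u v ≡ adjm v u
    adjm-sym u v = +-comm (A ! (u * n + v)) _

    reachStep : List ℕ → List ℕ → ℕ → ℕ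
    reachStep U R x = sg (R ! x + U ! x * Σ< n (λ y → R ! y * adjm y x))

    opaque
      reach : List ℕ → ℕ → List ℕ
      reach U v = it n (λ R → tab n (reachStep U R)) (tab n (λ x → eq x v))

      reach-def : ∀ U v → reach U v ≡ it n (λ R → tab n (reachStep U R)) (tab n (λ x → eq x v))
      reach-def U v = refl

    Conn : List ℕ → ℕ → ℕ → Set
    Conn U = Walk n adjm (λ x → 0 < U ! x)

    reach≤1 : ∀ U v x → reach U v ! x ≤ 1
    reach≤1 U v x = subst (λ R → R ! x ≤ 1) (sym (reach-def U v))
      (it-inv (λ R → ∀ x → R ! x ≤ 1) (λ R _ → tab-≤ n _ 1 (λ i _ → sg≤1 _)) n _ (tab-≤ n _ 1 (λ i _ → isz≤1 _)) x)

    reach-sound : ∀ U v x → 0 < reach U v ! x → x < n × Conn U v x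
    reach-sound U v = subst (λ R → ∀ x → 0 < R ! x → x < n × Conn U v x) (sym (reach-def U v))
                            (it-inv (λ R → ∀ x → 0 < R ! x → x < n × Conn U v x) stepP n _ start)
      where
      start : ∀ x → 0 < tab n (λ x → eq x v) ! x → x < n × Conn U v x
      start x h with tab-pos n (λ x → eq x v) {x} h
      ... | l , e with eq⁻ {x} e
      ... | refl = l , here
      stepP : ∀ R → (∀ x → 0 < R ! x → x < n × Conn U v x) → ∀ x → 0 < tab n (reachStep U R) ! x → x < n × Conn U v x
      stepP R ih x h with tab-pos n (reachStep U R) {x} h
      ... | l , e with +⁻ (R ! x) (sg⁻ {R ! x + U ! x * Σ< n (λ y → R ! y * adjm y x)} e)
      ...   | inj₁ p = ih x p
      ...   | inj₂ p with unand (U ! x) p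
      ...     | u , q with Σ⁻ n q
      ...       | y , y<n , r with unand (R ! y) r
      ...         | ry , a = l , proj₂ (ih y ry) ▻ (y<n , l , a , u)

    reachStep-mono : ∀ {U V R S x} → x < n → (0 < U ! x → 0 < V ! x) → (∀ y → y < n → 0 < R ! y → 0 < S ! y) →
                     0 < reachStep U R x → 0 < reachStep V S x
    reachStep-mono {U} {V} {R} {S} {x} l u r h with +⁻ (R ! x) (sg⁻ {R ! x + U ! x * Σ< n (λ y → R ! y * adjm y x)} h)
    ... | inj₁ p = subst (0 <_) (sym (sg⁺ (+⁺ˡ (V ! x * Σ< n (λ y → S ! y * adjm y x)) (r x l p)))) (s≤s z≤n)
    ... | inj₂ p with unand (U ! x) p
    ...   | ux , q with Σ⁻ n q
    ...     | y , y<n , t with unand (R ! y) t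
    ...       | ry , a = subst (0 <_) (sym (sg⁺ (+⁺ʳ (S ! x) (u ux & Σ⁺ y y<n (r y y<n ry & a))))) (s≤s z≤n)

    private
      module Closure (U : List ℕ) (v : ℕ) (v<n : v < n) where
        P Stop : List ℕ → Set
        P R = (∀ x → R ! x ≤ 1) × 0 < R ! v
        Stop R = ∀ x → x < n → 0 < reachStep U R x → 0 < R ! x
        nx : List ℕ → List ℕ
        nx R = tab n (reachStep U R)
        keepR : ∀ R x → x < n → 0 < R ! x → 0 < nx R ! x
        keepR R x l p = tab-pos⁺ n (reachStep U R) l (subst (0 <_) (sym (sg⁺ (+⁺ˡ _ p))) (s≤s z≤n))
        P-nx : ∀ R → P R → P (nx R)
        P-nx R (_ , p) = tab-≤ n _ 1 (λ i _ → sg≤1 _) , keepR R v v<n p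
        dec : ∀ R → P R → Stop R ⊎ (P (nx R) × n ∸ count n (nx R) < n ∸ count n R)
        dec R pr with 0<-dec (Σ< n (λ x → reachStep U R x * isz (R ! x)))
        ... | inj₁ e = inj₁ stop
          where
          stop : Stop R
          stop x l h with 0<-dec (R ! x)
          ... | inj₂ p = p
          ... | inj₁ z = ⊥-elim (0<⇒≢0 (h & isz⁺ z) (Σ≡0⁻ n e x l))
        ... | inj₂ h with Σ⁻ n h
        ...   | x , x<n , q with unand (reachStep U R x) q
        ...     | s , r = inj₂ (P-nx R pr , ∸-monoʳ-< grow (count≤n n (nx R) (λ y _ → proj₁ (P-nx R pr) y)))
          where
          grow : count n R < count n (nx R)
          grow = count-mono< n R (nx R) (λ y _ → proj₁ pr y) (keepR R) x x<n (isz⁻ r) (tab-pos⁺ n (reachStep U R) x<n s)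
        stay : ∀ R → P R → Stop R → P (nx R) × Stop (nx R)
        stay R pr st = P-nx R pr , λ x l h → keepR R x l (st x l (reachStep-mono {U} {U} {nx R} {R} l (λ q → q) (λ y y<n q → st y y<n (subst (0 <_) (tab-! (reachStep U R) y<n) q)) h))
        final : P (reach U v) × Stop (reach U v)
        final = subst (λ R → P R × Stop R) (sym (reach-def U v)) (it-stop P Stop (λ R → n ∸ count n R) dec stay n (tab n (λ x → eq x v))
          (tab-≤ n _ 1 (λ i _ → isz≤1 _) , tab-pos⁺ n (λ x → eq x v) v<n (eq⁺ {v} refl)) (m∸n≤m n (count n (tab n (λ x → eq x v)))))
        complete : ∀ {x} → Conn U v x → 0 < reach U v ! x
        complete here = proj₂ (proj₁ final)
        complete (_▻_ {x} {y} w (y<n , x<n , a , u)) = proj₂ final x x<n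
          (subst (0 <_) (sym (sg⁺ (+⁺ʳ (reach U v ! x) (u & Σ⁺ y y<n (complete w & a))))) (s≤s z≤n))

    -- As long as the set is not closed under adjacency, each round adds a vertex; so `n` rounds
    -- close it.
    reach-complete : ∀ U v → v < n → ∀ {x} → Conn U v x → 0 < reach U v ! x
    reach-complete U v l = Closure.complete U v l

    opaque
      -- For `x` in `U`, its component is named by its least vertex.
      cmpr : List ℕ → ℕ → ℕ
      cmpr U x = least n (λ y → reach U x ! y)

      cmpr-def : ∀ U x → cmpr U x ≡ least n (λ y → reach U x ! y)
      cmpr-def U x = refl

    cmpr-wit : ∀ U x → x < n → cmpr U x < n × Conn U x (cmpr U x)
    cmpr-wit U x l rewrite cmpr-def U x = reach-sound U x _ (least-wit n _ (least-< n (λ y → reach U x ! y) x l (reach-complete U x l here)))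

    cmpr-cong : ∀ U x y → x < n → y < n → 0 < U ! x → Conn U x y → cmpr U x ≡ cmpr U y
    cmpr-cong U x y x<n y<n ux w rewrite cmpr-def U x | cmpr-def U y = least-cong n
      (λ i _ h → reach-complete U y y<n (Walk-trans (Walk-sym adjm-sym ux w) (proj₂ (reach-sound U x i h))))
      (λ i _ h → reach-complete U x x<n (Walk-trans w (proj₂ (reach-sound U y i h))))

    cmpr-conn : ∀ U x y → x < n → y < n → 0 < U ! x → 0 < U ! y → cmpr U x ≡ cmpr U y → Conn U x y
    cmpr-conn U x y x<n y<n ux uy e = Walk-trans (proj₂ (cmpr-wit U x x<n))
      (subst (λ r → Conn U r y) (sym e) (Walk-sym adjm-sym uy (proj₂ (cmpr-wit U y y<n))))

    reach-count : ∀ U x y → x < n → y < n → 0 < U ! x → Conn U x y → count n (reach U y) ≡ count n (reach U x)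
    reach-count U x y x<n y<n ux w = ≤-antisym
      (count-mono n (reach U y) (reach U x) (λ i _ → reach≤1 U y i) (λ i _ h → reach-complete U x x<n (Walk-trans w (proj₂ (reach-sound U y i h)))))
      (count-mono n (reach U x) (reach U y) (λ i _ → reach≤1 U x i) (λ i _ h → reach-complete U y y<n (Walk-trans (Walk-sym adjm-sym ux w) (proj₂ (reach-sound U x i h)))))

  -- Path separators.  In a component C, a path is grown as in depth-first search: while some component D of the rest contains
  -- more than half of C, the path is extended into D if possible, and shortened otherwise.  The path is stored as the list of
  -- the positions of the vertices, counted from 1 (0 off the path).

    sepW : List ℕ → List ℕ → ℕ → ℕ
    sepW C st x = C ! x * isz (st ! x)

    -- The majority part: the vertices off the path whose component has more than half of the `tot`
    -- vertices of `C`. By `meet` it is empty or a single component.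
    sepD : List ℕ → ℕ → List ℕ → List ℕ
    sepD C tot st = tab n (λ x → sepW C st x * lt tot (2 * count n (reach (tab n (sepW C st)) x)))

    plen : List ℕ → ℕ
    plen st = Σ< n (λ x → sg (st ! x))

    cand : List ℕ → List ℕ → ℕ → ℕ
    cand D st d = D ! d * ifz (plen st) 1 (Σ< n (λ p → eq (st ! p) (plen st) * adjm p d))

    sepNew : List ℕ → List ℕ → ℕ → ℕ
    sepNew D st x = ifz (Σ< n (λ d → D ! d)) (st ! x)
      (ifz (Σ< n (cand D st)) (ifz (eq (st ! x) (plen st)) (st ! x) 0)
                              (ifz (eq x (least n (cand D st))) (st ! x) (suc (plen st))))

    sepStep : List ℕ → ℕ → List ℕ → List ℕ
    sepStep C tot st = tab n (sepNew (sepD C tot st) st)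

    opaque
      -- The measure `meas` starts at `2 * n` at most and drops in every step, whence the number of
      -- steps.
      sepPath : List ℕ → ℕ → List ℕ
      sepPath U r = it (2 * n) (sepStep (reach U r) (count n (reach U r))) (tab n (λ _ → 0))

      sepPath-def : ∀ U r → sepPath U r ≡ it (2 * n) (sepStep (reach U r) (count n (reach U r))) (tab n (λ _ → 0))
      sepPath-def U r = refl

    record Inv (C st : List ℕ) : Set where
      field
        istab : tab n (st !_) ≡ st
        inC   : ∀ x → x < n → 0 < st ! x → 0 < C ! x
        ≤plen : ∀ x → x < n → st ! x ≤ plen st
        inj   : ∀ x y → x < n → y < n → 0 < st ! x → st ! x ≡ st ! y → x ≡ y
        surj  : ∀ i → 0 < i → i ≤ plen st → ∃[ x ] (x < n × st ! x ≡ i)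
        cons  : ∀ x y → x < n → y < n → 0 < st ! x → st ! y ≡ suc (st ! x) → 0 < adjm x y

    private
      ifz0 : ∀ {x} {a b : ℕ} → x ≡ 0 → ifz x a b ≡ a
      ifz0 refl = refl

      ifz+ : ∀ {x} {a b : ℕ} → 0 < x → ifz x a b ≡ b
      ifz+ {suc x} _ = refl

      istab-tab : ∀ f → tab n (tab n f !_) ≡ tab n f
      istab-tab f = tab-cong n (λ i l → tab-! f l)

      plen≡0 : ∀ st → plen st ≡ 0 → ∀ x → x < n → st ! x ≡ 0
      plen≡0 st e x l with 0<-dec (st ! x)
      ... | inj₁ z = z
      ... | inj₂ p = ⊥-elim (0<⇒≢0 (subst (0 <_) (sym (sg⁺ p)) (s≤s z≤n)) (Σ≡0⁻ n e x l))

      module Sep (C : List ℕ) (C≤1 : ∀ x → C ! x ≤ 1) where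
        tot : ℕ
        tot = count n C

        D : List ℕ → List ℕ
        D st = sepD C tot st

        W : List ℕ → List ℕ
        W st = tab n (sepW C st)

        W⁺ : ∀ st {x} → x < n → 0 < C ! x → st ! x ≡ 0 → 0 < W st ! x
        W⁺ st l c e = tab-pos⁺ n (sepW C st) l (c & isz⁺ e)

        W⁻ : ∀ st {x} → 0 < W st ! x → x < n × 0 < C ! x × st ! x ≡ 0
        W⁻ st {x} h with tab-pos n (sepW C st) {x} h
        ... | l , q with unand (C ! x) q
        ... | c , e = l , c , isz⁻ e

        D⁺ : ∀ st {x} → 0 < W st ! x → tot < 2 * count n (reach (W st) x) → 0 < D st ! x
        D⁺ st {x} w b = let l , q = tab-pos n (sepW C st) {x} w in
          tab-pos⁺ n (λ x → sepW C st x * lt tot (2 * count n (reach (tab n (sepW C st)) x))) l (q & le⁺ b)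

        D⁻ : ∀ st {x} → 0 < D st ! x → 0 < W st ! x × tot < 2 * count n (reach (W st) x)
        D⁻ st {x} h with tab-pos n (λ x → sepW C st x * lt tot (2 * count n (reach (tab n (sepW C st)) x))) {x} h
        ... | l , q with unand (sepW C st x) q
        ... | w , b = tab-pos⁺ n (sepW C st) l w , le⁻ {suc tot} b

        D≤1 : ∀ st x → D st ! x ≤ 1
        D≤1 st = tab-≤ n _ 1 (λ i _ → *-mono-≤ {C ! i * isz (st ! i)} {1} {_} {1} (*-mono-≤ {C ! i} {1} {_} {1} (C≤1 i) (isz≤1 _)) (isz≤1 _))

        -- An extension lengthens the path by one, but takes a vertex out of the majority part,
        -- which counts twice. A shortening does not enlarge the majority part.
        meas : List ℕ → ℕ
        meas st = 2 * count n (D st) + plen st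

        nx : List ℕ → List ℕ
        nx = sepStep C tot

        -- Two disjoint majorities would together have more vertices than `C`.
        meet : ∀ R S → (∀ x → R ! x ≤ 1) → (∀ x → S ! x ≤ 1) → (∀ x → 0 < R ! x → 0 < C ! x) → (∀ x → 0 < S ! x → 0 < C ! x) →
               tot < 2 * count n R → tot < 2 * count n S → ∃[ y ] (0 < R ! y × 0 < S ! y)
        meet R S R≤ S≤ RC SC r s with 0<-dec (Σ< n (λ y → R ! y * S ! y))
        ... | inj₂ h = let y , _ , p = Σ⁻ n h in y , unand (R ! y) p
        ... | inj₁ e = ⊥-elim (<⇒≱ (+-mono-< r s) (begin
          2 * count n R + 2 * count n S          ≡⟨ sym (*-distribˡ-+ 2 (count n R) _) ⟩
          2 * (count n R + count n S)            ≡⟨ cong (2 *_) (sym (Σ-+ n (R !_) (S !_))) ⟩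
          2 * Σ< n (λ y → R ! y + S ! y)         ≤⟨ *-monoʳ-≤ 2 (Σ-mono n pt) ⟩
          2 * tot                                ≡⟨ cong (tot +_) (+-identityʳ tot) ⟩
          tot + tot                              ∎))
          where
          open ≤-Reasoning
          pt : ∀ y → y < n → R ! y + S ! y ≤ C ! y
          pt y l with 0<-dec (R ! y) | 0<-dec (S ! y)
          ... | inj₁ a | inj₁ b = ≤-trans (≤-reflexive (cong₂ _+_ a b)) z≤n
          ... | inj₁ a | inj₂ q = ≤-trans (≤-reflexive (cong (_+ S ! y) a)) (≤-trans (S≤ y) (SC y q))
          ... | inj₂ p | inj₁ b = ≤-trans (≤-reflexive (trans (cong (R ! y +_) b) (+-identityʳ _))) (≤-trans (R≤ y) (RC y p))
          ... | inj₂ p | inj₂ q = ⊥-elim (0<⇒≢0 (p & q) (Σ≡0⁻ n e y l))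

        Stop : List ℕ → Set
        Stop st = Σ< n (D st !_) ≡ 0

        -- the successor is x ↦ g x for the given g in each of the three cases
        module Push (st : List ℕ) (I : Inv C st) (d : ℕ) (d<n : d < n) (Dd : 0 < D st ! d)
                    (link : plen st ≡ 0 ⊎ ∃[ p ] (p < n × st ! p ≡ plen st × 0 < adjm p d))
                    (st′ : List ℕ) (istab′ : tab n (st′ !_) ≡ st′)
                    (st′d : st′ ! d ≡ suc (plen st)) (st′x : ∀ x → x < n → ¬ (x ≡ d) → st′ ! x ≡ st ! x) where
          open Inv I
          L = plen st
          Cd : 0 < C ! d
          Cd = proj₁ (proj₂ (W⁻ st (proj₁ (D⁻ st Dd))))
          std : st ! d ≡ 0
          std = proj₂ (proj₂ (W⁻ st (proj₁ (D⁻ st Dd))))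
          L′ : plen st′ ≡ suc L
          L′ = begin
            plen st′                ≡⟨ sym (+-identityʳ _) ⟩
            plen st′ + 0            ≡⟨ cong (λ t → plen st′ + sg t) (sym std) ⟩
            plen st′ + sg (st ! d)  ≡⟨ Σ-update n (λ x → sg (st′ ! x)) (λ x → sg (st ! x)) d d<n (λ x l ne → cong sg (st′x x l ne)) ⟩
            plen st + sg (st′ ! d)  ≡⟨ cong (λ t → plen st + sg t) st′d ⟩
            plen st + 1             ≡⟨ +-comm (plen st) 1 ⟩
            suc L                   ∎
            where open ≡-Reasoning
          data At (x : ℕ) : Set where
            new : x ≡ d → st′ ! x ≡ suc L → At x
            old : ¬ (x ≡ d) → st′ ! x ≡ st ! x → At x
          at : ∀ x → x < n → At x
          at x l with x ≟ d
          ... | yes refl = new refl st′d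
          ... | no ne = old ne (st′x x l ne)
          I′ : Inv C st′
          I′ = record { istab = istab′ ; inC = inC′ ; ≤plen = ≤plen′ ; inj = inj′ ; surj = surj′ ; cons = cons′ }
            where
            inC′ : ∀ x → x < n → 0 < st′ ! x → 0 < C ! x
            inC′ x l h with at x l
            ... | new refl _ = Cd
            ... | old _ e = inC x l (subst (0 <_) e h)
            ≤plen′ : ∀ x → x < n → st′ ! x ≤ plen st′
            ≤plen′ x l with at x l
            ... | new _ e = ≤-reflexive (trans e (sym L′))
            ... | old _ e = ≤-trans (≤-reflexive e) (≤-trans (≤plen x l) (≤-trans (n≤1+n L) (≤-reflexive (sym L′))))
            inj′ : ∀ x y → x < n → y < n → 0 < st′ ! x → st′ ! x ≡ st′ ! y → x ≡ y
            inj′ x y l m h e with at x l | at y m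
            ... | new refl _ | new refl _ = refl
            ... | new _ a | old _ b = ⊥-elim (<-irrefl (trans (sym b) (trans (sym e) a)) (s≤s (≤plen y m)))
            ... | old _ a | new _ b = ⊥-elim (<-irrefl (trans (sym a) (trans e b)) (s≤s (≤plen x l)))
            ... | old _ a | old _ b = inj x y l m (subst (0 <_) a h) (trans (sym a) (trans e b))
            surj′ : ∀ i → 0 < i → i ≤ plen st′ → ∃[ x ] (x < n × st′ ! x ≡ i)
            surj′ i 0<i i≤ with m≤n⇒m<n∨m≡n (≤-trans i≤ (≤-reflexive L′))
            ... | inj₂ refl = d , d<n , st′d
            ... | inj₁ (s≤s i≤L) with surj i 0<i i≤L
            ...   | x , l , e with at x l
            ...     | new refl _ = ⊥-elim (0<⇒≢0 0<i (trans (sym e) std))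
            ...     | old _ e′ = x , l , trans e′ e
            cons′ : ∀ x y → x < n → y < n → 0 < st′ ! x → st′ ! y ≡ suc (st′ ! x) → 0 < adjm x y
            cons′ x y l m h e with at x l | at y m
            ... | new _ a | new _ b = ⊥-elim (<-irrefl (trans a (trans (sym b) e)) (n<1+n _))
            ... | new _ a | old _ b = ⊥-elim (<-irrefl refl (≤-trans (≤-trans (n≤1+n _) (≤-reflexive (trans (cong suc (sym a)) (trans (sym e) b)))) (≤plen y m)))
            ... | old _ a | old _ b = cons x y l m (subst (0 <_) a h) (trans (sym b) (trans e (cong suc a)))
            ... | old _ a | new refl b = [ (λ z → ⊥-elim (0<⇒≢0 h (trans a (plen≡0 st z x l)))) ,
                    (λ (p , p<n , pe , pa) → subst (λ q → 0 < adjm q d)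
                      (sym (inj x p l p<n (subst (0 <_) a h) (trans (sym a) (trans (suc-injective (trans (sym e) b)) (sym pe))))) pa) ]′ link
          W⊆ : ∀ x → 0 < W st′ ! x → 0 < W st ! x
          W⊆ x h with W⁻ st′ h
          ... | l , c , e with at x l
          ...   | new _ e′ = ⊥-elim (1+n≢0 (trans (sym e′) e))
          ...   | old _ e′ = W⁺ st l c (trans (sym e′) e)
          D⊆ : ∀ x → x < n → 0 < D st′ ! x → 0 < D st ! x
          D⊆ x l h with D⁻ st′ h
          ... | w , b = D⁺ st (W⊆ x w) (≤-trans b (*-monoʳ-≤ 2 (count-mono n (reach (W st′) x) (reach (W st) x) (λ y _ → reach≤1 (W st′) x y)
                          (λ y _ r → reach-complete (W st) x l (Walk-map {P = λ z → 0 < W st′ ! z} {Q = λ z → 0 < W st ! z} (λ z _ → W⊆ z) (proj₂ (reach-sound (W st′) x y r)))))))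
          D′d : D st′ ! d ≡ 0
          D′d with 0<-dec (D st′ ! d)
          ... | inj₁ e = e
          ... | inj₂ h = ⊥-elim (1+n≢0 (trans (sym st′d) (proj₂ (proj₂ (W⁻ st′ (proj₁ (D⁻ st′ h)))))))
          dec : meas st′ < meas st
          dec = begin-strict
            2 * count n (D st′) + plen st′         ≡⟨ cong (2 * count n (D st′) +_) L′ ⟩
            2 * count n (D st′) + suc L            <⟨ +-monoʳ-< (2 * count n (D st′)) (n<1+n (suc L)) ⟩
            2 * count n (D st′) + (2 + L)          ≡⟨ sym (+-assoc (2 * count n (D st′)) 2 L) ⟩
            (2 * count n (D st′) + 2) + L          ≡⟨ cong (_+ L) (trans (+-comm _ 2) (sym (*-suc 2 (count n (D st′))))) ⟩
            2 * suc (count n (D st′)) + L          ≤⟨ +-monoˡ-≤ L (*-monoʳ-≤ 2 (count-mono< n (D st′) (D st) (λ x _ → D≤1 st′ x) D⊆ d d<n D′d Dd)) ⟩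
            2 * count n (D st) + L                 ∎
            where open ≤-Reasoning

        module Pop (st : List ℕ) (I : Inv C st) (d₀ : ℕ) (Dd₀ : 0 < D st ! d₀) (0<L : 0 < plen st)
                   (none : ∀ d p → d < n → p < n → 0 < D st ! d → st ! p ≡ plen st → ¬ (0 < adjm p d))
                   (st′ : List ℕ) (istab′ : tab n (st′ !_) ≡ st′)
                   (st′= : ∀ x → x < n → st ! x ≡ plen st → st′ ! x ≡ 0)
                   (st′≠ : ∀ x → x < n → ¬ (st ! x ≡ plen st) → st′ ! x ≡ st ! x) where
          open Inv I
          L = plen st
          pp : ∃[ x ] (x < n × st ! x ≡ L)
          pp = surj L 0<L ≤-refl
          p = proj₁ pp
          p<n = proj₁ (proj₂ pp)
          stp = proj₂ (proj₂ pp)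
          data At (x : ℕ) : Set where
            top : x ≡ p → st′ ! x ≡ 0 → At x
            old : ¬ (x ≡ p) → st ! x < L → st′ ! x ≡ st ! x → At x
          at : ∀ x → x < n → At x
          at x l with st ! x ≟ L
          ... | yes e = top (inj x p l p<n (subst (0 <_) (sym e) 0<L) (trans e (sym stp))) (st′= x l e)
          ... | no ne = old (λ { refl → ne stp }) (≤∧≢⇒< (≤plen x l) ne) (st′≠ x l ne)
          L′ : suc (plen st′) ≡ L
          L′ = begin
            suc (plen st′)          ≡⟨ +-comm 1 (plen st′) ⟩
            plen st′ + 1            ≡⟨ cong (plen st′ +_) (sym (sg⁺ (subst (0 <_) (sym stp) 0<L))) ⟩
            plen st′ + sg (st ! p)  ≡⟨ Σ-update n (λ x → sg (st′ ! x)) (λ x → sg (st ! x)) p p<n upd ⟩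
            plen st + sg (st′ ! p)  ≡⟨ cong (λ t → plen st + sg t) (st′= p p<n stp) ⟩
            plen st + 0             ≡⟨ +-identityʳ _ ⟩
            L                       ∎
            where
            open ≡-Reasoning
            upd : ∀ x → x < n → ¬ (x ≡ p) → sg (st′ ! x) ≡ sg (st ! x)
            upd x l ne with at x l
            ... | top e _ = ⊥-elim (ne e)
            ... | old _ _ e = cong sg e
          I′ : Inv C st′
          I′ = record { istab = istab′ ; inC = inC′ ; ≤plen = ≤plen′ ; inj = inj′ ; surj = surj′ ; cons = cons′ }
            where
            inC′ : ∀ x → x < n → 0 < st′ ! x → 0 < C ! x
            inC′ x l h with at x l
            ... | top _ e = ⊥-elim (0<⇒≢0 h e)
            ... | old _ _ e = inC x l (subst (0 <_) e h)
            ≤plen′ : ∀ x → x < n → st′ ! x ≤ plen st′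
            ≤plen′ x l with at x l
            ... | top _ e = ≤-trans (≤-reflexive e) z≤n
            ... | old _ lt′ e = ≤-pred (≤-trans (s≤s (≤-reflexive e)) (≤-trans lt′ (≤-reflexive (sym L′))))
            inj′ : ∀ x y → x < n → y < n → 0 < st′ ! x → st′ ! x ≡ st′ ! y → x ≡ y
            inj′ x y l m h e with at x l | at y m
            ... | top _ a | _ = ⊥-elim (0<⇒≢0 h a)
            ... | old _ _ _ | top _ b = ⊥-elim (0<⇒≢0 h (trans e b))
            ... | old _ _ a | old _ _ b = inj x y l m (subst (0 <_) a h) (trans (sym a) (trans e b))
            surj′ : ∀ i → 0 < i → i ≤ plen st′ → ∃[ x ] (x < n × st′ ! x ≡ i)
            surj′ i 0<i i≤ with surj i 0<i (≤-trans i≤ (≤-trans (n≤1+n _) (≤-reflexive L′)))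
            ... | x , l , e with at x l
            ...   | top refl _ = ⊥-elim (<-irrefl (trans (sym e) stp) (≤-trans (s≤s i≤) (≤-reflexive L′)))
            ...   | old _ _ e′ = x , l , trans e′ e
            cons′ : ∀ x y → x < n → y < n → 0 < st′ ! x → st′ ! y ≡ suc (st′ ! x) → 0 < adjm x y
            cons′ x y l m h e with at x l | at y m
            ... | top _ a | _ = ⊥-elim (0<⇒≢0 h a)
            ... | old _ _ _ | top _ b = ⊥-elim (1+n≢0 (trans (sym e) b))
            ... | old _ _ a | old _ _ b = cons x y l m (subst (0 <_) a h) (trans (sym b) (trans e (cong suc a)))
          WW′ : ∀ x → 0 < W st ! x → 0 < W st′ ! x
          WW′ x h with W⁻ st h
          ... | l , c , e with at x l
          ...   | top _ e′ = W⁺ st′ l c e′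
          ...   | old _ _ e′ = W⁺ st′ l c (trans e′ e)
          d₀W = proj₁ (D⁻ st Dd₀)
          d₀<n = proj₁ (W⁻ st d₀W)
          bigd₀ = proj₂ (D⁻ st Dd₀)
          compD : ∀ y → Conn (W st) d₀ y → 0 < D st ! y
          compD y w = D⁺ st wy (≤-trans bigd₀ (*-monoʳ-≤ 2 (≤-reflexive (sym (reach-count (W st) d₀ y d₀<n (proj₁ (W⁻ st wy)) d₀W w)))))
            where wy : 0 < W st ! y
                  wy = Walk-end {P = λ x → 0 < W st ! x} d₀W w
          -- the component of d₀ is not enlarged by returning p, because p has no neighbour in it
          stays : ∀ y → Conn (W st) d₀ y → ∀ z → Conn (W st′) y z → Conn (W st) d₀ z
          stays y w .y here = w
          stays y w z (w′ ▻ (a , b , c , d)) = let ih = stays y w _ w′ in ih ▻ (a , b , c , wz ih)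
            where
            wz : Conn (W st) d₀ _ → 0 < W st ! z
            wz ih with W⁻ st′ d
            ... | l , cz , e with at z l
            ...   | old _ _ e′ = W⁺ st l cz (trans (sym e′) e)
            ...   | top refl _ = ⊥-elim (none _ p a p<n (compD _ ih) stp (subst (0 <_) (adjm-sym _ p) c))
          reach⊆C : ∀ st x → 0 < W st ! x → ∀ y → 0 < reach (W st) x ! y → 0 < C ! y
          reach⊆C st x w y r = proj₁ (proj₂ (W⁻ st (Walk-end {P = λ x → 0 < W st ! x} w (proj₂ (reach-sound (W st) x y r)))))
          -- A majority component after the return of `p` meets the component of `d₀`, which was a
          -- majority before. By `stays` nothing new is reached from the latter, so `x` belongs to
          -- it.
          D⊆ : ∀ x → x < n → 0 < D st′ ! x → 0 < D st ! x
          D⊆ x l h with D⁻ st′ h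
          ... | w , b with meet (reach (W st′) x) (reach (W st) d₀) (reach≤1 (W st′) x) (reach≤1 (W st) d₀) (reach⊆C st′ x w) (reach⊆C st d₀ d₀W) b bigd₀
          ... | y , ry , sy = compD x (stays y (proj₂ (reach-sound (W st) d₀ y sy)) x (Walk-sym adjm-sym w (proj₂ (reach-sound (W st′) x y ry))))
          dec : meas st′ < meas st
          dec = +-mono-≤-< (*-monoʳ-≤ 2 (count-mono n (D st′) (D st) (λ x _ → D≤1 st′ x) D⊆)) (≤-reflexive L′)

        advance : ∀ st → Inv C st → Stop st ⊎ (Inv C (nx st) × meas (nx st) < meas st)
        advance st I with 0<-dec (Σ< n (D st !_))
        ... | inj₁ e = inj₁ e
        ... | inj₂ h with 0<-dec (Σ< n (cand (D st) st))
        ...   | inj₂ hc = inj₂ (I′ , dec)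
          where
          d = least n (cand (D st) st)
          wit = Σ⁻ n hc
          d<n : d < n
          d<n = least-< n _ (proj₁ wit) (proj₁ (proj₂ wit)) (proj₂ (proj₂ wit))
          cd : 0 < cand (D st) st d
          cd = least-wit n _ d<n
          lk : 0 < ifz (plen st) 1 (Σ< n (λ p → eq (st ! p) (plen st) * adjm p d)) →
               plen st ≡ 0 ⊎ ∃[ p ] (p < n × st ! p ≡ plen st × 0 < adjm p d)
          lk q with plen st
          ... | zero  = inj₁ refl
          ... | suc L = let p , l , r = Σ⁻ n q in inj₂ (p , l , eq⁻ (proj₁ (unand (eq (st ! p) (suc L)) r)) , proj₂ (unand (eq (st ! p) (suc L)) r))
          val′ : ∀ x → x < n → nx st ! x ≡ ifz (eq x d) (st ! x) (suc (plen st))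
          val′ x l = trans (tab-! (sepNew (D st) st) l) (trans (ifz+ h) (ifz+ hc))
          open Push st I d d<n (proj₁ (unand (D st ! d) cd)) (lk (proj₂ (unand (D st ! d) cd))) (nx st) (istab-tab _)
                 (trans (val′ d d<n) (ifz+ (eq⁺ {d} refl))) (λ x l ne → trans (val′ x l) (ifz0 (eq-val0 ne)))
        ...   | inj₁ ec = inj₂ (I′ , dec)
          where
          wit = Σ⁻ n h
          d₀ = proj₁ wit
          Dd₀ = proj₂ (proj₂ wit)
          0<L : 0 < plen st
          0<L with 0<-dec (plen st)
          ... | inj₂ p = p
          ... | inj₁ e = ⊥-elim (0<⇒≢0 (Dd₀ & subst (0 <_) (sym (ifz0 {b = Σ< n (λ p → eq (st ! p) (plen st) * adjm p d₀)} e)) (s≤s z≤n)) (Σ≡0⁻ n ec d₀ (proj₁ (proj₂ wit))))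
          none : ∀ d p → d < n → p < n → 0 < D st ! d → st ! p ≡ plen st → ¬ (0 < adjm p d)
          none d p d<n p<n Dd e a = 0<⇒≢0 (Dd & subst (0 <_) (sym (ifz+ 0<L)) (Σ⁺ p p<n (eq⁺ e & a))) (Σ≡0⁻ n ec d d<n)
          val′ : ∀ x → x < n → nx st ! x ≡ ifz (eq (st ! x) (plen st)) (st ! x) 0
          val′ x l = trans (tab-! (sepNew (D st) st) l) (trans (ifz+ h) (ifz0 ec))
          open Pop st I d₀ Dd₀ 0<L none (nx st) (istab-tab _)
                 (λ x l e → trans (val′ x l) (ifz+ (eq⁺ e))) (λ x l ne → trans (val′ x l) (ifz0 (eq-val0 ne)))

        stay : ∀ st → Inv C st → Stop st → Inv C (nx st) × Stop (nx st)
        stay st I s = subst (λ q → Inv C q × Stop q) (sym same) (I , s)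
          where same : nx st ≡ st
                same = trans (tab-cong n (λ x l → ifz0 s)) (Inv.istab I)

        zeros : List ℕ
        zeros = tab n (λ _ → 0)

        zeros! : ∀ x → x < n → zeros ! x ≡ 0
        zeros! x l = tab-! (λ _ → 0) l

        plen-zeros : plen zeros ≡ 0
        plen-zeros = Σ≡0 n (λ x l → cong sg (zeros! x l))

        I₀ : Inv C zeros
        I₀ = record
          { istab = istab-tab _
          ; inC = λ x l h → ⊥-elim (0<⇒≢0 h (zeros! x l))
          ; ≤plen = λ x l → ≤-trans (≤-reflexive (zeros! x l)) z≤n
          ; inj = λ x y l m h _ → ⊥-elim (0<⇒≢0 h (zeros! x l))
          ; surj = λ i p q → ⊥-elim (<⇒≱ p (≤-trans q (≤-reflexive plen-zeros)))
          ; cons = λ x y l m h _ → ⊥-elim (0<⇒≢0 h (zeros! x l))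
          }

        final : Inv C (it (2 * n) nx zeros) × Stop (it (2 * n) nx zeros)
        final = it-stop (Inv C) Stop meas advance stay (2 * n) zeros I₀
          (≤-trans (≤-reflexive (trans (cong (2 * count n (D zeros) +_) plen-zeros) (+-identityʳ _)))
                   (*-monoʳ-≤ 2 (count≤n n (D zeros) (λ x _ → D≤1 zeros x))))

        small : ∀ st → Stop st → ∀ x → 0 < W st ! x → 2 * count n (reach (W st) x) ≤ tot
        small st s x w with tot <? 2 * count n (reach (W st) x)
        ... | no ¬l = ≮⇒≥ ¬l
        ... | yes l = ⊥-elim (0<⇒≢0 (D⁺ st w l) (Σ≡0⁻ n s x (proj₁ (W⁻ st w))))

    sepPath-inv : ∀ U r → Inv (reach U r) (sepPath U r)
    sepPath-inv U r rewrite sepPath-def U r = proj₁ (Sep.final (reach U r) (reach≤1 U r))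

    sepPath-small : ∀ U r x → x < n → 0 < reach U r ! x → sepPath U r ! x ≡ 0 →
                    2 * count n (reach (tab n (sepW (reach U r) (sepPath U r))) x) ≤ count n (reach U r)
    sepPath-small U r x l c e rewrite sepPath-def U r = small (it (2 * n) nx zeros) (proj₂ final) x (W⁺ (it (2 * n) nx zeros) l c e)
      where open Sep (reach U r) (reach≤1 U r)

  -- The rounds: Us ℓ is the set of vertices left after ℓ rounds, in each of which every component loses a path separator

    Unext : List ℕ → List ℕ
    Unext U = tab n (λ x → U ! x * isz (sepPath U (cmpr U x) ! x))

    opaque
      Us : ℕ → List ℕ
      Us ℓ = it ℓ Unext (tab n (λ _ → 1))

      Us-def : ∀ ℓ → Us ℓ ≡ it ℓ Unext (tab n (λ _ → 1))
      Us-def ℓ = refl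

    -- The sets `Us ℓ` decrease, so the number of rounds that `x` survives is the index of the round
    -- in which it is removed.
    levm : ℕ → ℕ → ℕ
    levm b x = Σ< b (λ ℓ → sg (Us (suc ℓ) ! x))

    cmpm : ℕ → ℕ → ℕ
    cmpm ℓ x = cmpr (Us ℓ) x

    posm : ℕ → ℕ → ℕ
    posm b x = sepPath (Us (levm b x)) (cmpm (levm b x) x) ! x ∸ 1

    private
      Unext⁻ : ∀ U {x} → 0 < Unext U ! x → x < n × 0 < U ! x × sepPath U (cmpr U x) ! x ≡ 0
      Unext⁻ U {x} h with tab-pos n (λ x → U ! x * isz (sepPath U (cmpr U x) ! x)) {x} h
      ... | l , q with unand (U ! x) q
      ... | u , e = l , u , isz⁻ e

      -- The new component of `x` lies in its old component minus the separator, to which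
      -- `sepPath-small` applies.
      halve : ∀ U x → 0 < Unext U ! x → 2 * count n (reach (Unext U) x) ≤ count n (reach U x)
      halve U x h with Unext⁻ U {x} h
      ... | l , u , e = begin
        2 * count n (reach (Unext U) x)  ≤⟨ *-monoʳ-≤ 2 (count-mono n (reach (Unext U) x) (reach W x) (λ y _ → reach≤1 (Unext U) x y)
                                              (λ y _ q → reach-complete W x l (proj₁ (sub y (proj₂ (reach-sound (Unext U) x y q)))))) ⟩
        2 * count n (reach W x)          ≤⟨ sepPath-small U r x l (inC x here) e ⟩
        count n (reach U r)              ≡⟨ reach-count U x r l r<n u x→r ⟩
        count n (reach U x)              ∎
        where
        open ≤-Reasoning
        r = cmpr U x
        r<n = proj₁ (cmpr-wit U x l)
        x→r = proj₂ (cmpr-wit U x l)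
        C = reach U r
        W = tab n (sepW C (sepPath U r))
        inC : ∀ y → Conn U x y → 0 < C ! y
        inC y w = reach-complete U r r<n (Walk-trans (Walk-sym adjm-sym u x→r) w)
        sub : ∀ y → Conn (Unext U) x y → Conn W x y × Conn U x y
        sub .x here = here , here
        sub y (_▻_ {x = .y} {y = z} w (a , b , c , d)) with sub z w | Unext⁻ U {y} d
        ... | w₁ , w₂ | _ , uy , ey = w₁ ▻ (a , b , c , tab-pos⁺ n (sepW C (sepPath U r)) b (inC y w₃ & isz⁺ (subst (λ q → sepPath U q ! y ≡ 0) (sym (cmpr-cong U x y l b u w₃)) ey))) , w₃
          where w₃ = w₂ ▻ (a , b , c , uy)

      Us-suc : ∀ ℓ → Us (suc ℓ) ≡ Unext (Us ℓ)
      Us-suc ℓ = trans (Us-def (suc ℓ)) (trans (it-suc ℓ Unext _) (cong Unext (sym (Us-def ℓ))))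

      Us-0 : ∀ x → x < n → 0 < Us 0 ! x
      Us-0 x l = subst (λ U → 0 < U ! x) (sym (Us-def 0)) (tab-pos⁺ n (λ _ → 1) l (s≤s z≤n))

      Us-down : ∀ ℓ x → 0 < Us (suc ℓ) ! x → 0 < Us ℓ ! x
      Us-down ℓ x h = proj₁ (proj₂ (Unext⁻ (Us ℓ) {x} (subst (λ U → 0 < U ! x) (Us-suc ℓ) h)))

      Us-antitone : ∀ {ℓ ℓ′} x → ℓ ≤ ℓ′ → 0 < Us ℓ′ ! x → 0 < Us ℓ ! x
      Us-antitone {ℓ} {ℓ′} x l h with m≤n⇒m<n∨m≡n l
      ... | inj₂ refl = h
      Us-antitone {ℓ} {suc ℓ′} x l h | inj₁ (s≤s l′) = Us-antitone x l′ (Us-down ℓ′ x h)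

      Us-size : ∀ ℓ x → x < n → 0 < Us ℓ ! x → 2 ^ ℓ * count n (reach (Us ℓ) x) ≤ n
      Us-size zero x l h = ≤-trans (≤-reflexive (+-identityʳ _)) (count≤n n (reach (Us 0) x) (λ y _ → reach≤1 (Us 0) x y))
      Us-size (suc ℓ) x l h = begin
        2 ^ suc ℓ * count n (reach (Us (suc ℓ)) x)       ≡⟨ cong (_* count n (reach (Us (suc ℓ)) x)) (*-comm 2 (2 ^ ℓ)) ⟩
        2 ^ ℓ * 2 * count n (reach (Us (suc ℓ)) x)       ≡⟨ *-assoc (2 ^ ℓ) 2 _ ⟩
        2 ^ ℓ * (2 * count n (reach (Us (suc ℓ)) x))     ≤⟨ *-monoʳ-≤ (2 ^ ℓ) (subst (λ U → 2 * count n (reach U x) ≤ count n (reach (Us ℓ) x)) (sym (Us-suc ℓ))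
                                                              (halve (Us ℓ) x (subst (λ U → 0 < U ! x) (Us-suc ℓ) h))) ⟩
        2 ^ ℓ * count n (reach (Us ℓ) x)                 ≤⟨ Us-size ℓ x l (Us-down ℓ x h) ⟩
        n                                                ∎
        where open ≤-Reasoning

    module Rounds (b : ℕ) (n<2^b : n < 2 ^ b) where

      -- A component left after `b` rounds is nonempty, and `2 ^ b` times its size would be at most
      -- `n`.
      Us-b : ∀ x → x < n → Us b ! x ≡ 0
      Us-b x l with 0<-dec (Us b ! x)
      ... | inj₁ e = e
      ... | inj₂ h = ⊥-elim (<⇒≱ n<2^b (≤-trans (m≤m*n (2 ^ b) (count n (reach (Us b) x)) {{>-nonZero nonempty}}) (Us-size b x l h)))
        where nonempty : 0 < count n (reach (Us b) x)
              nonempty = ≤-trans (reach-complete (Us b) x l here) (Σ-point n x (reach (Us b) x !_) l)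

      -- levm b x is the last round that x survives
      lev-char : ∀ x → x < n → levm b x < b × 0 < Us (levm b x) ! x × Us (suc (levm b x)) ! x ≡ 0
      lev-char x l = subst (λ q → q < b × 0 < Us q ! x × Us (suc q) ! x ≡ 0) (sym eqn) (q<b , hq , eq′)
        where
        find : ∀ k → 0 < Us k ! x ⊎ ∃[ q ] (q < k × 0 < Us q ! x × Us (suc q) ! x ≡ 0)
        find zero = inj₁ (Us-0 x l)
        find (suc k) with find k
        ... | inj₂ (q , a , c) = inj₂ (q , m<n⇒m<1+n a , c)
        ... | inj₁ h with 0<-dec (Us (suc k) ! x)
        ...   | inj₂ h′ = inj₁ h′
        ...   | inj₁ e = inj₂ (k , ≤-refl , h , e)
        found : ∃[ q ] (q < b × 0 < Us q ! x × Us (suc q) ! x ≡ 0)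
        found with find b
        ... | inj₂ r = r
        ... | inj₁ h = ⊥-elim (0<⇒≢0 h (Us-b x l))
        q = proj₁ found
        q<b = proj₁ (proj₂ found)
        hq = proj₁ (proj₂ (proj₂ found))
        eq′ = proj₂ (proj₂ (proj₂ found))
        eqn : levm b x ≡ q
        eqn = Σ-initial b q _ (<⇒≤ q<b) (λ i i<q → sg⁺ (Us-antitone x i<q hq))
          (λ i q≤i → cong sg (zero-above i q≤i))
          where
          zero-above : ∀ i → q ≤ i → Us (suc i) ! x ≡ 0
          zero-above i l′ with 0<-dec (Us (suc i) ! x)
          ... | inj₁ e = e
          ... | inj₂ h = ⊥-elim (0<⇒≢0 (Us-antitone x (s≤s l′) h) eq′)

      alive : ∀ {ℓ} x → x < n → ℓ ≤ levm b x → 0 < Us ℓ ! x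
      alive x l le′ = Us-antitone x le′ (proj₁ (proj₂ (lev-char x l)))

      alive⁻ : ∀ ℓ x → x < n → 0 < Us ℓ ! x → ℓ ≤ levm b x
      alive⁻ ℓ x l h with ℓ ≤? levm b x
      ... | yes p = p
      ... | no ¬p = ⊥-elim (0<⇒≢0 (Us-antitone x (≰⇒> ¬p) h) (proj₂ (proj₂ (lev-char x l))))

      cmpm-wit : ∀ ℓ x → x < n → cmpm ℓ x < n
      cmpm-wit ℓ x l = proj₁ (cmpr-wit (Us ℓ) x l)

      on-path : ∀ x → x < n → 0 < sepPath (Us (levm b x)) (cmpm (levm b x) x) ! x
      on-path x l with 0<-dec (sepPath (Us (levm b x)) (cmpm (levm b x) x) ! x)
      ... | inj₂ h = h
      ... | inj₁ e = ⊥-elim (0<⇒≢0 (subst (λ U → 0 < U ! x) (sym (Us-suc (levm b x)))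
                      (tab-pos⁺ n (λ y → Us (levm b x) ! y * isz (sepPath (Us (levm b x)) (cmpr (Us (levm b x)) y) ! y)) l
                        (alive x l ≤-refl & isz⁺ e))) (proj₂ (proj₂ (lev-char x l))))

      pos-suc : ∀ x → x < n → sepPath (Us (levm b x)) (cmpm (levm b x) x) ! x ≡ suc (posm b x)
      pos-suc x l = sym (trans (+-comm 1 _) (m∸n+n≡m (on-path x l)))

      pos< : ∀ x → x < n → posm b x < n
      pos< x l = ≤-trans (≤-reflexive (sym (pos-suc x l)))
        (≤-trans (Inv.≤plen (sepPath-inv (Us (levm b x)) (cmpm (levm b x) x)) x l)
          (≤-trans (Σ-mono n (λ i _ → sg≤1 _)) (≤-reflexive (trans (Σ-const n 1) (*-identityʳ n)))))

      pos-inj : ∀ x y → x < n → y < n → levm b x ≡ levm b y → cmpm (levm b x) x ≡ cmpm (levm b y) y → posm b x ≡ posm b y → x ≡ y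
      pos-inj x y l m e f g = Inv.inj (sepPath-inv (Us (levm b x)) (cmpm (levm b x) x)) x y l m (on-path x l)
        (trans (pos-suc x l) (trans (cong suc g) (trans (sym (pos-suc y m)) (cong₂ (λ u v → sepPath (Us u) v ! y) (sym e) (sym f)))))

      cmp-adj : ∀ ℓ x y → x < n → y < n → ℓ ≤ levm b x → ℓ ≤ levm b y → 0 < adjm x y → cmpm ℓ x ≡ cmpm ℓ y
      cmp-adj ℓ x y l m p q a = cmpr-cong (Us ℓ) x y l m (alive x l p) (here ▻ (l , m , a , alive y m q))

      cmp-mono : ∀ ℓ′ ℓ x y → x < n → y < n → ℓ′ ≤ ℓ → ℓ ≤ levm b x → ℓ ≤ levm b y → cmpm ℓ x ≡ cmpm ℓ y → cmpm ℓ′ x ≡ cmpm ℓ′ y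
      cmp-mono ℓ′ ℓ x y l m k p q e = cmpr-cong (Us ℓ′) x y l m (alive x l (≤-trans k p))
        (Walk-map (λ z _ → Us-antitone z k) (cmpr-conn (Us ℓ) x y l m (alive x l p) (alive y m q) e))

      path-adj : ∀ x y → x < n → y < n → levm b x ≡ levm b y → cmpm (levm b x) x ≡ cmpm (levm b y) y → posm b y ≡ suc (posm b x) → 0 < adjm x y
      path-adj x y l m e f g = Inv.cons (sepPath-inv (Us (levm b x)) (cmpm (levm b x) x)) x y l m (on-path x l)
        (trans (cong₂ (λ u v → sepPath (Us u) v ! y) e f) (trans (pos-suc y m) (trans (cong suc g) (cong suc (sym (pos-suc x l))))))

      -- The separator of the component of `y` has a vertex at every earlier position. That vertex
      -- is in the same component and, being on the separator, is removed in the same round.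
      path-contig : ∀ y i → y < n → posm b y ≡ suc i →
                    ∃[ x ] (x < n × levm b x ≡ levm b y × cmpm (levm b x) x ≡ cmpm (levm b y) y × posm b x ≡ i)
      path-contig y i m g with Inv.surj I (suc i) (s≤s z≤n) (≤-trans (n≤1+n _) (≤-trans (≤-reflexive (trans (cong suc (sym g)) (sym (pos-suc y m)))) (Inv.≤plen I y m)))
        where I = sepPath-inv (Us (levm b y)) (cmpm (levm b y) y)
      ... | x , l , e = x , l , lev≡ , cmp≡′ , suc-injective (trans (sym (pos-suc x l)) (trans (cong₂ (λ u v → sepPath (Us u) v ! x) lev≡ cmp≡′) e))
        where
        ℓ = levm b y
        I = sepPath-inv (Us ℓ) (cmpm ℓ y)
        0<st : 0 < sepPath (Us ℓ) (cmpm ℓ y) ! x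
        0<st = subst (0 <_) (sym e) (s≤s z≤n)
        uy = alive y m ≤-refl
        wy = cmpr-wit (Us ℓ) y m
        wx = proj₂ (reach-sound (Us ℓ) (cmpm ℓ y) x (Inv.inC I x l 0<st))
        ux : 0 < Us ℓ ! x
        ux = Walk-end {P = λ z → 0 < Us ℓ ! z} uy (Walk-trans (proj₂ wy) wx)
        cmp≡ : cmpm ℓ y ≡ cmpm ℓ x
        cmp≡ = cmpr-cong (Us ℓ) y x m l uy (Walk-trans (proj₂ wy) wx)
        dead : Us (suc ℓ) ! x ≡ 0
        dead with 0<-dec (Us (suc ℓ) ! x)
        ... | inj₁ z = z
        ... | inj₂ h = ⊥-elim (0<⇒≢0 0<st (trans (cong (λ q → sepPath (Us ℓ) q ! x) cmp≡)
                         (proj₂ (proj₂ (Unext⁻ (Us ℓ) {x} (subst (λ U → 0 < U ! x) (Us-suc ℓ) h))))))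
        lev≡ : levm b x ≡ ℓ
        lev≡ = ≤-antisym (≮⇒≥ (λ h → 0<⇒≢0 (alive x l h) dead)) (alive⁻ ℓ x l ux)
        cmp≡′ : cmpm (levm b x) x ≡ cmpm (levm b y) y
        cmp≡′ = trans (cong (λ q → cmpm q x) lev≡) (sym cmp≡)

      comp-conn : ∀ ℓ x y → x < n → y < n → ℓ ≤ levm b x → ℓ ≤ levm b y → cmpm ℓ x ≡ cmpm ℓ y →
                  Walk n adjm (λ w → ℓ ≤ levm b w × cmpm ℓ w ≡ cmpm ℓ x) x y
      comp-conn ℓ x y l m p q e = strengthen (cmpr-conn (Us ℓ) x y l m (alive x l p) (alive y m q) e)
        where
        strengthen : ∀ {w} → Conn (Us ℓ) x w → Walk n adjm (λ w → ℓ ≤ levm b w × cmpm ℓ w ≡ cmpm ℓ x) x w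
        strengthen here = here
        strengthen (w ▻ (a , b′ , c , d)) = strengthen w ▻ (a , b′ , c , alive⁻ ℓ _ b′ d , sym (cmpr-cong (Us ℓ) x _ l b′ (alive x l p) (w ▻ (a , b′ , c , d))))

-- The contents of labels, separation by moduli, and nets

module Labels where

  open Macros using (Σ<; tab; tabOnto; _!_; it; ifz)
  open Arithmetic
  open NumberTheory
  open Hierarchy
  open import Data.Empty using (⊥-elim)
  import Data.Integer as ℤ
  import Data.Integer.Divisibility.Signed as ℤ∣
  open ℤ∣ using () renaming (_∣_ to _∣ℤ_)
  open import Data.List using (List; []; _∷_; _++_; length)
  open import Data.List.Relation.Unary.All using (All; []; _∷_)
  open import Data.List.Relation.Unary.Any using (Any; here; there; any?)
  open import Data.Nat.Divisibility
  open import Data.Nat.ListAction using (product)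
  open import Data.Nat.Tactic.RingSolver using (solve-∀)
  open import Data.Sum using (_⊎_; inj₁; inj₂)
  open import Relation.Nullary using (¬_; yes; no)
  open import Relation.Nullary.Decidable using (¬?)

  -- the adjacency relation and, for a vertex x, its round lev x, its component cmp ℓ x in round ℓ ≤ lev x, and its position on
  -- the path separator it belongs to
  record Hi : Set where
    field
      adj : ℕ → ℕ → ℕ
      lev pos : ℕ → ℕ
      cmp : ℕ → ℕ → ℕ

  -- The power is reduced after every factor, so that all intermediate results stay polynomially
  -- bounded.
  powm : ℕ → ℕ → ℕ → ℕ
  powm x j p = it j (λ y → rem (y * x) p) (rem 1 p)

  rank : ℕ → (ℕ → ℕ) → ℕ → List ℕ → ℕ → ℕ
  rank n key a E e = Σ< e (λ e′ → E ! e′ * eq (key e′) (key e))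

  -- Every `g`-th member of `E` within each strip of constant key, in the order of the indices.
  pick : ℕ → (ℕ → ℕ) → ℕ → List ℕ → ℕ → ℕ
  pick g key a E e = E ! e * eq (rem (suc (rank g key a E e)) g) 0

  module Tok (n b M : ℕ) where

    -- tokens: the dyadic interval { pos : ⌊ pos / 2ᵃ ⌋ = k } of the path c (used as a hub), and the link κ
    tokI : ℕ → ℕ → ℕ → ℕ
    tokI c a k = ((c * suc b + a) * suc n + k) * 2

    tokK : ℕ → ℕ
    tokK κ = κ * 2 + 1

    -- a group γ consists of a modulus and of three colours, i.e. residues: of the hub, of the link and of the target
    gmod c1 c2 c3 : ℕ → ℕ
    gmod γ = suc (quo (quo (quo γ M) M) M)
    c1 γ = rem (quo (quo γ M) M) M
    c2 γ = rem (quo γ M) M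
    c3 γ = rem γ M

    col : ℕ → ℕ → ℕ
    col γ τ = rem τ (gmod γ)

    key : ℕ → ℕ → ℕ
    key a e = shr (rem e n) a

    -- A chord from `x` to `y` has index `e = y * n + x`, so indices are ordered by the far end
    -- first. The chord counts as passing over position `P` when it covers the gap from `P` to
    -- `P + 1`.
    straddle : ℕ → ℕ → ℕ
    straddle P e = le (rem e n) P * lt P (quo e n)

  module Lab (n b : ℕ) (H : Hi) (M g p : ℕ) where
    open Hi H
    open Tok n b M public

    -- A path is identified by the round in which it is removed and the component from which it is
    -- removed.
    pid : ℕ → ℕ
    pid v = lev v * n + cmp (lev v) v

    inK : ℕ → ℕ → ℕ
    inK c x = le (quo c n) (lev x) * eq (cmp (quo c n) x) (rem c n)

    nb : ℕ → ℕ → ℕ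
    nb c w = lt (lev w) (quo c n) * Σ< n (λ x → inK c x * adj w x)

    -- κ = 0 stands for an edge, and κ = 1 + c for the component c
    link : ℕ → ℕ → ℕ → ℕ
    link w κ u = ifz κ (adj w u) (nb (κ ∸ 1) w * nb (κ ∸ 1) u)

    opaque
      -- Group `γ` admits only hubs, links and targets of its three colours. The condition
      -- `lev u ≤ lev w` makes the target the end that is removed no later; its path is then
      -- determined by its round and by the component of the hub.
      mem : ℕ → ℕ → ℕ → ℕ → ℕ → ℕ
      mem γ c a k u = eq (col γ (tokI c a k)) (c1 γ) * (eq (col γ (tokI (pid u) 0 (pos u))) (c3 γ) *
        Σ< n (λ w → eq (pid w) c * (eq (shr (pos w) a) k * (le (lev u) (lev w) *
          Σ< (suc (b * n)) (λ κ → eq (col γ (tokK κ)) (c2 γ) * link w κ u)))))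

      mem-def : ∀ γ c a k u → mem γ c a k u ≡
        (eq (col γ (tokI c a k)) (c1 γ) * (eq (col γ (tokI (pid u) 0 (pos u))) (c3 γ) *
          Σ< n (λ w → eq (pid w) c * (eq (shr (pos w) a) k * (le (lev u) (lev w) *
            Σ< (suc (b * n)) (λ κ → eq (col γ (tokK κ)) (c2 γ) * link w κ u))))))
      mem-def γ c a k u = refl

    opaque
      memp : ℕ → ℕ → ℕ → ℕ → ℕ → ℕ → ℕ
      memp γ c a k c′ x = Σ< n (λ u → eq (pid u) c′ * (eq (pos u) x * mem γ c a k u))

      memp-def : ∀ γ c a k c′ x → memp γ c a k c′ x ≡
        (Σ< n (λ u → eq (pid u) c′ * (eq (pos u) x * mem γ c a k u)))
      memp-def γ c a k c′ x = refl

    opaque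
      chord : ℕ → ℕ → ℕ → ℕ → ℕ
      chord γ c′ x y = lt x y * Σ< (b * n) (λ c → Σ< (suc b) (λ a → Σ< (suc n) (λ k →
        memp γ c a k c′ x * (memp γ c a k c′ y * isz (Σ< y (λ z → lt x z * memp γ c a k c′ z))))))

      chord-def : ∀ γ c′ x y → chord γ c′ x y ≡
        (lt x y * Σ< (b * n) (λ c → Σ< (suc b) (λ a → Σ< (suc n) (λ k →
          memp γ c a k c′ x * (memp γ c a k c′ y * isz (Σ< y (λ z → lt x z * memp γ c a k c′ z)))))))
      chord-def γ c′ x y = refl

    -- All scales are treated at once, since the scale of the strip that matters depends on the
    -- faults.
    Enext : List ℕ → List ℕ
    Enext E = tab (n * n) (λ e → sg (Σ< (suc b) (λ a → pick g (key a) a E e)))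

    E₀ : ℕ → ℕ → List ℕ
    E₀ γ c′ = tab (n * n) (λ e → sg (chord γ c′ (rem e n) (quo e n)))

    opaque
      Elev : ℕ → ℕ → ℕ → List ℕ
      Elev γ c′ i = it i Enext (E₀ γ c′)

      Elev-def : ∀ γ c′ i → Elev γ c′ i ≡
        (it i Enext (E₀ γ c′))
      Elev-def γ c′ i = refl

    -- The `j`-th power sum of the chords of level `i` over the gap behind `P`, taken from the
    -- indices of the chords.
    Wsum : ℕ → ℕ → ℕ → ℕ → ℕ → ℕ
    Wsum γ c′ P i j = rem (Σ< (n * n) (λ e → Elev γ c′ i ! e * (straddle P e * powm e j p))) p

    opaque
      -- Only a position is stored for each round `ℓ`: the path of the representative follows from
      -- `ℓ` and the hub, by `target-pid`. The value `n` means that there is no member.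
      rep : ℕ → ℕ → ℕ → ℕ → ℕ → ℕ
      rep γ c a k ℓ = least n (λ x → Σ< n (λ u → eq (lev u) ℓ * (eq (pos u) x * mem γ c a k u)))

      rep-def : ∀ γ c a k ℓ → rep γ c a k ℓ ≡
        (least n (λ x → Σ< n (λ u → eq (lev u) ℓ * (eq (pos u) x * mem γ c a k u))))
      rep-def γ c a k ℓ = refl

    -- the hubs for which the label of v stores representatives: the paths of the components containing v (slots below b),
    -- and the siblings of the dyadic intervals around v on its own path
    slotRep : ℕ → ℕ → ℕ → ℕ → ℕ
    slotRep v sl γ ℓ = ifz (lt sl b) (rep γ (pid v) (sl ∸ b) (sib (shr (pos v) (sl ∸ b))) ℓ) (rep γ (sl * n + cmp sl v) b 0 ℓ)

  -- Separation of tokens by a small modulus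

  rem≡⇒∣ : ∀ x y d → 0 < d → rem x d ≡ rem y d → d ∣ (x ∸ y) + (y ∸ x)
  rem≡⇒∣ x y d 0<d e = subst (d ∣_) (sym eqn) (∣m∣n⇒∣m+n (n∣m*n (quo x d ∸ quo y d)) (n∣m*n (quo y d ∸ quo x d)))
    where
    dif : ∀ q q′ r → (q * d + r) ∸ (q′ * d + r) ≡ (q ∸ q′) * d
    dif q q′ r = trans ([m+n]∸[o+n]≡m∸o (q * d) r (q′ * d)) (sym (*-distribʳ-∸ d q q′))
      where
      [m+n]∸[o+n]≡m∸o : ∀ m n o → (m + n) ∸ (o + n) ≡ m ∸ o
      [m+n]∸[o+n]≡m∸o m n o = trans (cong₂ _∸_ (+-comm m n) (+-comm o n)) ([m+n]∸[m+o]≡n∸o n m o)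
    xe = trans (quo-rem x d 0<d) (cong (quo x d * d +_) e)
    ye = quo-rem y d 0<d
    eqn : (x ∸ y) + (y ∸ x) ≡ (quo x d ∸ quo y d) * d + (quo y d ∸ quo x d) * d
    eqn = trans (cong₂ (λ u v → (u ∸ v) + (v ∸ u)) xe ye) (cong₂ _+_ (dif (quo x d) (quo y d) (rem y d)) (dif (quo y d) (quo x d) (rem y d)))

  module _ (NT : ℕ) (1≤NT : 1 ≤ NT) where

    product-bound : ∀ ds → All (λ d → 0 < d × d < NT) ds → 0 < product ds × product ds ≤ NT ^ length ds
    product-bound [] [] = s≤s z≤n , ≤-refl
    product-bound (d ∷ ds) ((p , l) ∷ h) = let q , r = product-bound ds h in p & q , *-mono-≤ (<⇒≤ l) r

    -- Otherwise the product of `ds` would be a common multiple of all numbers up to `M′ + 1`, hence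
    -- at least `2 ^ M′`.
    non-divisor : ∀ ds M′ → All (λ d → 0 < d × d < NT) ds → NT ^ length ds < 2 ^ M′ →
                  ∃[ μ ] (μ < suc M′ × ¬ Any (suc μ ∣_) ds)
    non-divisor ds M′ h small with anyUpTo? (λ μ → ¬? (any? (suc μ ∣?_) ds)) (suc M′)
    ... | yes r = r
    ... | no none = ⊥-elim (<⇒≱ small (≤-trans (common-multiple M′ (product ds) (proj₁ pb) div) (proj₂ pb)))
      where
      pb = product-bound ds h
      any⇒∣ : ∀ {m} ds → Any (m ∣_) ds → m ∣ product ds
      any⇒∣ (d ∷ ds) (here q)  = ∣m⇒∣m*n (product ds) q
      any⇒∣ (d ∷ ds) (there q) = ∣n⇒∣m*n d (any⇒∣ ds q)
      div : ∀ m → 1 ≤ m → m ≤ suc M′ → m ∣ product ds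
      div (suc μ) _ l with any? (suc μ ∣?_) ds
      ... | yes q = any⇒∣ ds q
      ... | no ¬q = ⊥-elim (none (μ , l , ¬q))

    private
      diffs : ℕ → List ℕ → List ℕ
      diffs τ [] = []
      diffs τ (x ∷ X) = (τ ∸ x) + (x ∸ τ) ∷ diffs τ X

      diffs-ok : ∀ τ X → τ < NT → All (_< NT) X → ¬ Any (τ ≡_) X → All (λ d → 0 < d × d < NT) (diffs τ X)
      diffs-ok τ [] l [] na = []
      diffs-ok τ (x ∷ X) l (m ∷ h) na = (pos , bnd) ∷ diffs-ok τ X l h (λ q → na (there q))
        where
        pos : 0 < (τ ∸ x) + (x ∸ τ)
        pos with 0<-dec ((τ ∸ x) + (x ∸ τ))
        ... | inj₂ q = q
        ... | inj₁ e = ⊥-elim (na (here (eq⁻ (isz⁺ e))))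
        bnd : (τ ∸ x) + (x ∸ τ) < NT
        bnd with ≤-total τ x
        ... | inj₁ k = ≤-<-trans (≤-trans (≤-reflexive (cong (_+ (x ∸ τ)) (m≤n⇒m∸n≡0 k))) (m∸n≤m x τ)) m
        ... | inj₂ k = ≤-<-trans (≤-trans (≤-reflexive (trans (cong ((τ ∸ x) +_) (m≤n⇒m∸n≡0 k)) (+-identityʳ _))) (m∸n≤m τ x)) l

      length-diffs : ∀ τ X → length (diffs τ X) ≡ length X
      length-diffs τ [] = refl
      length-diffs τ (x ∷ X) = cong suc (length-diffs τ X)

      diffs-any : ∀ τ X μ → Any (λ x → rem τ (suc μ) ≡ rem x (suc μ)) X → Any (suc μ ∣_) (diffs τ X)
      diffs-any τ (x ∷ X) μ (here e) = here (rem≡⇒∣ τ x (suc μ) (s≤s z≤n) e)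
      diffs-any τ (x ∷ X) μ (there q) = there (diffs-any τ X μ q)

      open import Data.List.Relation.Unary.All.Properties using (++⁺)
      open import Data.List.Relation.Unary.Any.Properties using (++⁺ˡ; ++⁺ʳ)
      open import Data.List.Properties using (length-++)

    -- One modulus serves all three tokens: it has to divide none of the `3 * length X` differences
    -- between a token and a member of `X`.
    separate : ∀ X M′ τ₁ τ₂ τ₃ → All (_< NT) X → τ₁ < NT → τ₂ < NT → τ₃ < NT →
               ¬ Any (τ₁ ≡_) X → ¬ Any (τ₂ ≡_) X → ¬ Any (τ₃ ≡_) X → NT ^ (3 * length X) < 2 ^ M′ →
               ∃[ μ ] (μ < suc M′ × ¬ Any (λ x → rem τ₁ (suc μ) ≡ rem x (suc μ)) X ×
                       ¬ Any (λ x → rem τ₂ (suc μ) ≡ rem x (suc μ)) X × ¬ Any (λ x → rem τ₃ (suc μ) ≡ rem x (suc μ)) X)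
    separate X M′ τ₁ τ₂ τ₃ hX l₁ l₂ l₃ n₁ n₂ n₃ small
      with non-divisor (D₁ ++ D₂ ++ D₃) M′ (++⁺ (diffs-ok τ₁ X l₁ hX n₁) (++⁺ (diffs-ok τ₂ X l₂ hX n₂) (diffs-ok τ₃ X l₃ hX n₃)))
             (subst (λ k → NT ^ k < 2 ^ M′) (sym len) small)
      where
      D₁ = diffs τ₁ X
      D₂ = diffs τ₂ X
      D₃ = diffs τ₃ X
      len : length (D₁ ++ D₂ ++ D₃) ≡ 3 * length X
      len = trans (length-++ D₁) (cong₂ _+_ (length-diffs τ₁ X) (trans (length-++ D₂) (cong₂ _+_ (length-diffs τ₂ X) (trans (length-diffs τ₃ X) (sym (+-identityʳ _))))))
    ... | μ , l , na = μ , l , (λ q → na (++⁺ˡ (diffs-any τ₁ X μ q))) , (λ q → na (++⁺ʳ D₁ (++⁺ˡ (diffs-any τ₂ X μ q)))) ,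
                       (λ q → na (++⁺ʳ D₁ (++⁺ʳ D₂ (diffs-any τ₃ X μ q))))
      where
      D₁ = diffs τ₁ X
      D₂ = diffs τ₂ X

  -- Nets

  Σ-surj : ∀ N f s → (∀ e → f e ≤ 1) → s < Σ< N f → ∃[ e ] (e < N × 0 < f e × Σ< e f ≡ s)
  Σ-surj (suc N) f s f≤1 l with s <? Σ< N f
  ... | yes l′ = let e , a , c , d = Σ-surj N f s f≤1 l′ in e , m<n⇒m<1+n a , c , d
  ... | no ¬l = N , ≤-refl , fN , ≤-antisym (≮⇒≥ ¬l) (≤-pred (≤-trans l (≤-trans (+-monoʳ-≤ (Σ< N f) (f≤1 N)) (≤-reflexive (+-comm _ 1)))))
    where
    fN : 0 < f N
    fN with 0<-dec (f N)
    ... | inj₂ h = h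
    ... | inj₁ e = ⊥-elim (¬l (≤-trans l (≤-reflexive (trans (cong (Σ< N f +_) e) (+-identityʳ _)))))

  rem-suc : ∀ c g → 0 < g → (rem (suc c) g ≡ 0 × suc (rem c g) ≡ g) ⊎ (0 < rem (suc c) g × rem (suc c) g ≡ suc (rem c g))
  rem-suc c g 0<g with divMod c g 0<g
  ... | q , r , r<g , refl with m≤n⇒m<n∨m≡n r<g
  ...   | inj₁ l = inj₂ (subst (0 <_) (sym e) (s≤s z≤n) , trans e (cong suc (sym (rem-unique q r g r<g))))
    where e : rem (suc (q * g + r)) g ≡ suc r
          e = trans (cong (λ t → rem t g) (sym (+-suc (q * g) r))) (rem-unique q (suc r) g l)
  ...   | inj₂ refl = inj₁ (trans (cong (λ t → rem t (suc r)) (l q r)) (rem-unique (suc q) 0 (suc r) (s≤s z≤n)) , cong suc (rem-unique q r (suc r) r<g))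
    where l : ∀ q r → suc (q * suc r + r) ≡ suc q * suc r + 0
          l = solve-∀

  module _ (g : ℕ) (0<g : 0 < g) (key : ℕ → ℕ) (a : ℕ) (E : List ℕ) (E≤1 : ∀ e → E ! e ≤ 1) where

    private
      cntk : ℕ → ℕ → ℕ
      cntk N v = Σ< N (λ e → E ! e * eq (key e) v)

      -- The members seen since the last pick, summed over the strips. With `g` for each pick they
      -- account for all members seen, which gives `pick-count`.
      pot : ℕ → ℕ → ℕ
      pot V N = Σ< V (λ v → rem (cntk N v) g)

      bit-dec : ∀ e → E ! e ≡ 0 ⊎ E ! e ≡ 1
      bit-dec e with E ! e | E≤1 e
      ... | 0 | _ = inj₁ refl
      ... | 1 | _ = inj₂ refl
      ... | suc (suc _) | s≤s ()

      pot-eq : ∀ V N → (∀ e → e < N → key e < V) → Σ< N (pick g key a E) * g + pot V N ≡ Σ< N (E !_)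
      pot-eq V zero h = Σ≡0 V (λ v _ → rem-0 g)
      pot-eq V (suc N) h with bit-dec N
      ... | inj₁ e0 = begin
        (Σ< N pk + pk N) * g + pot V (suc N)  ≡⟨ cong₂ (λ u v → (Σ< N pk + u) * g + v) pk0 pot0 ⟩
        (Σ< N pk + 0) * g + pot V N           ≡⟨ cong (λ u → u * g + pot V N) (+-identityʳ (Σ< N pk)) ⟩
        Σ< N pk * g + pot V N                 ≡⟨ pot-eq V N (λ e l → h e (m<n⇒m<1+n l)) ⟩
        Σ< N (E !_)                           ≡⟨ sym (trans (cong (Σ< N (E !_) +_) e0) (+-identityʳ _)) ⟩
        Σ< N (E !_) + E ! N                   ∎
        where
        open ≡-Reasoning
        pk = pick g key a E
        pk0 : pk N ≡ 0
        pk0 = cong (_* eq (rem (suc (rank g key a E N)) g) 0) e0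
        pot0 : pot V (suc N) ≡ pot V N
        pot0 = Σ-cong V (λ v _ → cong (λ t → rem t g) (trans (cong (λ t → cntk N v + t * eq (key N) v) e0) (+-identityʳ _)))
      ... | inj₂ e1 = trans (+-cancelʳ-≡ (rem c g) _ _ main) (sym (trans (cong (Σ< N (E !_) +_) e1) (+-comm _ 1)))
        where
        open ≡-Reasoning
        pk = pick g key a E
        v₀ = key N
        c = cntk N v₀
        c′ : cntk (suc N) v₀ ≡ suc c
        c′ = trans (cong₂ (λ u v → c + u * v) e1 (eq-val {key N} refl)) (+-comm c 1)
        other : ∀ v → v < V → ¬ (v ≡ v₀) → rem (cntk (suc N) v) g ≡ rem (cntk N v) g
        other v _ ne = cong (λ t → rem t g) (trans (cong (λ t → cntk N v + E ! N * t) (eq-val0 (λ e → ne (sym e)))) (trans (cong (cntk N v +_) (*-zeroʳ (E ! N))) (+-identityʳ _)))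
        upd : pot V (suc N) + rem c g ≡ pot V N + rem (suc c) g
        upd = trans (Σ-update V (λ v → rem (cntk (suc N) v) g) (λ v → rem (cntk N v) g) v₀ (h N ≤-refl) other) (cong (λ t → pot V N + rem t g) c′)
        pkN : pk N * g + rem (suc c) g ≡ suc (rem c g)
        pkN with rem-suc c g 0<g
        ... | inj₁ (z , s) = trans (cong₂ (λ u v → u * g + v) (trans (cong₂ (λ u v → u * eq v 0) e1 z) refl) z)
                                   (trans (+-identityʳ _) (trans (+-identityʳ g) (sym s)))
        ... | inj₂ (q , s) = trans (cong₂ (λ u v → u * g + v) (trans (cong (_* eq (rem (suc c) g) 0) e1) (trans (*-identityˡ _) (eq-val0 (0<⇒≢0 q)))) refl) s
        IH = pot-eq V N (λ e l → h e (m<n⇒m<1+n l))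
        main : (Σ< N pk + pk N) * g + pot V (suc N) + rem c g ≡ suc (Σ< N (E !_)) + rem c g
        main = begin
          (Σ< N pk + pk N) * g + pot V (suc N) + rem c g      ≡⟨ +-assoc ((Σ< N pk + pk N) * g) _ _ ⟩
          (Σ< N pk + pk N) * g + (pot V (suc N) + rem c g)    ≡⟨ cong ((Σ< N pk + pk N) * g +_) upd ⟩
          (Σ< N pk + pk N) * g + (pot V N + rem (suc c) g)    ≡⟨ l₁ (Σ< N pk) (pk N) g (pot V N) (rem (suc c) g) ⟩
          (Σ< N pk * g + pot V N) + (pk N * g + rem (suc c) g) ≡⟨ cong₂ _+_ IH pkN ⟩
          Σ< N (E !_) + suc (rem c g)                         ≡⟨ +-suc _ _ ⟩
          suc (Σ< N (E !_)) + rem c g                         ∎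
          where l₁ : ∀ a b g c d → (a + b) * g + (c + d) ≡ (a * g + c) + (b * g + d)
                l₁ = solve-∀

    pick-count : ∀ V N → (∀ e → e < N → key e < V) → Σ< N (pick g key a E) * g ≤ Σ< N (E !_)
    pick-count V N h = ≤-trans (m≤m+n _ (pot V N)) (≤-reflexive (pot-eq V N h))

    -- cells are cut out of the strips { key = k } by the values of a function that is monotone along the order of the chords
    net : ∀ N k (cnt : ℕ → ℕ) q → (∀ e e′ → e ≤ e′ → cnt e ≤ cnt e′) →
          g ≤ Σ< N (λ e → E ! e * eq (key e) k * eq (cnt e) q) →
          ∃[ e ] (e < N × 0 < E ! e × key e ≡ k × cnt e ≡ q × 0 < pick g key a E e)
    net N k cnt q mono big with Σ-surj N cell s cell≤1 (<-≤-trans s<g big)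
      where
      cell : ℕ → ℕ
      cell e = E ! e * eq (key e) k * eq (cnt e) q
      cell≤1 : ∀ e → cell e ≤ 1
      cell≤1 e = *-mono-≤ {E ! e * eq (key e) k} {1} {_} {1} (*-mono-≤ {E ! e} {1} {_} {1} (E≤1 e) (isz≤1 _)) (isz≤1 _)
      r₀ = Σ< N (λ e → E ! e * eq (key e) k * lt (cnt e) q)
      -- In the order of its strip, the cell is a block preceded by `r₀` members. The member of the
      -- block with number `s < g` has rank `r₀ + s`, and `r₀ + s + 1` is divisible by `g`.
      s = g ∸ suc (rem r₀ g)
      s<g : s < g
      s<g = ∸-monoʳ-< {g} {suc (rem r₀ g)} {0} (s≤s z≤n) (rem-< r₀ g 0<g)
    ... | e , e<N , ce , se with unand (E ! e * eq (key e) k) ce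
    ...   | ek , cq with unand (E ! e) ek
    ...     | Ee , ke = e , e<N , Ee , eq⁻ {key e} ke , eq⁻ {cnt e} cq , Ee & eq⁺ {rem (suc (rank g key a E e)) g} divisible
      where
      open ≡-Reasoning
      P : ℕ → ℕ
      P e′ = E ! e′ * eq (key e′) k
      r₀ = Σ< N (λ e′ → P e′ * lt (cnt e′) q)
      s = g ∸ suc (rem r₀ g)
      split : ∀ e′ → e′ < e → P e′ ≡ P e′ * lt (cnt e′) q + P e′ * eq (cnt e′) q
      split e′ l with m≤n⇒m<n∨m≡n (≤-trans (mono e′ e (<⇒≤ l)) (≤-reflexive (eq⁻ {cnt e} cq)))
      ... | inj₁ c<q = sym (trans (cong₂ (λ u v → P e′ * u + P e′ * v) (le-val c<q) (eq-val0 {cnt e′} {q} (λ c≡q → <-irrefl c≡q c<q)))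
                         (trans (cong₂ _+_ (*-identityʳ (P e′)) (*-zeroʳ (P e′))) (+-identityʳ _)))
      ... | inj₂ c≡q = sym (trans (cong₂ (λ u v → P e′ * u + P e′ * v) (le-val0 {suc (cnt e′)} (s≤s (≤-reflexive (sym c≡q)))) (eq-val c≡q))
                         (cong₂ _+_ (*-zeroʳ (P e′)) (*-identityʳ (P e′))))
      early : Σ< e (λ e′ → P e′ * lt (cnt e′) q) ≡ r₀
      early with m≤n⇒∃[o]m+o≡n (<⇒≤ e<N)
      ... | o , refl = sym (trans (Σ-split e o _) (trans (cong (Σ< e (λ e′ → P e′ * lt (cnt e′) q) +_)
        (Σ≡0 o (λ i _ → trans (cong (P (e + i) *_) (le-val0 {suc (cnt (e + i))} (s≤s (≤-trans (≤-reflexive (sym (eq⁻ {cnt e} cq))) (mono e (e + i) (m≤m+n e i)))))) (*-zeroʳ (P (e + i)))))) (+-identityʳ _)))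
      rank-eq : rank g key a E e ≡ r₀ + s
      rank-eq = begin
        Σ< e (λ e′ → E ! e′ * eq (key e′) (key e))                     ≡⟨ cong (λ t → Σ< e (λ e′ → E ! e′ * eq (key e′) t)) (eq⁻ {key e} ke) ⟩
        Σ< e P                                                         ≡⟨ Σ-cong e split ⟩
        Σ< e (λ e′ → P e′ * lt (cnt e′) q + P e′ * eq (cnt e′) q)      ≡⟨ Σ-+ e _ _ ⟩
        Σ< e (λ e′ → P e′ * lt (cnt e′) q) + Σ< e (λ e′ → P e′ * eq (cnt e′) q) ≡⟨ cong₂ _+_ early se ⟩
        r₀ + s                                                         ∎
      divisible : rem (suc (rank g key a E e)) g ≡ 0
      divisible = begin
        rem (suc (rank g key a E e)) g                       ≡⟨ cong (λ t → rem (suc t) g) rank-eq ⟩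
        rem (suc (r₀ + s)) g                                 ≡⟨ cong (λ t → rem (suc (t + s)) g) (quo-rem r₀ g 0<g) ⟩
        rem (suc (quo r₀ g * g + rem r₀ g + s)) g            ≡⟨ cong (λ t → rem t g) (l (quo r₀ g * g) (rem r₀ g) s) ⟩
        rem (quo r₀ g * g + (suc (rem r₀ g) + s)) g          ≡⟨ cong (λ t → rem (quo r₀ g * g + t) g) (m+[n∸m]≡n (rem-< r₀ g 0<g)) ⟩
        rem (quo r₀ g * g + g) g                             ≡⟨ cong (λ t → rem t g) (trans (+-comm (quo r₀ g * g) g) (sym (+-identityʳ _))) ⟩
        rem (suc (quo r₀ g) * g + 0) g                       ≡⟨ rem-unique (suc (quo r₀ g)) 0 g 0<g ⟩
        0                                                    ∎
        where l : ∀ a b c → suc (a + b + c) ≡ a + (suc b + c)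
              l = solve-∀

-- Congruences, summation by parts, and the shrinking of nets

module Congruences where

  open Macros using (Σ<; tab; tabOnto; _!_; it; ifz)
  open Arithmetic
  open NumberTheory
  open Hierarchy
  open Labels
  open import Data.Empty using (⊥-elim)
  import Data.Integer as ℤ
  import Data.Integer.Properties as ℤₚ
  open import Data.Integer using (ℤ)
  import Data.Integer.Divisibility.Signed as ℤ∣
  open ℤ∣ using () renaming (_∣_ to _∣ℤ_)
  import Data.Integer.Tactic.RingSolver as ℤ-Solver
  open import Data.Nat.Divisibility
  open import Data.Nat.Tactic.RingSolver using (solve-∀)
  open import Data.Sum using (inj₁; inj₂)
  open import Relation.Nullary using (yes; no)

  -- Congruences of sums

  Σℤ-pos : ∀ n f → Σℤ n (λ i → ℤ.+ f i) ≡ ℤ.+ Σ< n f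
  Σℤ-pos zero    f = refl
  Σℤ-pos (suc n) f = cong (ℤ._+ ℤ.+ f n) (Σℤ-pos n f)

  module _ (p : ℕ) where

    record _≈_ (x y : ℤ) : Set where
      constructor cong-mod
      field ≈⇒∣ : ℤ.+ p ∣ℤ x ℤ.- y

    open _≈_

    ≈-refl : ∀ {x y} → x ≡ y → x ≈ y
    ≈-refl {x} refl = cong-mod (ℤ∣.divides (ℤ.+ 0) (ℤₚ.+-inverseʳ x))

    ≈-trans : ∀ {x y w} → x ≈ y → y ≈ w → x ≈ w
    ≈-trans {x} {y} {w} (cong-mod d) (cong-mod e) = cong-mod (subst (ℤ.+ p ∣ℤ_) (l x y w) (ℤ∣.∣m∣n⇒∣m+n d e))
      where l : ∀ x y w → (x ℤ.- y) ℤ.+ (y ℤ.- w) ≡ x ℤ.- w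
            l = ℤ-Solver.solve-∀

    ≈-sym : ∀ {x y} → x ≈ y → y ≈ x
    ≈-sym {x} {y} (cong-mod d) = cong-mod (subst (ℤ.+ p ∣ℤ_) (l x y) (ℤ∣.∣m⇒∣-m d))
      where l : ∀ x y → ℤ.- (x ℤ.- y) ≡ y ℤ.- x
            l = ℤ-Solver.solve-∀

    ≈-* : ∀ w {x y} → x ≈ y → (w ℤ.* x) ≈ (w ℤ.* y)
    ≈-* w {x} {y} (cong-mod d) = cong-mod (subst (ℤ.+ p ∣ℤ_) (l w x y) (ℤ∣.∣n⇒∣m*n w d))
      where l : ∀ w x y → w ℤ.* (x ℤ.- y) ≡ w ℤ.* x ℤ.- w ℤ.* y
            l = ℤ-Solver.solve-∀

    ≈-Σ : ∀ n f h → (∀ i → i < n → f i ≈ h i) → Σℤ n f ≈ Σℤ n h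
    ≈-Σ zero    f h d = ≈-refl refl
    ≈-Σ (suc n) f h d = cong-mod (subst (ℤ.+ p ∣ℤ_) (l (Σℤ n f) (Σℤ n h) (f n) (h n)) (ℤ∣.∣m∣n⇒∣m+n (≈⇒∣ (≈-Σ n f h (λ i l → d i (m<n⇒m<1+n l)))) (≈⇒∣ (d n ≤-refl))))
      where l : ∀ a b c d → (a ℤ.- b) ℤ.+ (c ℤ.- d) ≡ (a ℤ.+ c) ℤ.- (b ℤ.+ d)
            l = ℤ-Solver.solve-∀

    ≈-∣ : ∀ {x y} → x ≈ y → ℤ.+ p ∣ℤ y → ℤ.+ p ∣ℤ x
    ≈-∣ {x} {y} (cong-mod d) e = subst (ℤ.+ p ∣ℤ_) (l x y) (ℤ∣.∣m∣n⇒∣m+n d e)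
      where l : ∀ x y → (x ℤ.- y) ℤ.+ y ≡ x
            l = ℤ-Solver.solve-∀

    module _ (0<p : 0 < p) where

      ≈-rem : ∀ x → (ℤ.+ x) ≈ (ℤ.+ rem x p)
      ≈-rem x = cong-mod (ℤ∣.divides (ℤ.+ quo x p) (begin
        ℤ.+ x ℤ.- ℤ.+ r                          ≡⟨ cong (λ t → ℤ.+ t ℤ.- ℤ.+ r) (quo-rem x p 0<p) ⟩
        (ℤ.+ (quo x p * p) ℤ.+ ℤ.+ r) ℤ.- ℤ.+ r  ≡⟨ cong (λ t → (t ℤ.+ ℤ.+ r) ℤ.- ℤ.+ r) (ℤₚ.pos-* (quo x p) p) ⟩
        (ℤ.+ quo x p ℤ.* ℤ.+ p ℤ.+ ℤ.+ r) ℤ.- ℤ.+ r ≡⟨ l (ℤ.+ quo x p ℤ.* ℤ.+ p) (ℤ.+ r) ⟩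
        ℤ.+ quo x p ℤ.* ℤ.+ p                    ∎))
        where
        open ≡-Reasoning
        r = rem x p
        l : ∀ a b → (a ℤ.+ b) ℤ.- b ≡ a
        l = ℤ-Solver.solve-∀

      ≈-powm : ∀ x j → (ℤ.+ powm x j p) ≈ (ℤ.+ (x ^ j))
      ≈-powm x zero = ≈-sym (≈-rem 1)
      ≈-powm x (suc j) = ≈-trans (≈-refl (cong ℤ.+_ (it-suc j (λ y → rem (y * x) p) (rem 1 p))))
        (≈-trans (≈-sym (≈-rem (powm x j p * x)))
          (≈-trans (≈-refl (trans (ℤₚ.pos-* (powm x j p) x) (ℤₚ.*-comm (ℤ.+ powm x j p) (ℤ.+ x))))
            (≈-trans (≈-* (ℤ.+ x) (≈-powm x j)) (≈-refl (sym (ℤₚ.pos-* x (x ^ j)))))))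

  -- Summation by parts

  telescope : ∀ n x y (f : ℕ → ℤ) → x ≤ y → y ≤ n → Σℤ n (λ P → ℤ.+ (le x P * lt P y) ℤ.* (f P ℤ.- f (suc P))) ≡ f x ℤ.- f y
  telescope zero    zero zero f z≤n z≤n = sym (ℤₚ.+-inverseʳ (f 0))
  telescope (suc n) x y f x≤y y≤1+n with m≤n⇒m<n∨m≡n y≤1+n
  ... | inj₁ (s≤s y≤n) = trans (cong₂ ℤ._+_ (telescope n x y f x≤y y≤n)
          (cong (λ t → ℤ.+ t ℤ.* (f n ℤ.- f (suc n))) (trans (cong (le x n *_) (le-val0 {suc n} {y} (s≤s y≤n))) (*-zeroʳ (le x n))))) (ℤₚ.+-identityʳ _)
  ... | inj₂ refl with m≤n⇒m<n∨m≡n x≤y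
  ...   | inj₁ (s≤s x≤n) = trans (cong₂ ℤ._+_
          (trans (Σℤ-cong n (λ P l → cong (λ t → ℤ.+ (le x P * t) ℤ.* (f P ℤ.- f (suc P))) (trans (le-val {suc P} {suc n} (s≤s (<⇒≤ l))) (sym (le-val {suc P} {n} l))))) (telescope n x n f x≤n ≤-refl))
          (trans (cong (λ t → ℤ.+ t ℤ.* (f n ℤ.- f (suc n))) (cong₂ _*_ (le-val x≤n) (le-val {suc n} ≤-refl))) (ℤₚ.*-identityˡ _))) (l (f x) (f n) (f (suc n)))
          where l : ∀ a b c → (a ℤ.- b) ℤ.+ (b ℤ.- c) ≡ a ℤ.- c
                l = ℤ-Solver.solve-∀
  ...   | inj₂ refl = trans (Σℤ-0 (suc n) (λ P l → cong (λ t → ℤ.+ (t * lt P (suc n)) ℤ.* (f P ℤ.- f (suc P))) (le-val0 {suc n} l))) (sym (ℤₚ.+-inverseʳ (f (suc n))))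

  -- The difference of `f` between the ends of a chord is the sum of its drops over the gaps in
  -- between. Exchanging the sums leaves one term for each gap, weighted by the chords over it.
  by-parts : ∀ N n (E x y : ℕ → ℕ) (f : ℕ → ℤ) (e^ : ℕ → ℕ) → (∀ e → e < N → 0 < E e → x e ≤ y e × y e ≤ n) →
             Σℤ N (λ e → (ℤ.+ E e ℤ.* (f (x e) ℤ.- f (y e))) ℤ.* ℤ.+ e^ e) ≡
             Σℤ n (λ P → (f P ℤ.- f (suc P)) ℤ.* ℤ.+ Σ< N (λ e → E e * ((le (x e) P * lt P (y e)) * e^ e)))
  by-parts N n E x y f e^ h = begin
    Σℤ N (λ e → (ℤ.+ E e ℤ.* (f (x e) ℤ.- f (y e))) ℤ.* ℤ.+ e^ e)          ≡⟨ Σℤ-cong N inner ⟩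
    Σℤ N (λ e → Σℤ n (λ P → Δ P ℤ.* ℤ.+ t e P))                              ≡⟨ Σℤ-swap N n (λ e P → Δ P ℤ.* ℤ.+ t e P) ⟩
    Σℤ n (λ P → Σℤ N (λ e → Δ P ℤ.* ℤ.+ t e P))                              ≡⟨ Σℤ-cong n (λ P _ → trans (Σℤ-*ˡ N (Δ P) (λ e → ℤ.+ t e P)) (cong (Δ P ℤ.*_) (Σℤ-pos N (λ e → t e P)))) ⟩
    Σℤ n (λ P → Δ P ℤ.* ℤ.+ Σ< N (λ e → t e P))                              ∎
    where
    open ≡-Reasoning
    Δ : ℕ → ℤ
    Δ P = f P ℤ.- f (suc P)
    t : ℕ → ℕ → ℕ
    t e P = E e * ((le (x e) P * lt P (y e)) * e^ e)
    inner : ∀ e → e < N → (ℤ.+ E e ℤ.* (f (x e) ℤ.- f (y e))) ℤ.* ℤ.+ e^ e ≡ Σℤ n (λ P → Δ P ℤ.* ℤ.+ t e P)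
    inner e l with 0<-dec (E e)
    ... | inj₁ z = trans (cong (λ u → (ℤ.+ u ℤ.* (f (x e) ℤ.- f (y e))) ℤ.* ℤ.+ e^ e) z)
                         (sym (Σℤ-0 n (λ P _ → trans (cong (λ u → Δ P ℤ.* ℤ.+ (u * ((le (x e) P * lt P (y e)) * e^ e))) z) (ℤₚ.*-zeroʳ (Δ P)))))
    ... | inj₂ q = begin
      (ℤ.+ E e ℤ.* (f (x e) ℤ.- f (y e))) ℤ.* ℤ.+ e^ e   ≡⟨ cong (λ u → (ℤ.+ E e ℤ.* u) ℤ.* ℤ.+ e^ e) (sym (telescope n (x e) (y e) f (proj₁ (h e l q)) (proj₂ (h e l q)))) ⟩
      (ℤ.+ E e ℤ.* Σℤ n u) ℤ.* ℤ.+ e^ e                  ≡⟨ l₁ (ℤ.+ E e) (Σℤ n u) (ℤ.+ e^ e) ⟩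
      (ℤ.+ E e ℤ.* ℤ.+ e^ e) ℤ.* Σℤ n u                  ≡⟨ sym (Σℤ-*ˡ n (ℤ.+ E e ℤ.* ℤ.+ e^ e) u) ⟩
      Σℤ n (λ P → (ℤ.+ E e ℤ.* ℤ.+ e^ e) ℤ.* u P)        ≡⟨ Σℤ-cong n (λ P _ → trans (l₂ (ℤ.+ E e) (ℤ.+ e^ e) (ℤ.+ s P) (Δ P))
                                                              (cong (Δ P ℤ.*_) (trans (cong (ℤ.+ E e ℤ.*_) (sym (ℤₚ.pos-* (s P) (e^ e)))) (sym (ℤₚ.pos-* (E e) _))))) ⟩
      Σℤ n (λ P → Δ P ℤ.* ℤ.+ t e P)                     ∎
      where
      s : ℕ → ℕ
      s P = le (x e) P * lt P (y e)
      u : ℕ → ℤ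
      u P = ℤ.+ s P ℤ.* Δ P
      l₁ : ∀ a b c → (a ℤ.* b) ℤ.* c ≡ (a ℤ.* c) ℤ.* b
      l₁ = ℤ-Solver.solve-∀
      l₂ : ∀ a b c d → (a ℤ.* b) ℤ.* (c ℤ.* d) ≡ d ℤ.* (a ℤ.* (c ℤ.* b))
      l₂ = ℤ-Solver.solve-∀

  -- Chords of a group and the levels of its net

  record Member (n b : ℕ) (H : Hi) (M g p γ c a k u : ℕ) : Set where
    open Hi H
    open Lab n b H M g p
    field
      colI : col γ (tokI c a k) ≡ c1 γ
      colU : col γ (tokI (pid u) 0 (pos u)) ≡ c3 γ
      w    : ℕ
      w<n  : w < n
      pidw : pid w ≡ c
      shrw : shr (pos w) a ≡ k
      lev≤ : lev u ≤ lev w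
      κ    : ℕ
      κ<   : κ < suc (b * n)
      colK : col γ (tokK κ) ≡ c2 γ
      lk   : 0 < link w κ u

  module LabP (n b : ℕ) (H : Hi) (M p : ℕ) where
    g : ℕ
    g = 2 * suc b
    open Hi H
    open Lab n b H M g p public

    mem⁻ : ∀ {γ c a k u} → 0 < mem γ c a k u → Member n b H M g p γ c a k u
    mem⁻ {γ} {c} {a} {k} {u} h =
      let h₁ , h′ = unand (eq (col γ (tokI c a k)) (c1 γ)) (subst (0 <_) (mem-def γ c a k u) h)
          h₂ , h″ = unand (eq (col γ (tokI (pid u) 0 (pos u))) (c3 γ)) h′
          w , w<n , q = Σ⁻ n h″
          q₁ , q′ = unand (eq (pid w) c) q
          q₂ , q″ = unand (eq (shr (pos w) a) k) q′
          q₃ , r = unand (le (lev u) (lev w)) q″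
          κ , κ< , t = Σ⁻ (suc (b * n)) r
          t₁ , t₂ = unand (eq (col γ (tokK κ)) (c2 γ)) t
      in record { colI = eq⁻ h₁ ; colU = eq⁻ h₂ ; w = w ; w<n = w<n ; pidw = eq⁻ q₁ ; shrw = eq⁻ {shr (pos w) a} q₂ ; lev≤ = le⁻ {lev u} q₃
                ; κ = κ ; κ< = κ< ; colK = eq⁻ t₁ ; lk = t₂ }

    mem⁺ : ∀ {γ c a k u} → Member n b H M g p γ c a k u → 0 < mem γ c a k u
    mem⁺ {γ} {c} {a} {k} {u} m = subst (0 <_) (sym (mem-def γ c a k u))
      (eq⁺ (Member.colI m) & eq⁺ (Member.colU m) & Σ⁺ w w<n (eq⁺ pidw & eq⁺ shrw & le⁺ lev≤ & Σ⁺ κ κ< (eq⁺ (Member.colK m) & lk)))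
      where open Member m

    memp⁻ : ∀ {γ c a k c′ x} → 0 < memp γ c a k c′ x → ∃[ u ] (u < n × pid u ≡ c′ × pos u ≡ x × 0 < mem γ c a k u)
    memp⁻ {γ} {c} {a} {k} {c′} {x} h =
      let u , l , q = Σ⁻ n (subst (0 <_) (memp-def γ c a k c′ x) h)
          q₁ , q′ = unand (eq (pid u) c′) q
          q₂ , q₃ = unand (eq (pos u) x) q′
      in u , l , eq⁻ q₁ , eq⁻ {pos u} q₂ , q₃

    memp⁺ : ∀ {γ c a k} u → u < n → 0 < mem γ c a k u → 0 < memp γ c a k (pid u) (pos u)
    memp⁺ {γ} {c} {a} {k} u l h = subst (0 <_) (sym (memp-def γ c a k (pid u) (pos u))) (Σ⁺ u l (eq⁺ {pid u} refl & eq⁺ {pos u} refl & h))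

    chord⁻ : ∀ {γ c′ x y} → 0 < chord γ c′ x y → x < y × ∃[ c ] ∃[ a ] ∃[ k ] (a < suc b × 0 < memp γ c a k c′ x × 0 < memp γ c a k c′ y)
    chord⁻ {γ} {c′} {x} {y} h =
      let l , q = unand (lt x y) (subst (0 <_) (chord-def γ c′ x y) h)
          c , _ , q₁ = Σ⁻ (b * n) q
          a , a≤ , q₂ = Σ⁻ (suc b) q₁
          k , _ , q₃ = Σ⁻ (suc n) q₂
          m₁ , q₄ = unand (memp γ c a k c′ x) q₃
      in le⁻ {suc x} l , c , a , k , a≤ , m₁ , proj₁ (unand (memp γ c a k c′ y) q₄)

    chord⁺ : ∀ {γ c′ x y} c a k → x < y → c < b * n → a < suc b → k < suc n → 0 < memp γ c a k c′ x → 0 < memp γ c a k c′ y →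
             (∀ v → x < v → v < y → memp γ c a k c′ v ≡ 0) → 0 < chord γ c′ x y
    chord⁺ {γ} {c′} {x} {y} c a k l c< a< k< mx my none = subst (0 <_) (sym (chord-def γ c′ x y))
      (le⁺ {suc x} l & Σ⁺ c c< (Σ⁺ a a< (Σ⁺ k k< (mx & my & isz⁺ (Σ≡0 y between)))))
      where
      between : ∀ v → v < y → lt x v * memp γ c a k c′ v ≡ 0
      between v v<y with x <? v
      ... | yes x<v = trans (cong (lt x v *_) (none v x<v v<y)) (*-zeroʳ (lt x v))
      ... | no ¬l = cong (_* memp γ c a k c′ v) (le-val0 {suc x} {v} (s≤s (≮⇒≥ ¬l)))

    N : ℕ
    N = n * n

    Elev-suc : ∀ γ c′ i → Elev γ c′ (suc i) ≡ Enext (Elev γ c′ i)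
    Elev-suc γ c′ i = trans (Elev-def γ c′ (suc i)) (trans (it-suc i Enext (E₀ γ c′)) (cong Enext (sym (Elev-def γ c′ i))))

    Elev-0 : ∀ γ c′ → Elev γ c′ 0 ≡ E₀ γ c′
    Elev-0 γ c′ = Elev-def γ c′ 0

    Elev≤1 : ∀ γ c′ i e → Elev γ c′ i ! e ≤ 1
    Elev≤1 γ c′ i e = subst (λ E → E ! e ≤ 1) (sym (Elev-def γ c′ i))
      (it-inv (λ E → ∀ e → E ! e ≤ 1) (λ E _ → tab-≤ N _ 1 (λ e _ → sg≤1 _)) i (E₀ γ c′) (tab-≤ N _ 1 (λ e _ → sg≤1 _)) e)

    Enext⁻ : ∀ E e → 0 < Enext E ! e → e < N × 0 < E ! e
    Enext⁻ E e h =
      let l , q = tab-pos N (λ e → sg (Σ< (suc b) (λ a → pick g (key a) a E e))) {e} h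
          a , _ , r = Σ⁻ (suc b) (sg⁻ {Σ< (suc b) (λ a → pick g (key a) a E e)} q)
      in l , proj₁ (unand (E ! e) r)

    Enext⁺ : ∀ E e a → e < N → a < suc b → 0 < pick g (key a) a E e → 0 < Enext E ! e
    Enext⁺ E e a l a< h = tab-pos⁺ N (λ e → sg (Σ< (suc b) (λ a → pick g (key a) a E e))) l (subst (0 <_) (sym (sg⁺ (Σ⁺ a a< h))) (s≤s z≤n))

    Elev⇒E₀ : ∀ γ c′ i e → 0 < Elev γ c′ i ! e → 0 < E₀ γ c′ ! e
    Elev⇒E₀ γ c′ zero e h = subst (λ E → 0 < E ! e) (Elev-0 γ c′) h
    Elev⇒E₀ γ c′ (suc i) e h = Elev⇒E₀ γ c′ i e (proj₂ (Enext⁻ (Elev γ c′ i) e (subst (λ E → 0 < E ! e) (Elev-suc γ c′ i) h)))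

    E₀⁻ : ∀ γ c′ e → 0 < E₀ γ c′ ! e → e < N × 0 < chord γ c′ (rem e n) (quo e n)
    E₀⁻ γ c′ e h = let l , q = tab-pos N (λ e → sg (chord γ c′ (rem e n) (quo e n))) {e} h in l , sg⁻ q

    E₀⁺ : ∀ γ c′ x y → x < n → y < n → 0 < chord γ c′ x y → 0 < E₀ γ c′ ! (y * n + x)
    E₀⁺ γ c′ x y x<n y<n h = subst (0 <_) (sym (trans (tab-! (λ e → sg (chord γ c′ (rem e n) (quo e n))) in-range)
        (trans (cong₂ (λ u v → sg (chord γ c′ u v)) (rem-unique y x n x<n) (quo-unique y x n x<n)) (sg⁺ h)))) (s≤s z≤n)
      where in-range : y * n + x < n * n
            in-range = ≤-trans (+-monoʳ-< (y * n) x<n) (≤-trans (≤-reflexive (+-comm (y * n) n)) (*-monoˡ-≤ n y<n))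

    -- Each of the `b + 1` scales picks at most a fraction `1 / g` of the chords, and
    -- `g = 2 * (b + 1)`.
    halving : ∀ γ c′ i → Σ< N (Elev γ c′ (suc i) !_) * 2 ≤ Σ< N (Elev γ c′ i !_)
    halving γ c′ i = *-cancelʳ-≤ _ _ (suc b) (begin
      Σ< N (Elev γ c′ (suc i) !_) * 2 * suc b                    ≡⟨ *-assoc (Σ< N (Elev γ c′ (suc i) !_)) 2 (suc b) ⟩
      Σ< N (Elev γ c′ (suc i) !_) * g                            ≤⟨ *-monoˡ-≤ g (Σ-mono N pt) ⟩
      Σ< N (λ e → Σ< (suc b) (λ a → pick g (key a) a E e)) * g   ≡⟨ cong (_* g) (Σ-swap N (suc b) (λ e a → pick g (key a) a E e)) ⟩
      Σ< (suc b) (λ a → Σ< N (pick g (key a) a E)) * g           ≡⟨ trans (*-comm (Σ< (suc b) (λ a → Σ< N (pick g (key a) a E))) g) (sym (Σ-*ˡ (suc b) g (λ a → Σ< N (pick g (key a) a E)))) ⟩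
      Σ< (suc b) (λ a → g * Σ< N (pick g (key a) a E))           ≤⟨ Σ-mono (suc b) (λ a _ → ≤-trans (≤-reflexive (*-comm g _)) (pick-count g (s≤s z≤n) (key a) a E (Elev≤1 γ c′ i) (suc N) N (λ e l → s≤s (key≤ a e l)))) ⟩
      Σ< (suc b) (λ _ → Σ< N (E !_))                             ≡⟨ trans (Σ-const (suc b) _) (*-comm (suc b) _) ⟩
      Σ< N (E !_) * suc b                                        ∎)
      where
      open ≤-Reasoning
      E = Elev γ c′ i
      key≤ : ∀ a e → e < N → key a e ≤ N
      key≤ a e l = ≤-trans (shr≤ (rem e n) a) (≤-trans (rem≤ e n) (<⇒≤ l))
      pt : ∀ e → e < N → Elev γ c′ (suc i) ! e ≤ Σ< (suc b) (λ a → pick g (key a) a E e)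
      pt e l = ≤-trans (≤-reflexive (trans (cong (λ E → E ! e) (Elev-suc γ c′ i)) (tab-! _ l))) (sg≤ _)
        where sg≤ : ∀ x → sg x ≤ x
              sg≤ zero = z≤n
              sg≤ (suc x) = s≤s z≤n

    -- Fewer than `2 ^ (2 * b)` chords do not survive `2 * b` halvings.
    exhausted : n < 2 ^ b → ∀ γ c′ e → Elev γ c′ (2 * b) ! e ≡ 0
    exhausted n<2^b γ c′ e with 0<-dec (Elev γ c′ (2 * b) ! e)
    ... | inj₁ z = z
    ... | inj₂ h = ⊥-elim (<⇒≱ N<2^L (≤-trans (m≤n*m (2 ^ (2 * b)) _ {{>-nonZero sum>0}}) (≤-trans (decay (2 * b)) total)))
      where
      open ≤-Reasoning
      sum>0 : 0 < Σ< N (Elev γ c′ (2 * b) !_)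
      sum>0 = Σ⁺ e (proj₁ (E₀⁻ γ c′ e (Elev⇒E₀ γ c′ (2 * b) e h))) h
      decay : ∀ i → Σ< N (Elev γ c′ i !_) * 2 ^ i ≤ Σ< N (E₀ γ c′ !_)
      decay zero = ≤-reflexive (trans (*-identityʳ _) (cong (λ E → Σ< N (E !_)) (Elev-0 γ c′)))
      decay (suc i) = begin
        Σ< N (Elev γ c′ (suc i) !_) * (2 * 2 ^ i)    ≡⟨ sym (*-assoc (Σ< N (Elev γ c′ (suc i) !_)) 2 (2 ^ i)) ⟩
        Σ< N (Elev γ c′ (suc i) !_) * 2 * 2 ^ i      ≤⟨ *-monoˡ-≤ (2 ^ i) (halving γ c′ i) ⟩
        Σ< N (Elev γ c′ i !_) * 2 ^ i                ≤⟨ decay i ⟩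
        Σ< N (E₀ γ c′ !_)                            ∎
      total : Σ< N (E₀ γ c′ !_) ≤ N
      total = ≤-trans (Σ-mono N (λ e _ → subst (λ E → E ! e ≤ 1) (Elev-0 γ c′) (Elev≤1 γ c′ 0 e))) (≤-reflexive (trans (Σ-const N 1) (*-identityʳ N)))
      N<2^L : N < 2 ^ (2 * b)
      N<2^L = begin-strict
        n * n            <⟨ *-mono-< n<2^b n<2^b ⟩
        2 ^ b * 2 ^ b    ≡⟨ sym (^-distribˡ-+-* 2 b b) ⟩
        2 ^ (b + b)      ≡⟨ cong (λ t → 2 ^ (b + t)) (sym (+-identityʳ b)) ⟩
        2 ^ (2 * b)      ∎

-- Clean groups, and the cut in one graph

module OneGraph where

  open Macros using (Σ<; tab; tabOnto; _!_; it; ifz)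
  open Arithmetic
  open NumberTheory
  open Hierarchy
  open Labels
  open Congruences
  open import Data.Empty using (⊥; ⊥-elim)
  import Data.Integer as ℤ
  import Data.Integer.Divisibility.Signed as ℤ∣
  open ℤ∣ using () renaming (_∣_ to _∣ℤ_)
  open import Data.List using (List; []; _∷_; _++_; length)
  open import Data.List.Properties using (length-++)
  open import Data.List.Relation.Unary.All using (All; []; _∷_)
  import Data.List.Relation.Unary.All.Properties as Allₚ
  open import Data.List.Relation.Unary.Any using (Any; here)
  import Data.List.Relation.Unary.Any.Properties as Anyₚ
  open import Data.Nat.Divisibility
  open import Data.Sum using (_⊎_; inj₁; inj₂)
  open import Relation.Nullary using (¬_; Dec; yes; no)
  open import Relation.Nullary.Decidable using (_×-dec_; ¬?)

  -- The interface of the decomposition: the comparison of two graphs uses nothing else about its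
  -- construction.
  record OK (n b : ℕ) (H : Hi) : Set where
    open Hi H
    field
      n<2^b    : n < 2 ^ b
      adj-sym  : ∀ x y → adj x y ≡ adj y x
      lev<b    : ∀ x → x < n → lev x < b
      cmp<n    : ∀ ℓ x → x < n → cmp ℓ x < n
      pos<n    : ∀ x → x < n → pos x < n
      pos-inj  : ∀ x y → x < n → y < n → lev x ≡ lev y → cmp (lev x) x ≡ cmp (lev y) y → pos x ≡ pos y → x ≡ y
      cmp-adj  : ∀ ℓ x y → x < n → y < n → ℓ ≤ lev x → ℓ ≤ lev y → 0 < adj x y → cmp ℓ x ≡ cmp ℓ y
      cmp-mono : ∀ ℓ′ ℓ x y → x < n → y < n → ℓ′ ≤ ℓ → ℓ ≤ lev x → ℓ ≤ lev y → cmp ℓ x ≡ cmp ℓ y → cmp ℓ′ x ≡ cmp ℓ′ y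
      path-adj : ∀ x y → x < n → y < n → lev x ≡ lev y → cmp (lev x) x ≡ cmp (lev y) y → pos y ≡ suc (pos x) → 0 < adj x y
      path-contig : ∀ y i → y < n → pos y ≡ suc i →
                    ∃[ x ] (x < n × lev x ≡ lev y × cmp (lev x) x ≡ cmp (lev y) y × pos x ≡ i)
      comp-conn : ∀ ℓ x y → x < n → y < n → ℓ ≤ lev x → ℓ ≤ lev y → cmp ℓ x ≡ cmp ℓ y →
                  Walk n adj (λ w → ℓ ≤ lev w × cmp ℓ w ≡ cmp ℓ x) x y

  ups : ℕ → (ℕ → List ℕ) → List ℕ
  ups zero    h = []
  ups (suc k) h = ups k h ++ h k

  ups-any : ∀ {P : ℕ → Set} k h i → i < k → Any P (h i) → Any P (ups k h)
  ups-any (suc k) h i (s≤s i≤k) q with m≤n⇒m<n∨m≡n i≤k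
  ... | inj₁ i<k  = Anyₚ.++⁺ˡ (ups-any k h i i<k q)
  ... | inj₂ refl = Anyₚ.++⁺ʳ (ups k h) q

  ups-any⁻ : ∀ {P : ℕ → Set} k h → Any P (ups k h) → ∃[ i ] (i < k × Any P (h i))
  ups-any⁻ (suc k) h q with Anyₚ.++⁻ (ups k h) q
  ... | inj₁ q′ = let i , l , r = ups-any⁻ k h q′ in i , m<n⇒m<1+n l , r
  ... | inj₂ q′ = k , ≤-refl , q′

  ups-all : ∀ {P : ℕ → Set} k h → (∀ i → i < k → All P (h i)) → All P (ups k h)
  ups-all zero h q = []
  ups-all (suc k) h q = Allₚ.++⁺ (ups-all k h (λ i l → q i (m<n⇒m<1+n l))) (q k ≤-refl)

  ups-length : ∀ k h c → (∀ i → length (h i) ≡ c) → length (ups k h) ≡ k * c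
  ups-length zero h c q = refl
  ups-length (suc k) h c q = trans (length-++ (ups k h)) (trans (cong₂ _+_ (ups-length k h c q) (q k)) (+-comm (k * c) c))

  -- What the decoder knows about the faults (indices below m: path and position) and about the faults and the two query
  -- vertices (indices below kz: round and components)
  record Coords : Set where
    field
      m kz : ℕ
      fc fp : ℕ → ℕ
      vz : ℕ → ℕ
      zlev : ℕ → ℕ
      zcmp : ℕ → ℕ → ℕ

  module Known (n b M : ℕ) (C : Coords) where
    open Coords C
    open Tok n b M

    -- the component r of round ℓ contains a fault or a query vertex
    aliveAt : ℕ → ℕ → Set
    aliveAt ℓ r = ∃[ i ] (i < kz × ℓ ≤ zlev i × zcmp ℓ i ≡ r)

    aliveAt? : ∀ ℓ r → Dec (aliveAt ℓ r)
    aliveAt? ℓ r = anyUpTo? (λ i → (ℓ ≤? zlev i) ×-dec (zcmp ℓ i ≟ r)) kz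

    NoFault : ℕ → ℕ → ℕ → Set
    NoFault c a k = ∀ l → l < m → fc l ≡ c → ¬ (shr (fp l) a ≡ k)

    -- The equation `0 ≡ 0` stands for truth, as a link by an edge cannot be blocked.
    LinkOK : ℕ → Set
    LinkOK zero    = 0 ≡ 0
    LinkOK (suc c) = ¬ aliveAt (quo c n) (rem c n)

    -- Whatever has the colours of `γ` is untouched by the query: hubs and targets avoid the faults,
    -- and the linking components avoid both faults and query vertices. The chords of such a group
    -- are therefore real connections.
    record Clean (γ : ℕ) : Set where
      field
        hubs    : ∀ c a k → a < suc b → col γ (tokI c a k) ≡ c1 γ → NoFault c a k
        links   : ∀ κ → col γ (tokK κ) ≡ c2 γ → LinkOK κ
        targets : ∀ c P → col γ (tokI c 0 P) ≡ c3 γ → NoFault c 0 P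

    noFault? : ∀ c a k → Dec (∃[ l ] (l < m × (fc l ≡ c × shr (fp l) a ≡ k)))
    noFault? c a k = anyUpTo? (λ l → (fc l ≟ c) ×-dec (shr (fp l) a ≟ k)) m

    -- the maximal dyadic interval around P that contains no fault is the sibling of an interval around a fault, or the path
    live : ∀ c P → P < n → n < 2 ^ b → (∀ l → l < m → fp l < n) → NoFault c 0 P → (∀ l → l < m → ¬ (fc l ≡ c)) ⊎
           ∃[ l ] ∃[ a ] (l < m × a < b × fc l ≡ c × shr P a ≡ sib (shr (fp l) a) × NoFault c a (shr P a))
    live c P P<n n<2^b fp<n nf with climb b
      where
      climb : ∀ k → NoFault c k (shr P k) ⊎ ∃[ a ] (a < k × NoFault c a (shr P a) × ∃[ l ] (l < m × (fc l ≡ c × shr (fp l) (suc a) ≡ shr P (suc a))))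
      climb zero = inj₁ nf
      climb (suc k) with climb k
      ... | inj₂ (a , l , r) = inj₂ (a , m<n⇒m<1+n l , r)
      ... | inj₁ h with noFault? c (suc k) (shr P (suc k))
      ...   | yes q = inj₂ (k , ≤-refl , h , q)
      ...   | no ¬q = inj₁ (λ l l<m e s → ¬q (l , l<m , e , s))
    ... | inj₁ h = inj₁ (λ l l<m e → h l l<m e (trans (<2^⇒shr≡0 b (fp l) (<-trans (fp<n l l<m) n<2^b)) (sym (<2^⇒shr≡0 b P (<-trans P<n n<2^b)))))
    ... | inj₂ (a , a<b , h , l , l<m , e , s) = inj₂ (l , a , l<m , a<b , e ,
            half-sib (shr (fp l) a) (shr P a) (trans (sym (shr-suc (fp l) a)) (trans s (shr-suc P a))) (h l l<m e) , h)

    private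
      -- The dyadic intervals around a fault at all scales, and the components around a fault or
      -- query vertex. Rounds after the removal of the vertex are replaced by its last round, so
      -- that each vertex contributes exactly `b` tokens.
      Xs₁ Xs₂ : ℕ → List ℕ
      Xs₁ l = ups (suc b) (λ a → tokI (fc l) a (shr (fp l) a) ∷ [])
      Xs₂ i = ups b (λ ℓ → tokK (suc ((ℓ ⊓ zlev i) * n + zcmp (ℓ ⊓ zlev i) i)) ∷ [])

    -- the blocked tokens
    Xs : List ℕ
    Xs = ups m Xs₁ ++ ups kz Xs₂

    X-length : length Xs ≡ m * suc b + kz * b
    X-length = trans (length-++ (ups m Xs₁)) (cong₂ _+_
      (ups-length m Xs₁ (suc b) (λ l → trans (ups-length (suc b) (λ a → tokI (fc l) a (shr (fp l) a) ∷ []) 1 (λ _ → refl)) (*-identityʳ (suc b))))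
      (ups-length kz Xs₂ b (λ i → trans (ups-length b (λ ℓ → tokK (suc ((ℓ ⊓ zlev i) * n + zcmp (ℓ ⊓ zlev i) i)) ∷ []) 1 (λ _ → refl)) (*-identityʳ b))))

    X-inI : ∀ {Q : ℕ → Set} l a → l < m → a < suc b → Q (tokI (fc l) a (shr (fp l) a)) → Any Q Xs
    X-inI l a l<m la q = Anyₚ.++⁺ˡ (ups-any m Xs₁ l l<m (ups-any (suc b) (λ a → tokI (fc l) a (shr (fp l) a) ∷ []) a la (here q)))

    X-inK : ∀ {Q : ℕ → Set} i ℓ → i < kz → ℓ < b → Q (tokK (suc ((ℓ ⊓ zlev i) * n + zcmp (ℓ ⊓ zlev i) i))) → Any Q Xs
    X-inK i ℓ i<kz ℓ<b q = Anyₚ.++⁺ʳ (ups m Xs₁) (ups-any kz Xs₂ i i<kz (ups-any b (λ ℓ → tokK (suc ((ℓ ⊓ zlev i) * n + zcmp (ℓ ⊓ zlev i) i)) ∷ []) ℓ ℓ<b (here q)))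

    X-split : ∀ {Q : ℕ → Set} {A : Set} → Any Q Xs → (∀ l a → l < m → a < suc b → Q (tokI (fc l) a (shr (fp l) a)) → A) →
              (∀ i ℓ → i < kz → Q (tokK (suc ((ℓ ⊓ zlev i) * n + zcmp (ℓ ⊓ zlev i) i))) → A) → A
    X-split {Q} {A} q f h with Anyₚ.++⁻ (ups m Xs₁) q
    ... | inj₁ q₁ = let l , l<m , q₂ = ups-any⁻ m Xs₁ q₁
                        a , la , q₃ = ups-any⁻ (suc b) (λ a → tokI (fc l) a (shr (fp l) a) ∷ []) q₂
                    in f l a l<m la (single q₃)
      where single : ∀ {x} → Any Q (x ∷ []) → Q x
            single (here p) = p
    ... | inj₂ q₁ = let i , i<kz , q₂ = ups-any⁻ kz Xs₂ q₁
                        ℓ , _ , q₃ = ups-any⁻ b (λ ℓ → tokK (suc ((ℓ ⊓ zlev i) * n + zcmp (ℓ ⊓ zlev i) i)) ∷ []) q₂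
                    in h i ℓ i<kz (single q₃)
      where single : ∀ {x} → Any Q (x ∷ []) → Q x
            single (here p) = p

    X-all : ∀ {Q : ℕ → Set} → (∀ l a → l < m → a < suc b → Q (tokI (fc l) a (shr (fp l) a))) →
            (∀ i ℓ → i < kz → Q (tokK (suc ((ℓ ⊓ zlev i) * n + zcmp (ℓ ⊓ zlev i) i)))) → All Q Xs
    X-all f h = Allₚ.++⁺ (ups-all m Xs₁ (λ l l<m → ups-all (suc b) (λ a → tokI (fc l) a (shr (fp l) a) ∷ []) (λ a la → f l a l<m la ∷ [])))
                         (ups-all kz Xs₂ (λ i i<kz → ups-all b (λ ℓ → tokK (suc ((ℓ ⊓ zlev i) * n + zcmp (ℓ ⊓ zlev i) i)) ∷ []) (λ ℓ _ → h i ℓ i<kz ∷ [])))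

    NT : ℕ
    NT = suc (b * n) * suc b * suc n * 2

    radix : ∀ {q r d Q} → q < Q → r < d → q * d + r < Q * d
    radix {q} {r} {d} q<Q r<d = ≤-trans (+-monoʳ-< (q * d) r<d) (≤-trans (≤-reflexive (+-comm (q * d) d)) (*-monoˡ-≤ d q<Q))

    tokI<NT : ∀ {c a k} → c < suc (b * n) → a < suc b → k < suc n → tokI c a k < NT
    tokI<NT l m h = *-monoˡ-< 2 (radix (radix l m) h)

    tokK<NT : ∀ {κ} → κ < suc (b * n) → tokK κ < NT
    tokK<NT {κ} l = ≤-trans (radix {κ} {1} {2} l (s≤s (s≤s z≤n))) (*-monoˡ-≤ 2 (≤-trans (m≤m*n (suc (b * n)) (suc b)) (m≤m*n (suc (b * n) * suc b) (suc n))))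

    tokI-inj : ∀ {c a k c′ a′ k′} → a < suc b → a′ < suc b → k < suc n → k′ < suc n → tokI c a k ≡ tokI c′ a′ k′ → c ≡ c′ × a ≡ a′ × k ≡ k′
    tokI-inj {c} {a} {k} {c′} {a′} {k′} la la′ lk lk′ e =
      trans (sym (quo-unique c a (suc b) la)) (trans (cong (λ t → quo t (suc b)) e₂) (quo-unique c′ a′ (suc b) la′)) ,
      trans (sym (rem-unique c a (suc b) la)) (trans (cong (λ t → rem t (suc b)) e₂) (rem-unique c′ a′ (suc b) la′)) ,
      trans (sym (rem-unique (c * suc b + a) k (suc n) lk)) (trans (cong (λ t → rem t (suc n)) e₁) (rem-unique (c′ * suc b + a′) k′ (suc n) lk′))
      where
      e₁ : (c * suc b + a) * suc n + k ≡ (c′ * suc b + a′) * suc n + k′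
      e₁ = *-cancelʳ-≡ _ _ 2 e
      e₂ : c * suc b + a ≡ c′ * suc b + a′
      e₂ = trans (sym (quo-unique (c * suc b + a) k (suc n) lk)) (trans (cong (λ t → quo t (suc n)) e₁) (quo-unique (c′ * suc b + a′) k′ (suc n) lk′))

    tokK-inj : ∀ {κ κ′} → tokK κ ≡ tokK κ′ → κ ≡ κ′
    tokK-inj {κ} {κ′} e = *-cancelʳ-≡ κ κ′ 2 (+-cancelʳ-≡ 1 (κ * 2) (κ′ * 2) e)

    tokI≢tokK : ∀ {c a k κ} → ¬ (tokI c a k ≡ tokK κ)
    tokI≢tokK {c} {a} {k} {κ} e = 0≢1 (trans (sym (rem-unique ((c * suc b + a) * suc n + k) 0 2 (s≤s z≤n)))
        (trans (cong (λ t → rem t 2) (trans (+-identityʳ _) e)) (rem-unique κ 1 2 (s≤s (s≤s z≤n)))))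
      where 0≢1 : ¬ (0 ≡ 1)
            0≢1 ()

    group : ℕ → ℕ → ℕ → ℕ → ℕ
    group μ r₁ r₂ r₃ = ((μ * M + r₁) * M + r₂) * M + r₃

    group-ok : ∀ μ r₁ r₂ r₃ → μ < M → r₁ < M → r₂ < M → r₃ < M → group μ r₁ r₂ r₃ < M * M * M * M ×
               gmod (group μ r₁ r₂ r₃) ≡ suc μ × c1 (group μ r₁ r₂ r₃) ≡ r₁ × c2 (group μ r₁ r₂ r₃) ≡ r₂ × c3 (group μ r₁ r₂ r₃) ≡ r₃
    group-ok μ r₁ r₂ r₃ l₀ l₁ l₂ l₃ = radix (radix (radix l₀ l₁) l₂) l₃ ,
      cong suc (trans (cong (λ t → quo (quo t M) M) q₃) (trans (cong (λ t → quo t M) q₂) q₁)) ,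
      trans (cong (λ t → rem (quo t M) M) q₃) (trans (cong (λ t → rem t M) q₂) (rem-unique μ r₁ M l₁)) ,
      trans (cong (λ t → rem t M) q₃) (rem-unique (μ * M + r₁) r₂ M l₂) ,
      rem-unique ((μ * M + r₁) * M + r₂) r₃ M l₃
      where
      q₃ = quo-unique ((μ * M + r₁) * M + r₂) r₃ M l₃
      q₂ = quo-unique (μ * M + r₁) r₂ M l₂
      q₁ = quo-unique μ r₁ M l₁

    module _ (fbd : ∀ l → l < m → fc l < b * n × fp l < n) (zbd : ∀ i ℓ → i < kz → ℓ ≤ zlev i → ℓ < b × zcmp ℓ i < n) where

      private
        fpk : ∀ l → l < m → ∀ a → shr (fp l) a < suc n
        fpk l l<m a = s≤s (≤-trans (shr≤ (fp l) a) (<⇒≤ (proj₂ (fbd l l<m))))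

        comp-index : ∀ i c → i < kz → quo c n ≤ zlev i → zcmp (quo c n) i ≡ rem c n → c ≡ (quo c n ⊓ zlev i) * n + zcmp (quo c n ⊓ zlev i) i
        comp-index i c i<kz l e = trans (quo-rem c n (≤-<-trans z≤n (proj₂ (zbd i (quo c n) i<kz l))))
          (trans (cong (quo c n * n +_) (sym e)) (cong (λ t → t * n + zcmp t i) (sym (m≤n⇒m⊓n≡m l))))

      notinI : ∀ c a k → a < suc b → k < suc n → NoFault c a k → ¬ Any (tokI c a k ≡_) Xs
      notinI c a k la lk nf q = X-split q
        (λ l a′ l<m la′ e → let e₁ , e₂ , e₃ = tokI-inj {c} {a} {k} {fc l} {a′} {shr (fp l) a′} la la′ lk (fpk l l<m a′) e in
                            nf l l<m (sym e₁) (trans (cong (shr (fp l)) e₂) (sym e₃)))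
        (λ i ℓ _ e → tokI≢tokK {c} {a} {k} {suc ((ℓ ⊓ zlev i) * n + zcmp (ℓ ⊓ zlev i) i)} e)

      notinK : ∀ κ → LinkOK κ → ¬ Any (tokK κ ≡_) Xs
      notinK κ ok q = X-split q
        (λ l a _ _ e → tokI≢tokK {fc l} {a} {shr (fp l) a} {κ} (sym e))
        (λ i ℓ i<kz e → blocked i (ℓ ⊓ zlev i) i<kz (m⊓n≤n ℓ (zlev i)) κ (tokK-inj {κ} {suc ((ℓ ⊓ zlev i) * n + zcmp (ℓ ⊓ zlev i) i)} e) ok)
        where
        blocked : ∀ i ℓ → i < kz → ℓ ≤ zlev i → ∀ κ → κ ≡ suc (ℓ * n + zcmp ℓ i) → LinkOK κ → ⊥
        blocked i ℓ i<kz l (suc _) refl ok = ok (i , i<kz , ≤-trans (≤-reflexive q≡) l , trans (cong (λ t → zcmp t i) q≡) (sym (rem-unique ℓ (zcmp ℓ i) n z<)))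
          where z< = proj₂ (zbd i ℓ i<kz l)
                q≡ = quo-unique ℓ (zcmp ℓ i) n z<

      X<NT : All (_< NT) Xs
      X<NT = X-all (λ l a l<m la → tokI<NT {fc l} {a} {shr (fp l) a} (m<n⇒m<1+n (proj₁ (fbd l l<m))) la (fpk l l<m a))
                   (λ i ℓ i<kz → let q , r = zbd i (ℓ ⊓ zlev i) i<kz (m⊓n≤n ℓ (zlev i)) in tokK<NT {suc ((ℓ ⊓ zlev i) * n + zcmp (ℓ ⊓ zlev i) i)} (s≤s (radix q r)))

      module _ (μ : ℕ) (γ : ℕ) (gm : gmod γ ≡ suc μ) where
        same : ∀ τ x r → r ≡ rem τ (suc μ) → col γ x ≡ r → rem τ (suc μ) ≡ rem x (suc μ)
        same τ x r e e′ = trans (sym e) (trans (sym e′) (cong (rem x) gm))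

        clean : ∀ τ₁ τ₂ τ₃ → c1 γ ≡ rem τ₁ (suc μ) → c2 γ ≡ rem τ₂ (suc μ) → c3 γ ≡ rem τ₃ (suc μ) →
                ¬ Any (λ x → rem τ₁ (suc μ) ≡ rem x (suc μ)) Xs → ¬ Any (λ x → rem τ₂ (suc μ) ≡ rem x (suc μ)) Xs →
                ¬ Any (λ x → rem τ₃ (suc μ) ≡ rem x (suc μ)) Xs → Clean γ
        clean τ₁ τ₂ τ₃ e₁ e₂ e₃ n₁ n₂ n₃ = record
          { hubs = λ { c a k la e l l<m refl refl → n₁ (X-inI l a l<m la (same τ₁ (tokI (fc l) a (shr (fp l) a)) (c1 γ) e₁ e)) }
          ; links = links′
          ; targets = λ { c P e l l<m refl refl → n₃ (X-inI l 0 l<m (s≤s z≤n) (same τ₃ (tokI (fc l) 0 (fp l)) (c3 γ) e₃ e)) } }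
          where
          links′ : ∀ κ → col γ (tokK κ) ≡ c2 γ → LinkOK κ
          links′ zero e = refl
          links′ (suc c) e (i , i<kz , l , w) = n₂ (X-inK i (quo c n) i<kz (proj₁ (zbd i (quo c n) i<kz l))
            (trans (same τ₂ (tokK (suc c)) (c2 γ) e₂ e) (cong (λ t → rem (tokK (suc t)) (suc μ)) (comp-index i c i<kz l w))))

      -- A modulus that separates the three tokens from all blocked ones is taken together with
      -- their residues; a blocked token of one of these colours would not have been separated.
      clean-group : ∀ M′ → M ≡ suc M′ → NT ^ (3 * (m * suc b + kz * b)) < 2 ^ M′ →
                    ∀ c a k κ c′ P → c < b * n → a < suc b → k < suc n → κ < suc (b * n) → c′ < b * n → P < n →
                    NoFault c a k → LinkOK κ → NoFault c′ 0 P →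
                    ∃[ γ ] (γ < M * M * M * M × Clean γ × col γ (tokI c a k) ≡ c1 γ × col γ (tokK κ) ≡ c2 γ × col γ (tokI c′ 0 P) ≡ c3 γ)
      clean-group M′ M≡ small c a k κ c′ P c< a< k< κ< c′< P< nfI lok nfP =
        finish {tokI c a k} {tokK κ} {tokI c′ 0 P} (separate NT (≤-trans (s≤s z≤n) (tokK<NT {0} (s≤s z≤n))) Xs M′ (tokI c a k) (tokK κ) (tokI c′ 0 P) X<NT
          (tokI<NT {c} {a} {k} (m<n⇒m<1+n c<) a< k<) (tokK<NT {κ} κ<) (tokI<NT {c′} {0} {P} (m<n⇒m<1+n c′<) (s≤s z≤n) (m<n⇒m<1+n P<))
          (notinI c a k a< k< nfI) (notinK κ lok) (notinI c′ 0 P (s≤s z≤n) (m<n⇒m<1+n P<) nfP) (subst (λ t → NT ^ (3 * t) < 2 ^ M′) (sym X-length) small))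
        where
        finish : ∀ {τ₁ τ₂ τ₃} → ∃[ μ ] (μ < suc M′ × ¬ Any (λ x → rem τ₁ (suc μ) ≡ rem x (suc μ)) Xs ×
                   ¬ Any (λ x → rem τ₂ (suc μ) ≡ rem x (suc μ)) Xs × ¬ Any (λ x → rem τ₃ (suc μ) ≡ rem x (suc μ)) Xs) →
                 ∃[ γ ] (γ < M * M * M * M × Clean γ × col γ τ₁ ≡ c1 γ × col γ τ₂ ≡ c2 γ × col γ τ₃ ≡ c3 γ)
        finish {τ₁} {τ₂} {τ₃} (μ , μ<′ , n₁ , n₂ , n₃) = colour {group μ (rem τ₁ (suc μ)) (rem τ₂ (suc μ)) (rem τ₃ (suc μ))} (group-ok μ (rem τ₁ (suc μ)) (rem τ₂ (suc μ)) (rem τ₃ (suc μ)) μ< (rb τ₁) (rb τ₂) (rb τ₃))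
          where
          μ< : μ < M
          μ< = <-≤-trans μ<′ (≤-reflexive (sym M≡))
          rb : ∀ τ → rem τ (suc μ) < M
          rb τ = <-≤-trans (rem-< τ (suc μ) (s≤s z≤n)) μ<
          colour : ∀ {γ} → γ < M * M * M * M × gmod γ ≡ suc μ × c1 γ ≡ rem τ₁ (suc μ) × c2 γ ≡ rem τ₂ (suc μ) × c3 γ ≡ rem τ₃ (suc μ) →
                   ∃[ γ ] (γ < M * M * M * M × Clean γ × col γ τ₁ ≡ c1 γ × col γ τ₂ ≡ c2 γ × col γ τ₃ ≡ c3 γ)
          colour {γ} (γ< , gm , e₁ , e₂ , e₃) = γ , γ< , clean μ γ gm τ₁ τ₂ τ₃ e₁ e₂ e₃ n₁ n₂ n₃ ,
            trans (cong (rem τ₁) gm) (sym e₁) , trans (cong (rem τ₂) gm) (sym e₂) , trans (cong (rem τ₃) gm) (sym e₃)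

  -- The vertices of a particular graph to which the coordinates belong. The same `C` is matched by
  -- both graphs that are compared.
  record Match (n b : ℕ) (H : Hi) (C : Coords) : Set where
    open Coords C
    open Hi H
    field
      v z   : ℕ → ℕ
      v<n   : ∀ l → l < m → v l < n
      v-pid : ∀ l → l < m → lev (v l) * n + cmp (lev (v l)) (v l) ≡ fc l
      v-pos : ∀ l → l < m → pos (v l) ≡ fp l
      vz<   : ∀ l → l < m → vz l < kz
      v-z   : ∀ l → l < m → z (vz l) ≡ v l
      z<n   : ∀ i → i < kz → z i < n
      z-lev : ∀ i → i < kz → lev (z i) ≡ zlev i
      z-cmp : ∀ i ℓ → i < kz → ℓ ≤ zlev i → cmp ℓ (z i) ≡ zcmp ℓ i

  -- Soundness in one graph

  module One (n b M p : ℕ) (H : Hi) (ok : OK n b H) (C : Coords) (mt : Match n b H C) where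
    open Hi H
    open OK ok
    open Coords C
    open Match mt
    open LabP n b H M p
    open Known n b M C

    lev-pid : ∀ v → v < n → quo (pid v) n ≡ lev v
    lev-pid v l = quo-unique (lev v) (cmp (lev v) v) n (cmp<n (lev v) v l)

    cmp-pid : ∀ v → v < n → rem (pid v) n ≡ cmp (lev v) v
    cmp-pid v l = rem-unique (lev v) (cmp (lev v) v) n (cmp<n (lev v) v l)

    pid-eq : ∀ x y → x < n → y < n → pid x ≡ pid y → lev x ≡ lev y × cmp (lev x) x ≡ cmp (lev y) y
    pid-eq x y l m e = trans (sym (lev-pid x l)) (trans (cong (λ t → quo t n) e) (lev-pid y m)) ,
                       trans (sym (cmp-pid x l)) (trans (cong (λ t → rem t n) e) (cmp-pid y m))

    pid-cong : ∀ x y → lev x ≡ lev y → cmp (lev x) x ≡ cmp (lev y) y → pid x ≡ pid y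
    pid-cong x y e f = cong₂ (λ s t → s * n + t) e f

    pid< : ∀ x → x < n → pid x < b * n
    pid< x l = radix (lev<b x l) (cmp<n _ x l)

    isF : ℕ → Set
    isF x = ∃[ l ] (l < m × x ≡ v l)

    isF? : ∀ x → Dec (isF x)
    isF? x = anyUpTo? (λ l → x ≟ v l) m

    FW : ℕ → ℕ → Set
    FW = Walk n adj (λ y → ¬ isF y)

    FW-sym : ∀ {x y} → ¬ isF x → FW x y → FW y x
    FW-sym = Walk-sym adj-sym

    noF : ∀ c a k w → pid w ≡ c → shr (pos w) a ≡ k → NoFault c a k → ¬ isF w
    noF c a k w refl refl nf (l , l<m , refl) = nf l l<m (sym (v-pid l l<m)) (cong (λ t → shr t a) (sym (v-pos l l<m)))

    F-NoFault : ∀ x → x < n → ¬ isF x → NoFault (pid x) 0 (pos x)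
    F-NoFault x l nf k k<m e s = nf (k , k<m , pos-inj x (v k) l (v<n k k<m) (proj₁ pe) (proj₂ pe) (trans (sym s) (sym (v-pos k k<m))))
      where pe = pid-eq x (v k) l (v<n k k<m) (trans (sym e) (sym (v-pid k k<m)))

    hub-up : ∀ c a k → NoFault c a k → ∀ d w w′ → w < n → w′ < n → pid w ≡ c → pid w′ ≡ c → shr (pos w) a ≡ k → shr (pos w′) a ≡ k →
             pos w′ ≡ pos w + d → FW w w′
    hub-up c a k nf zero w w′ l m e e′ s s′ q with pid-eq w w′ l m (trans e (sym e′))
    ... | p₁ , p₂ with pos-inj w w′ l m p₁ p₂ (sym (trans q (+-identityʳ _)))
    ... | refl = here
    hub-up c a k nf (suc d) w w′ l m e e′ s s′ q with path-contig w′ (pos w + d) m (trans q (+-suc (pos w) d))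
    ... | w″ , l″ , p₁ , p₂ , p₃ = hub-up c a k nf d w w″ l l″ e e″ s s″ p₃ ▻
          (l″ , m , path-adj w″ w′ l″ m p₁ p₂ (trans q (trans (+-suc (pos w) d) (cong suc (sym p₃)))) , noF c a k w′ e′ s′ nf)
      where
      e″ = trans (pid-cong w″ w′ p₁ p₂) e′
      s″ : shr (pos w″) a ≡ k
      s″ = ≤-antisym (≤-trans (shr-mono a (≤-trans (≤-reflexive p₃) (≤-trans (n≤1+n _) (≤-reflexive (sym (trans q (+-suc (pos w) d))))))) (≤-reflexive s′))
                     (≤-trans (≤-reflexive (sym s)) (shr-mono a (≤-trans (m≤m+n _ d) (≤-reflexive (sym p₃)))))

    -- The piece of the path between two vertices of a dyadic interval stays in the interval, so it
    -- contains no fault.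
    hubConn : ∀ c a k → NoFault c a k → ∀ w w′ → w < n → w′ < n → pid w ≡ c → pid w′ ≡ c → shr (pos w) a ≡ k → shr (pos w′) a ≡ k → FW w w′
    hubConn c a k nf w w′ l m e e′ s s′ with ≤-total (pos w) (pos w′)
    ... | inj₁ q = hub-up c a k nf (pos w′ ∸ pos w) w w′ l m e e′ s s′ (sym (m+[n∸m]≡n q))
    ... | inj₂ q = FW-sym (noF c a k w′ e′ s′ nf) (hub-up c a k nf (pos w ∸ pos w′) w′ w m l e′ e s′ s (sym (m+[n∸m]≡n q)))

    dead-noF : ∀ ℓ r x → ¬ aliveAt ℓ r → ℓ ≤ lev x → cmp ℓ x ≡ r → ¬ isF x
    dead-noF ℓ r x na l e (k , k<m , refl) = na (vz k , vz< k k<m , l′ , trans (sym (z-cmp (vz k) ℓ (vz< k k<m) l′)) (trans (cong (cmp ℓ) (v-z k k<m)) e))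
      where l′ : ℓ ≤ zlev (vz k)
            l′ = ≤-trans l (≤-reflexive (trans (cong lev (sym (v-z k k<m))) (z-lev (vz k) (vz< k k<m))))

    compConn : ∀ ℓ r → ¬ aliveAt ℓ r → ∀ x x′ → x < n → x′ < n → ℓ ≤ lev x → ℓ ≤ lev x′ → cmp ℓ x ≡ r → cmp ℓ x′ ≡ r → FW x x′
    compConn ℓ r na x x′ l m p q e e′ = Walk-map (λ y _ (ly , ey) → dead-noF ℓ r y na ly (trans ey e)) (comp-conn ℓ x x′ l m p q (trans e (sym e′)))

    nb⁻ : ∀ c w → 0 < nb c w → lev w < quo c n × ∃[ x ] (x < n × quo c n ≤ lev x × cmp (quo c n) x ≡ rem c n × 0 < adj w x)
    nb⁻ c w h =
      let h₁ , h₂ = unand (lt (lev w) (quo c n)) h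
          x , l , q = Σ⁻ n h₂
          q₁ , q₂ = unand (inK c x) q
          q₃ , q₄ = unand (le (quo c n) (lev x)) q₁
      in le⁻ {suc (lev w)} h₁ , x , l , le⁻ q₃ , eq⁻ q₄ , q₂

    nb⁺ : ∀ c w x → lev w < quo c n → x < n → quo c n ≤ lev x → cmp (quo c n) x ≡ rem c n → 0 < adj w x → 0 < nb c w
    nb⁺ c w x l x<n q e a = le⁺ l & Σ⁺ x x<n ((le⁺ q & eq⁺ e) & a)

    linkConn : ∀ w κ u → w < n → u < n → ¬ isF w → ¬ isF u → LinkOK κ → 0 < link w κ u → FW w u
    linkConn w zero u l m nw nu ok h = here ▻ (l , m , h , nu)
    linkConn w (suc c) u l m nw nu ok h =
      let h₁ , h₂ = unand (nb c w) h
          _ , x , x<n , p , e , a = nb⁻ c w h₁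
          _ , x′ , x′<n , p′ , e′ , a′ = nb⁻ c u h₂
      in Walk-trans (here ▻ (l , x<n , a , dead-noF _ _ x ok p e))
           (compConn _ _ ok x x′ x<n x′<n p p′ e e′ ▻ (x′<n , m , subst (0 <_) (adj-sym u x′) a′ , nu))

    -- All vertices of the connection are still present in round `lev u`, so it lies in a single
    -- component of that round.
    linkCmp : ∀ w κ u → w < n → u < n → lev u ≤ lev w → 0 < link w κ u → cmp (lev u) u ≡ cmp (lev u) w
    linkCmp w zero u l m le′ h = sym (cmp-adj (lev u) w u l m le′ ≤-refl h)
    linkCmp w (suc c) u l m le′ h =
      let h₁ , h₂ = unand (nb c w) h
          lw , x , x<n , p , e , a = nb⁻ c w h₁
          lu , x′ , x′<n , p′ , e′ , a′ = nb⁻ c u h₂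
      in trans (cmp-adj (lev u) u x′ m x′<n ≤-refl (≤-trans (<⇒≤ lu) p′) a′)
           (trans (cmp-mono (lev u) (quo c n) x′ x x′<n x<n (<⇒≤ lu) p′ p (trans e′ (sym e)))
             (sym (cmp-adj (lev u) w x l x<n le′ (≤-trans (<⇒≤ lu) p) a)))

    record Hooked (c a k u : ℕ) : Set where
      field
        nfI : NoFault c a k
        nfu : ¬ isF u
        w   : ℕ
        w<n : w < n
        pidw : pid w ≡ c
        shrw : shr (pos w) a ≡ k
        conn : FW w u
        lev≤ : lev u ≤ lev w
        cmp≡ : cmp (lev u) u ≡ cmp (lev u) w

    memConn : ∀ γ → Clean γ → ∀ c a k u → a < suc b → u < n → 0 < mem γ c a k u → Hooked c a k u
    memConn γ cl c a k u la l h = record { nfI = nfI ; nfu = nfu ; w = w ; w<n = w<n ; pidw = pidw ; shrw = shrw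
        ; conn = linkConn w κ u w<n l (noF c a k w pidw shrw nfI) nfu (Clean.links cl κ colK) lk ; lev≤ = lev≤ ; cmp≡ = linkCmp w κ u w<n l lev≤ lk }
      where
      open Member (mem⁻ h)
      nfI = Clean.hubs cl c a k la colI
      nfu = noF (pid u) 0 (pos u) u refl refl (Clean.targets cl (pid u) (pos u) colU)

    -- Vertex `i` of the query lies in the component of the hub, and by `linkCmp` the target shares
    -- its component in round `lev u`. So the path of the target can be read off the coordinates of
    -- `i`.
    target-pid : ∀ {c a k u} → u < n → Hooked c a k u → ∀ i → i < kz → quo c n ≤ zlev i → zcmp (quo c n) i ≡ rem c n →
                 pid u ≡ lev u * n + zcmp (lev u) i
    target-pid {c} {a} {k} {u} l hk i i<kz q e = cong (lev u * n +_) (trans cmp≡ (trans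
        (cmp-mono (lev u) (quo c n) w (z i) w<n (z<n i i<kz) lu (≤-reflexive lc) (≤-trans q (≤-reflexive (sym (z-lev i i<kz))))
          (trans (trans (cong (λ t → cmp t w) lc) (trans (sym (cmp-pid w w<n)) (cong (λ t → rem t n) pidw))) (sym (trans (z-cmp i (quo c n) i<kz q) e))))
        (z-cmp i (lev u) i<kz (≤-trans lu q))))
      where
      open Hooked hk
      lc : quo c n ≡ lev w
      lc = trans (cong (λ t → quo t n) (sym pidw)) (lev-pid w w<n)
      lu : lev u ≤ quo c n
      lu = ≤-trans lev≤ (≤-reflexive (sym lc))

    rep⁻ : ∀ γ c a k ℓ → rep γ c a k ℓ < n → ∃[ u ] (u < n × lev u ≡ ℓ × pos u ≡ rep γ c a k ℓ × 0 < mem γ c a k u)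
    rep⁻ γ c a k ℓ h =
      let u , l , q = Σ⁻ n (subst (λ t → 0 < Σ< n (λ u → eq (lev u) ℓ * (eq (pos u) t * mem γ c a k u))) (sym (rep-def γ c a k ℓ))
                             (least-wit n _ (subst (_< n) (rep-def γ c a k ℓ) h)))
          q₁ , q₂ = unand (eq (lev u) ℓ) q
          q₃ , q₄ = unand (eq (pos u) (rep γ c a k ℓ)) q₂
      in u , l , eq⁻ q₁ , eq⁻ {pos u} q₃ , q₄

    rep⁺ : ∀ γ c a k u → u < n → 0 < mem γ c a k u → rep γ c a k (lev u) < n
    rep⁺ γ c a k u l h = subst (_< n) (sym (rep-def γ c a k (lev u)))
      (least-< n _ (pos u) (pos<n u l) (Σ⁺ u l (eq⁺ {lev u} refl & eq⁺ {pos u} refl & h)))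

    -- coordinates below n exist for the positions that occur in chords
    chord-end : ∀ γ → Clean γ → ∀ c a k c′ x → a < suc b → 0 < memp γ c a k c′ x → ∃[ u ] (u < n × pid u ≡ c′ × pos u ≡ x × Hooked c a k u)
    chord-end γ cl c a k c′ x la h = let u , l , e , q , q′ = memp⁻ h in u , l , e , q , memConn γ cl c a k u la l q′

    -- A side of a potential cut, transported to coordinates
    module Side (R : ℕ → ℕ) (R≤1 : ∀ x → R x ≤ 1) (R-resp : ∀ x y → x < n → y < n → ¬ isF x → ¬ isF y → FW x y → R x ≡ R y) where

      at? : ∀ c P → Dec (∃[ u ] (u < n × (pid u ≡ c × pos u ≡ P × ¬ isF u)))
      at? c P = anyUpTo? (λ u → (pid u ≟ c) ×-dec ((pos u ≟ P) ×-dec ¬? (isF? u))) n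

      -- A position without a fault-free vertex inherits the value before it. So `χ` is defined also
      -- at positions that exist only in the other graph, and it changes only behind a fault.
      χ : ℕ → ℕ → ℕ
      χ-at : ∀ c P → Dec (∃[ u ] (u < n × (pid u ≡ c × pos u ≡ P × ¬ isF u))) → ℕ
      χ c P = χ-at c P (at? c P)
      χ-at c P       (yes (u , _)) = R u
      χ-at c zero    (no _) = 0
      χ-at c (suc P) (no _) = χ c P

      χ≤1 : ∀ c P → χ c P ≤ 1
      χ≤1′ : ∀ c P d → χ-at c P d ≤ 1
      χ≤1 c P = χ≤1′ c P (at? c P)
      χ≤1′ c P (yes (u , _)) = R≤1 u
      χ≤1′ c zero (no _) = z≤n
      χ≤1′ c (suc P) (no _) = χ≤1 c P

      χ-val : ∀ u c P → u < n → ¬ isF u → pid u ≡ c → pos u ≡ P → χ c P ≡ R u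
      χ-val u c P l nf refl refl = go (at? (pid u) (pos u))
        where
        go : ∀ d → χ-at (pid u) (pos u) d ≡ R u
        go (yes (u′ , l′ , e , q , _)) = let p₁ , p₂ = pid-eq u′ u l′ l e in cong R (pos-inj u′ u l′ l p₁ p₂ q)
        go (no none) = ⊥-elim (none (u , l , refl , refl , nf))

      -- If `P + 1` carries no fault-free vertex, the value is inherited. Otherwise its predecessor
      -- on the path exists and is adjacent to it, and if fault-free it would be on the same side.
      χ-jump : ∀ c P → ¬ (χ c P ≡ χ c (suc P)) → ∃[ l ] (l < m × fc l ≡ c × fp l ≡ P)
      χ-jump c P ne = go (at? c (suc P)) ne
        where
        go : ∀ d → ¬ (χ c P ≡ χ-at c (suc P) d) → ∃[ l ] (l < m × fc l ≡ c × fp l ≡ P)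
        go (no _) ne = ⊥-elim (ne refl)
        go (yes (u′ , l′ , refl , q , nf′)) ne with path-contig u′ P l′ q
        ... | u , l , p₁ , p₂ , p₃ with isF? u
        ...   | yes (k , k<m , refl) = k , k<m , trans (sym (v-pid k k<m)) (pid-cong (v k) u′ p₁ p₂) , trans (sym (v-pos k k<m)) p₃
        ...   | no nf = ⊥-elim (ne (trans (χ-val u (pid u′) P l nf (pid-cong u u′ p₁ p₂) p₃)
                  (R-resp u u′ l l′ nf nf′ (here ▻ (l , l′ , path-adj u u′ l l′ p₁ p₂ (trans q (cong suc (sym p₃))) , nf′)))))

      χ-const : ∀ c P d → (∀ l → l < m → fc l ≡ c → P ≤ fp l → fp l < P + d → ⊥) → χ c P ≡ χ c (P + d)
      χ-const c P zero h = cong (χ c) (sym (+-identityʳ P))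
      χ-const c P (suc d) h with χ c (P + d) ≟ χ c (suc (P + d))
      ... | yes e = trans (χ-const c P d (λ l l<m e p q → h l l<m e p (≤-trans q (+-monoʳ-≤ P (n≤1+n d))))) (trans e (cong (χ c) (sym (+-suc P d))))
      ... | no ne = let l , l<m , e , q = χ-jump c (P + d) ne in
        ⊥-elim (h l l<m e (≤-trans (m≤m+n P d) (≤-reflexive (sym q))) (≤-reflexive (trans (cong suc q) (sym (+-suc P d)))))

      χ-range : ∀ c P Q → P ≤ Q → (∀ l → l < m → fc l ≡ c → P ≤ fp l → fp l < Q → ⊥) → χ c P ≡ χ c Q
      χ-range c P Q le′ h = subst (λ t → χ c P ≡ χ c t) (m+[n∸m]≡n le′)
        (χ-const c P (Q ∸ P) (λ l l<m e p q → h l l<m e p (≤-trans q (≤-reflexive (m+[n∸m]≡n le′)))))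

      χ-hub : ∀ c a k P Q → NoFault c a k → shr P a ≡ k → shr Q a ≡ k → χ c P ≡ χ c Q
      χ-hub c a k P Q nf s s′ with ≤-total P Q
      ... | inj₁ le′ = χ-range c P Q le′ (λ l l<m e p q → nf l l<m e
              (≤-antisym (≤-trans (shr-mono a (<⇒≤ q)) (≤-reflexive s′)) (≤-trans (≤-reflexive (sym s)) (shr-mono a p))))
      ... | inj₂ le′ = sym (χ-range c Q P le′ (λ l l<m e p q → nf l l<m e
              (≤-antisym (≤-trans (shr-mono a (<⇒≤ q)) (≤-reflexive s)) (≤-trans (≤-reflexive (sym s′)) (shr-mono a p)))))

      -- In the graph of the cut, the two ends of a chord of a clean group are connected through
      -- their common fault-free hub.
      chord-χ : ∀ γ → Clean γ → ∀ c′ i e → 0 < Elev γ c′ i ! e → χ c′ (rem e n) ≡ χ c′ (quo e n)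
      chord-χ γ cl c′ i e h =
        let _ , c , a , k , la , mx , my = chord⁻ (proj₂ (E₀⁻ γ c′ e (Elev⇒E₀ γ c′ i e h)))
            u , l , eu , qu , hu = chord-end γ cl c a k c′ (rem e n) la mx
            y , l′ , ey , qy , hy = chord-end γ cl c a k c′ (quo e n) la my
            module U = Hooked hu
            module Y = Hooked hy
        in trans (χ-val u c′ (rem e n) l U.nfu eu qu) (trans (R-resp u y l l′ U.nfu Y.nfu
             (Walk-trans (FW-sym (noF c a k U.w U.pidw U.shrw U.nfI) U.conn)
               (Walk-trans (hubConn c a k U.nfI U.w Y.w U.w<n Y.w<n U.pidw Y.pidw U.shrw Y.shrw) Y.conn)))
             (sym (χ-val y c′ (quo e n) l′ Y.nfu ey qy)))

-- Equal labels give equal answers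

module TwoGraphs where

  open Macros using (Σ<; tab; tabOnto; _!_; it; ifz)
  open Arithmetic
  open NumberTheory
  open Hierarchy
  open Labels
  open Congruences
  open OneGraph
  open import Data.Empty using (⊥-elim)
  import Data.Integer as ℤ
  import Data.Integer.Properties as ℤₚ
  open import Data.Integer using (ℤ)
  import Data.Integer.Divisibility.Signed as ℤ∣
  open ℤ∣ using () renaming (_∣_ to _∣ℤ_)
  open import Data.List using (List)
  open import Data.Nat.Divisibility
  open import Data.Nat.Primality using (Prime; prime⇒nonTrivial)
  open import Data.Sum using (_⊎_; inj₁; inj₂; [_,_]′)
  open import Relation.Nullary using (¬_; yes; no)
  open import Relation.Binary.Definitions using (tri<; tri≈; tri>)

  small-diff : ∀ e a b → e ≤ 1 → a ≤ 1 → b ≤ 1 → ℤ.∣ ℤ.+ e ℤ.* (ℤ.+ a ℤ.- ℤ.+ b) ∣ ≤ 1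
  small-diff 0 a b _ _ _ = z≤n
  small-diff 1 0 0 _ _ _ = z≤n
  small-diff 1 0 1 _ _ _ = s≤s z≤n
  small-diff 1 1 0 _ _ _ = s≤s z≤n
  small-diff 1 1 1 _ _ _ = z≤n
  small-diff (suc (suc _)) _ _ (s≤s ()) _ _
  small-diff 1 (suc (suc _)) _ _ (s≤s ()) _
  small-diff 1 0 (suc (suc _)) _ _ (s≤s ())
  small-diff 1 1 (suc (suc _)) _ _ (s≤s ())

  diff≢0 : ∀ e a b → 0 < e → ¬ (a ≡ b) → ¬ (ℤ.+ e ℤ.* (ℤ.+ a ℤ.- ℤ.+ b) ≡ ℤ.+ 0)
  diff≢0 (suc e) a b _ ne z with ℤₚ.i*j≡0⇒i≡0∨j≡0 (ℤ.+ suc e) z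
  ... | inj₂ q = ne (ℤₚ.+-injective (ℤₚ.i-j≡0⇒i≡j (ℤ.+ a) (ℤ.+ b) q))

  small-multiple : ∀ p x → 2 ≤ p → ℤ.+ p ∣ℤ x → ℤ.∣ x ∣ ≤ 1 → x ≡ ℤ.+ 0
  small-multiple p x 2≤p d l with ℤ.∣ x ∣ in e
  ... | 0 = ℤₚ.∣i∣≡0⇒i≡0 e
  ... | 1 = ⊥-elim (<⇒≱ 2≤p (∣⇒≤ (subst (p ∣_) e (ℤ∣.∣⇒∣ᵤ d))))
  small-multiple p x 2≤p d (s≤s ()) | suc (suc _)

  first-zero : ∀ k (h : ℕ → ℕ) → 0 < h 0 → h k ≡ 0 → ∃[ i ] (i < k × 0 < h i × h (suc i) ≡ 0)
  first-zero zero h p z = ⊥-elim (0<⇒≢0 p z)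
  first-zero (suc k) h p z with 0<-dec (h k)
  ... | inj₁ z′ = let i , l , q = first-zero k h p z′ in i , m<n⇒m<1+n l , q
  ... | inj₂ q = k , ≤-refl , q , z

  -- The factors count the faults, the scales, the possible numbers of faults below the far end of a
  -- chord, and, as `g`, the chords in one cell.
  moments : ℕ → ℕ → ℕ
  moments f b = f * (b * (suc f * (2 * suc b)))

  module Slots (n b M p : ℕ) (H : Hi) where
    open LabP n b H M p
    open Hi H

    slot-root : ∀ v sl γ ℓ → sl < b → slotRep v sl γ ℓ ≡ rep γ (sl * n + cmp sl v) b 0 ℓ
    slot-root v sl γ ℓ l = cong (λ t → ifz t (rep γ (pid v) (sl ∸ b) (sib (shr (pos v) (sl ∸ b))) ℓ) (rep γ (sl * n + cmp sl v) b 0 ℓ)) (le-val {suc sl} {b} l)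

    slot-sib : ∀ v a γ ℓ → slotRep v (b + a) γ ℓ ≡ rep γ (pid v) a (sib (shr (pos v) a)) ℓ
    slot-sib v a γ ℓ = trans (cong (λ t → ifz t (rep γ (pid v) (b + a ∸ b) (sib (shr (pos v) (b + a ∸ b))) ℓ) (rep γ ((b + a) * n + cmp (b + a) v) b 0 ℓ)) (le-val0 {suc (b + a)} {b} (s≤s (m≤m+n b a))))
                             (cong (λ t → rep γ (pid v) t (sib (shr (pos v) t)) ℓ) (m+n∸m≡n b a))

  -- The cut `R` respects connections in the first graph; the goal is that a walk in the second
  -- graph cannot cross it. `W-eq` and `slot-eq` express what the equality of the labels provides.
  module Two (n b M f p : ℕ) (C : Coords) (H₁ H₂ : Hi) (ok₁ : OK n b H₁) (ok₂ : OK n b H₂) (mt₁ : Match n b H₁ C) (mt₂ : Match n b H₂ C)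
             (pp : Prime p) (N≤p : n * n ≤ p) (m≤f : Coords.m C ≤ f)
             (M′ : ℕ) (M≡ : M ≡ suc M′) (small : Known.NT n b M C ^ (3 * (Coords.m C * suc b + Coords.kz C * b)) < 2 ^ M′)
             (W-eq : ∀ l γ i j → l < Coords.m C → γ < M * M * M * M → i < 2 * b → j < moments f b →
                     LabP.Wsum n b H₁ M p γ (Coords.fc C l) (Coords.fp C l) i j ≡ LabP.Wsum n b H₂ M p γ (Coords.fc C l) (Coords.fp C l) i j)
             (slot-eq : ∀ i sl γ ℓ → i < Coords.kz C → sl < b + b → γ < M * M * M * M → ℓ < b →
                     LabP.slotRep n b H₁ M p (Match.z mt₁ i) sl γ ℓ ≡ LabP.slotRep n b H₂ M p (Match.z mt₂ i) sl γ ℓ)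
             (R : ℕ → ℕ) (R≤1 : ∀ x → R x ≤ 1)
             (R-resp : ∀ x y → x < n → y < n → ¬ One.isF n b M p H₁ ok₁ C mt₁ x → ¬ One.isF n b M p H₁ ok₁ C mt₁ y →
                       One.FW n b M p H₁ ok₁ C mt₁ x y → R x ≡ R y) where
    module A = One n b M p H₁ ok₁ C mt₁
    module B = One n b M p H₂ ok₂ C mt₂
    module LA = LabP n b H₁ M p
    module LB = LabP n b H₂ M p
    module SA = Slots n b M p H₁
    module SB = Slots n b M p H₂
    open Coords C
    open Known n b M C
    open Tok n b M
    open A.Side R R≤1 R-resp
    open Hi H₂
    open OK ok₂

    N = n * n
    g = 2 * suc b

    2≤p : 2 ≤ p
    2≤p = nonTrivial⇒n>1 p {{prime⇒nonTrivial pp}}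

    fbd : ∀ l → l < m → fc l < b * n × fp l < n
    fbd l l<m = ≤-trans (≤-reflexive (cong suc (sym (Match.v-pid mt₂ l l<m)))) (B.pid< _ (Match.v<n mt₂ l l<m)) ,
                ≤-trans (≤-reflexive (cong suc (sym (Match.v-pos mt₂ l l<m)))) (pos<n _ (Match.v<n mt₂ l l<m))

    zbd : ∀ i ℓ → i < kz → ℓ ≤ zlev i → ℓ < b × zcmp ℓ i < n
    zbd i ℓ i<kz l = ≤-<-trans (≤-trans l (≤-reflexive (sym (Match.z-lev mt₂ i i<kz)))) (lev<b _ (Match.z<n mt₂ i i<kz)) ,
                     ≤-trans (≤-reflexive (cong suc (sym (Match.z-cmp mt₂ i ℓ i<kz l)))) (cmp<n ℓ _ (Match.z<n mt₂ i i<kz))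

    module Group (γ : ℕ) (γ< : γ < M * M * M * M) (cl : Clean γ) (c : ℕ) where

      X Y : ℕ → ℕ
      X e = χ c (rem e n)
      Y e = χ c (quo e n)

      coef : List ℕ → ℕ → ℤ
      coef E e = ℤ.+ (E ! e) ℤ.* (ℤ.+ X e ℤ.- ℤ.+ Y e)

      S : List ℕ → ℕ → ℕ → ℕ
      S E j P = Σ< N (λ e → E ! e * ((le (rem e n) P * lt P (quo e n)) * e ^ j))

      S≈W : ∀ E j P → _≈_ p (ℤ.+ S E j P) (ℤ.+ rem (Σ< N (λ e → E ! e * (straddle P e * powm e j p))) p)
      S≈W E j P = ≈-trans p (≈-refl p (sym (Σℤ-pos N _))) (≈-trans p (≈-Σ p N _ _ term)
          (≈-trans p (≈-refl p (Σℤ-pos N _)) (≈-rem p (≤-trans (s≤s z≤n) 2≤p) _)))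
        where
        pull : ∀ a s x → ℤ.+ (a * (s * x)) ≡ ℤ.+ (a * s) ℤ.* ℤ.+ x
        pull a s x = trans (cong ℤ.+_ (sym (*-assoc a s x))) (ℤₚ.pos-* (a * s) x)
        term : ∀ e → e < N → _≈_ p (ℤ.+ (E ! e * (straddle P e * e ^ j))) (ℤ.+ (E ! e * (straddle P e * powm e j p)))
        term e _ = ≈-trans p (≈-refl p (pull (E ! e) (straddle P e) (e ^ j)))
          (≈-trans p (≈-* p (ℤ.+ (E ! e * straddle P e)) (≈-sym p (≈-powm p (≤-trans (s≤s z≤n) 2≤p) e j)))
            (≈-refl p (sym (pull (E ! e) (straddle P e) (powm e j p)))))

      parts : ∀ E j → (∀ e → e < N → 0 < E ! e → rem e n ≤ quo e n × quo e n ≤ n) →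
              Σℤ N (λ e → coef E e ℤ.* ℤ.+ (e ^ j)) ≡ Σℤ n (λ P → (ℤ.+ χ c P ℤ.- ℤ.+ χ c (suc P)) ℤ.* ℤ.+ S E j P)
      parts E j h = by-parts N n (E !_) (λ e → rem e n) (λ e → quo e n) (λ P → ℤ.+ χ c P) (λ e → e ^ j) h

      ordered : ∀ (H : Hi) i e → e < N → 0 < LabP.Elev n b H M p γ c i ! e → rem e n ≤ quo e n × quo e n ≤ n
      ordered H i e e<N h = <⇒≤ (proj₁ (LabP.chord⁻ n b H M p (proj₂ (LabP.E₀⁻ n b H M p γ c e (LabP.Elev⇒E₀ n b H M p γ c i e h))))) ,
                            <⇒≤ (quo-< e n n 0<n e<N)
        where 0<n : 0 < n
              0<n with 0<-dec n
              ... | inj₂ q = q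
              ... | inj₁ z = ⊥-elim (<⇒≱ e<N (≤-trans (≤-reflexive (cong (λ t → t * n) z)) z≤n))

      -- After summation by parts only the gaps behind faults contribute, and there the stored sums
      -- of both graphs agree modulo `p`. For the first graph the total is zero, because none of its
      -- chords is cut.
      moment-zero : ∀ i j → i < 2 * b → j < moments f b → ℤ.+ p ∣ℤ Σℤ N (λ e → coef (LB.Elev γ c i) e ℤ.* ℤ.+ (e ^ j))
      moment-zero i j i< j< = ≈-∣ p (≈-trans p (≈-refl p (parts EB j (ordered H₂ i))) (≈-trans p (≈-Σ p n _ _ term)
          (≈-refl p (sym (parts EA j (ordered H₁ i)))))) (subst (ℤ.+ p ∣ℤ_) (sym zero-A) (ℤ∣.divides (ℤ.+ 0) refl))
        where
        EA = LA.Elev γ c i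
        EB = LB.Elev γ c i
        zero-A : Σℤ N (λ e → coef EA e ℤ.* ℤ.+ (e ^ j)) ≡ ℤ.+ 0
        zero-A = Σℤ-0 N pt
          where
          pt : ∀ e → e < N → coef EA e ℤ.* ℤ.+ (e ^ j) ≡ ℤ.+ 0
          pt e _ with 0<-dec (EA ! e)
          ... | inj₁ z = cong (λ t → (ℤ.+ t ℤ.* (ℤ.+ X e ℤ.- ℤ.+ Y e)) ℤ.* ℤ.+ (e ^ j)) z
          ... | inj₂ h = trans (cong (λ t → (ℤ.+ (EA ! e) ℤ.* t) ℤ.* ℤ.+ (e ^ j)) (trans (cong (λ t → ℤ.+ t ℤ.- ℤ.+ Y e) (chord-χ γ cl c i e h)) (ℤₚ.+-inverseʳ (ℤ.+ Y e))))
                               (cong (ℤ._* ℤ.+ (e ^ j)) (ℤₚ.*-zeroʳ (ℤ.+ (EA ! e))))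
        term : ∀ P → P < n → _≈_ p ((ℤ.+ χ c P ℤ.- ℤ.+ χ c (suc P)) ℤ.* ℤ.+ S EB j P) ((ℤ.+ χ c P ℤ.- ℤ.+ χ c (suc P)) ℤ.* ℤ.+ S EA j P)
        term P _ with χ c P ≟ χ c (suc P)
        ... | yes e = ≈-refl p (trans (zr (S EB j P)) (sym (zr (S EA j P))))
          where zr : ∀ s → (ℤ.+ χ c P ℤ.- ℤ.+ χ c (suc P)) ℤ.* ℤ.+ s ≡ ℤ.+ 0
                zr s = cong (ℤ._* ℤ.+ s) (trans (cong (λ t → ℤ.+ t ℤ.- ℤ.+ χ c (suc P)) e) (ℤₚ.+-inverseʳ (ℤ.+ χ c (suc P))))
        ... | no ne with χ-jump c P ne
        ...   | l , l<m , refl , refl = ≈-* p (ℤ.+ χ c P ℤ.- ℤ.+ χ c (suc P)) (≈-trans p (S≈W EB j P) (≈-trans p (≈-refl p (cong ℤ.+_ (sym (W-eq l γ i j l<m γ< i< j<)))) (≈-sym p (S≈W EA j P))))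

      neq : ℕ → ℕ → ℕ
      neq a b = isz (eq a b)

      neq⁺ : ∀ {a b} → ¬ (a ≡ b) → 0 < neq a b
      neq⁺ ne = isz⁺ (eq-val0 ne)

      neq⁻ : ∀ {a b} → 0 < neq a b → ¬ (a ≡ b)
      neq⁻ {a} h refl = 0<⇒≢0 (eq⁺ {a} refl) (isz⁻ h)

      crb : ℕ → ℕ → ℕ
      crb i e = LB.Elev γ c i ! e * neq (X e) (Y e)

      crb≤1 : ∀ i e → crb i e ≤ 1
      crb≤1 i e = *-mono-≤ {LB.Elev γ c i ! e} {1} {_} {1} (LB.Elev≤1 γ c i e) (isz≤1 _)

      nz≤crb : ∀ i e → nz (coef (LB.Elev γ c i) e) ≤ crb i e
      nz≤crb i e with 0<-dec (LB.Elev γ c i ! e)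
      ... | inj₁ z = ≤-trans (≤-reflexive (cong (λ t → nz (ℤ.+ t ℤ.* (ℤ.+ X e ℤ.- ℤ.+ Y e))) z)) z≤n
      ... | inj₂ h with X e ≟ Y e
      ...   | yes q = ≤-trans (≤-reflexive (cong nz (trans (cong (λ t → ℤ.+ (LB.Elev γ c i ! e) ℤ.* (ℤ.+ t ℤ.- ℤ.+ Y e)) q)
                        (trans (cong (ℤ.+ (LB.Elev γ c i ! e) ℤ.*_) (ℤₚ.+-inverseʳ (ℤ.+ Y e))) (ℤₚ.*-zeroʳ (ℤ.+ (LB.Elev γ c i ! e))))))) z≤n
      ...   | no ne = ≤-trans (sg≤1 _) (h & neq⁺ ne)

      kS : ℕ → ℕ → ℕ
      kS l a = sib (shr (fp l) a)

      cleanb : ℕ → ℕ → ℕ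
      cleanb l a = isz (Σ< m (λ l′ → eq (fc l′) c * eq (shr (fp l′) a) (kS l a)))

      cnt : ℕ → ℕ
      cnt y = Σ< m (λ l → eq (fc l) c * lt (fp l) y)

      -- The crossing chords whose lower end lies in the fault-free sibling of the interval of scale
      -- `a` around fault `l`, and whose upper end has exactly `q` faults of the path below it. On
      -- each of these two ranges `χ` is constant.
      cell : ℕ → ℕ → ℕ → ℕ → ℕ → ℕ
      cell i l a q e = crb i e * (eq (fc l) c * (cleanb l a * (eq (key a e) (kS l a) * eq (cnt (quo e n)) q)))

      cnt≤m : ∀ y → cnt y ≤ m
      cnt≤m y = ≤-trans (Σ-mono m (λ l _ → *-mono-≤ {eq (fc l) c} {1} {_} {1} (isz≤1 _) (isz≤1 _))) (≤-reflexive (trans (Σ-const m 1) (*-identityʳ m)))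

      cnt-mono : ∀ y y′ → y ≤ y′ → cnt y ≤ cnt y′
      cnt-mono y y′ le′ = Σ-mono m (λ l _ → *-monoʳ-≤ (eq (fc l) c) (lt-mono l))
        where
        lt-mono : ∀ l → lt (fp l) y ≤ lt (fp l) y′
        lt-mono l with 0<-dec (lt (fp l) y)
        ... | inj₁ z = ≤-trans (≤-reflexive z) z≤n
        ... | inj₂ h = ≤-trans (isz≤1 _) (≤-reflexive (sym (le-val {suc (fp l)} (≤-trans (le⁻ {suc (fp l)} h) le′))))

      cnt-χ : ∀ y y′ → y ≤ y′ → cnt y ≡ cnt y′ → χ c y ≡ χ c y′
      cnt-χ y y′ le′ e = χ-range c y y′ le′ (λ l l<m q p₁ p₂ → <-irrefl e
        (Σ-mono< m (λ l′ _ → *-monoʳ-≤ (eq (fc l′) c) (ltm l′)) l l<m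
          (subst (_< eq (fc l) c * lt (fp l) y′) (sym (trans (cong (eq (fc l) c *_) (le-val0 {suc (fp l)} {y} (s≤s p₁))) (*-zeroʳ (eq (fc l) c)))) (eq⁺ q & le⁺ {suc (fp l)} p₂))))
        where
        ltm : ∀ l → lt (fp l) y ≤ lt (fp l) y′
        ltm l with 0<-dec (lt (fp l) y)
        ... | inj₁ z = ≤-trans (≤-reflexive z) z≤n
        ... | inj₂ h = ≤-trans (isz≤1 _) (≤-reflexive (sym (le-val {suc (fp l)} (≤-trans (le⁻ {suc (fp l)} h) le′))))

      cnt-χ′ : ∀ y y′ → cnt y ≡ cnt y′ → χ c y ≡ χ c y′
      cnt-χ′ y y′ e with ≤-total y y′
      ... | inj₁ l = cnt-χ y y′ l e
      ... | inj₂ l = sym (cnt-χ y′ y l (sym e))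

      -- On a path without faults `χ` is constant and nothing crosses; otherwise `live` yields the
      -- interval of the lower end.
      in-cell : ∀ i e → 0 < crb i e → ∃[ l ] ∃[ a ] (l < m × a < b × 0 < cell i l a (cnt (quo e n)) e)
      in-cell i e h = go (live c (rem e n) x<n n<2^b (λ l l<m → proj₂ (fbd l l<m)) nf)
        where
        hE = proj₁ (unand (LB.Elev γ c i ! e) h)
        ne = neq⁻ {X e} {Y e} (proj₂ (unand (LB.Elev γ c i ! e) h))
        ch = chord-info (LB.Elev⇒E₀ γ c i e hE)
          where
          chord-info : 0 < LB.E₀ γ c ! e → rem e n < quo e n × ∃[ u ] (u < n × LB.pid u ≡ c × pos u ≡ rem e n × ¬ B.isF u)
          chord-info h₀ = let q , c₁ , a , k , la , mx , _ = LB.chord⁻ (proj₂ (LB.E₀⁻ γ c e h₀))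
                              u , l , e₁ , e₂ , hk = B.chord-end γ cl c₁ a k c (rem e n) la mx
                          in q , u , l , e₁ , e₂ , B.Hooked.nfu hk
        u = proj₁ (proj₂ ch)
        u-info = proj₂ (proj₂ ch)
        x<n : rem e n < n
        x<n = ≤-trans (≤-reflexive (cong suc (sym (proj₁ (proj₂ (proj₂ u-info)))))) (pos<n u (proj₁ u-info))
        nf : NoFault c 0 (rem e n)
        nf = subst₂ (λ s t → NoFault s 0 t) (proj₁ (proj₂ u-info)) (proj₁ (proj₂ (proj₂ u-info))) (B.F-NoFault u (proj₁ u-info) (proj₂ (proj₂ (proj₂ u-info))))
        go : (∀ l → l < m → ¬ (fc l ≡ c)) ⊎ ∃[ l ] ∃[ a ] (l < m × a < b × fc l ≡ c × shr (rem e n) a ≡ sib (shr (fp l) a) × NoFault c a (shr (rem e n) a)) →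
             ∃[ l ] ∃[ a ] (l < m × a < b × 0 < cell i l a (cnt (quo e n)) e)
        go (inj₁ none) = ⊥-elim (ne (χ-range c (rem e n) (quo e n) (<⇒≤ (proj₁ ch)) (λ l l<m q _ _ → none l l<m q)))
        go (inj₂ (l , a , l<m , a<b , q , s , nfa)) = l , a , l<m , a<b ,
          (h & eq⁺ q & isz⁺ (Σ≡0 m fz) & eq⁺ s & eq⁺ {cnt (quo e n)} refl)
          where
          fz : ∀ l′ → l′ < m → eq (fc l′) c * eq (shr (fp l′) a) (kS l a) ≡ 0
          fz l′ l′<m with 0<-dec (eq (fc l′) c * eq (shr (fp l′) a) (kS l a))
          ... | inj₁ z = z
          ... | inj₂ q′ = let q₁ , q₂ = unand (eq (fc l′) c) q′ in ⊥-elim (nfa l′ l′<m (eq⁻ q₁) (trans (eq⁻ {shr (fp l′) a} q₂) (sym s)))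

      -- As soon as one chord of the cell crosses, all chords with its ranges do. If these were `g`
      -- or more, `net` would pass one of them on to the next level, which has no crossing.
      cell-bound : ∀ i → Σ< N (crb (suc i)) ≡ 0 → ∀ l a q → l < m → a < b → Σ< N (cell i l a q) ≤ g
      cell-bound i next l a q l<m a<b with 0<-dec (Σ< N (cell i l a q))
      ... | inj₁ z = ≤-trans (≤-reflexive z) z≤n
      ... | inj₂ h with g ≤? Σ< N (λ e → LB.Elev γ c i ! e * eq (key a e) (kS l a) * eq (cnt (quo e n)) q)
      ...   | no ¬big = <⇒≤ (≤-<-trans (Σ-mono N pt) (≰⇒> ¬big))
        where
        pt : ∀ e → e < N → cell i l a q e ≤ LB.Elev γ c i ! e * eq (key a e) (kS l a) * eq (cnt (quo e n)) q
        pt e _ with 0<-dec (cell i l a q e)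
        ... | inj₁ z = ≤-trans (≤-reflexive z) z≤n
        ... | inj₂ h′ = let h₁ , h₂ = unand (crb i e) h′
                            h₃ , h₄ = unand (eq (fc l) c) h₂
                            h₅ , h₆ = unand (cleanb l a) h₄
                            h₇ , h₈ = unand (eq (key a e) (kS l a)) h₆
                        in ≤-trans (*-mono-≤ {crb i e} {1} {_} {1} (crb≤1 i e) (*-mono-≤ {eq (fc l) c} {1} {_} {1} (isz≤1 _) (*-mono-≤ {cleanb l a} {1} {_} {1} (isz≤1 _)
                             (*-mono-≤ {eq (key a e) (kS l a)} {1} {_} {1} (isz≤1 _) (isz≤1 _))))) ((proj₁ (unand (LB.Elev γ c i ! e) h₁) & h₇) & h₈)
      ...   | yes big =
        let e₀ , _ , h′ = Σ⁻ N h
            h₁ , h₂ = unand (crb i e₀) h′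
            h₃ , h₄ = unand (eq (fc l) c) h₂
            h₅ , h₆ = unand (cleanb l a) h₄
            h₇ , h₈ = unand (eq (key a e₀) (kS l a)) h₆
            e₁ , e₁<N , q₁ , q₂ , q₃ , q₄ = net g (s≤s z≤n) (key a) a (LB.Elev γ c i) (LB.Elev≤1 γ c i) N (kS l a) (λ e → cnt (quo e n)) q
                                              (λ e e′ le′ → cnt-mono _ _ (quo-mono n le′)) big
            nfa : NoFault c a (kS l a)
            nfa = λ l′ l′<m p₁ p₂ → 0<⇒≢0 (eq⁺ p₁ & eq⁺ p₂) (Σ≡0⁻ m (isz⁻ h₅) l′ l′<m)
            X≡ : X e₁ ≡ X e₀
            X≡ = χ-hub c a (kS l a) (rem e₁ n) (rem e₀ n) nfa q₂ (eq⁻ {key a e₀} h₇)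
            Y≡ : Y e₁ ≡ Y e₀
            Y≡ = cnt-χ′ (quo e₁ n) (quo e₀ n) (trans q₃ (sym (eq⁻ {cnt (quo e₀ n)} h₈)))
            ne = neq⁻ {X e₀} {Y e₀} (proj₂ (unand (LB.Elev γ c i ! e₀) h₁))
            el : 0 < LB.Elev γ c (suc i) ! e₁
            el = subst (λ E → 0 < E ! e₁) (sym (LB.Elev-suc γ c i)) (LB.Enext⁺ (LB.Elev γ c i) e₁ a e₁<N (m<n⇒m<1+n a<b) q₄)
        in ⊥-elim (0<⇒≢0 (el & neq⁺ (λ q′ → ne (trans (sym X≡) (trans q′ Y≡)))) (Σ≡0⁻ N next e₁ e₁<N))

      support : ∀ i → Σ< N (crb (suc i)) ≡ 0 → Σ< N (λ e → nz (coef (LB.Elev γ c i) e)) ≤ moments f b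
      support i next = begin
        Σ< N (λ e → nz (coef (LB.Elev γ c i) e))                                          ≤⟨ Σ-mono N (λ e _ → ≤-trans (nz≤crb i e) (covered e)) ⟩
        Σ< N (λ e → Σ< m (λ l → Σ< b (λ a → Σ< (suc f) (λ q → cell i l a q e))))           ≡⟨ Σ-swap N m (λ e l → Σ< b (λ a → Σ< (suc f) (λ q → cell i l a q e))) ⟩
        Σ< m (λ l → Σ< N (λ e → Σ< b (λ a → Σ< (suc f) (λ q → cell i l a q e))))           ≤⟨ Σ-mono m inner ⟩
        Σ< m (λ _ → b * (suc f * g))                                                       ≡⟨ Σ-const m _ ⟩
        m * (b * (suc f * g))                                                              ≤⟨ *-monoˡ-≤ _ m≤f ⟩
        moments f b                                                                        ∎
        where
        open ≤-Reasoning
        covered : ∀ e → crb i e ≤ Σ< m (λ l → Σ< b (λ a → Σ< (suc f) (λ q → cell i l a q e)))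
        covered e with 0<-dec (crb i e)
        ... | inj₁ z = ≤-trans (≤-reflexive z) z≤n
        ... | inj₂ h = let l , a , l<m , a<b , r = in-cell i e h in
          ≤-trans (crb≤1 i e) (Σ⁺ {m} {λ l → Σ< b (λ a → Σ< (suc f) (λ q → cell i l a q e))} l l<m (Σ⁺ {b} {λ a → Σ< (suc f) (λ q → cell i l a q e)} a a<b
            (Σ⁺ {suc f} {λ q → cell i l a q e} (cnt (quo e n)) (s≤s (≤-trans (cnt≤m (quo e n)) m≤f)) r)))
        inner : ∀ l → l < m → Σ< N (λ e → Σ< b (λ a → Σ< (suc f) (λ q → cell i l a q e))) ≤ b * (suc f * g)
        inner l l<m = begin
          Σ< N (λ e → Σ< b (λ a → Σ< (suc f) (λ q → cell i l a q e)))   ≡⟨ Σ-swap N b (λ e a → Σ< (suc f) (λ q → cell i l a q e)) ⟩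
          Σ< b (λ a → Σ< N (λ e → Σ< (suc f) (λ q → cell i l a q e)))   ≤⟨ Σ-mono b (λ a a<b → ≤-trans (≤-reflexive (Σ-swap N (suc f) (λ e q → cell i l a q e)))
                                                                            (≤-trans (Σ-mono (suc f) {λ q → Σ< N (λ e → cell i l a q e)} {λ _ → g} (λ q _ → cell-bound i next l a q l<m a<b)) (≤-reflexive (Σ-const (suc f) g)))) ⟩
          Σ< b (λ _ → suc f * g)                                        ≡⟨ Σ-const b _ ⟩
          b * (suc f * g)                                               ∎

      no-crossing : ∀ e → 0 < LB.E₀ γ c ! e → X e ≡ Y e
      no-crossing e h with X e ≟ Y e
      ... | yes q = q
      ... | no ne with first-zero (2 * b) (λ i → Σ< N (crb i)) (Σ⁺ e (proj₁ (LB.E₀⁻ γ c e h)) (subst (λ E → 0 < E ! e) (sym (LB.Elev-0 γ c)) h & neq⁺ ne))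
                       (Σ≡0 N (λ e′ _ → cong (_* neq (X e′) (Y e′)) (LB.exhausted n<2^b γ c e′)))
      ... | i , i< , h₁ , next =
        let e₁ , e₁<N , h₂ = Σ⁻ N h₁
            h₃ , h₄ = unand (LB.Elev γ c i ! e₁) h₂
            d = vandermonde {p} {N} pp N≤p (moments f b) (coef (LB.Elev γ c i)) (support i next) (λ j → moment-zero i j i<) e₁ e₁<N
        in ⊥-elim (diff≢0 (LB.Elev γ c i ! e₁) (X e₁) (Y e₁) h₃ (neq⁻ {X e₁} {Y e₁} h₄)
             (small-multiple p _ 2≤p d (small-diff (LB.Elev γ c i ! e₁) (X e₁) (Y e₁) (LB.Elev≤1 γ c i e₁) (χ≤1 c _) (χ≤1 c _))))

      -- members of a hub are linked by a chain of chords
      chain : ∀ c₁ a k → c₁ < b * n → a < suc b → k < suc n → ∀ d x y → x < y → y ≤ x + d →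
              0 < LB.memp γ c₁ a k c x → 0 < LB.memp γ c₁ a k c y → χ c x ≡ χ c y
      chain c₁ a k lc la lk zero x y l le′ mx my = ⊥-elim (<⇒≱ l (≤-trans le′ (≤-reflexive (+-identityʳ x))))
      chain c₁ a k lc la lk (suc d) x y l le′ mx my with 0<-dec (Σ< y (λ v → lt x v * LB.memp γ c₁ a k c v))
      ... | inj₂ h = let v , v<y , q = Σ⁻ y h
                         q₁ , q₂ = unand (lt x v) q
                         x<v = le⁻ {suc x} q₁
                     in trans (chain c₁ a k lc la lk d x v x<v (≤-pred (≤-trans v<y (≤-trans le′ (≤-reflexive (+-suc x d))))) mx q₂)
                              (chain c₁ a k lc la lk d v y v<y (≤-trans le′ (≤-trans (≤-reflexive (+-suc x d)) (+-monoˡ-≤ d x<v))) q₂ my)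
      ... | inj₁ z = trans (cong (χ c) (sym (rem-unique y x n x<n))) (trans (no-crossing (y * n + x) (LB.E₀⁺ γ c x y x<n y<n
                       (LB.chord⁺ c₁ a k l lc la lk mx my none))) (cong (χ c) (quo-unique y x n x<n)))
        where
        bd : ∀ {v} → 0 < LB.memp γ c₁ a k c v → v < n
        bd h = let u , l , _ , q , _ = LB.memp⁻ h in ≤-trans (≤-reflexive (cong suc (sym q))) (pos<n u l)
        x<n = bd mx
        y<n = bd my
        none : ∀ v → x < v → v < y → LB.memp γ c₁ a k c v ≡ 0
        none v x<v v<y with 0<-dec (LB.memp γ c₁ a k c v)
        ... | inj₁ e = e
        ... | inj₂ h = ⊥-elim (0<⇒≢0 (le⁺ {suc x} x<v & h) (Σ≡0⁻ y z v v<y))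

      chain′ : ∀ c₁ a k → c₁ < b * n → a < suc b → k < suc n → ∀ x y → 0 < LB.memp γ c₁ a k c x → 0 < LB.memp γ c₁ a k c y → χ c x ≡ χ c y
      chain′ c₁ a k lc la lk x y mx my with <-cmp x y

      ... | tri< l _ _ = chain c₁ a k lc la lk y x y l (m≤n+m y x) mx my

      ... | tri≈ _ refl _ = refl
      ... | tri> _ _ l = sym (chain c₁ a k lc la lk x y x l (m≤n+m x y) my mx)

    -- the hub of a vertex, its representatives being stored in the label of a fault or of a query vertex
    record Hub (w : ℕ) : Set where
      field
        a k i : ℕ
        a<    : a < suc b
        k<    : k < suc n
        shrw  : shr (pos w) a ≡ k
        nf    : NoFault (LB.pid w) a k
        reps  : ∀ γ ℓ → γ < M * M * M * M → ℓ < b → LA.rep γ (LB.pid w) a k ℓ ≡ LB.rep γ (LB.pid w) a k ℓ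
        i<kz  : i < kz
        zl    : quo (LB.pid w) n ≤ zlev i
        zc    : zcmp (quo (LB.pid w) n) i ≡ rem (LB.pid w) n

    -- If the path of `w` has no fault, the hub is the whole path, and slot `lev w` of a query
    -- vertex or fault in the component of `w` describes it. Otherwise it is the sibling of an
    -- interval around a fault, described in slot `b + a` of that fault.
    hub : ∀ w → w < n → ¬ B.isF w → aliveAt (lev w) (cmp (lev w) w) → Hub w
    hub w w<n nfw (i , i<kz , zl , zc) = go (live (LB.pid w) (pos w) (pos<n w w<n) n<2^b (λ l l<m → proj₂ (fbd l l<m)) (B.F-NoFault w w<n nfw))
      where
      c = LB.pid w
      sl = lev w
      q≡ = B.lev-pid w w<n
      r≡ = B.cmp-pid w w<n
      go : (∀ l → l < m → ¬ (fc l ≡ c)) ⊎ ∃[ l ] ∃[ a ] (l < m × a < b × fc l ≡ c × shr (pos w) a ≡ sib (shr (fp l) a) × NoFault c a (shr (pos w) a)) → Hub w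
      go (inj₁ none) = record
        { a = b ; k = 0 ; i = i ; a< = ≤-refl ; k< = s≤s z≤n
        ; shrw = <2^⇒shr≡0 b (pos w) (<-trans (pos<n w w<n) n<2^b)
        ; nf = λ l l<m e _ → none l l<m e
        ; reps = reps
        ; i<kz = i<kz ; zl = ≤-trans (≤-reflexive q≡) zl ; zc = trans (cong (λ t → zcmp t i) q≡) (trans zc (sym r≡)) }
        where
        sl<b = lev<b w w<n
        c₁ : sl * n + Hi.cmp H₁ sl (Match.z mt₁ i) ≡ c
        c₁ = cong (sl * n +_) (trans (Match.z-cmp mt₁ i sl i<kz zl) zc)
        c₂ : sl * n + cmp sl (Match.z mt₂ i) ≡ c
        c₂ = cong (sl * n +_) (trans (Match.z-cmp mt₂ i sl i<kz zl) zc)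
        reps : ∀ γ ℓ → γ < M * M * M * M → ℓ < b → LA.rep γ c b 0 ℓ ≡ LB.rep γ c b 0 ℓ
        reps γ ℓ γ< ℓ< = trans (cong (λ t → LA.rep γ t b 0 ℓ) (sym c₁)) (trans (sym (SA.slot-root (Match.z mt₁ i) sl γ ℓ sl<b))
          (trans (slot-eq i sl γ ℓ i<kz (≤-trans sl<b (m≤m+n b b)) γ< ℓ<) (trans (SB.slot-root (Match.z mt₂ i) sl γ ℓ sl<b) (cong (λ t → LB.rep γ t b 0 ℓ) c₂))))
      go (inj₂ (l , a , l<m , a<b , fc≡ , s , nf)) = record
        { a = a ; k = shr (pos w) a ; i = vz l ; a< = m<n⇒m<1+n a<b ; k< = s≤s (≤-trans (shr≤ (pos w) a) (<⇒≤ (pos<n w w<n))) ; shrw = refl ; nf = nf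
        ; reps = reps ; i<kz = vz<
        ; zl = ≤-trans (≤-reflexive (trans q≡′ (cong lev (sym (Match.v-z mt₂ l l<m))))) (≤-reflexive (Match.z-lev mt₂ (vz l) vz<))
        ; zc = trans (sym (Match.z-cmp mt₂ (vz l) (quo c n) vz< (≤-trans (≤-reflexive (trans q≡′ (cong lev (sym (Match.v-z mt₂ l l<m))))) (≤-reflexive (Match.z-lev mt₂ (vz l) vz<)))))
                     (trans (cong₂ cmp q≡′ (Match.v-z mt₂ l l<m)) (trans (sym (B.cmp-pid v v<n)) (cong (λ t → rem t n) pv))) }
        where
        vz< = Match.vz< mt₂ l l<m
        v = Match.v mt₂ l
        v<n = Match.v<n mt₂ l l<m
        pv : LB.pid v ≡ c
        pv = trans (Match.v-pid mt₂ l l<m) fc≡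
        q≡′ : quo c n ≡ lev v
        q≡′ = trans (cong (λ t → quo t n) (sym pv)) (B.lev-pid v v<n)
        z₁ = Match.z mt₁ (vz l)
        z₂ = Match.z mt₂ (vz l)
        p₁ : LA.pid z₁ ≡ c
        p₁ = trans (cong LA.pid (Match.v-z mt₁ l l<m)) (trans (Match.v-pid mt₁ l l<m) fc≡)
        p₂ : LB.pid z₂ ≡ c
        p₂ = trans (cong LB.pid (Match.v-z mt₂ l l<m)) pv
        s₁ : sib (shr (Hi.pos H₁ z₁) a) ≡ shr (pos w) a
        s₁ = trans (cong (λ t → sib (shr t a)) (trans (cong (Hi.pos H₁) (Match.v-z mt₁ l l<m)) (Match.v-pos mt₁ l l<m))) (sym s)
        s₂ : sib (shr (pos z₂) a) ≡ shr (pos w) a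
        s₂ = trans (cong (λ t → sib (shr t a)) (trans (cong pos (Match.v-z mt₂ l l<m)) (Match.v-pos mt₂ l l<m))) (sym s)
        reps : ∀ γ ℓ → γ < M * M * M * M → ℓ < b → LA.rep γ c a (shr (pos w) a) ℓ ≡ LB.rep γ c a (shr (pos w) a) ℓ
        reps γ ℓ γ< ℓ< = trans (cong₂ (λ t u → LA.rep γ t a u ℓ) (sym p₁) (sym s₁)) (trans (sym (SA.slot-sib z₁ a γ ℓ))
          (trans (slot-eq (vz l) (b + a) γ ℓ vz< (+-monoʳ-< b a<b) γ< ℓ<) (trans (SB.slot-sib z₂ a γ ℓ) (cong₂ (λ t u → LB.rep γ t a u ℓ) p₂ s₂))))

    χv : ℕ → ℕ
    χv x = χ (LB.pid x) (pos x)

    -- In a clean group for this hub, link and target, the representative of round `lev u` has the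
    -- same coordinates in both graphs. In the first graph it is connected with the hub; in the
    -- second it is joined to `u` by a chain of chords, none of which is cut.
    triple : ∀ w κ u → w < n → u < n → ¬ B.isF w → ¬ B.isF u → aliveAt (lev w) (cmp (lev w) w) → lev u ≤ lev w → LinkOK κ →
             κ < suc (b * n) → 0 < LB.link w κ u → χv w ≡ χv u
    triple w κ u w<n u<n nfw nfu al le′ lok κ< lk =
      conclude (clean-group fbd zbd M′ M≡ small (LB.pid w) a k κ (LB.pid u) (pos u) (B.pid< w w<n) a< k< κ< (B.pid< u u<n) (pos<n u u<n) nf lok (B.F-NoFault u u<n nfu))
      where
      open Hub (hub w w<n nfw al)
      c = LB.pid w
      ℓ = lev u
      ℓ<b = lev<b u u<n
      conclude : ∃[ γ ] (γ < M * M * M * M × Clean γ × col γ (tokI c a k) ≡ c1 γ × col γ (tokK κ) ≡ c2 γ × col γ (tokI (LB.pid u) 0 (pos u)) ≡ c3 γ) → χv w ≡ χv u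
      conclude (γ , γ< , cl , e₁ , e₂ , e₃) = via (B.rep⁻ γ c a k ℓ r<n) (A.rep⁻ γ c a k ℓ (subst (_< n) (sym (reps γ ℓ γ< ℓ<b)) r<n))
        where
        memu : 0 < LB.mem γ c a k u
        memu = LB.mem⁺ (record { colI = e₁ ; colU = e₃ ; w = w ; w<n = w<n ; pidw = refl ; shrw = shrw ; lev≤ = le′ ; κ = κ ; κ< = κ< ; colK = e₂ ; lk = lk })
        r<n : LB.rep γ c a k ℓ < n
        r<n = B.rep⁺ γ c a k u u<n memu
        via : ∃[ u₀ ] (u₀ < n × lev u₀ ≡ ℓ × pos u₀ ≡ LB.rep γ c a k ℓ × 0 < LB.mem γ c a k u₀) →
              ∃[ u₁ ] (u₁ < n × Hi.lev H₁ u₁ ≡ ℓ × Hi.pos H₁ u₁ ≡ LA.rep γ c a k ℓ × 0 < LA.mem γ c a k u₁) → χv w ≡ χv u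
        via (u₀ , u₀<n , l₀ , p₀ , m₀) (u₁ , u₁<n , l₁ , p₁ , m₁) = begin
          χ c (pos w)                        ≡⟨ χ-hub c a k (pos w) (Hi.pos H₁ h₁.w) nf shrw h₁.shrw ⟩
          χ c (Hi.pos H₁ h₁.w)               ≡⟨ χ-val h₁.w c (Hi.pos H₁ h₁.w) h₁.w<n nfw₁ h₁.pidw refl ⟩
          R h₁.w                             ≡⟨ R-resp h₁.w u₁ h₁.w<n u₁<n nfw₁ h₁.nfu h₁.conn ⟩
          R u₁                               ≡⟨ sym (χ-val u₁ (LB.pid u) (pos u₀) u₁<n h₁.nfu (trans pid₁ (sym pidu)) (trans p₁ (trans (reps γ ℓ γ< ℓ<b) (sym p₀)))) ⟩
          χ (LB.pid u) (pos u₀)              ≡⟨ Group.chain′ γ γ< cl (LB.pid u) c a k (B.pid< w w<n) a< k< (pos u₀) (pos u)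
                                                  (subst (λ t → 0 < LB.memp γ c a k t (pos u₀)) (trans pid₀ (sym pidu)) (LB.memp⁺ u₀ u₀<n m₀)) (LB.memp⁺ u u<n memu) ⟩
          χ (LB.pid u) (pos u)               ∎
          where
          open ≡-Reasoning
          module h₁ = A.Hooked (A.memConn γ cl c a k u₁ a< u₁<n m₁)
          nfw₁ = A.noF c a k h₁.w h₁.pidw h₁.shrw nf
          pidu : LB.pid u ≡ ℓ * n + zcmp ℓ i
          pidu = B.target-pid u<n (B.memConn γ cl c a k u a< u<n memu) i i<kz zl zc
          pid₀ : LB.pid u₀ ≡ ℓ * n + zcmp ℓ i
          pid₀ = trans (B.target-pid u₀<n (B.memConn γ cl c a k u₀ a< u₀<n m₀) i i<kz zl zc) (cong (λ t → t * n + zcmp t i) l₀)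
          pid₁ : LA.pid u₁ ≡ ℓ * n + zcmp ℓ i
          pid₁ = trans (A.target-pid u₁<n (A.memConn γ cl c a k u₁ a< u₁<n m₁) i i<kz zl zc) (cong (λ t → t * n + zcmp t i) l₁)

    aliveV : ℕ → Set
    aliveV x = aliveAt (lev x) (cmp (lev x) x)

    link-sym : ∀ w κ u → 0 < LB.link w κ u → 0 < LB.link u κ w
    link-sym w zero u h = subst (0 <_) (adj-sym w u) h
    link-sym w (suc c) u h = let h₁ , h₂ = unand (LB.nb c w) h in h₂ & h₁

    tie : ∀ w κ u → w < n → u < n → ¬ B.isF w → ¬ B.isF u → aliveV w → aliveV u → LinkOK κ → κ < suc (b * n) → 0 < LB.link w κ u → χv w ≡ χv u
    tie w κ u w<n u<n nfw nfu aw au lok κ< lk with ≤-total (lev u) (lev w)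
    ... | inj₁ l = triple w κ u w<n u<n nfw nfu aw l lok κ< lk
    ... | inj₂ l = sym (triple u κ w u<n w<n nfu nfw au l lok κ< (link-sym w κ u lk))

    alive-down : ∀ ℓ′ ℓ w → w < n → ℓ ≤ lev w → ℓ′ ≤ ℓ → aliveAt ℓ (cmp ℓ w) → aliveAt ℓ′ (cmp ℓ′ w)
    alive-down ℓ′ ℓ w w<n l l′ (i , i<kz , zl , zc) = i , i<kz , ≤-trans l′ zl ,
      trans (sym (Match.z-cmp mt₂ i ℓ′ i<kz (≤-trans l′ zl)))
        (cmp-mono ℓ′ ℓ _ w (Match.z<n mt₂ i i<kz) w<n l′ (≤-trans zl (≤-reflexive (sym (Match.z-lev mt₂ i i<kz)))) l (trans (Match.z-cmp mt₂ i ℓ i<kz zl) zc))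

    -- If `w` were still present in round `ℓ`, it would lie in the dead component of its neighbour
    -- `y`.
    above : ∀ w y ℓ → w < n → y < n → aliveV w → ℓ ≤ lev y → ¬ aliveAt ℓ (cmp ℓ y) → 0 < adj w y → lev w < ℓ
    above w y ℓ w<n y<n aw l na a with lev w <? ℓ
    ... | yes q = q
    ... | no ¬q = ⊥-elim (na (subst (aliveAt ℓ) (cmp-adj ℓ w y w<n y<n (≮⇒≥ ¬q) l a) (alive-down ℓ (lev w) w w<n ≤-refl (≮⇒≥ ¬q) aw)))

    first-dead : ∀ x k → k ≤ lev x → (∀ ℓ → ℓ ≤ k → aliveAt ℓ (cmp ℓ x)) ⊎
                 ∃[ ℓ ] (ℓ ≤ k × ¬ aliveAt ℓ (cmp ℓ x) × (∀ ℓ′ → ℓ′ < ℓ → aliveAt ℓ′ (cmp ℓ′ x)))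
    first-dead x zero l with aliveAt? 0 (cmp 0 x)
    ... | yes q = inj₁ (λ { zero _ → q })
    ... | no ¬q = inj₂ (0 , z≤n , ¬q , λ _ ())
    first-dead x (suc k) l with first-dead x k (<⇒≤ l)
    ... | inj₂ (ℓ , l′ , r) = inj₂ (ℓ , m≤n⇒m≤1+n l′ , r)
    ... | inj₁ all with aliveAt? (suc k) (cmp (suc k) x)
    ...   | no ¬q = inj₂ (suc k , ≤-refl , ¬q , λ ℓ′ l′ → all ℓ′ (≤-pred l′))
    ...   | yes q = inj₁ (λ ℓ l′ → [ (λ l″ → all ℓ (≤-pred l″)) , (λ e → subst (λ t → aliveAt t (cmp t x)) (sym e) q) ]′ (m≤n⇒m<n∨m≡n l′))

    -- A walk through a component without faults and query vertices is recorded by the vertex from which the component is entered.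
    data Reached (χ₀ x : ℕ) : Set where
      at-live : aliveV x → χv x ≡ χ₀ → Reached χ₀ x
      at-dead : ∀ w ℓ y → w < n → ¬ B.isF w → aliveV w → χv w ≡ χ₀ → ℓ ≤ lev x → ¬ aliveAt ℓ (cmp ℓ x) →
                (∀ ℓ′ → ℓ′ < ℓ → aliveAt ℓ′ (cmp ℓ′ x)) → lev w < ℓ → y < n → ℓ ≤ lev y → cmp ℓ y ≡ cmp ℓ x → 0 < adj w y → Reached χ₀ x

    reached : ∀ {s} → s < n → ¬ B.isF s → aliveV s → ∀ {x} → B.FW s x → Reached (χv s) x
    reached s<n nfs as here = at-live as refl
    reached {s} s<n nfs as (_▻_ {x} {y} w (y<n , x<n , a , nfx)) = next (reached s<n nfs as w)
      where
      nfy : ¬ B.isF y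
      nfy = Walk-end {P = λ t → ¬ B.isF t} nfs w
      enter : aliveV y → χv y ≡ χv s → Reached (χv s) x
      enter ay e with first-dead x (lev x) ≤-refl
      ... | inj₁ all = at-live (all (lev x) ≤-refl) (trans (sym (tie y 0 x y<n x<n nfy nfx ay (all (lev x) ≤-refl) refl (s≤s z≤n) a)) e)
      ... | inj₂ (ℓ , l , na , up) = at-dead y ℓ x y<n nfy ay e l na up (above y x ℓ y<n x<n ay l na a) x<n l refl a
      next : Reached (χv s) y → Reached (χv s) x
      next (at-live ay e) = enter ay e
      next (at-dead v ℓ t v<n nfv av e l na up lv t<n lt′ ct at) = further (first-dead x (lev x) ≤-refl)
        where
        c = ℓ * n + cmp ℓ y
        quo≡ : quo c n ≡ ℓ
        quo≡ = quo-unique ℓ (cmp ℓ y) n (cmp<n ℓ y y<n)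
        rem≡ : rem c n ≡ cmp ℓ y
        rem≡ = rem-unique ℓ (cmp ℓ y) n (cmp<n ℓ y y<n)
        further : (∀ ℓ′ → ℓ′ ≤ lev x → aliveAt ℓ′ (cmp ℓ′ x)) ⊎ ∃[ ℓ′ ] (ℓ′ ≤ lev x × ¬ aliveAt ℓ′ (cmp ℓ′ x) × (∀ ℓ″ → ℓ″ < ℓ′ → aliveAt ℓ″ (cmp ℓ″ x))) → Reached (χv s) x
        -- The walk leaves the dead component `c`. Both `v`, from which it was entered, and `x` are
        -- neighbours of it, so the link `suc c` joins them.
        further (inj₁ all) = at-live ax (trans (sym (tie v (suc c) x v<n x<n nfv nfx av ax
            (λ q → na (subst₂ aliveAt quo≡ rem≡ q)) (s≤s (radix (≤-<-trans l (lev<b y y<n)) (cmp<n ℓ y y<n)))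
            (B.nb⁺ c v t (≤-trans lv (≤-reflexive (sym quo≡))) t<n (≤-trans (≤-reflexive quo≡) lt′) (trans (cong (λ q → cmp q t) quo≡) (trans ct (sym rem≡))) at &
             B.nb⁺ c x y (≤-trans (above x y ℓ x<n y<n ax l na a′) (≤-reflexive (sym quo≡))) y<n (≤-trans (≤-reflexive quo≡) l) (trans (cong (λ q → cmp q y) quo≡) (sym rem≡)) a′))) e)
          where
          ax = all (lev x) ≤-refl
          a′ : 0 < adj x y
          a′ = subst (0 <_) (adj-sym y x) a
        further (inj₂ (ℓ′ , l′ , na′ , up′)) with ℓ ≤? lev x
        ... | yes q = at-dead v ℓ t v<n nfv av e q (λ r → na (subst (aliveAt ℓ) (sym same≡) r)) up″ lv t<n lt′ (trans ct same≡) at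
          where
          same≡ : cmp ℓ y ≡ cmp ℓ x
          same≡ = cmp-adj ℓ y x y<n x<n l q a
          up″ : ∀ ℓ″ → ℓ″ < ℓ → aliveAt ℓ″ (cmp ℓ″ x)
          up″ ℓ″ l″ = subst (aliveAt ℓ″) (cmp-mono ℓ″ ℓ y x y<n x<n (<⇒≤ l″) l q same≡) (up ℓ″ l″)
        -- Here `x` is removed before round `ℓ`. A dead component of `x` in a round `ℓ′ < ℓ` would
        -- also contain `y`, whose components before round `ℓ` are alive.
        ... | no ¬q = ⊥-elim (na′ (subst (aliveAt ℓ′) (cmp-adj ℓ′ y x y<n x<n (≤-trans l′ (<⇒≤ (≤-trans (≰⇒> ¬q) l))) l′ a) (up ℓ′ (≤-<-trans l′ (≰⇒> ¬q)))))

    aliveZ : ∀ i → i < kz → aliveV (Match.z mt₂ i)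
    aliveZ i i<kz = i , i<kz , ≤-reflexive (Match.z-lev mt₂ i i<kz) , sym (Match.z-cmp mt₂ i _ i<kz (≤-reflexive (Match.z-lev mt₂ i i<kz)))

    decode : ∀ i j → i < kz → j < kz → Hi.pos H₁ (Match.z mt₁ i) ≡ pos (Match.z mt₂ i) → Hi.pos H₁ (Match.z mt₁ j) ≡ pos (Match.z mt₂ j) →
             ¬ B.isF (Match.z mt₂ i) → ¬ B.isF (Match.z mt₂ j) → B.FW (Match.z mt₂ i) (Match.z mt₂ j) → R (Match.z mt₁ i) ≡ R (Match.z mt₁ j)
    decode i j i<kz j<kz pi pj nfi nfj walk = trans (sym (val i i<kz pi nfi)) (trans (sym (final (reached (Match.z<n mt₂ i i<kz) nfi (aliveZ i i<kz) walk))) (val j j<kz pj nfj))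
      where
      coords : ∀ i → i < kz → LA.pid (Match.z mt₁ i) ≡ LB.pid (Match.z mt₂ i)
      coords i i<kz = cong₂ (λ s t → s * n + t) lv (trans (cong (λ t → Hi.cmp H₁ t (Match.z mt₁ i)) (Match.z-lev mt₁ i i<kz))
          (trans (Match.z-cmp mt₁ i (zlev i) i<kz ≤-refl) (trans (sym (Match.z-cmp mt₂ i (zlev i) i<kz ≤-refl)) (cong (λ t → cmp t (Match.z mt₂ i)) (sym (Match.z-lev mt₂ i i<kz))))))
        where lv = trans (Match.z-lev mt₁ i i<kz) (sym (Match.z-lev mt₂ i i<kz))
      val : ∀ i → i < kz → Hi.pos H₁ (Match.z mt₁ i) ≡ pos (Match.z mt₂ i) → ¬ B.isF (Match.z mt₂ i) → χv (Match.z mt₂ i) ≡ R (Match.z mt₁ i)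
      val i i<kz p nf = χ-val (Match.z mt₁ i) _ _ (Match.z<n mt₁ i i<kz)
        (A.noF _ 0 _ (Match.z mt₁ i) (coords i i<kz) p (B.F-NoFault (Match.z mt₂ i) (Match.z<n mt₂ i i<kz) nf)) (coords i i<kz) p
      final : Reached (χv (Match.z mt₂ i)) (Match.z mt₂ j) → χv (Match.z mt₂ j) ≡ χv (Match.z mt₂ i)
      final (at-live _ e) = e
      final (at-dead w ℓ y _ _ _ _ l na _ _ _ _ _ _) = ⊥-elim (na (alive-down ℓ _ (Match.z mt₂ j) (Match.z<n mt₂ j j<kz) ≤-refl l (aliveZ j j<kz)))

-- Expressions for the decomposition

module HierarchyPrograms where

  open Macros
  open Expressions
  open Arithmetic
  open Hierarchy
  open Labels
  open import Data.List using (List; []; _∷_)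

  v0 : ∀ {Γ k} → Exp (k ∷ Γ) k proj₁
  v0 = var vz
  v1 : ∀ {Γ k a} → Exp (a ∷ k ∷ Γ) k (λ γ → proj₁ (proj₂ γ))
  v1 = var (vs vz)
  v2 : ∀ {Γ k a b} → Exp (a ∷ b ∷ k ∷ Γ) k (λ γ → proj₁ (proj₂ (proj₂ γ)))
  v2 = var (vs (vs vz))
  v3 : ∀ {Γ k a b c} → Exp (a ∷ b ∷ c ∷ k ∷ Γ) k (λ γ → proj₁ (proj₂ (proj₂ (proj₂ γ))))
  v3 = var (vs (vs (vs vz)))
  v4 : ∀ {Γ k a b c d} → Exp (a ∷ b ∷ c ∷ d ∷ k ∷ Γ) k (λ γ → proj₁ (proj₂ (proj₂ (proj₂ (proj₂ γ)))))
  v4 = var (vs (vs (vs (vs vz))))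
  v5 : ∀ {Γ k a b c d e} → Exp (a ∷ b ∷ c ∷ d ∷ e ∷ k ∷ Γ) k (λ γ → proj₁ (proj₂ (proj₂ (proj₂ (proj₂ (proj₂ γ))))))
  v5 = var (vs (vs (vs (vs (vs vz)))))
  v6 : ∀ {Γ k a b c d e f} → Exp (a ∷ b ∷ c ∷ d ∷ e ∷ f ∷ k ∷ Γ) k (λ γ → proj₁ (proj₂ (proj₂ (proj₂ (proj₂ (proj₂ (proj₂ γ)))))))
  v6 = var (vs (vs (vs (vs (vs (vs vz))))))
  v7 : ∀ {Γ k a b c d e f g} → Exp (a ∷ b ∷ c ∷ d ∷ e ∷ f ∷ g ∷ k ∷ Γ) k (λ γ → proj₁ (proj₂ (proj₂ (proj₂ (proj₂ (proj₂ (proj₂ (proj₂ γ))))))))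
  v7 = var (vs (vs (vs (vs (vs (vs (vs vz)))))))
  v8 : ∀ {Γ k a b c d e f g h} → Exp (a ∷ b ∷ c ∷ d ∷ e ∷ f ∷ g ∷ h ∷ k ∷ Γ) k (λ γ → proj₁ (proj₂ (proj₂ (proj₂ (proj₂ (proj₂ (proj₂ (proj₂ (proj₂ γ)))))))))
  v8 = var (vs (vs (vs (vs (vs (vs (vs (vs vz))))))))
  v9 : ∀ {Γ k a b c d e f g h i} → Exp (a ∷ b ∷ c ∷ d ∷ e ∷ f ∷ g ∷ h ∷ i ∷ k ∷ Γ) k (λ γ → proj₁ (proj₂ (proj₂ (proj₂ (proj₂ (proj₂ (proj₂ (proj₂ (proj₂ (proj₂ γ))))))))))
  v9 = var (vs (vs (vs (vs (vs (vs (vs (vs (vs vz)))))))))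
  v10 : ∀ {Γ k a b c d e f g h i j} → Exp (a ∷ b ∷ c ∷ d ∷ e ∷ f ∷ g ∷ h ∷ i ∷ j ∷ k ∷ Γ) k (λ γ → proj₁ (proj₂ (proj₂ (proj₂ (proj₂ (proj₂ (proj₂ (proj₂ (proj₂ (proj₂ (proj₂ γ)))))))))))
  v10 = var (vs (vs (vs (vs (vs (vs (vs (vs (vs (vs vz))))))))))
  v11 : ∀ {Γ k a b c d e f g h i j l} → Exp (a ∷ b ∷ c ∷ d ∷ e ∷ f ∷ g ∷ h ∷ i ∷ j ∷ l ∷ k ∷ Γ) k (λ γ → proj₁ (proj₂ (proj₂ (proj₂ (proj₂ (proj₂ (proj₂ (proj₂ (proj₂ (proj₂ (proj₂ (proj₂ γ))))))))))))
  v11 = var (vs (vs (vs (vs (vs (vs (vs (vs (vs (vs (vs vz)))))))))))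
  v12 : ∀ {Γ k a b c d e f g h i j l m} → Exp (a ∷ b ∷ c ∷ d ∷ e ∷ f ∷ g ∷ h ∷ i ∷ j ∷ l ∷ m ∷ k ∷ Γ) k (λ γ → proj₁ (proj₂ (proj₂ (proj₂ (proj₂ (proj₂ (proj₂ (proj₂ (proj₂ (proj₂ (proj₂ (proj₂ (proj₂ γ)))))))))))))
  v12 = var (vs (vs (vs (vs (vs (vs (vs (vs (vs (vs (vs (vs vz))))))))))))

  module _ {Γ : Ctx} where

    lit : (n : ℕ) → Exp Γ nat (λ _ → n)
    lit zero    = zer
    lit (suc n) = inc (lit n)

    sgE : ∀ {f} → Exp Γ nat f → Exp Γ nat (λ γ → sg (f γ))
    sgE e = cond e zer (inc zer)

    iszE : ∀ {f} → Exp Γ nat f → Exp Γ nat (λ γ → isz (f γ))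
    iszE e = cond e (inc zer) zer

    leE : ∀ {f g} → Exp Γ nat f → Exp Γ nat g → Exp Γ nat (λ γ → le (f γ) (g γ))
    leE e e′ = iszE (sub e e′)

    ltE : ∀ {f g} → Exp Γ nat f → Exp Γ nat g → Exp Γ nat (λ γ → lt (f γ) (g γ))
    ltE e e′ = iszE (sub (inc e) e′)

    eqE : ∀ {f g} → Exp Γ nat f → Exp Γ nat g → Exp Γ nat (λ γ → eq (f γ) (g γ))
    eqE e e′ = iszE (add (sub e e′) (sub e′ e))

  mul₀ : Exp (nat ∷ nat ∷ []) nat (λ (x , y , _) → x * y)
  mul₀ = conv (sum v0 v2) (λ (x , y , _) → Σ-const x y)

  mulE : ∀ {Γ f g} → Exp Γ nat f → Exp Γ nat g → Exp Γ nat (λ γ → f γ * g γ)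
  mulE e e′ = app mul₀ (e ∷ e′ ∷ [])

  quo₀ : Exp (nat ∷ nat ∷ []) nat (λ (x , d , _) → quo x d)
  quo₀ = conv (sum v0 (leE (mulE (inc v0) v2) v1)) (λ (x , d , _) → sym (quo-def x d))

  quoE : ∀ {Γ f g} → Exp Γ nat f → Exp Γ nat g → Exp Γ nat (λ γ → quo (f γ) (g γ))
  quoE e e′ = app quo₀ (e ∷ e′ ∷ [])

  rem₀ : Exp (nat ∷ nat ∷ []) nat (λ (x , d , _) → rem x d)
  rem₀ = conv (cond v1 zer (sub v0 (mulE (quoE v0 v1) v1))) (λ (x , d , _) → sym (rem-def x d))

  remE : ∀ {Γ f g} → Exp Γ nat f → Exp Γ nat g → Exp Γ nat (λ γ → rem (f γ) (g γ))
  remE e e′ = app rem₀ (e ∷ e′ ∷ [])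

  it-single : ∀ t (s : ℕ → ℕ) x → it t (λ l → tab 1 (λ _ → s (l ! 0))) (x ∷ []) ≡ it t s x ∷ []
  it-single zero    s x = refl
  it-single (suc t) s x = it-single t s (s x)

  -- Since `iter` works on lists, a number is iterated as a list of length one.
  iterN : ∀ {Γ n bd} (x : Env Γ → ℕ) (s : ℕ → Env Γ → ℕ) → Exp Γ nat n → Exp (nat ∷ Γ) nat (λ γ → x (proj₂ γ)) →
          Exp (nat ∷ arr ∷ Γ) nat (λ γ → s (proj₁ (proj₂ γ) ! 0) (proj₂ (proj₂ γ))) → Exp Γ nat bd →
          (∀ γ t → it t (λ v → s v γ) (x γ) ≤ bd γ) → Exp Γ nat (λ γ → it (n γ) (λ v → s v γ) (x γ))
  iterN {n = n} {bd} x s en ex es eb h = conv (get (iter en (tabu (lit 1) ex) (tabu (lit 1) es) (inc eb)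
      (λ γ t _ → ≤-trans (≤-reflexive (trans (cong (size arr) (it-single t (λ v → s v γ) (x γ))) (size-cons (it t (λ v → s v γ) (x γ)) [])))
                   (≤-trans (≤-reflexive (+-identityʳ _)) (s≤s (h γ t))))) zer)
      (λ γ → cong (λ l → l ! 0) (it-single (n γ) (λ v → s v γ) (x γ)))

  -- The size bound that `iter` asks for: tables of fixed length with bounded entries do not grow,
  -- however often they are recomputed.
  size-it-tab : ∀ t n c (F : List ℕ → ℕ → ℕ) (l : List ℕ) → size arr l ≤ n * suc c → (∀ x → l ! x ≤ c) → (∀ l → (∀ x → l ! x ≤ c) → ∀ i → i < n → F l i ≤ c) →
                size arr (it t (λ l → tab n (F l)) l) ≤ n * suc c
  size-it-tab t n c F l sz b h = proj₁ (it-inv (λ l → size arr l ≤ n * suc c × (∀ x → l ! x ≤ c))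
    (λ l (_ , p) → size-tab n (F l) c (h l p) , tab-≤ n (F l) c (h l p)) t l (sz , b))

  shr₀ : Exp (nat ∷ nat ∷ []) nat (λ (x , a , _) → shr x a)
  shr₀ = iterN (λ (x , _) → x) (λ v _ → half v) v1 v1 (quoE (get v1 zer) (lit 2)) v0 (λ (x , _) t → shr≤ x t)

  shrE : ∀ {Γ f g} → Exp Γ nat f → Exp Γ nat g → Exp Γ nat (λ γ → shr (f γ) (g γ))
  shrE e e′ = app shr₀ (e ∷ e′ ∷ [])

  blog₀ : Exp (nat ∷ []) nat (λ (x , _) → blog x)
  blog₀ = sum (inc v0) (iszE (sum (inc v0) (iszE (shrE v2 v0))))

  sib₀ : Exp (nat ∷ []) nat (λ (k , _) → sib k)
  sib₀ = cond (remE v0 (lit 2)) (inc v0) (sub v0 (lit 1))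

  powm≤ : ∀ x j p → powm x j p ≤ p
  powm≤ x zero p = rem≤d 1 p
  powm≤ x (suc j) p = ≤-trans (≤-reflexive (it-suc j (λ y → rem (y * x) p) (rem 1 p))) (rem≤d _ p)

  powm₀ : Exp (nat ∷ nat ∷ nat ∷ []) nat (λ (x , j , p , _) → powm x j p)
  powm₀ = iterN (λ (x , j , p , _) → rem 1 p) (λ y (x , j , p , _) → rem (y * x) p) v1 (remE (lit 1) v3) (remE (mulE (get v1 zer) v2) v4) v2 (λ (x , j , p , _) t → powm≤ x t p)

  adj₀ : Exp (nat ∷ nat ∷ nat ∷ arr ∷ []) nat (λ (u , v , n , A , _) → adjm n A u v)
  adj₀ = add (get v3 (add (mulE v0 v2) v1)) (get v3 (add (mulE v1 v2) v0))

  reach₀ : Exp (nat ∷ arr ∷ nat ∷ arr ∷ []) arr (λ (v , U , n , A , _) → reach n A U v)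
  reach₀ = conv (iter v2 (tabu v2 (eqE v0 v1))
      (tabu v3 (sgE (add (get v1 v0) (mulE (get v3 v0) (sum v4 (mulE (get v2 v0) (app adj₀ (v0 ∷ v1 ∷ v5 ∷ v6 ∷ []))))))))
      (mulE v2 (lit 2))
      (λ (v , U , n , A , _) t _ → size-it-tab t n 1 (reachStep n A U) _ (size-tab n _ 1 (λ i _ → isz≤1 _)) (tab-≤ n _ 1 (λ i _ → isz≤1 _)) (λ l _ i _ → sg≤1 _)))
    (λ (v , U , n , A , _) → sym (reach-def n A U v))

  count₀ : Exp (arr ∷ nat ∷ []) nat (λ (R , n , _) → count n R)
  count₀ = sum v1 (get v1 v0)

  cmpr₀ : Exp (nat ∷ arr ∷ nat ∷ arr ∷ []) nat (λ (x , U , n , A , _) → cmpr n A U x)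
  cmpr₀ = conv (sum v2 (iszE (sum (inc v0) (get (app reach₀ (v2 ∷ v3 ∷ v4 ∷ v5 ∷ [])) v0)))) (λ (x , U , n , A , _) → sym (cmpr-def n A U x))

  sepW₀ : Exp (arr ∷ arr ∷ nat ∷ []) arr (λ (C , st , n , _) → tab n (λ x → C ! x * isz (st ! x)))
  sepW₀ = tabu v2 (mulE (get v1 v0) (iszE (get v2 v0)))

  sepD₀ : Exp (arr ∷ nat ∷ arr ∷ nat ∷ arr ∷ []) arr (λ (C , tot , st , n , A , _) → sepD n A C tot st)
  sepD₀ = tabu v3 (mulE (mulE (get v1 v0) (iszE (get v3 v0)))
    (ltE v2 (mulE (lit 2) (app count₀ (app reach₀ (v0 ∷ app sepW₀ (v1 ∷ v3 ∷ v4 ∷ []) ∷ v4 ∷ v5 ∷ []) ∷ v4 ∷ [])))))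

  plen₀ : Exp (arr ∷ nat ∷ []) nat (λ (st , n , _) → Σ< n (λ x → sg (st ! x)))
  plen₀ = sum v1 (sgE (get v1 v0))

  cand₀ : Exp (nat ∷ arr ∷ arr ∷ nat ∷ arr ∷ []) nat (λ (d , D , st , n , A , _) → cand n A D st d)
  cand₀ = mulE (get v1 v0) (cond (app plen₀ (v2 ∷ v3 ∷ [])) (lit 1)
    (sum v3 (mulE (eqE (get v3 v0) (app plen₀ (v3 ∷ v4 ∷ []))) (app adj₀ (v0 ∷ v1 ∷ v4 ∷ v5 ∷ [])))))

  sepNew₀ : Exp (nat ∷ arr ∷ arr ∷ nat ∷ arr ∷ []) nat (λ (x , D , st , n , A , _) → sepNew n A D st x)
  sepNew₀ = cond (sum v3 (get v2 v0)) (get v2 v0)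
    (cond (sum v3 (app cand₀ (v0 ∷ v2 ∷ v3 ∷ v4 ∷ v5 ∷ [])))
      (cond (eqE (get v2 v0) (app plen₀ (v2 ∷ v3 ∷ []))) (get v2 v0) zer)
      (cond (eqE v0 (sum v3 (iszE (sum (inc v0) (app cand₀ (v0 ∷ v3 ∷ v4 ∷ v5 ∷ v6 ∷ []))))))
        (get v2 v0) (inc (app plen₀ (v2 ∷ v3 ∷ [])))))

  sepNew≤ : ∀ n A D st x → (∀ x → st ! x ≤ suc n) → sepNew n A D st x ≤ suc n
  sepNew≤ n A D st x h with Σ< n (λ d → D ! d)
  ... | zero = h x
  ... | suc _ with Σ< n (cand n A D st)
  ...   | zero with eq (st ! x) (plen n A st)
  ...     | zero = h x
  ...     | suc _ = z≤n
  sepNew≤ n A D st x h | suc _ | suc _ with eq x (least n (cand n A D st))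
  ...     | zero = h x
  ...     | suc _ = s≤s (≤-trans (Σ-mono n (λ i _ → sg≤1 _)) (≤-reflexive (trans (Σ-const n 1) (*-identityʳ n))))

  sepPath₀ : Exp (nat ∷ arr ∷ nat ∷ arr ∷ []) arr (λ (r , U , n , A , _) → sepPath n A U r)
  sepPath₀ = conv (iter (mulE (lit 2) v2) (tabu v2 zer)
      (tabu v3 (app sepNew₀ (v0 ∷ app sepD₀ (C₀ ∷ app count₀ (C₀ ∷ v4 ∷ []) ∷ v1 ∷ v4 ∷ v5 ∷ []) ∷ v1 ∷ v4 ∷ v5 ∷ [])))
      (mulE v2 (inc (inc v2)))
      (λ (r , U , n , A , _) t _ → size-it-tab t n (suc n) (λ l → sepNew n A (sepD n A (reach n A U r) (count n (reach n A U r)) l) l) _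
        (size-tab n _ (suc n) (λ i _ → z≤n)) (tab-≤ n _ (suc n) (λ i _ → z≤n)) (λ l p i _ → sepNew≤ n A (sepD n A (reach n A U r) (count n (reach n A U r)) l) l i p)))
    (λ (r , U , n , A , _) → sym (sepPath-def n A U r))
    where
    C₀ : Exp (nat ∷ arr ∷ nat ∷ arr ∷ nat ∷ arr ∷ []) arr (λ (i , l , r , U , n , A , _) → reach n A U r)
    C₀ = app reach₀ (v2 ∷ v3 ∷ v4 ∷ v5 ∷ [])

  Unext₀ : Exp (arr ∷ nat ∷ arr ∷ []) arr (λ (U , n , A , _) → Unext n A U)
  Unext₀ = tabu v1 (mulE (get v1 v0) (iszE (get (app sepPath₀ (app cmpr₀ (v0 ∷ v1 ∷ v2 ∷ v3 ∷ []) ∷ v1 ∷ v2 ∷ v3 ∷ [])) v0)))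

  Us₀ : Exp (nat ∷ nat ∷ arr ∷ []) arr (λ (ℓ , n , A , _) → Us n A ℓ)
  Us₀ = conv (iter v0 (tabu v1 (lit 1)) (app Unext₀ (v0 ∷ v2 ∷ v3 ∷ [])) (mulE v1 (lit 2))
      (λ (ℓ , n , A , _) t _ → size-it-tab t n 1 (λ U x → U ! x * isz (sepPath n A U (cmpr n A U x) ! x)) _ (size-tab n _ 1 (λ i _ → ≤-refl)) (tab-≤ n _ 1 (λ i _ → ≤-refl))
        (λ U p i _ → *-mono-≤ {U ! i} {1} {_} {1} (p i) (isz≤1 _))))
    (λ (ℓ , n , A , _) → sym (Us-def n A ℓ))

  lev₀ : Exp (nat ∷ nat ∷ nat ∷ arr ∷ []) nat (λ (x , n , b , A , _) → levm n A b x)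
  lev₀ = sum v2 (sgE (get (app Us₀ (inc v0 ∷ v2 ∷ v4 ∷ [])) v1))

  cmp₀ : Exp (nat ∷ nat ∷ nat ∷ arr ∷ []) nat (λ (ℓ , x , n , A , _) → cmpm n A ℓ x)
  cmp₀ = app cmpr₀ (v1 ∷ app Us₀ (v0 ∷ v2 ∷ v3 ∷ []) ∷ v2 ∷ v3 ∷ [])

  pos₀ : Exp (nat ∷ nat ∷ nat ∷ arr ∷ []) nat (λ (x , n , b , A , _) → posm n A b x)
  pos₀ = sub (get (app sepPath₀ (app cmp₀ (ℓ₀ ∷ v0 ∷ v1 ∷ v3 ∷ []) ∷ app Us₀ (ℓ₀ ∷ v1 ∷ v3 ∷ []) ∷ v1 ∷ v3 ∷ [])) v0) (lit 1)
    where ℓ₀ : Exp (nat ∷ nat ∷ nat ∷ arr ∷ []) nat (λ (x , n , b , A , _) → levm n A b x)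
          ℓ₀ = app lev₀ (v0 ∷ v1 ∷ v2 ∷ v3 ∷ [])

-- Expressions for chords, nets, power sums and representatives

module LabelPrograms where

  open Macros
  open Expressions
  open Arithmetic
  open Hierarchy
  open Labels
  open TwoGraphs using (moments)
  open HierarchyPrograms
  open import Data.List using (List; []; _∷_)

  hier : ℕ → ℕ → List ℕ → Hi
  hier n b A = record { adj = adjm n A ; lev = levm n A b ; pos = posm n A b ; cmp = cmpm n A }

  module LabA (n b M p : ℕ) (A : List ℕ) = Lab n b (hier n b A) M (2 * suc b) p

  Θ : Ctx
  Θ = nat ∷ nat ∷ nat ∷ nat ∷ arr ∷ []

  pid₀ : Exp (nat ∷ Θ) nat (λ (v , n , b , M , p , A , _) → LabA.pid n b M p A v)
  pid₀ = add (mulE ℓ₀ v1) (app cmp₀ (ℓ₀ ∷ v0 ∷ v1 ∷ v5 ∷ []))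
    where ℓ₀ : Exp (nat ∷ Θ) nat (λ (v , n , b , M , p , A , _) → levm n A b v)
          ℓ₀ = app lev₀ (v0 ∷ v1 ∷ v2 ∷ v5 ∷ [])

  tokI₀ : Exp (nat ∷ nat ∷ nat ∷ nat ∷ nat ∷ []) nat (λ (c , a , k , n , b , _) → Tok.tokI n b 0 c a k)
  tokI₀ = mulE (add (mulE (add (mulE v0 (inc v4)) v1) (inc v3)) v2) (lit 2)

  col₀ : Exp (nat ∷ nat ∷ nat ∷ []) nat (λ (γ , τ , M , _) → Tok.col 0 0 M γ τ)
  col₀ = remE v1 (inc (quoE (quoE (quoE v0 v2) v2) v2))

  c1₀ c2₀ c3₀ : Exp (nat ∷ nat ∷ []) nat _
  c1₀ = remE (quoE (quoE v0 v1) v1) v1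
  c2₀ = remE (quoE v0 v1) v1
  c3₀ = remE v0 v1

  inK₀ : Exp (nat ∷ nat ∷ nat ∷ nat ∷ arr ∷ []) nat (λ (c , x , n , b , A , _) → LabA.inK n b 0 0 A c x)
  inK₀ = mulE (leE (quoE v0 v2) (app lev₀ (v1 ∷ v2 ∷ v3 ∷ v4 ∷ []))) (eqE (app cmp₀ (quoE v0 v2 ∷ v1 ∷ v2 ∷ v4 ∷ [])) (remE v0 v2))

  nb₀ : Exp (nat ∷ nat ∷ nat ∷ nat ∷ arr ∷ []) nat (λ (c , w , n , b , A , _) → LabA.nb n b 0 0 A c w)
  nb₀ = mulE (ltE (app lev₀ (v1 ∷ v2 ∷ v3 ∷ v4 ∷ [])) (quoE v0 v2))
    (sum v2 (mulE (app inK₀ (v1 ∷ v0 ∷ v3 ∷ v4 ∷ v5 ∷ [])) (app adj₀ (v2 ∷ v0 ∷ v3 ∷ v5 ∷ []))))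

  link₀ : Exp (nat ∷ nat ∷ nat ∷ nat ∷ nat ∷ arr ∷ []) nat (λ (w , κ , u , n , b , A , _) → LabA.link n b 0 0 A w κ u)
  link₀ = cond v1 (app adj₀ (v0 ∷ v2 ∷ v3 ∷ v5 ∷ []))
    (mulE (app nb₀ (sub v1 (lit 1) ∷ v0 ∷ v3 ∷ v4 ∷ v5 ∷ [])) (app nb₀ (sub v1 (lit 1) ∷ v2 ∷ v3 ∷ v4 ∷ v5 ∷ [])))

  mem₀ : Exp (nat ∷ nat ∷ nat ∷ nat ∷ nat ∷ Θ) nat (λ (γ , c , a , k , u , n , b , M , p , A , _) → LabA.mem n b M p A γ c a k u)
  mem₀ = conv
    (mulE (eqE (app col₀ (v0 ∷ app tokI₀ (v1 ∷ v2 ∷ v3 ∷ v5 ∷ v6 ∷ []) ∷ v7 ∷ [])) (app c1₀ (v0 ∷ v7 ∷ [])))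
    (mulE (eqE (app col₀ (v0 ∷ app tokI₀ (app pid₀ (v4 ∷ v5 ∷ v6 ∷ v7 ∷ v8 ∷ v9 ∷ []) ∷ zer ∷ app pos₀ (v4 ∷ v5 ∷ v6 ∷ v9 ∷ []) ∷ v5 ∷ v6 ∷ []) ∷ v7 ∷ [])) (app c3₀ (v0 ∷ v7 ∷ [])))
      (sum v5 (mulE (eqE (app pid₀ (v0 ∷ v6 ∷ v7 ∷ v8 ∷ v9 ∷ v10 ∷ [])) v2)
        (mulE (eqE (shrE (app pos₀ (v0 ∷ v6 ∷ v7 ∷ v10 ∷ [])) v3) v4)
        (mulE (leE (app lev₀ (v5 ∷ v6 ∷ v7 ∷ v10 ∷ [])) (app lev₀ (v0 ∷ v6 ∷ v7 ∷ v10 ∷ [])))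
          (sum (inc (mulE v7 v6)) (mulE (eqE (app col₀ (v2 ∷ add (mulE v0 (lit 2)) (lit 1) ∷ v9 ∷ [])) (app c2₀ (v2 ∷ v9 ∷ [])))
            (app link₀ (v1 ∷ v0 ∷ v6 ∷ v7 ∷ v8 ∷ v11 ∷ []))))))))))
    (λ (γ , c , a , k , u , n , b , M , p , A , _) → sym (LabA.mem-def n b M p A γ c a k u))

  memp₀ : Exp (nat ∷ nat ∷ nat ∷ nat ∷ nat ∷ nat ∷ Θ) nat (λ (γ , c , a , k , c′ , x , n , b , M , p , A , _) → LabA.memp n b M p A γ c a k c′ x)
  memp₀ = conv
    (sum v6 (mulE (eqE (app pid₀ (v0 ∷ v7 ∷ v8 ∷ v9 ∷ v10 ∷ v11 ∷ [])) v5) (mulE (eqE (app pos₀ (v0 ∷ v7 ∷ v8 ∷ v11 ∷ [])) v6)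
      (app mem₀ (v1 ∷ v2 ∷ v3 ∷ v4 ∷ v0 ∷ v7 ∷ v8 ∷ v9 ∷ v10 ∷ v11 ∷ [])))))
    (λ (γ , c , a , k , c′ , x , n , b , M , p , A , _) → sym (LabA.memp-def n b M p A γ c a k c′ x))

  chord₀ : Exp (nat ∷ nat ∷ nat ∷ nat ∷ Θ) nat (λ (γ , c′ , x , y , n , b , M , p , A , _) → LabA.chord n b M p A γ c′ x y)
  chord₀ = conv
    (mulE (ltE v2 v3) (sum (mulE v5 v4) (sum (inc v6) (sum (inc v6)
      (mulE (app memp₀ (v3 ∷ v2 ∷ v1 ∷ v0 ∷ v4 ∷ v5 ∷ v7 ∷ v8 ∷ v9 ∷ v10 ∷ v11 ∷ []))
      (mulE (app memp₀ (v3 ∷ v2 ∷ v1 ∷ v0 ∷ v4 ∷ v6 ∷ v7 ∷ v8 ∷ v9 ∷ v10 ∷ v11 ∷ []))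
        (iszE (sum v6 (mulE (ltE v6 v0) (app memp₀ (v4 ∷ v3 ∷ v2 ∷ v1 ∷ v5 ∷ v0 ∷ v8 ∷ v9 ∷ v10 ∷ v11 ∷ v12 ∷ [])))))))))))
    (λ (γ , c′ , x , y , n , b , M , p , A , _) → sym (LabA.chord-def n b M p A γ c′ x y))

  E₀₀ : Exp (nat ∷ nat ∷ Θ) arr (λ (γ , c′ , n , b , M , p , A , _) → LabA.E₀ n b M p A γ c′)
  E₀₀ = tabu (mulE v2 v2) (sgE (app chord₀ (v1 ∷ v2 ∷ remE v0 v3 ∷ quoE v0 v3 ∷ v3 ∷ v4 ∷ v5 ∷ v6 ∷ v7 ∷ [])))

  key₀ : Exp (nat ∷ nat ∷ nat ∷ []) nat (λ (a , e , n , _) → Tok.key n 0 0 a e)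
  key₀ = shrE (remE v1 v2) v0

  pick₀ : Exp (nat ∷ arr ∷ nat ∷ nat ∷ nat ∷ []) nat (λ (a , E , e , n , g , _) → pick g (Tok.key n 0 0 a) a E e)
  pick₀ = mulE (get v1 v2) (eqE (remE (inc (sum v2 (mulE (get v2 v0) (eqE (app key₀ (v1 ∷ v0 ∷ v4 ∷ [])) (app key₀ (v1 ∷ v3 ∷ v4 ∷ [])))))) v4) zer)

  Enext₀ : Exp (arr ∷ Θ) arr (λ (E , n , b , M , p , A , _) → LabA.Enext n b M p A E)
  Enext₀ = tabu (mulE v1 v1) (sgE (sum (inc v3) (app pick₀ (v0 ∷ v2 ∷ v1 ∷ v3 ∷ mulE (lit 2) (inc v4) ∷ []))))

  Elev₀ : Exp (nat ∷ nat ∷ nat ∷ Θ) arr (λ (γ , c′ , i , n , b , M , p , A , _) → LabA.Elev n b M p A γ c′ i)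
  Elev₀ = conv (iter v2 (app E₀₀ (v0 ∷ v1 ∷ v3 ∷ v4 ∷ v5 ∷ v6 ∷ v7 ∷ [])) (app Enext₀ (v0 ∷ v4 ∷ v5 ∷ v6 ∷ v7 ∷ v8 ∷ [])) (mulE (mulE v3 v3) (lit 2))
      (λ (γ , c′ , i , n , b , M , p , A , _) t _ → size-it-tab t (n * n) 1 (λ E e → sg (Σ< (suc b) (λ a → pick (2 * suc b) (Tok.key n 0 0 a) a E e))) (LabA.E₀ n b M p A γ c′)
        (size-tab (n * n) (λ e → sg (LabA.chord n b M p A γ c′ (rem e n) (quo e n))) 1 (λ i _ → sg≤1 _)) (tab-≤ (n * n) _ 1 (λ i _ → sg≤1 _)) (λ l _ i _ → sg≤1 _)))
    (λ (γ , c′ , i , n , b , M , p , A , _) → sym (LabA.Elev-def n b M p A γ c′ i))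

  Wsum₀ : Exp (nat ∷ nat ∷ nat ∷ nat ∷ nat ∷ Θ) nat (λ (γ , c′ , P , i , j , n , b , M , p , A , _) → LabA.Wsum n b M p A γ c′ P i j)
  Wsum₀ = remE (sum (mulE v5 v5) (mulE (get (app Elev₀ (v1 ∷ v2 ∷ v4 ∷ v6 ∷ v7 ∷ v8 ∷ v9 ∷ v10 ∷ [])) v0)
      (mulE (mulE (leE (remE v0 v6) v3) (ltE v3 (quoE v0 v6))) (app powm₀ (v0 ∷ v5 ∷ v9 ∷ []))))) v8

  rep₀ : Exp (nat ∷ nat ∷ nat ∷ nat ∷ nat ∷ Θ) nat (λ (γ , c , a , k , ℓ , n , b , M , p , A , _) → LabA.rep n b M p A γ c a k ℓ)
  rep₀ = conv (sum v5 (iszE (sum (inc v0) (sum v7 (mulE (eqE (app lev₀ (v0 ∷ v8 ∷ v9 ∷ v12 ∷ [])) v7)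
      (mulE (eqE (app pos₀ (v0 ∷ v8 ∷ v9 ∷ v12 ∷ [])) v1) (app mem₀ (v3 ∷ v4 ∷ v5 ∷ v6 ∷ v0 ∷ v8 ∷ v9 ∷ v10 ∷ v11 ∷ v12 ∷ []))))))))
    (λ (γ , c , a , k , ℓ , n , b , M , p , A , _) → sym (LabA.rep-def n b M p A γ c a k ℓ))

  slotRep₀ : Exp (nat ∷ nat ∷ nat ∷ nat ∷ Θ) nat (λ (v , sl , γ , ℓ , n , b , M , p , A , _) → LabA.slotRep n b M p A v sl γ ℓ)
  slotRep₀ = cond (ltE v1 v5)
    (app rep₀ (v2 ∷ app pid₀ (v0 ∷ v4 ∷ v5 ∷ v6 ∷ v7 ∷ v8 ∷ []) ∷ sub v1 v5 ∷ app sib₀ (shrE (app pos₀ (v0 ∷ v4 ∷ v5 ∷ v8 ∷ [])) (sub v1 v5) ∷ []) ∷ v3 ∷ v4 ∷ v5 ∷ v6 ∷ v7 ∷ v8 ∷ []))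
    (app rep₀ (v2 ∷ add (mulE v1 v4) (app cmp₀ (v1 ∷ v0 ∷ v4 ∷ v8 ∷ [])) ∷ v5 ∷ zer ∷ v3 ∷ v4 ∷ v5 ∷ v6 ∷ v7 ∷ v8 ∷ []))

-- The parameters: prime, modulus, number and width of the entries

module Sizes where

  open Macros
  open Expressions
  open Arithmetic
  open NumberTheory
  open Hierarchy
  open Labels
  open TwoGraphs using (moments)
  open LabelPrograms
  open import Data.Empty using (⊥-elim)
  open import Data.Nat.Divisibility
  open import Data.Nat.Primality using (Prime; prime)
  open import Data.Sum using (inj₁; inj₂)

  isPr : ℕ → ℕ
  isPr q = le 2 q * isz (Σ< q (λ d → le 2 d * eq (rem q d) 0))

  isPr-sound : ∀ q → 0 < isPr q → Prime q
  isPr-sound q h = let l , z = unand (le 2 q) h in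
    prime {{n>1⇒nonTrivial (le⁻ {2} l)}} (λ { (hasNonTrivialDivisor {d} d<q d∣q) →
      0<⇒≢0 (le⁺ (nonTrivial⇒n>1 d) & eq⁺ {rem q d} (div d d∣q (<⇒≤ (nonTrivial⇒n>1 d)))) (Σ≡0⁻ q (isz⁻ {Σ< q (λ d → le 2 d * eq (rem q d) 0)} z) d d<q) })
    where
    div : ∀ d → d ∣ q → 0 < d → rem q d ≡ 0
    div d (divides c refl) l = trans (cong (λ t → rem t d) (sym (+-identityʳ (c * d)))) (rem-unique c 0 d l)

  isPr-complete : ∀ q → Prime q → 0 < isPr q
  isPr-complete q (prime nc) = le⁺ (nonTrivial⇒n>1 q) & isz⁺ (Σ≡0 q zeros)
    where
    zeros : ∀ d → d < q → le 2 d * eq (rem q d) 0 ≡ 0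
    zeros d d<q with 0<-dec (le 2 d * eq (rem q d) 0)
    ... | inj₁ e = e
    ... | inj₂ h = let l , z = unand (le 2 d) h in
      ⊥-elim (nc (hasNonTrivialDivisor {{n>1⇒nonTrivial (le⁻ {2} l)}} d<q
        (divides (quo q d) (trans (quo-rem q d (<⇒≤ (le⁻ {2} l))) (trans (cong (quo q d * d +_) (eq⁻ {rem q d} z)) (+-identityʳ _))))))

  opaque
    -- The least prime above `N`; `prime-above` guarantees it in the range of the search.
    pr : ℕ → ℕ
    pr N = least (suc ((4 + N) * (4 + N))) (λ q → lt N q * isPr q)

    pr-def : ∀ N → pr N ≡ least (suc ((4 + N) * (4 + N))) (λ q → lt N q * isPr q)
    pr-def N = refl

  pr-spec : ∀ N → pr N ≤ (4 + N) * (4 + N) × N < pr N × Prime (pr N)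
  pr-spec N = let p , p< , N<p , pp = prime-above N
                  w = least-prop _ (λ q → lt N q * isPr q) p p< (le⁺ {suc N} (<⇒≤ N<p) & isPr-complete p pp)
                  a , c = unand (lt N (least (suc ((4 + N) * (4 + N))) (λ q → lt N q * isPr q))) (proj₁ w)
              in subst (λ q → q ≤ (4 + N) * (4 + N) × N < q × Prime q) (sym (pr-def N))
                   (≤-trans (proj₂ w) (≤-pred p<) , le⁻ {suc N} a , isPr-sound _ c)

  -- `toks` bounds the tokens. `mexp` is three times the largest number of blocked ones: `b + 1`
  -- intervals for each of `f` faults, and `b` components for each of `f + 2` vertices.
  toks mexp : ℕ → ℕ → ℕ
  toks n b = suc (b * n) * suc b * suc n * 2
  mexp f b = 3 * (f * suc b + (f + 2) * b)

  -- One more than the `M′` of `non-divisor`, which has to satisfy `toks ^ mexp < 2 ^ M′`.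
  modulus : ℕ → ℕ → ℕ → ℕ
  modulus n f b = suc (suc (blog (toks n b) * mexp f b))

  modulus-large : ∀ n f b e → e ≤ mexp f b → toks n b ^ e < 2 ^ suc (blog (toks n b) * mexp f b)
  modulus-large n f b e l = begin-strict
    toks n b ^ e                           ≤⟨ ^-monoˡ-≤ e (<⇒≤ (<2^blog (toks n b))) ⟩
    (2 ^ blog (toks n b)) ^ e              ≡⟨ ^-*-assoc 2 (blog (toks n b)) e ⟩
    2 ^ (blog (toks n b) * e)              ≤⟨ ^-monoʳ-≤ 2 (*-monoʳ-≤ (blog (toks n b)) l) ⟩
    2 ^ (blog (toks n b) * mexp f b)       <⟨ ^-monoʳ-< 2 (s≤s (s≤s z≤n)) (n<1+n (blog (toks n b) * mexp f b)) ⟩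
    2 ^ suc (blog (toks n b) * mexp f b)   ∎
    where open ≤-Reasoning

  -- A group is a modulus with three residues. A representative belongs to one of `2 * b` hubs, a
  -- round and a group; a power sum to a group, a level and an exponent. The remaining `4 + b`
  -- entries are `n`, `f`, round, position and components.
  groups slots count# : ℕ → ℕ → ℕ → ℕ
  groups n f b = modulus n f b * modulus n f b * modulus n f b * modulus n f b
  slots n f b = (b + b) * b * groups n f b
  count# n f b = 4 + b + (slots n f b + groups n f b * (2 * b) * moments f b)

  -- The largest entries are power sums modulo `pr (n * n)`, which is at most `(4 + n * n)²`.
  width : ℕ → ℕ
  width n = blog ((4 + n * n) * (4 + n * n))

  labelLength : ℕ → ℕ → ℕ
  labelLength n f = suc (width n) + width n * count# n f (blog n)

-- Labels as bit strings, and what equal bit strings imply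

module LabelLayout where

  open Sizes
  open Macros
  open Expressions
  open Arithmetic
  open NumberTheory
  open Hierarchy
  open Labels
  open TwoGraphs using (moments)
  open LabelPrograms
  open import Data.Empty using (⊥-elim)
  open import Data.List using (List; length)
  open import Data.Nat.Divisibility
  open import Relation.Binary.Definitions using (tri<; tri≈; tri>)

  ifz≤ : ∀ c {x y B} → x ≤ B → y ≤ B → ifz c x y ≤ B
  ifz≤ zero    p q = p
  ifz≤ (suc _) p q = q

  -- the numbers stored in a label, followed by their binary expansions with w digits, after the header 1ʷ0
  module Layout (n f lev pos b s : ℕ) (cmp slot sum : ℕ → ℕ) where

    num : ℕ → ℕ
    num q = ifz q n (ifz (q ∸ 1) f (ifz (q ∸ 2) lev (ifz (q ∸ 3) pos (ifz (lt (q ∸ 4) b)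
      (ifz (lt (q ∸ (4 + b)) s) (sum (q ∸ (4 + b) ∸ s)) (slot (q ∸ (4 + b))))
      (cmp (q ∸ 4))))))

    num-cmp : ∀ ℓ → ℓ < b → num (4 + ℓ) ≡ cmp ℓ
    num-cmp ℓ l rewrite le-val {suc ℓ} {b} l = refl

    num-tail : ∀ r → num (4 + b + r) ≡ ifz (lt r s) (sum (r ∸ s)) (slot r)
    num-tail r rewrite le-val0 {suc (b + r)} {b} (s≤s (m≤m+n b r)) | m+n∸m≡n b r = refl

    num-slot : ∀ r → r < s → num (4 + b + r) ≡ slot r
    num-slot r l = trans (num-tail r) (cong (λ t → ifz t (sum (r ∸ s)) (slot r)) (le-val {suc r} l))

    num-sum : ∀ r → num (4 + b + (s + r)) ≡ sum r
    num-sum r = trans (num-tail (s + r)) (trans (cong (λ t → ifz t (sum (s + r ∸ s)) (slot (s + r))) (le-val0 {suc (s + r)} (s≤s (m≤m+n s r))))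
      (cong sum (m+n∸m≡n s r)))

    num-≤ : ∀ {B} → n ≤ B → f ≤ B → lev ≤ B → pos ≤ B → (∀ ℓ → cmp ℓ ≤ B) → (∀ r → slot r ≤ B) → (∀ r → sum r ≤ B) → ∀ q → num q ≤ B
    num-≤ a c d e g h k q = ifz≤ q a (ifz≤ (q ∸ 1) c (ifz≤ (q ∸ 2) d (ifz≤ (q ∸ 3) e (ifz≤ (lt (q ∸ 4) b) (ifz≤ (lt (q ∸ (4 + b)) s) (k _) (h _)) (g _)))))

  module Bits (w : ℕ) (num : ℕ → ℕ) where

    bit# : ℕ → ℕ
    bit# r = ifz (lt r w) (ifz (eq r w) (rem (shr (num (quo (r ∸ suc w) w)) (rem (r ∸ suc w) w)) 2) 0) 1

    bit-ones : ∀ r → r < w → bit# r ≡ 1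
    bit-ones r l = cong (λ t → ifz t (ifz (eq r w) (rem (shr (num (quo (r ∸ suc w) w)) (rem (r ∸ suc w) w)) 2) 0) 1) (le-val {suc r} l)

    bit-end : bit# w ≡ 0
    bit-end = trans (cong (λ t → ifz t (ifz (eq w w) (rem (shr (num (quo (w ∸ suc w) w)) (rem (w ∸ suc w) w)) 2) 0) 1) (le-val0 {suc w} ≤-refl))
                    (cong (λ t → ifz t (rem (shr (num (quo (w ∸ suc w) w)) (rem (w ∸ suc w) w)) 2) 0) (eq-val {w} refl))

    bit-num : ∀ q i → i < w → bit# (suc w + (q * w + i)) ≡ rem (shr (num q) i) 2
    bit-num q i l = trans (cong (λ t → ifz t (ifz (eq r w) (rem (shr (num (quo (r ∸ suc w) w)) (rem (r ∸ suc w) w)) 2) 0) 1) (le-val0 {suc r} (s≤s (<⇒≤ w<r))))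
      (trans (cong (λ t → ifz t (rem (shr (num (quo (r ∸ suc w) w)) (rem (r ∸ suc w) w)) 2) 0) (eq-val0 {r} {w} (λ e → <-irrefl (sym e) w<r)))
        (cong₂ (λ s t → rem (shr (num s) t) 2) (trans (cong (λ t → quo t w) m) (quo-unique q i w l)) (trans (cong (λ t → rem t w) m) (rem-unique q i w l))))
      where
      r = suc w + (q * w + i)
      w<r : w < r
      w<r = m≤m+n (suc w) (q * w + i)
      m : r ∸ suc w ≡ q * w + i
      m = m+n∸m≡n (suc w) (q * w + i)

    bit≤1 : ∀ r → bit# r ≤ 1
    bit≤1 r = ifz≤ (lt r w) (ifz≤ (eq r w) (≤-pred (rem-< (shr (num (quo (r ∸ suc w) w)) (rem (r ∸ suc w) w)) 2 (s≤s z≤n))) z≤n) ≤-refl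

    -- the symbols of a word of the given length and its separator, coded by numbers: 1 for the separator and 2 + x for the bit x
    code# : ℕ → ℕ → ℕ
    code# k r = ifz (lt r k) 1 (2 + bit# r)

    code-bit : ∀ k r → r < k → code# k r ≡ 2 + bit# r
    code-bit k r l = cong (λ t → ifz t 1 (2 + bit# r)) (le-val {suc r} l)

    code-end : ∀ k → code# k k ≡ 1
    code-end k = cong (λ t → ifz t 1 (2 + bit# k)) (le-val0 {suc k} ≤-refl)

  module Label (n f : ℕ) (A : List ℕ) where

    b M p w : ℕ
    b = blog n
    M = modulus n f b
    p = pr (n * n)
    w = width n

    open LabA n b M p A public

    slotNum sumNum : ℕ → ℕ → ℕ
    slotNum v r = slotRep v (quo (quo r (groups n f b)) b) (rem r (groups n f b)) (rem (quo r (groups n f b)) b)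
    sumNum v r = Wsum (quo (quo r (moments f b)) (2 * b)) (pid v) (posm n A b v) (rem (quo r (moments f b)) (2 * b)) (rem r (moments f b))

    module LayoutOf (v : ℕ) = Layout n f (levm n A b v) (posm n A b v) b (slots n f b) (λ ℓ → cmpm n A ℓ v) (slotNum v) (sumNum v)
    open LayoutOf public
    module BitsOf (v : ℕ) = Bits w (num v)
    open BitsOf public

    labelCode : ℕ → ℕ → ℕ
    labelCode v r = code# v (labelLength n f) r

    module _ (f≤n : f ≤ n) (v : ℕ) (v<n : v < n) where

      private
        n<2^b : n < 2 ^ b
        n<2^b = <2^blog n
        module R = Rounds n A b n<2^b
        B = (4 + n * n) * (4 + n * n)
        n≤B : n ≤ B
        n≤B = ≤-trans (square n) (≤-trans (m≤n+m (n * n) 4) (m≤m*n (4 + n * n) (4 + n * n)))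
          where square : ∀ n → n ≤ n * n
                square zero = z≤n
                square (suc n) = m≤m*n (suc n) (suc n)
        b≤n : b ≤ n
        b≤n = proj₂ (least-prop (suc n) (λ i → isz (shr n i)) n ≤-refl (isz⁺ (shr≡0 n n ≤-refl)))
        rep≤ : ∀ γ c a k ℓ → rep γ c a k ℓ ≤ B
        rep≤ γ c a k ℓ = ≤-trans (≤-reflexive (rep-def γ c a k ℓ)) (≤-trans (least≤ n _) n≤B)

      num≤ : ∀ q → num v q ≤ B
      num≤ = num-≤ v n≤B (≤-trans f≤n n≤B) (≤-trans (<⇒≤ (proj₁ (R.lev-char v v<n))) (≤-trans b≤n n≤B)) (≤-trans (<⇒≤ (R.pos< v v<n)) n≤B)
        (λ ℓ → ≤-trans (<⇒≤ (R.cmpm-wit ℓ v v<n)) n≤B)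
        (λ r → ifz≤ (lt (quo (quo r (groups n f b)) b) b) (rep≤ _ _ _ _ _) (rep≤ _ _ _ _ _))
        (λ r → ≤-trans (rem≤d _ p) (proj₁ (pr-spec (n * n))))

      num-bits : ∀ q → shr (num v q) w ≡ 0
      num-bits q = <2^⇒shr≡0 w (num v q) (≤-<-trans (num≤ q) (<2^blog B))

  radix< : ∀ {q r d Q} → q < Q → r < d → q * d + r < Q * d
  radix< {q} {r} {d} q<Q r<d = ≤-trans (+-monoʳ-< (q * d) r<d) (≤-trans (≤-reflexive (+-comm (q * d) d)) (*-monoˡ-≤ d q<Q))

  w<labelLength : ∀ n f → width n < labelLength n f
  w<labelLength n f = m≤m+n (suc (width n)) _

  num<labelLength : ∀ n f q i → q < count# n f (blog n) → i < width n → suc (width n) + (q * width n + i) < labelLength n f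
  num<labelLength n f q i l m = +-monoʳ-< (suc (width n)) (≤-trans (radix< l m) (≤-reflexive (*-comm (count# n f (blog n)) (width n))))

  module _ (w₁ w₂ k : ℕ) (num₁ num₂ : ℕ → ℕ) (w₁<k : w₁ < k) (w₂<k : w₂ < k)
           (bits≡ : ∀ r → r < k → Bits.bit# w₁ num₁ r ≡ Bits.bit# w₂ num₂ r) where

    private
      module B₁ = Bits w₁ num₁
      module B₂ = Bits w₂ num₂

    -- The first zero ends the header. Were the widths different, it would meet a one in the longer
    -- header.
    width≡ : w₁ ≡ w₂
    width≡ with <-cmp w₁ w₂
    ... | tri≈ _ e _ = e
    ... | tri< l _ _ = ⊥-elim (0≢1+n (trans (sym B₁.bit-end) (trans (bits≡ w₁ w₁<k) (B₂.bit-ones w₁ l))))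
    ... | tri> _ _ l = ⊥-elim (0≢1+n (trans (sym B₂.bit-end) (trans (sym (bits≡ w₂ w₂<k)) (B₁.bit-ones w₂ l))))

    num≡ : ∀ q → shr (num₁ q) w₁ ≡ 0 → shr (num₂ q) w₂ ≡ 0 → (∀ i → i < w₁ → suc w₁ + (q * w₁ + i) < k) → num₁ q ≡ num₂ q
    num≡ q z₁ z₂ l = shr-ext w₁ (num₁ q) (num₂ q) z₁ (trans (cong (shr (num₂ q)) width≡) z₂) (λ i m →
      trans (sym (B₁.bit-num q i m)) (trans (bits≡ _ (l i m)) (trans (cong (λ t → B₂.bit# (suc t + (q * t + i))) width≡) (B₂.bit-num q i (<-≤-trans m (≤-reflexive width≡))))))

  -- The header yields the common width, with which all entries can be compared; `n` and `f` are the
  -- first two, so a label reveals them.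
  same-label : ∀ n₁ f₁ A₁ n₂ f₂ A₂ u v → f₁ ≤ n₁ → f₂ ≤ n₂ → u < n₁ → v < n₂ → labelLength n₁ f₁ ≡ labelLength n₂ f₂ →
               (∀ r → r < labelLength n₁ f₁ → Label.bit# n₁ f₁ A₁ u r ≡ Label.bit# n₂ f₂ A₂ v r) →
               n₁ ≡ n₂ × f₁ ≡ f₂ × (∀ q → q < count# n₁ f₁ (blog n₁) → Label.num n₁ f₁ A₁ u q ≡ Label.num n₂ f₂ A₂ v q)
  same-label n₁ f₁ A₁ n₂ f₂ A₂ u v f≤₁ f≤₂ u< v< lens bits≡ = nums 0 (s≤s z≤n) , nums 1 (s≤s (s≤s z≤n)) , nums
    where
    k = labelLength n₁ f₁
    num₁ num₂ : ℕ → ℕ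
    num₁ = Label.num n₁ f₁ A₁ u
    num₂ = Label.num n₂ f₂ A₂ v
    w₂< : width n₂ < k
    w₂< = <-≤-trans (w<labelLength n₂ f₂) (≤-reflexive (sym lens))
    nums : ∀ q → q < count# n₁ f₁ (blog n₁) → num₁ q ≡ num₂ q
    nums q l = num≡ (width n₁) (width n₂) k num₁ num₂ (w<labelLength n₁ f₁) w₂< bits≡ q
      (Label.num-bits n₁ f₁ A₁ f≤₁ u u< q) (Label.num-bits n₂ f₂ A₂ f≤₂ v v< q) (λ i → num<labelLength n₁ f₁ q i l)

-- Expressions for the parameters

module SizePrograms where

  open Sizes
  open LabelLayout
  open Macros
  open Expressions
  open Arithmetic
  open NumberTheory
  open Hierarchy
  open Labels
  open TwoGraphs using (moments)
  open HierarchyPrograms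
  open LabelPrograms
  open import Data.List using ([]; _∷_)
  open import Data.Nat.Divisibility

  isPr₀ : Exp (nat ∷ []) nat (λ (q , _) → isPr q)
  isPr₀ = mulE (leE (lit 2) v0) (iszE (sum v0 (mulE (leE (lit 2) v0) (eqE (remE v1 v0) zer))))

  pr₀ : Exp (nat ∷ []) nat (λ (N , _) → pr N)
  pr₀ = conv (sum (inc (mulE (add (lit 4) v0) (add (lit 4) v0))) (iszE (sum (inc v0) (mulE (ltE v2 v0) (app isPr₀ (v0 ∷ []))))))
    (λ (N , _) → sym (pr-def N))

  moments₀ : Exp (nat ∷ nat ∷ []) nat (λ (f , b , _) → moments f b)
  moments₀ = mulE v0 (mulE v1 (mulE (inc v0) (mulE (lit 2) (inc v1))))

  modulus₀ : Exp (nat ∷ nat ∷ nat ∷ []) nat (λ (n , f , b , _) → modulus n f b)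
  modulus₀ = inc (inc (mulE (app blog₀ (mulE (mulE (mulE (inc (mulE v2 v0)) (inc v2)) (inc v0)) (lit 2) ∷ []))
    (mulE (lit 3) (add (mulE v1 (inc v2)) (mulE (add v1 (lit 2)) v2)))))

  groups₀ : Exp (nat ∷ nat ∷ nat ∷ []) nat (λ (n , f , b , _) → groups n f b)
  groups₀ = mulE (mulE (mulE m m) m) m
    where m : Exp (nat ∷ nat ∷ nat ∷ []) nat (λ (n , f , b , _) → modulus n f b)
          m = app modulus₀ (v0 ∷ v1 ∷ v2 ∷ [])

  slots₀ : Exp (nat ∷ nat ∷ nat ∷ []) nat (λ (n , f , b , _) → slots n f b)
  slots₀ = mulE (mulE (add v2 v2) v2) (app groups₀ (v0 ∷ v1 ∷ v2 ∷ []))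

  count₁ : Exp (nat ∷ nat ∷ nat ∷ []) nat (λ (n , f , b , _) → count# n f b)
  count₁ = add (add (lit 4) v2) (add (app slots₀ (v0 ∷ v1 ∷ v2 ∷ [])) (mulE (mulE (app groups₀ (v0 ∷ v1 ∷ v2 ∷ [])) (mulE (lit 2) v2)) (app moments₀ (v1 ∷ v2 ∷ []))))

  width₀ : Exp (nat ∷ []) nat (λ (n , _) → width n)
  width₀ = app blog₀ (mulE (add (lit 4) (mulE v0 v0)) (add (lit 4) (mulE v0 v0)) ∷ [])

  labelLength₀ : Exp (nat ∷ nat ∷ []) nat (λ (n , f , _) → labelLength n f)
  labelLength₀ = add (inc (app width₀ (v0 ∷ []))) (mulE (app width₀ (v0 ∷ [])) (app count₁ (v0 ∷ v1 ∷ app blog₀ (v0 ∷ []) ∷ [])))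

-- Expressions for the bits of a label

module LayoutPrograms where

  open Sizes
  open LabelLayout
  open SizePrograms
  open Macros
  open Expressions
  open Arithmetic
  open NumberTheory
  open Hierarchy
  open Labels
  open TwoGraphs using (moments)
  open HierarchyPrograms
  open LabelPrograms
  open import Data.List using ([]; _∷_)
  open import Data.Nat.Divisibility

  num₀ : Exp (nat ∷ nat ∷ nat ∷ nat ∷ arr ∷ []) nat (λ (v , q , n , f , A , _) → Label.num n f A v q)
  num₀ = app num₁ (v0 ∷ v1 ∷ v3 ∷ v2 ∷ b₀ ∷ app modulus₀ (v2 ∷ v3 ∷ b₀ ∷ []) ∷ app pr₀ (mulE v2 v2 ∷ []) ∷ v4 ∷ [])
    where
    b₀ : Exp (nat ∷ nat ∷ nat ∷ nat ∷ arr ∷ []) nat (λ (v , q , n , f , A , _) → blog n)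
    b₀ = app blog₀ (v2 ∷ [])
    Γ : Ctx
    Γ = nat ∷ nat ∷ nat ∷ Θ
    slot₁ : Exp Γ nat (λ (v , r , f , n , b , M , p , A , _) →
      LabA.slotRep n b M p A v (quo (quo r (groups n f b)) b) (rem r (groups n f b)) (rem (quo r (groups n f b)) b))
    slot₁ = app slotRep₀ (v0 ∷ quoE (quoE v1 g) v4 ∷ remE v1 g ∷ remE (quoE v1 g) v4 ∷ v3 ∷ v4 ∷ v5 ∷ v6 ∷ v7 ∷ [])
      where g : Exp Γ nat (λ (v , r , f , n , b , M , p , A , _) → groups n f b)
            g = app groups₀ (v3 ∷ v2 ∷ v4 ∷ [])
    sum₁ : Exp Γ nat (λ (v , r , f , n , b , M , p , A , _) →
      LabA.Wsum n b M p A (quo (quo r (moments f b)) (2 * b)) (LabA.pid n b M p A v) (posm n A b v) (rem (quo r (moments f b)) (2 * b)) (rem r (moments f b)))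
    sum₁ = app Wsum₀ (quoE (quoE v1 k) (mulE (lit 2) v4) ∷ app pid₀ (v0 ∷ v3 ∷ v4 ∷ v5 ∷ v6 ∷ v7 ∷ []) ∷ app pos₀ (v0 ∷ v3 ∷ v4 ∷ v7 ∷ []) ∷
      remE (quoE v1 k) (mulE (lit 2) v4) ∷ remE v1 k ∷ v3 ∷ v4 ∷ v5 ∷ v6 ∷ v7 ∷ [])
      where k : Exp Γ nat (λ (v , r , f , n , b , M , p , A , _) → moments f b)
            k = app moments₀ (v2 ∷ v4 ∷ [])
    num₁ : Exp Γ nat (λ (v , q , f , n , b , M , p , A , _) →
      Layout.num n f (levm n A b v) (posm n A b v) b (slots n f b) (λ ℓ → cmpm n A ℓ v)
        (λ r → LabA.slotRep n b M p A v (quo (quo r (groups n f b)) b) (rem r (groups n f b)) (rem (quo r (groups n f b)) b))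
        (λ r → LabA.Wsum n b M p A (quo (quo r (moments f b)) (2 * b)) (LabA.pid n b M p A v) (posm n A b v) (rem (quo r (moments f b)) (2 * b)) (rem r (moments f b))) q)
    num₁ = cond v1 v3 (cond (sub v1 (lit 1)) v2 (cond (sub v1 (lit 2)) (app lev₀ (v0 ∷ v3 ∷ v4 ∷ v7 ∷ [])) (cond (sub v1 (lit 3)) (app pos₀ (v0 ∷ v3 ∷ v4 ∷ v7 ∷ []))
      (cond (ltE (sub v1 (lit 4)) v4)
        (cond (ltE r s) (app sum₁ (v0 ∷ sub r s ∷ v2 ∷ v3 ∷ v4 ∷ v5 ∷ v6 ∷ v7 ∷ [])) (app slot₁ (v0 ∷ r ∷ v2 ∷ v3 ∷ v4 ∷ v5 ∷ v6 ∷ v7 ∷ [])))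
        (app cmp₀ (sub v1 (lit 4) ∷ v0 ∷ v3 ∷ v7 ∷ []))))))
      where r : Exp Γ nat (λ (v , q , f , n , b , M , p , A , _) → q ∸ (4 + b))
            r = sub v1 (add (lit 4) v4)
            s : Exp Γ nat (λ (v , q , f , n , b , M , p , A , _) → slots n f b)
            s = app slots₀ (v3 ∷ v2 ∷ v4 ∷ [])

  labelCode₀ : Exp (nat ∷ nat ∷ nat ∷ nat ∷ arr ∷ []) nat (λ (v , r , n , f , A , _) → Label.labelCode n f A v r)
  labelCode₀ = cond (ltE v1 (app labelLength₀ (v2 ∷ v3 ∷ []))) (lit 1) (add (lit 2)
    (cond (ltE v1 w) (cond (eqE v1 w)
      (remE (shrE (app num₀ (v0 ∷ quoE (sub v1 (inc w)) w ∷ v2 ∷ v3 ∷ v4 ∷ [])) (remE (sub v1 (inc w)) w)) (lit 2)) zer) (lit 1)))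
    where w : Exp (nat ∷ nat ∷ nat ∷ nat ∷ arr ∷ []) nat (λ (v , r , n , f , A , _) → width n)
          w = app width₀ (v2 ∷ [])

-- Instances that explain a query, and the agreement of their answers

module Queries where

  open Macros
  open Expressions
  open Arithmetic
  open NumberTheory
  open Hierarchy
  open Labels
  open Congruences
  open OneGraph
  open TwoGraphs
  open LabelPrograms
  open Sizes
  open LabelLayout
  open import Data.Empty using (⊥; ⊥-elim)
  open import Data.List using (List; length)
  open import Data.Nat.Primality using (Prime)
  open import Data.Sum using (_⊎_; inj₁; inj₂)
  open import Relation.Binary.Definitions using (tri<; tri≈; tri>)
  open import Relation.Nullary using (¬_)

  -- The instance (n, f, A) explains the query Q when every word of Q is the label of one of its vertices.
  module Words (n f k : ℕ) (code : ℕ → ℕ → ℕ) (A Q : List ℕ) where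

    stride words : ℕ
    stride = suc k
    words = quo (length Q) stride

    opaque
      match : ℕ → ℕ → ℕ
      match i v = isz (Σ< stride (λ r → isz (eq (Q ! (i * stride + r)) (code v r))))

      match-def : ∀ i v → match i v ≡ isz (Σ< stride (λ r → isz (eq (Q ! (i * stride + r)) (code v r))))
      match-def i v = refl

    opaque
      -- The vertices that carry no fault label. Words 0 and 1 of a query belong to `s` and `t`, and
      -- the faults begin with word 2.
      alive# : List ℕ
      alive# = tab n (λ x → isz (Σ< (words ∸ 2) (λ i → match (2 + i) x)))

      alive#-def : alive# ≡ tab n (λ x → isz (Σ< (words ∸ 2) (λ i → match (2 + i) x)))
      alive#-def = refl

    -- The number of faults is tested too, because candidates are arbitrary and the bound on
    -- crossing chords depends on it.
    explains : ℕ
    explains = le 2 words * (eq (words * stride) (length Q) * (le f n *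
      (isz (Σ< words (λ i → isz (Σ< n (match i)))) * le (Σ< n (λ x → isz (alive# ! x))) f)))

    connected : ℕ
    connected = Σ< n (λ s → match 0 s * (alive# ! s * Σ< n (λ t → match 1 t * (alive# ! t * reach n A alive# s ! t))))

    record Explains : Set where
      field
        2≤words : 2 ≤ words
        total   : words * stride ≡ length Q
        f≤n     : f ≤ n
        matched : ∀ i → i < words → ∃[ v ] (v < n × 0 < match i v)
        few     : Σ< n (λ x → isz (alive# ! x)) ≤ f

    explains⁻ : 0 < explains → Explains
    explains⁻ h =
      let a , h₁ = unand (le 2 words) h
          c , h₂ = unand (eq (words * stride) (length Q)) h₁
          d , h₃ = unand (le f n) h₂
          e , k = unand (isz (Σ< words (λ i → isz (Σ< n (match i))))) h₃
      in record { 2≤words = le⁻ {2} a ; total = eq⁻ {words * stride} c ; f≤n = le⁻ {f} d ; few = le⁻ {Σ< n (λ x → isz (alive# ! x))} k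
                ; matched = λ i l → Σ⁻ n (nonzero (Σ< n (match i)) (Σ≡0⁻ words (isz⁻ {Σ< words (λ i → isz (Σ< n (match i)))} e) i l)) }
      where
      nonzero : ∀ x → isz x ≡ 0 → 0 < x
      nonzero (suc x) _ = s≤s z≤n

    explains⁺ : Explains → 0 < explains
    explains⁺ e = le⁺ 2≤words & (eq⁺ total & (le⁺ f≤n & (isz⁺ (Σ≡0 words (λ i l → let v , v< , m = matched i l in zero! (Σ⁺ v v< m))) & le⁺ few)))
      where
      open Explains e
      zero! : ∀ {x} → 0 < x → isz x ≡ 0
      zero! (s≤s _) = refl

    match⁻ : ∀ i v → 0 < match i v → ∀ r → r < stride → Q ! (i * stride + r) ≡ code v r
    match⁻ i v h r l = eq⁻ {Q ! (i * stride + r)} (pos (eq (Q ! (i * stride + r)) (code v r))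
        (Σ≡0⁻ stride (isz⁻ {Σ< stride (λ r → isz (eq (Q ! (i * stride + r)) (code v r)))} (subst (0 <_) (match-def i v) h)) r l))
      where
      pos : ∀ x → isz x ≡ 0 → 0 < x
      pos (suc x) _ = s≤s z≤n

    match⁺ : ∀ i v → (∀ r → r < stride → Q ! (i * stride + r) ≡ code v r) → 0 < match i v
    match⁺ i v h = subst (0 <_) (sym (match-def i v)) (isz⁺ (Σ≡0 stride (λ r l → zero! (eq⁺ {Q ! (i * stride + r)} (h r l)))))
      where
      zero! : ∀ {x} → 0 < x → isz x ≡ 0
      zero! (s≤s _) = refl

    alive-≤ : ∀ x → 0 < alive# ! x → x < n × (∀ i → i < words ∸ 2 → match (2 + i) x ≡ 0)
    alive-≤ x h = let l , z = tab-pos n (λ x → isz (Σ< (words ∸ 2) (λ i → match (2 + i) x))) {x} (subst (λ U → 0 < U ! x) alive#-def h)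
                  in l , Σ≡0⁻ (words ∸ 2) (isz⁻ {Σ< (words ∸ 2) (λ i → match (2 + i) x)} z)

    alive-≥ : ∀ x → x < n → alive# ! x ≡ 0 → ∃[ i ] (i < words ∸ 2 × 0 < match (2 + i) x)
    alive-≥ x l e = Σ⁻ (words ∸ 2) (pos (Σ< (words ∸ 2) (λ i → match (2 + i) x))
        (trans (sym (tab-! (λ x → isz (Σ< (words ∸ 2) (λ i → match (2 + i) x))) l)) (trans (cong (λ U → U ! x) (sym alive#-def)) e)))
      where
      pos : ∀ x → isz x ≡ 0 → 0 < x
      pos (suc x) _ = s≤s z≤n

    connected⁻ : 0 < connected → ∃[ s ] ∃[ t ] (s < n × t < n × 0 < match 0 s × 0 < match 1 t ×
                                                0 < alive# ! s × 0 < alive# ! t × 0 < reach n A alive# s ! t)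
    connected⁻ h = let s , s< , h₁ = Σ⁻ n h
                       a , h₂ = unand (match 0 s) h₁
                       c , h₃ = unand (alive# ! s) h₂
                       t , t< , h₄ = Σ⁻ n h₃
                       d , h₅ = unand (match 1 t) h₄
                       e , k = unand (alive# ! t) h₅
                   in s , t , s< , t< , a , d , c , e , k

    connected⁺ : ∀ s t → s < n → t < n → 0 < match 0 s → 0 < match 1 t → 0 < alive# ! s → 0 < alive# ! t →
                 0 < reach n A alive# s ! t → 0 < connected
    connected⁺ s t s< t< a d c e k = Σ⁺ s s< (a & (c & Σ⁺ t t< (d & (e & k))))

  search : ∀ n P → ∃[ i ] (i < n × 0 < P i) → least n P < n × 0 < P (least n P)
  search n P (i , l , h) = let q = least-< n P i l h in q , least-wit n P q

  module Enum (n : ℕ) (P : ℕ → ℕ) (P≤1 : ∀ x → P x ≤ 1) where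

    total# : ℕ
    total# = Σ< n P

    nth : ℕ → ℕ
    nth l = least n (λ x → P x * eq (Σ< x P) l)

    nth-spec : ∀ l → l < total# → nth l < n × 0 < P (nth l)
    nth-spec l l< = let x , x< , h , e = Σ-surj n P l P≤1 l<
                        q , k = search n (λ x → P x * eq (Σ< x P) l) (x , x< , h & eq⁺ {Σ< x P} e)
                    in q , fst⁺ k

    nth-all : ∀ x → x < n → 0 < P x → ∃[ l ] (l < total# × x ≡ nth l)
    nth-all x x< h = Σ< x P , ≤-trans (grow x h) (Σ-mono-range P x<) , sym (uniq (nth (Σ< x P)) (fst⁺ w) (eq⁻ {Σ< (nth (Σ< x P)) P} (snd⁺ (P (nth (Σ< x P))) w)))
      where
      w = proj₁ (least-prop n (λ y → P y * eq (Σ< y P) (Σ< x P)) x x< (h & eq⁺ {Σ< x P} refl))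
      grow : ∀ x → 0 < P x → Σ< x P < Σ< (suc x) P
      grow x h = ≤-trans (≤-reflexive (+-comm 1 _)) (+-monoʳ-≤ (Σ< x P) h)
      uniq : ∀ y → 0 < P y → Σ< y P ≡ Σ< x P → y ≡ x
      uniq y hy e with <-cmp y x
      ... | tri≈ _ q _ = q
      ... | tri< l _ _ = ⊥-elim (<-irrefl e (≤-trans (grow y hy) (Σ-mono-range P l)))
      ... | tri> _ _ l = ⊥-elim (<-irrefl (sym e) (≤-trans (grow x h) (Σ-mono-range P l)))

  module Query (n f : ℕ) (A Q : List ℕ) = Words n f (labelLength n f) (Label.labelCode n f A) A Q

  module Bridge (n b M f p : ℕ) (A₁ A₂ : List ℕ) (lev₁ pos₁ lev₂ pos₂ : ℕ → ℕ) (cmp₁ cmp₂ : ℕ → ℕ → ℕ) (C : Coords) where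

    private
      H₁ H₂ : Hi
      H₁ = record { adj = adjm n A₁ ; lev = lev₁ ; pos = pos₁ ; cmp = cmp₁ }
      H₂ = record { adj = adjm n A₂ ; lev = lev₂ ; pos = pos₂ ; cmp = cmp₂ }
    open Coords C

    module _ (ok₁ : OK n b H₁) (ok₂ : OK n b H₂) (mt₁ : Match n b H₁ C) (mt₂ : Match n b H₂ C) (U₁ U₂ : List ℕ)
             (dead₁ : ∀ x → x < n → U₁ ! x ≡ 0 → ∃[ l ] (l < m × x ≡ Match.v mt₁ l)) (dead₂ : ∀ l → l < m → ¬ (0 < U₂ ! Match.v mt₂ l))
             (pp : Prime p) (N≤p : n * n ≤ p) (m≤f : m ≤ f)
             (M′ : ℕ) (M≡ : M ≡ suc M′) (small : Known.NT n b M C ^ (3 * (m * suc b + kz * b)) < 2 ^ M′)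
             (W-eq : ∀ l γ i j → l < m → γ < M * M * M * M → i < 2 * b → j < moments f b →
                     LabP.Wsum n b H₁ M p γ (fc l) (fp l) i j ≡ LabP.Wsum n b H₂ M p γ (fc l) (fp l) i j)
             (slot-eq : ∀ i sl γ ℓ → i < kz → sl < b + b → γ < M * M * M * M → ℓ < b →
                     LabP.slotRep n b H₁ M p (Match.z mt₁ i) sl γ ℓ ≡ LabP.slotRep n b H₂ M p (Match.z mt₂ i) sl γ ℓ)
             (i j : ℕ) (i< : i < kz) (j< : j < kz) (pi : pos₁ (Match.z mt₁ i) ≡ pos₂ (Match.z mt₂ i)) (pj : pos₁ (Match.z mt₁ j) ≡ pos₂ (Match.z mt₂ j)) where

      private
        module O₁ = One n b M p H₁ ok₁ C mt₁
        module O₂ = One n b M p H₂ ok₂ C mt₂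
        s₁ s₂ t₁ t₂ : ℕ
        s₁ = Match.z mt₁ i
        s₂ = Match.z mt₂ i
        t₁ = Match.z mt₁ j
        t₂ = Match.z mt₂ j
        s₁< : s₁ < n
        s₁< = Match.z<n mt₁ i i<

        R : ℕ → ℕ
        R x = reach n A₁ U₁ s₁ ! x

        notF-alive : ∀ x → x < n → ¬ O₁.isF x → 0 < U₁ ! x
        notF-alive x x< nf with 0<-dec (U₁ ! x)
        ... | inj₂ h = h
        ... | inj₁ e = ⊥-elim (nf (dead₁ x x< e))

        R-step : ∀ x y → x < n → O₁.FW x y → 0 < R x → 0 < R y
        R-step x y x< w h = reach-complete n A₁ U₁ s₁ s₁< (Walk-trans (proj₂ (reach-sound n A₁ U₁ s₁ x h)) (Walk-map notF-alive w))

        R-resp : ∀ x y → x < n → y < n → ¬ O₁.isF x → ¬ O₁.isF y → O₁.FW x y → R x ≡ R y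
        R-resp x y x< y< nx ny w = bit (R x) (R y) (reach≤1 n A₁ U₁ s₁ x) (reach≤1 n A₁ U₁ s₁ y) (R-step x y x< w)
            (R-step y x y< (Walk-sym (adjm-sym n A₁) nx w))
          where
          bit : ∀ a c → a ≤ 1 → c ≤ 1 → (0 < a → 0 < c) → (0 < c → 0 < a) → a ≡ c
          bit 0 0 _ _ _ _ = refl
          bit 1 1 _ _ _ _ = refl
          bit 0 (suc c) _ _ _ g = ⊥-elim (<-irrefl refl (g (s≤s z≤n)))
          bit (suc a) 0 _ _ g _ = ⊥-elim (<-irrefl refl (g (s≤s z≤n)))
          bit (suc (suc _)) _ (s≤s ()) _ _ _
          bit _ (suc (suc _)) _ (s≤s ()) _ _

        alive-notF : ∀ x → 0 < U₂ ! x → ¬ O₂.isF x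
        alive-notF x h (l , l< , e) = dead₂ l l< (subst (λ y → 0 < U₂ ! y) e h)

      transfer-conn : 0 < U₂ ! s₂ → 0 < U₂ ! t₂ → 0 < reach n A₂ U₂ s₂ ! t₂ → 0 < reach n A₁ U₁ s₁ ! t₁
      transfer-conn hs ht hr = subst (0 <_) (Two.decode n b M f p C H₁ H₂ ok₁ ok₂ mt₁ mt₂ pp N≤p m≤f M′ M≡ small W-eq slot-eq R (reach≤1 n A₁ U₁ s₁) R-resp
          i j i< j< pi pj (alive-notF s₂ hs) (alive-notF t₂ ht) (Walk-map (λ y _ → alive-notF y) (proj₂ (reach-sound n A₂ U₂ s₂ t₂ hr))))
        (reach-complete n A₁ U₁ s₁ s₁< here)

  module Pair (n f : ℕ) (A₁ A₂ Q : List ℕ) (ex₁ : Query.Explains n f A₁ Q) (ex₂ : Query.Explains n f A₂ Q) where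

    module Q₁ = Query n f A₁ Q
    module Q₂ = Query n f A₂ Q
    module E₁ = Q₁.Explains ex₁
    module E₂ = Q₂.Explains ex₂
    module L₁ = Label n f A₁
    module L₂ = Label n f A₂
    b = blog n
    H₁ = hier n b A₁
    H₂ = hier n b A₂

    n<2^b : n < 2 ^ b
    n<2^b = <2^blog n

    ok : ∀ A → OK n b (hier n b A)
    ok A = record { n<2^b = n<2^b ; adj-sym = adjm-sym n A ; lev<b = λ x l → proj₁ (R.lev-char x l) ; cmp<n = R.cmpm-wit ; pos<n = R.pos<
                  ; pos-inj = R.pos-inj ; cmp-adj = R.cmp-adj ; cmp-mono = R.cmp-mono ; path-adj = R.path-adj ; path-contig = R.path-contig
                  ; comp-conn = R.comp-conn }
      where module R = Rounds n A b n<2^b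

    Same : ℕ → ℕ → Set
    Same u v = ∀ q → q < count# n f b → L₁.num u q ≡ L₂.num v q

    matches-same : ∀ i u v → u < n → v < n → 0 < Q₁.match i u → 0 < Q₂.match i v → Same u v
    matches-same i u v u< v< m₁ m₂ = proj₂ (proj₂ (same-label n f A₁ n f A₂ u v E₁.f≤n E₂.f≤n u< v< refl
      (λ r l → +-cancelˡ-≡ 2 _ _ (trans (sym (L₁.code-bit u _ r l)) (trans (sym (Q₁.match⁻ i u m₁ r (m<n⇒m<1+n l))) (trans (Q₂.match⁻ i v m₂ r (m<n⇒m<1+n l)) (L₂.code-bit v _ r l)))))))

    module SameV (u v : ℕ) (u< : u < n) (v< : v < n) (s : Same u v) where

      lev≡ : levm n A₁ b u ≡ levm n A₂ b v
      lev≡ = s 2 (s≤s (s≤s (s≤s z≤n)))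

      pos≡ : posm n A₁ b u ≡ posm n A₂ b v
      pos≡ = s 3 (s≤s (s≤s (s≤s (s≤s z≤n))))

      cmp≡ : ∀ ℓ → ℓ < b → cmpm n A₁ ℓ u ≡ cmpm n A₂ ℓ v
      cmp≡ ℓ l = trans (sym (L₁.num-cmp u ℓ l)) (trans (s (4 + ℓ) (≤-trans (+-monoʳ-< 4 l) (m≤m+n (4 + b) _))) (L₂.num-cmp v ℓ l))

      pid≡ : L₁.pid u ≡ L₂.pid v
      pid≡ = cong₂ (λ s t → s * n + t) lev≡ (trans (cmp≡ _ (OK.lev<b (ok A₁) u u<)) (cong (λ ℓ → cmpm n A₂ ℓ v) lev≡))

      slot≡ : ∀ sl γ ℓ → sl < b + b → γ < groups n f b → ℓ < b → L₁.slotRep u sl γ ℓ ≡ L₂.slotRep v sl γ ℓ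
      slot≡ sl γ ℓ sl< γ< ℓ< = trans (sym (dec L₁.slotRep u)) (trans (trans (sym (L₁.num-slot u r r<)) (trans (s (4 + b + r) (+-monoʳ-< (4 + b) (<-≤-trans r< (m≤m+n _ _)))) (L₂.num-slot v r r<))) (dec L₂.slotRep v))
        where
        G = groups n f b
        r = (sl * b + ℓ) * G + γ
        r< : r < slots n f b
        r< = radix< (radix< sl< ℓ<) γ<
        q₁ : quo r G ≡ sl * b + ℓ
        q₁ = quo-unique (sl * b + ℓ) γ G γ<
        dec : ∀ (F : ℕ → ℕ → ℕ → ℕ → ℕ) x → F x (quo (quo r G) b) (rem r G) (rem (quo r G) b) ≡ F x sl γ ℓ
        dec F x = trans (cong₂ (λ s t → F x (quo s b) t (rem s b)) q₁ (rem-unique (sl * b + ℓ) γ G γ<))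
                        (cong₂ (λ s t → F x s γ t) (quo-unique sl ℓ b ℓ<) (rem-unique sl ℓ b ℓ<))

      sum≡ : ∀ γ i j → γ < groups n f b → i < 2 * b → j < moments f b →
             L₁.Wsum γ (L₁.pid u) (posm n A₁ b u) i j ≡ L₂.Wsum γ (L₂.pid v) (posm n A₂ b v) i j
      sum≡ γ i j γ< i< j< = trans (sym (dec (λ γ i j → L₁.Wsum γ (L₁.pid u) (posm n A₁ b u) i j)))
          (trans (trans (sym (L₁.num-sum u r)) (trans (s (4 + b + (slots n f b + r)) (+-monoʳ-< (4 + b) (+-monoʳ-< (slots n f b) r<))) (L₂.num-sum v r)))
            (dec (λ γ i j → L₂.Wsum γ (L₂.pid v) (posm n A₂ b v) i j)))
        where
        K = moments f b
        r = (γ * (2 * b) + i) * K + j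
        r< : r < groups n f b * (2 * b) * K
        r< = radix< (radix< γ< i<) j<
        q₁ : quo r K ≡ γ * (2 * b) + i
        q₁ = quo-unique (γ * (2 * b) + i) j K j<
        dec : ∀ (F : ℕ → ℕ → ℕ → ℕ) → F (quo (quo r K) (2 * b)) (rem (quo r K) (2 * b)) (rem r K) ≡ F γ i j
        dec F = trans (cong₂ (λ s t → F (quo s (2 * b)) (rem s (2 * b)) t) q₁ (rem-unique (γ * (2 * b) + i) j K j<))
                      (cong₂ (λ s t → F s t j) (quo-unique γ i (2 * b) i<) (rem-unique γ i (2 * b) i<))

    -- Round, component and position determine a vertex, and all three are among the entries of a
    -- label.
    same-inj : ∀ u v v′ → u < n → v < n → v′ < n → Same u v → Same u v′ → v ≡ v′
    same-inj u v v′ u< v< v′< s s′ = OK.pos-inj (ok A₂) v v′ v< v′< ll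
        (trans (sym (S.cmp≡ _ b₁)) (trans (S′.cmp≡ _ b₁) (cong (λ ℓ → cmpm n A₂ ℓ v′) ll))) (trans (sym S.pos≡) S′.pos≡)
      where
      module S = SameV u v u< v< s
      module S′ = SameV u v′ u< v′< s′
      ll = trans (sym S.lev≡) S′.lev≡
      b₁ = OK.lev<b (ok A₂) v v<

    isFault : ℕ → ℕ
    isFault x = isz (Q₁.alive# ! x)

    open Enum n isFault (λ x → isz≤1 (Q₁.alive# ! x)) public renaming (total# to m)

    index : ℕ → ℕ
    index l = least (Q₁.words ∸ 2) (λ i → Q₁.match (2 + i) (nth l))

    index-spec : ∀ l → l < m → index l < Q₁.words ∸ 2 × 0 < Q₁.match (2 + index l) (nth l)
    index-spec l l< = let x< , h = nth-spec l l< in search (Q₁.words ∸ 2) (λ i → Q₁.match (2 + i) (nth l)) (Q₁.alive-≥ (nth l) x< (isz⁻ {Q₁.alive# ! nth l} h))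

    word< : ∀ i → i < Q₁.words ∸ 2 → 2 + i < Q₁.words
    word< i l = ≤-trans (≤-reflexive (cong suc (+-comm 2 i))) (≤-trans (+-monoˡ-≤ 2 l) (≤-reflexive (m∸n+n≡m E₁.2≤words)))

    -- A vertex of the second graph with the label of fault `l` of the first, found through a word
    -- that shows `nth l` to be a fault.
    twin : ℕ → ℕ
    twin l = least n (Q₂.match (2 + index l))

    twin-spec : ∀ l → l < m → twin l < n × 0 < Q₂.match (2 + index l) (twin l)
    twin-spec l l< = search n (Q₂.match (2 + index l)) (E₂.matched (2 + index l) (word< (index l) (proj₁ (index-spec l l<))))

    fault-twin : ∀ l → l < m → Same (nth l) (twin l)
    fault-twin l l< = matches-same (2 + index l) (nth l) (twin l) (proj₁ (nth-spec l l<)) (proj₁ (twin-spec l l<)) (proj₂ (index-spec l l<)) (proj₂ (twin-spec l l<))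

    twin-dead : ∀ l → l < m → ¬ (0 < Q₂.alive# ! twin l)
    twin-dead l l< h = 0<⇒≢0 (proj₂ (twin-spec l l<)) (proj₂ (Q₂.alive-≤ (twin l) h) (index l) (proj₁ (index-spec l l<)))

    -- The vertices whose labels are shown: the two query vertices, then the faults. This is why
    -- fault `l` has index `2 + l`.
    point : ℕ → ℕ → (ℕ → ℕ) → ℕ → ℕ
    point s t h 0 = s
    point s t h 1 = t
    point s t h (suc (suc l)) = h l

    module _ (s₁ t₁ s₂ t₂ : ℕ) (s₁< : s₁ < n) (t₁< : t₁ < n) (s₂< : s₂ < n) (t₂< : t₂ < n) (ss : Same s₁ s₂) (tt′ : Same t₁ t₂) where

      z₁ z₂ : ℕ → ℕ
      z₁ = point s₁ t₁ nth
      z₂ = point s₂ t₂ twin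

      z₁< : ∀ i → i < 2 + m → z₁ i < n
      z₁< 0 _ = s₁<
      z₁< 1 _ = t₁<
      z₁< (suc (suc l)) (s≤s (s≤s l<)) = proj₁ (nth-spec l l<)

      z₂< : ∀ i → i < 2 + m → z₂ i < n
      z₂< 0 _ = s₂<
      z₂< 1 _ = t₂<
      z₂< (suc (suc l)) (s≤s (s≤s l<)) = proj₁ (twin-spec l l<)

      z-same : ∀ i → i < 2 + m → Same (z₁ i) (z₂ i)
      z-same 0 _ = ss
      z-same 1 _ = tt′
      z-same (suc (suc l)) (s≤s (s≤s l<)) = fault-twin l l<

      module Z (i : ℕ) (l : i < 2 + m) = SameV (z₁ i) (z₂ i) (z₁< i l) (z₂< i l) (z-same i l)

      C : Coords
      C = record { m = m ; kz = 2 + m ; fc = λ l → L₁.pid (nth l) ; fp = λ l → posm n A₁ b (nth l) ; vz = 2 +_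
                 ; zlev = λ i → levm n A₁ b (z₁ i) ; zcmp = λ ℓ i → cmpm n A₁ ℓ (z₁ i) }

      mt₁ : Match n b H₁ C
      mt₁ = record { v = nth ; z = z₁ ; v<n = λ l l< → proj₁ (nth-spec l l<) ; v-pid = λ l _ → refl ; v-pos = λ l _ → refl
                   ; vz< = λ l l< → s≤s (s≤s l<) ; v-z = λ l _ → refl ; z<n = z₁< ; z-lev = λ i _ → refl ; z-cmp = λ i ℓ _ _ → refl }

      mt₂ : Match n b H₂ C
      mt₂ = record { v = twin ; z = z₂ ; v<n = λ l l< → proj₁ (twin-spec l l<)
                   ; v-pid = λ l l< → sym (Z.pid≡ (2 + l) (s≤s (s≤s l<))) ; v-pos = λ l l< → sym (Z.pos≡ (2 + l) (s≤s (s≤s l<)))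
                   ; vz< = λ l l< → s≤s (s≤s l<) ; v-z = λ l _ → refl ; z<n = z₂<
                   ; z-lev = λ i l → sym (Z.lev≡ i l)
                   ; z-cmp = λ i ℓ l ℓ≤ → sym (Z.cmp≡ i l ℓ (≤-<-trans ℓ≤ (OK.lev<b (ok A₁) (z₁ i) (z₁< i l)))) }

      M = modulus n f b
      p = pr (n * n)

      transfer-conn : 0 < Q₂.alive# ! s₂ → 0 < Q₂.alive# ! t₂ → 0 < reach n A₂ Q₂.alive# s₂ ! t₂ → 0 < reach n A₁ Q₁.alive# s₁ ! t₁
      transfer-conn = Bridge.transfer-conn n b M f p A₁ A₂ (levm n A₁ b) (posm n A₁ b) (levm n A₂ b) (posm n A₂ b) (cmpm n A₁) (cmpm n A₂)
        C (ok A₁) (ok A₂) mt₁ mt₂ Q₁.alive# Q₂.alive# dead₁ twin-dead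
        (proj₂ (proj₂ (pr-spec (n * n)))) (<⇒≤ (proj₁ (proj₂ (pr-spec (n * n))))) E₁.few (suc (blog (toks n b) * mexp f b)) refl
        (modulus-large n f b (3 * (m * suc b + (2 + m) * b)) (*-monoʳ-≤ 3 (+-mono-≤ (*-monoˡ-≤ (suc b) E₁.few)
                (*-monoˡ-≤ b (≤-trans (+-monoʳ-≤ 2 E₁.few) (≤-reflexive (+-comm 2 f)))))))
        (λ l γ i j l< γ< i< j< → trans (Z.sum≡ (2 + l) (s≤s (s≤s l<)) γ i j γ< i< j<)
          (cong₂ (λ c P → L₂.Wsum γ c P i j) (sym (Z.pid≡ (2 + l) (s≤s (s≤s l<)))) (sym (Z.pos≡ (2 + l) (s≤s (s≤s l<))))))
        (λ i sl γ ℓ l sl< γ< ℓ< → Z.slot≡ i l sl γ ℓ sl< γ< ℓ<)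
        0 1 (s≤s z≤n) (s≤s (s≤s z≤n)) (Z.pos≡ 0 (s≤s z≤n)) (Z.pos≡ 1 (s≤s (s≤s z≤n)))
        where
        dead₁ : ∀ x → x < n → Q₁.alive# ! x ≡ 0 → ∃[ l ] (l < m × x ≡ nth l)
        dead₁ x x< e = nth-all x x< (isz⁺ {Q₁.alive# ! x} e)

    -- A fault word matched by `u` is matched by some vertex of the second graph as well. That
    -- vertex has the entries of `v`, hence is `v`.
    alive-same : ∀ u v → u < n → v < n → Same u v → 0 < Q₂.alive# ! v → 0 < Q₁.alive# ! u
    alive-same u v u< v< s h = decide (0<-dec (Q₁.alive# ! u))
      where
      none : ∀ i v′ → v′ < n → i < Q₂.words ∸ 2 → 0 < Q₁.match (2 + i) u → 0 < Q₂.match (2 + i) v′ → ⊥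
      none i v′ v′< i< k k′ = 0<⇒≢0 {Q₂.match (2 + i) v} (subst (λ y → 0 < Q₂.match (2 + i) y) v≡ k′) (proj₂ (Q₂.alive-≤ v h) i i<)
        where v≡ : v′ ≡ v
              v≡ = same-inj u v′ v u< v′< v< (matches-same (2 + i) u v′ u< v′< k k′) s
      dead : ∃[ i ] (i < Q₁.words ∸ 2 × 0 < Q₁.match (2 + i) u) → ⊥
      dead (i , i< , k) = found (E₂.matched (2 + i) (word< i i<))
        where found : ∃[ v′ ] (v′ < n × 0 < Q₂.match (2 + i) v′) → ⊥
              found (v′ , v′< , k′) = none i v′ v′< i< k k′
      decide : Q₁.alive# ! u ≡ 0 ⊎ 0 < Q₁.alive# ! u → 0 < Q₁.alive# ! u
      decide (inj₂ k) = k
      decide (inj₁ e) = ⊥-elim (dead (Q₁.alive-≥ u u< e))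

    connected-transfer : 0 < Q₂.connected → 0 < Q₁.connected
    connected-transfer h = go (Q₂.connected⁻ h) (E₁.matched 0 (≤-trans (s≤s z≤n) E₁.2≤words)) (E₁.matched 1 E₁.2≤words)
      where
      go : ∃[ s ] ∃[ t ] (s < n × t < n × 0 < Q₂.match 0 s × 0 < Q₂.match 1 t × 0 < Q₂.alive# ! s × 0 < Q₂.alive# ! t × 0 < reach n A₂ Q₂.alive# s ! t) →
           ∃[ s ] (s < n × 0 < Q₁.match 0 s) → ∃[ t ] (t < n × 0 < Q₁.match 1 t) → 0 < Q₁.connected
      go (s₂ , t₂ , s₂< , t₂< , ms , mt , as , at , hr) (s₁ , s₁< , ms′) (t₁ , t₁< , mt′) =
        Q₁.connected⁺ s₁ t₁ s₁< t₁< ms′ mt′ (alive-same s₁ s₂ s₁< s₂< ss as) (alive-same t₁ t₂ t₁< t₂< st at)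
          (transfer-conn s₁ t₁ s₂ t₂ s₁< t₁< s₂< t₂< ss st as at hr)
        where
        ss : Same s₁ s₂
        ss = matches-same 0 s₁ s₂ s₁< s₂< ms′ ms
        st : Same t₁ t₂
        st = matches-same 1 t₁ t₂ t₁< t₂< mt′ mt

  -- The separator stands right behind the last bit, so it fixes the length of the word.
  code-agree : ∀ w₁ num₁ k₁ w₂ num₂ k₂ (F : ℕ → ℕ) → (∀ r → r < suc k₁ → F r ≡ Bits.code# w₁ num₁ k₁ r) → (∀ r → r < suc k₂ → F r ≡ Bits.code# w₂ num₂ k₂ r) →
               k₁ ≡ k₂ × (∀ r → r < k₁ → Bits.bit# w₁ num₁ r ≡ Bits.bit# w₂ num₂ r)
  code-agree w₁ num₁ k₁ w₂ num₂ k₂ F h₁ h₂ = k≡ , λ r l → +-cancelˡ-≡ 2 _ _ (trans (sym (B₁.code-bit k₁ r l)) (trans (sym (h₁ r (m<n⇒m<1+n l)))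
      (trans (h₂ r (m<n⇒m<1+n (≤-trans l (≤-reflexive k≡)))) (B₂.code-bit k₂ r (≤-trans l (≤-reflexive k≡))))))
    where
    module B₁ = Bits w₁ num₁
    module B₂ = Bits w₂ num₂
    1≢2+ : ∀ {x} → ¬ (1 ≡ 2 + x)
    1≢2+ ()
    k≡ : k₁ ≡ k₂
    k≡ with <-cmp k₁ k₂
    ... | tri≈ _ e _ = e
    ... | tri< l _ _ = ⊥-elim (1≢2+ (trans (sym (B₁.code-end k₁)) (trans (sym (h₁ k₁ ≤-refl)) (trans (h₂ k₁ (m<n⇒m<1+n l)) (B₂.code-bit k₂ k₁ l)))))
    ... | tri> _ _ l = ⊥-elim (1≢2+ (trans (sym (B₂.code-end k₂)) (trans (sym (h₂ k₂ ≤-refl)) (trans (h₁ k₂ (m<n⇒m<1+n l)) (B₁.code-bit k₁ k₂ l)))))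

  -- The first word reveals `n` and `f`, so two explanations differ only in the graph. As either may
  -- be taken first, all explanations of a query give the same answer.
  consistent : ∀ n₁ f₁ A₁ n₂ f₂ A₂ Q → Query.Explains n₁ f₁ A₁ Q → Query.Explains n₂ f₂ A₂ Q →
               0 < Query.connected n₂ f₂ A₂ Q → 0 < Query.connected n₁ f₁ A₁ Q
  consistent n₁ f₁ A₁ n₂ f₂ A₂ Q ex₁ ex₂ = go (Query.Explains.matched ex₁ 0 (≤-trans (s≤s z≤n) (Query.Explains.2≤words ex₁)))
                                              (Query.Explains.matched ex₂ 0 (≤-trans (s≤s z≤n) (Query.Explains.2≤words ex₂)))
    where
    with-equal : ∀ {n₁ n₂ f₁ f₂} → n₁ ≡ n₂ → f₁ ≡ f₂ → Query.Explains n₁ f₁ A₁ Q → Query.Explains n₂ f₂ A₂ Q →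
                 0 < Query.connected n₂ f₂ A₂ Q → 0 < Query.connected n₁ f₁ A₁ Q
    with-equal {n} {_} {f} refl refl e₁ e₂ = Pair.connected-transfer n f A₁ A₂ Q e₁ e₂
    go : ∃[ u ] (u < n₁ × 0 < Query.match n₁ f₁ A₁ Q 0 u) → ∃[ v ] (v < n₂ × 0 < Query.match n₂ f₂ A₂ Q 0 v) →
         0 < Query.connected n₂ f₂ A₂ Q → 0 < Query.connected n₁ f₁ A₁ Q
    go (u , u< , mu) (v , v< , mv) = finish lab
      where
      agree : labelLength n₁ f₁ ≡ labelLength n₂ f₂ × (∀ r → r < labelLength n₁ f₁ → Label.bit# n₁ f₁ A₁ u r ≡ Label.bit# n₂ f₂ A₂ v r)
      agree = code-agree (width n₁) (Label.num n₁ f₁ A₁ u) (labelLength n₁ f₁) (width n₂) (Label.num n₂ f₂ A₂ v) (labelLength n₂ f₂) (Q !_)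
        (Query.match⁻ n₁ f₁ A₁ Q 0 u mu) (Query.match⁻ n₂ f₂ A₂ Q 0 v mv)
      lab : n₁ ≡ n₂ × f₁ ≡ f₂ × (∀ q → q < count# n₁ f₁ (blog n₁) → Label.num n₁ f₁ A₁ u q ≡ Label.num n₂ f₂ A₂ v q)
      lab = same-label n₁ f₁ A₁ n₂ f₂ A₂ u v (Query.Explains.f≤n ex₁) (Query.Explains.f≤n ex₂) u< v< (proj₁ agree) (proj₂ agree)
      finish : n₁ ≡ n₂ × f₁ ≡ f₂ × (∀ q → q < count# n₁ f₁ (blog n₁) → Label.num n₁ f₁ A₁ u q ≡ Label.num n₂ f₂ A₂ v q) →
               0 < Query.connected n₂ f₂ A₂ Q → 0 < Query.connected n₁ f₁ A₁ Q
      finish (n≡ , f≡ , _) = with-equal n≡ f≡ ex₁ ex₂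

-- The asymptotic length of a label

module LabelLength where

  open Arithmetic
  open TwoGraphs using (moments)
  open Sizes
  open import Data.Nat.Logarithm using (⌊log₂_⌋; ⌊log₂⌋-mono-≤; ⌊log₂[2^n]⌋≡n)
  open import Data.Nat.Tactic.RingSolver using (solve-∀)

  -- The relation `x = O(F ^ i * B ^ j)` with its constant as an index, which the rules for sums and
  -- products compute.
  record Bound (F B c i j x : ℕ) : Set where
    constructor bounded
    field
      x≤ : x ≤ c * (F ^ i * B ^ j)

  open Bound

  module _ {F B : ℕ} (1≤F : 1 ≤ F) (1≤B : 1 ≤ B) where

    1≤^ : ∀ {x} k → 1 ≤ x → 1 ≤ x ^ k
    1≤^ zero    h = ≤-refl
    1≤^ (suc k) h = *-mono-≤ {1} {_} {1} h (1≤^ k h)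

    bound-const : ∀ c → Bound F B c 0 0 c
    bound-const c = bounded (≤-reflexive (sym (*-identityʳ c)))

    bound-* : ∀ {c d i j k l x y} → Bound F B c i j x → Bound F B d k l y → Bound F B (c * d) (i + k) (j + l) (x * y)
    bound-* {c} {d} {i} {j} {k} {l} (bounded p) (bounded q) = bounded (≤-trans (*-mono-≤ p q) (≤-reflexive
      (trans (arith c (F ^ i) (B ^ j) d (F ^ k) (B ^ l)) (cong₂ (λ s t → c * d * (s * t)) (sym (^-distribˡ-+-* F i k)) (sym (^-distribˡ-+-* B j l))))))
      where arith : ∀ c p q d r s → (c * (p * q)) * (d * (r * s)) ≡ c * d * ((p * r) * (q * s))
            arith = solve-∀

    bound-+ : ∀ {c d i j x y} → Bound F B c i j x → Bound F B d i j y → Bound F B (c + d) i j (x + y)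
    bound-+ {c} {d} {i} {j} (bounded p) (bounded q) = bounded (≤-trans (+-mono-≤ p q) (≤-reflexive (sym (*-distribʳ-+ (F ^ i * B ^ j) c d))))

    bound-up : ∀ {c i j x} k l → Bound F B c i j x → Bound F B c (i + k) (j + l) x
    bound-up {c} {i} {j} k l (bounded p) = bounded (≤-trans p (*-monoʳ-≤ c (*-mono-≤
      (≤-trans (m≤m*n (F ^ i) (F ^ k) {{>-nonZero (1≤^ k 1≤F)}}) (≤-reflexive (sym (^-distribˡ-+-* F i k))))
      (≤-trans (m≤m*n (B ^ j) (B ^ l) {{>-nonZero (1≤^ l 1≤B)}}) (≤-reflexive (sym (^-distribˡ-+-* B j l)))))))

    bound-F : ∀ {x} → x ≤ F → Bound F B 1 1 0 x
    bound-F {x} h = bounded (≤-trans h (≤-reflexive (arith F)))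
      where arith : ∀ F → F ≡ 1 * (F * 1 * 1)
            arith = solve-∀

    bound-B : ∀ {x} → x ≤ B → Bound F B 1 0 1 x
    bound-B {x} h = bounded (≤-trans h (≤-reflexive (arith B)))
      where arith : ∀ B → B ≡ 1 * (1 * (B * 1))
            arith = solve-∀

    module _ {n f : ℕ} (f≤F : f ≤ F) (b≤B : blog n ≤ B) (n<2^B : n < 2 ^ B) where

      private
        b = blog n

        2≤2^B : 2 ≤ 2 ^ B
        2≤2^B = ^-monoʳ-≤ 2 1≤B

        x<2^x : ∀ x → x < 2 ^ x
        x<2^x zero = s≤s z≤n
        x<2^x (suc x) = ≤-trans (+-mono-≤ {1} {2 ^ x} (1≤^ x (s≤s z≤n)) (x<2^x x)) (≤-reflexive (cong (2 ^ x +_) (sym (+-identityʳ (2 ^ x)))))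

        b<2^B : b < 2 ^ B
        b<2^B = ≤-<-trans b≤B (x<2^x B)

        pow-* : ∀ i j → 2 ^ (i * B) * 2 ^ (j * B) ≡ 2 ^ ((i + j) * B)
        pow-* i j = trans (sym (^-distribˡ-+-* 2 (i * B) (j * B))) (cong (2 ^_) (sym (*-distribʳ-+ B i j)))

        ≤pow-1 : ∀ {x} → x ≤ 2 ^ B → x ≤ 2 ^ (1 * B)
        ≤pow-1 h = ≤-trans h (≤-reflexive (cong (2 ^_) (sym (+-identityʳ B))))

        ≤pow-* : ∀ {x y} i j → x ≤ 2 ^ (i * B) → y ≤ 2 ^ (j * B) → x * y ≤ 2 ^ ((i + j) * B)
        ≤pow-* i j p q = ≤-trans (*-mono-≤ p q) (≤-reflexive (pow-* i j))

        double : ∀ x i → x ≤ 2 ^ (i * B) → x + x ≤ 2 ^ ((i + 1) * B)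
        double x i h = ≤-trans (≤-reflexive (sym (trans (*-comm x 2) (cong (x +_) (+-identityʳ x))))) (≤pow-* i 1 h (≤pow-1 2≤2^B))

        strict : ∀ x i → 0 < x → x ≤ 2 ^ (i * B) → blog x ≤ (i + 1) * B
        strict x i 0<x h = blog-min x ((i + 1) * B) (<-≤-trans (m<m+n x 0<x) (double x i h))

        toks≤ : blog (toks n b) ≤ 6 * B
        toks≤ = strict (toks n b) 5 (s≤s z≤n) (≤pow-* 4 1 (≤pow-* 3 1 (≤pow-* 2 1 bn (≤pow-1 b<2^B)) (≤pow-1 n<2^B)) (≤pow-1 2≤2^B))
          where bn : suc (b * n) ≤ 2 ^ (2 * B)
                bn = ≤-trans (s≤s (*-monoˡ-≤ n (<⇒≤ b<2^B))) (≤-trans (*-monoʳ-< (2 ^ B) {{>-nonZero (1≤^ B (s≤s z≤n))}} n<2^B)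
                       (≤-trans (*-mono-≤ (≤pow-1 ≤-refl) (≤pow-1 ≤-refl)) (≤-reflexive (pow-* 1 1))))

        width≤ : width n ≤ 7 * B
        width≤ = strict ((4 + n * n) * (4 + n * n)) 6 (s≤s z≤n) (≤pow-* 3 3 sq sq)
          where
          four : 4 ≤ 2 ^ (2 * B)
          four = ≤pow-* {2} {2} 1 1 (≤pow-1 2≤2^B) (≤pow-1 2≤2^B)
          nn : n * n ≤ 2 ^ (2 * B)
          nn = ≤pow-* 1 1 (≤pow-1 (<⇒≤ n<2^B)) (≤pow-1 (<⇒≤ n<2^B))
          sq : 4 + n * n ≤ 2 ^ (3 * B)
          sq = ≤-trans (+-mono-≤ four nn) (double (2 ^ (2 * B)) 2 ≤-refl)

        6B : Bound F B 6 0 1 (blog (toks n b))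
        6B = bounded (≤-trans toks≤ (≤-reflexive (arith B)))
          where arith : ∀ B → 6 * B ≡ 6 * (1 * (B * 1))
                arith = solve-∀

        7B : Bound F B 7 0 1 (width n)
        7B = bounded (≤-trans width≤ (≤-reflexive (arith B)))
          where arith : ∀ B → 7 * B ≡ 7 * (1 * (B * 1))
                arith = solve-∀

        bb = bound-B b≤B
        ff = bound-F f≤F
        sb : Bound F B 2 0 1 (suc b)
        sb = bound-+ (bound-up 0 1 (bound-const 1)) bb
        sf : Bound F B 2 1 0 (suc f)
        sf = bound-+ (bound-up 1 0 (bound-const 1)) ff
        mexpB : Bound F B _ 1 1 (mexp f b)
        mexpB = bound-* (bound-const 3) (bound-+ (bound-* ff sb) (bound-* (bound-+ ff (bound-up 1 0 (bound-const 2))) bb))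
        modB : Bound F B _ 1 2 (modulus n f b)
        modB = bound-+ (bound-up 1 2 (bound-const 2)) (bound-* 6B mexpB)
        groupsB : Bound F B _ 4 8 (groups n f b)
        groupsB = bound-* (bound-* (bound-* modB modB) modB) modB
        momentsB : Bound F B _ 2 2 (moments f b)
        momentsB = bound-* ff (bound-* bb (bound-* sf (bound-* (bound-const 2) sb)))
        -- The power sums dominate: groups contribute the exponents 4 and 8, levels 0 and 1, moments
        -- 2 and 2.
        countB : Bound F B _ 6 11 (count# n f b)
        countB = bound-+ (bound-+ (bound-up 6 11 (bound-const 4)) (bound-up 6 10 bb))
          (bound-+ (bound-up 2 1 (bound-* (bound-* (bound-+ bb bb) bb) groupsB)) (bound-* (bound-* groupsB (bound-* (bound-const 2) bb)) momentsB))

      labelLength-bound : Bound F B _ 6 12 (labelLength n f)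
      labelLength-bound = bound-+ (bound-+ (bound-up 6 12 (bound-const 1)) (bound-up 6 11 7B)) (bound-* 7B countB)

  -- the constant is kept abstract, since a literal factor would be unfolded to a sum
  opaque
    bound-exists : ∃[ c ] (∀ {F B n f} → 1 ≤ F → 1 ≤ B → f ≤ F → blog n ≤ B → n < 2 ^ B → Bound F B c 6 12 (labelLength n f))
    bound-exists = _ , λ 1≤F 1≤B → labelLength-bound 1≤F 1≤B

  labelLength-bounded : ∃[ C ] (∀ n f F → 1 ≤ F → f ≤ F → 2 ≤ n → labelLength n f ≤ C * (F ^ 7 * ⌊log₂ n ⌋ ^ 13))
  labelLength-bounded = proj₁ bound-exists * 2 ^ 12 , final
    where
    module _ (n f F : ℕ) (1≤F : 1 ≤ F) (f≤F : f ≤ F) (2≤n : 2 ≤ n) where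
      ℓ = ⌊log₂ n ⌋
      1≤ℓ : 1 ≤ ℓ
      1≤ℓ = ≤-trans (≤-reflexive (sym (⌊log₂[2^n]⌋≡n 1))) (⌊log₂⌋-mono-≤ 2≤n)
      n<2^ : n < 2 ^ suc ℓ
      n<2^ = ≰⇒> (λ h → <-irrefl refl (≤-trans (≤-reflexive (sym (⌊log₂[2^n]⌋≡n (suc ℓ)))) (⌊log₂⌋-mono-≤ h)))
      -- The bit length of `n` is at most `ℓ + 1`, and `ℓ` is positive as `2 ≤ n`. The factor 2 is
      -- the origin of `2 ^ 12` in the constant.
      B = 2 * ℓ
      sucℓ≤ : suc ℓ ≤ B
      sucℓ≤ = +-mono-≤ 1≤ℓ (≤-reflexive (sym (+-identityʳ ℓ)))
      rearrange : ∀ c p q r → c * (p * (q * r)) ≡ c * q * (p * r)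
      rearrange = solve-∀
      pow-distrib : ∀ k → (2 * ℓ) ^ k ≡ 2 ^ k * ℓ ^ k
      pow-distrib zero = refl
      pow-distrib (suc k) = trans (cong (2 * ℓ *_) (pow-distrib k)) (swap 2 ℓ (2 ^ k) (ℓ ^ k))
        where swap : ∀ a l p q → a * l * (p * q) ≡ a * p * (l * q)
              swap = solve-∀
      ^13 : ∀ x k → 1 ≤ x → x ^ k ≤ x ^ suc k
      ^13 x k h = m≤n*m (x ^ k) x {{>-nonZero h}}
      expand : ∀ c → c * (F ^ 6 * B ^ 12) ≤ c * 2 ^ 12 * (F ^ 7 * ℓ ^ 13)
      expand c = ≤-trans (≤-reflexive (trans (cong (λ t → c * (F ^ 6 * t)) (pow-distrib 12)) (rearrange c (F ^ 6) (2 ^ 12) (ℓ ^ 12))))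
        (*-monoʳ-≤ (c * 2 ^ 12) (*-mono-≤ (^13 F 6 1≤F) (^13 ℓ 12 1≤ℓ)))
      final : labelLength n f ≤ proj₁ bound-exists * 2 ^ 12 * (F ^ 7 * ℓ ^ 13)
      final = ≤-trans (x≤ (proj₂ bound-exists {F} {B} {n} {f} 1≤F (≤-trans (s≤s z≤n) sucℓ≤) f≤F (≤-trans (blog-min n (suc ℓ) n<2^) sucℓ≤) (<-≤-trans n<2^ (^-monoʳ-≤ 2 sucℓ≤))))
                      (expand (proj₁ bound-exists))

-- Words of symbols as lists of numbers

module Codes where

  open import Defs hiding (sym)
  open Macros
  open Arithmetic
  open LabelLayout using (radix<)
  open import Data.Bool using (Bool; true; false)
  open import Data.Digit using (toDigits; fromDigits)
  open import Data.Fin as Fin using (Fin; zero; suc; toℕ)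
  open import Data.Fin.Properties using (2↔Bool)
  open import Data.List using (List; []; _∷_; _++_; length; map; tabulate)
  open import Data.List.Properties using (map-++; ++-assoc; length-++)
  import Data.List.Membership.Propositional as List
  open import Data.List.Relation.Unary.All using (All; []; _∷_)
  open import Data.List.Relation.Unary.Any using (here; there)
  open import Data.Sum using (inj₁; inj₂)
  open import Function using (Inverse; _∘_)

  bitval : Bool → ℕ
  bitval false = 0
  bitval true  = 1

  codeOf : Symbol → ℕ
  codeOf blank   = 0
  codeOf sep     = 1
  codeOf (bit b) = 2 + bitval b

  codes : List Symbol → List ℕ
  codes = map codeOf

  bool : ℕ → Bool
  bool zero    = false
  bool (suc _) = true

  bitval-bool : ∀ {x} → x ≤ 1 → bitval (bool x) ≡ x
  bitval-bool {0} _ = refl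
  bitval-bool {1} _ = refl
  bitval-bool {suc (suc _)} (s≤s ())

  tabOnto-++ : ∀ n f l → tabOnto n f l ≡ tab n f ++ l
  tabOnto-++ zero    f l = refl
  tabOnto-++ (suc n) f l = trans (tabOnto-++ n f (f n ∷ l)) (trans (sym (++-assoc (tab n f) (f n ∷ []) l)) (cong (_++ l) (sym (tabOnto-++ n f (f n ∷ [])))))

  tab-+ : ∀ m n f → tab (m + n) f ≡ tab m f ++ tab n (λ i → f (m + i))
  tab-+ m zero    f = trans (cong (λ k → tab k f) (+-identityʳ m)) (++-[] (tab m f))
    where ++-[] : ∀ (l : List ℕ) → l ≡ l ++ []
          ++-[] [] = refl
          ++-[] (x ∷ l) = cong (x ∷_) (++-[] l)
  tab-+ m (suc n) f = begin
    tab (m + suc n) f                                                ≡⟨ cong (λ k → tab k f) (+-suc m n) ⟩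
    tabOnto (m + n) f (f (m + n) ∷ [])                               ≡⟨ tabOnto-++ (m + n) f _ ⟩
    tab (m + n) f ++ (f (m + n) ∷ [])                                ≡⟨ cong (_++ (f (m + n) ∷ [])) (tab-+ m n f) ⟩
    (tab m f ++ tab n (λ i → f (m + i))) ++ (f (m + n) ∷ [])         ≡⟨ ++-assoc (tab m f) _ _ ⟩
    tab m f ++ (tab n (λ i → f (m + i)) ++ (f (m + n) ∷ []))         ≡⟨ cong (tab m f ++_) (sym (tabOnto-++ n _ _)) ⟩
    tab m f ++ tab (suc n) (λ i → f (m + i))                         ∎
    where open ≡-Reasoning

  map-tab : ∀ {A : Set} (φ : ℕ → A) n f l → map φ (tabOnto n f l) ≡ map φ (tab n f) ++ map φ l
  map-tab φ n f l = trans (cong (map φ) (tabOnto-++ n f l)) (map-++ φ (tab n f) l)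

  labelWord : ℕ → (ℕ → ℕ) → List Bool
  labelWord k g = map bool (tab k g)

  map∘map-tab : ∀ (φ : ℕ → ℕ) (ψ : Bool → ℕ) k g → (∀ r → r < k → ψ (bool (g r)) ≡ φ (g r)) → map ψ (labelWord k g) ≡ tab k (φ ∘ g)
  map∘map-tab φ ψ zero g h = refl
  map∘map-tab φ ψ (suc k) g h = begin
    map ψ (map bool (tabOnto k g (g k ∷ [])))            ≡⟨ cong (map ψ) (map-tab bool k g (g k ∷ [])) ⟩
    map ψ (map bool (tab k g) ++ bool (g k) ∷ [])        ≡⟨ map-++ ψ (map bool (tab k g)) _ ⟩
    map ψ (map bool (tab k g)) ++ ψ (bool (g k)) ∷ []    ≡⟨ cong₂ (λ l x → l ++ x ∷ []) (map∘map-tab φ ψ k g (λ r l → h r (m<n⇒m<1+n l))) (h k ≤-refl) ⟩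
    tab k (φ ∘ g) ++ φ (g k) ∷ []                        ≡⟨ sym (tabOnto-++ k (φ ∘ g) _) ⟩
    tab (suc k) (φ ∘ g)                                  ∎
    where open ≡-Reasoning

  map-map : ∀ w → map codeOf (map bit w) ≡ map (λ b → 2 + bitval b) w
  map-map [] = refl
  map-map (b ∷ w) = cong (2 + bitval b ∷_) (map-map w)

  length-labelWord : ∀ k g → length (labelWord k g) ≡ k
  length-labelWord k g = trans (len-map (tab k g)) (length-tab k g)
    where len-map : ∀ l → length (map bool l) ≡ length l
          len-map [] = refl
          len-map (x ∷ l) = cong suc (len-map l)

  codes-word : ∀ k g → (∀ r → g r ≤ 1) → codes (encodeWord (labelWord k g)) ≡ tab (suc k) (λ r → ifz (lt r k) 1 (2 + g r))
  codes-word k g g≤1 = begin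
    codes (map bit (labelWord k g) ++ sep ∷ [])                     ≡⟨ map-++ codeOf (map bit (labelWord k g)) _ ⟩
    codes (map bit (labelWord k g)) ++ 1 ∷ []                       ≡⟨ cong (_++ 1 ∷ []) (trans (map-map (labelWord k g)) (map∘map-tab (2 +_) (λ b → 2 + bitval b) k g (λ r _ → cong (2 +_) (bitval-bool (g≤1 r))))) ⟩
    tab k (λ r → 2 + g r) ++ 1 ∷ []                                 ≡⟨ cong₂ (λ l x → l ++ x ∷ []) (tab-cong k (λ r l → sym (cong (λ t → ifz t 1 (2 + g r)) (le-val {suc r} l))))
                                                                         (sym (cong (λ t → ifz t 1 (2 + g k)) (le-val0 {suc k} {k} ≤-refl))) ⟩
    tab k c ++ c k ∷ []                                             ≡⟨ sym (tabOnto-++ k c _) ⟩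
    tab (suc k) c                                                   ∎
    where open ≡-Reasoning
          c = λ r → ifz (lt r k) 1 (2 + g r)

  codes-words : ∀ n k (W : ℕ → List Bool) (c : ℕ → ℕ → ℕ) → (∀ v → codes (encodeWord (W v)) ≡ tab (suc k) (c v)) →
                codes (encodeWords (tabulate {n = n} (W ∘ toℕ))) ≡ tab (n * suc k) (λ i → c (quo i (suc k)) (rem i (suc k)))
  codes-words zero k W c h = refl
  codes-words (suc n) k W c h = begin
    codes (encodeWord (W 0) ++ encodeWords (tabulate {n = n} (W ∘ suc ∘ toℕ)))          ≡⟨ map-++ codeOf (encodeWord (W 0)) _ ⟩
    codes (encodeWord (W 0)) ++ codes (encodeWords (tabulate {n = n} (W ∘ suc ∘ toℕ)))  ≡⟨ cong₂ _++_ (h 0) (codes-words n k (W ∘ suc) (c ∘ suc) (h ∘ suc)) ⟩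
    tab (suc k) (c 0) ++ tab (n * suc k) (λ i → c (suc (quo i s)) (rem i s))    ≡⟨ cong₂ _++_ (tab-cong (suc k) first) (tab-cong (n * suc k) later) ⟩
    tab (suc k) F ++ tab (n * suc k) (λ i → F (suc k + i))                      ≡⟨ sym (tab-+ (suc k) (n * suc k) F) ⟩
    tab (suc n * suc k) F                                                       ∎
    where
    open ≡-Reasoning
    s = suc k
    F = λ i → c (quo i s) (rem i s)
    first : ∀ r → r < s → c 0 r ≡ F r
    first r l = sym (cong₂ c (quo-unique 0 r s l) (rem-unique 0 r s l))
    later : ∀ i → i < n * s → c (suc (quo i s)) (rem i s) ≡ F (s + i)
    later i _ = sym (cong₂ c (trans (cong (λ t → quo t s) e) (quo-unique (suc (quo i s)) (rem i s) s r<)) (trans (cong (λ t → rem t s) e) (rem-unique (suc (quo i s)) (rem i s) s r<)))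
      where r< = rem-< i s (s≤s z≤n)
            e : s + i ≡ suc (quo i s) * s + rem i s
            e = trans (cong (s +_) (quo-rem i s (s≤s z≤n))) (sym (+-assoc s (quo i s * s) (rem i s)))

  -- Positions in lists

  data At {A : Set} : List A → ℕ → A → Set where
    here  : ∀ {x xs} → At (x ∷ xs) 0 x
    there : ∀ {x xs i y} → At xs i y → At (x ∷ xs) (suc i) y

  At-tabulate : ∀ {A : Set} {n} (h : Fin n → A) u → At (tabulate h) (toℕ u) (h u)
  At-tabulate h zero    = here
  At-tabulate h (suc u) = there (At-tabulate (h ∘ suc) u)

  At-< : ∀ {A : Set} {xs : List A} {i x} → At xs i x → i < length xs
  At-< here      = s≤s z≤n
  At-< (there a) = s≤s (At-< a)

  At-total : ∀ {A : Set} (xs : List A) i → i < length xs → ∃[ x ] At xs i x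
  At-total (x ∷ xs) zero    l       = x , here
  At-total (x ∷ xs) (suc i) (s≤s l) = let y , a = At-total xs i l in y , there a

  At-∈ : ∀ {A : Set} {xs : List A} {i x} → At xs i x → x List.∈ xs
  At-∈ here      = here refl
  At-∈ (there a) = there (At-∈ a)

  ∈-At : ∀ {A : Set} {xs : List A} {x} → x List.∈ xs → ∃[ i ] At xs i x
  ∈-At (here refl) = 0 , here
  ∈-At (there p)   = let i , a = ∈-At p in suc i , there a

  ++-!ˡ : ∀ (l : List ℕ) {l′ i} → i < length l → (l ++ l′) ! i ≡ l ! i
  ++-!ˡ (x ∷ l) {i = zero}  _       = refl
  ++-!ˡ (x ∷ l) {i = suc i} (s≤s h) = ++-!ˡ l h

  ++-!ʳ : ∀ (l : List ℕ) {l′} i → (l ++ l′) ! (length l + i) ≡ l′ ! i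
  ++-!ʳ []      i = refl
  ++-!ʳ (x ∷ l) i = ++-!ʳ l i

  length-codes : ∀ w → length (codes (encodeWord w)) ≡ suc (length w)
  length-codes []      = refl
  length-codes (b ∷ w) = cong suc (length-codes w)

  length-words : ∀ ws k rest → All (λ w → length w ≡ k) ws → length (codes (encodeWords ws) ++ rest) ≡ length ws * suc k + length rest
  length-words [] k rest [] = refl
  length-words (w ∷ ws) k rest (refl ∷ h) = begin
    length (codes (encodeWord w ++ encodeWords ws) ++ rest)                  ≡⟨ cong (λ l → length (l ++ rest)) (map-++ codeOf (encodeWord w) (encodeWords ws)) ⟩
    length ((codes (encodeWord w) ++ codes (encodeWords ws)) ++ rest)        ≡⟨ cong length (++-assoc (codes (encodeWord w)) _ rest) ⟩
    length (codes (encodeWord w) ++ (codes (encodeWords ws) ++ rest))        ≡⟨ length-++ (codes (encodeWord w)) ⟩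
    length (codes (encodeWord w)) + length (codes (encodeWords ws) ++ rest)  ≡⟨ cong₂ _+_ (length-codes w) (length-words ws (length w) rest h) ⟩
    suc (length w) + (length ws * suc (length w) + length rest)              ≡⟨ sym (+-assoc (suc (length w)) _ _) ⟩
    suc (length ws) * suc (length w) + length rest                           ∎
    where open ≡-Reasoning

  words-! : ∀ ws k rest → All (λ w → length w ≡ k) ws → ∀ {i w r} → At ws i w → r < suc k →
            (codes (encodeWords ws) ++ rest) ! (i * suc k + r) ≡ codes (encodeWord w) ! r
  words-! (w ∷ ws) k rest (refl ∷ h) {r = r} here l =
    trans (cong (λ x → x ! r) (trans (cong (_++ rest) (map-++ codeOf (encodeWord w) (encodeWords ws))) (++-assoc (codes (encodeWord w)) _ rest)))
          (++-!ˡ (codes (encodeWord w)) (≤-trans l (≤-reflexive (sym (length-codes w)))))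
  words-! (w ∷ ws) k rest (refl ∷ h) {suc i} {w′} {r} (there a) l =
    trans (cong₂ _!_ (trans (cong (_++ rest) (map-++ codeOf (encodeWord w) (encodeWords ws))) (++-assoc (codes (encodeWord w)) _ rest))
                     (trans (+-assoc (suc k) (i * suc k) r) (cong (_+ (i * suc k + r)) (sym (length-codes w)))))
          (trans (++-!ʳ (codes (encodeWord w)) (i * suc k + r)) (words-! ws k rest h a l))

  words-rest : ∀ ws k rest → All (λ w → length w ≡ k) ws → ∀ i → (codes (encodeWords ws) ++ rest) ! (length ws * suc k + i) ≡ rest ! i
  words-rest ws k rest h i = trans (cong (λ t → (codes (encodeWords ws) ++ rest) ! (t + i)) len) (++-!ʳ (codes (encodeWords ws)) i)
    where len : length ws * suc k ≡ length (codes (encodeWords ws))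
          len = +-cancelʳ-≡ (length rest) _ _ (trans (sym (length-words ws k rest h)) (length-++ (codes (encodeWords ws))))

  word-! : ∀ {w r x} → At w r x → codes (encodeWord w) ! r ≡ 2 + bitval x
  word-! here      = refl
  word-! (there a) = word-! a

  -- Every word ends with one separator and contains no other, so the `n` rows and the word for `f`
  -- have `n + 1` of them.
  seps : List ℕ → ℕ
  seps l = Σ< (length l) (λ i → eq (l ! i) 1)

  seps-∷ : ∀ x l → seps (x ∷ l) ≡ eq x 1 + seps l
  seps-∷ x l = Σ-split 1 (length l) (λ i → eq ((x ∷ l) ! i) 1)

  seps-words : ∀ ws rest → seps (codes (encodeWords ws) ++ rest) ≡ length ws + seps rest
  seps-words [] rest = refl
  seps-words ([] ∷ ws) rest = trans (seps-∷ 1 (codes (encodeWords ws) ++ rest)) (cong suc (seps-words ws rest))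
  seps-words ((b ∷ w) ∷ ws) rest = trans (seps-∷ (2 + bitval b) (codes (encodeWords (w ∷ ws)) ++ rest)) (trans (cong (_+ seps (codes (encodeWords (w ∷ ws)) ++ rest)) (nosep b)) (seps-words (w ∷ ws) rest))
    where nosep : ∀ b → eq (2 + bitval b) 1 ≡ 0
          nosep false = refl
          nosep true = refl

  -- Binary numbers, truncated at n so that their unary representation stays short

  cut : ℕ → ℕ → ℕ
  cut n x = ifz (le x n) n x

  cut-⊓ : ∀ n x → cut n x ≡ n ⊓ x
  cut-⊓ n x with ≤-total x n
  ... | inj₁ l = trans (cong (λ t → ifz t n x) (le-val l)) (sym (m≥n⇒m⊓n≡n l))
  ... | inj₂ l with m≤n⇒m<n∨m≡n l
  ...   | inj₁ n<x = trans (cong (λ t → ifz t n x) (le-val0 n<x)) (sym (m≤n⇒m⊓n≡m l))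
  ...   | inj₂ refl = trans (cong (λ t → ifz t n n) (le-val (≤-refl {n}))) (sym (⊓-idem n))

  cut≤ : ∀ n x → cut n x ≤ n
  cut≤ n x = ≤-trans (≤-reflexive (cut-⊓ n x)) (m⊓n≤m n x)

  doubled : ℕ → ℕ → ℕ → ℕ
  doubled n i y = it i (λ y → cut n (y + y)) y

  decimal : List Bool → ℕ
  decimal []       = 0
  decimal (b ∷ bs) = bitval b + decimal bs * 2

  ⊓-absorb : ∀ n a s → n ⊓ ((n ⊓ a) + s) ≡ n ⊓ (a + s)
  ⊓-absorb n a s with ≤-total a n
  ... | inj₁ l = cong (λ t → n ⊓ (t + s)) (m≥n⇒m⊓n≡n l)
  ... | inj₂ l = trans (cong (λ t → n ⊓ (t + s)) (m≤n⇒m⊓n≡m l)) (trans (m≤n⇒m⊓n≡m (m≤m+n n s)) (sym (m≤n⇒m⊓n≡m (≤-trans l (m≤m+n a s)))))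

  ⊓-absorbʳ : ∀ n a s → n ⊓ (a + (n ⊓ s)) ≡ n ⊓ (a + s)
  ⊓-absorbʳ n a s = trans (cong (n ⊓_) (+-comm a (n ⊓ s))) (trans (⊓-absorb n s a) (cong (n ⊓_) (+-comm s a)))

  -- Truncating the powers of two and the partial sums does not affect the minimum of the total with
  -- `n`. The number itself could be exponential in the length of the input.
  truncated : ∀ n bs y (D : ℕ → ℕ) → (∀ {i x} → At bs i x → D i ≡ bitval x) →
              n ⊓ Σ< (length bs) (λ i → D i * doubled n i (cut n y)) ≡ n ⊓ (decimal bs * y)
  truncated n [] y D h = refl
  truncated n (b ∷ bs) y D h = begin
    n ⊓ Σ< (1 + length bs) (λ i → D i * doubled n i (cut n y))         ≡⟨ cong (n ⊓_) (Σ-split 1 (length bs) _) ⟩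
    n ⊓ (D 0 * cut n y + Σ< (length bs) (λ i → D (suc i) * doubled n (suc i) (cut n y)))
                                                                        ≡⟨ cong₂ (λ s t → n ⊓ (s * t + Σ< (length bs) (λ i → D (suc i) * doubled n (suc i) (cut n y)))) (h here) (cut-⊓ n y) ⟩
    n ⊓ (bitval b * (n ⊓ y) + S)                                        ≡⟨ sym (⊓-absorbʳ n _ S) ⟩
    n ⊓ (bitval b * (n ⊓ y) + (n ⊓ S))                                  ≡⟨ cong (λ t → n ⊓ (bitval b * (n ⊓ y) + t)) ih ⟩
    n ⊓ (bitval b * (n ⊓ y) + (n ⊓ (decimal bs * (y + y))))             ≡⟨ ⊓-absorbʳ n _ _ ⟩
    n ⊓ (bitval b * (n ⊓ y) + decimal bs * (y + y))                     ≡⟨ digit b ⟩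
    n ⊓ (bitval b * y + decimal bs * (y + y))                           ≡⟨ cong (n ⊓_) (arith (bitval b) (decimal bs) y) ⟩
    n ⊓ ((bitval b + decimal bs * 2) * y)                               ∎
    where
    open ≡-Reasoning
    open import Data.Nat.Tactic.RingSolver using (solve-∀)
    S = Σ< (length bs) (λ i → D (suc i) * doubled n (suc i) (cut n y))
    double-cut : cut n (cut n y + cut n y) ≡ cut n (y + y)
    double-cut = trans (cut-⊓ n _) (trans (cong (λ t → n ⊓ (t + t)) (cut-⊓ n y)) (trans (⊓-absorb n y (n ⊓ y)) (trans (⊓-absorbʳ n y y) (sym (cut-⊓ n (y + y))))))
    ih : n ⊓ S ≡ n ⊓ (decimal bs * (y + y))
    ih = trans (cong (n ⊓_) (Σ-cong (length bs) (λ i _ → cong (λ t → D (suc i) * it i (λ y → cut n (y + y)) t) double-cut)))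
               (truncated n bs (y + y) (D ∘ suc) (λ a → h (there a)))
    digit : ∀ b → n ⊓ (bitval b * (n ⊓ y) + decimal bs * (y + y)) ≡ n ⊓ (bitval b * y + decimal bs * (y + y))
    digit false = refl
    digit true  = trans (cong (λ t → n ⊓ (t + decimal bs * (y + y))) (*-identityˡ (n ⊓ y)))
      (trans (⊓-absorb n y _) (cong (λ t → n ⊓ (t + decimal bs * (y + y))) (sym (*-identityˡ y))))
    arith : ∀ d e y → d * y + e * (y + y) ≡ (d + e * 2) * y
    arith = solve-∀

  decimal-binary : ∀ m → decimal (binary m) ≡ m
  decimal-binary m = trans (go (proj₁ (toDigits 2 m))) (proj₂ (toDigits 2 m))
    where
    go : ∀ ds → decimal (map (Inverse.to 2↔Bool) ds) ≡ fromDigits ds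
    go [] = refl
    go (zero ∷ ds) = cong (_* 2) (go ds)
    go (suc zero ∷ ds) = cong (λ t → suc (t * 2)) (go ds)

-- Expressions for the labeling and for the search

module SchemePrograms where

  open Macros
  open Expressions
  open Arithmetic
  open Hierarchy
  open Labels
  open HierarchyPrograms
  open Sizes
  open LabelLayout
  open SizePrograms
  open LayoutPrograms
  open Queries
  open Codes
  open import Data.List using (List; []; _∷_; length)

  size# : List ℕ → ℕ
  size# X = seps X ∸ 1

  -- The code 3 is the bit 1, and each row occupies `n + 1` cells because of its separator.
  matrix : List ℕ → ℕ → List ℕ
  matrix X n = tab (n * n) (λ i → eq (X ! (quo i n * suc n + rem i n)) 3)

  faults# : List ℕ → ℕ → ℕ
  faults# X n = cut n (Σ< (length X ∸ suc (n * suc n)) (λ i → (X ! (n * suc n + i) ∸ 2) * doubled n i (cut n 1)))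

  opaque
    labels : ℕ → ℕ → List ℕ → List ℕ
    labels n f A = tab (n * suc (labelLength n f)) (λ i → Label.labelCode n f A (quo i (suc (labelLength n f))) (rem i (suc (labelLength n f))))

    labels-def : ∀ n f A → labels n f A ≡ tab (n * suc (labelLength n f)) (λ i → Label.labelCode n f A (quo i (suc (labelLength n f))) (rem i (suc (labelLength n f))))
    labels-def n f A = refl

  -- The bits of `c` run through all bit matrices; `adjm` symmetrises, so that every one of them
  -- describes an adjacency relation.
  graph : ℕ → ℕ → List ℕ
  graph n c = tab (n * n) (λ i → rem (shr c i) 2)

  opaque
    -- `found` tests whether an instance with all parameters below `m` explains the query, and
    -- `answer` whether such an instance connects the query vertices; by `consistent` the choice of
    -- the instance does not matter.
    found answer : ℕ → List ℕ → ℕ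
    found m Q = Σ< m (λ n → Σ< m (λ f → Σ< m (λ c → Query.explains n f (graph n c) Q)))
    answer m Q = Σ< m (λ n → Σ< m (λ f → Σ< m (λ c → Query.explains n f (graph n c) Q * Query.connected n f (graph n c) Q)))

    found-def : ∀ m Q → found m Q ≡ Σ< m (λ n → Σ< m (λ f → Σ< m (λ c → Query.explains n f (graph n c) Q)))
    found-def m Q = refl

    answer-def : ∀ m Q → answer m Q ≡ Σ< m (λ n → Σ< m (λ f → Σ< m (λ c → Query.explains n f (graph n c) Q * Query.connected n f (graph n c) Q)))
    answer-def m Q = refl

  cut₀ : Exp (nat ∷ nat ∷ []) nat (λ (n , x , _) → cut n x)
  cut₀ = cond (leE v1 v0) v0 v1

  doubled₀ : Exp (nat ∷ nat ∷ []) nat (λ (n , i , _) → doubled n i (cut n 1))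
  doubled₀ = iterN (λ (n , i , _) → cut n 1) (λ y (n , i , _) → cut n (y + y)) v1 (app cut₀ (v1 ∷ lit 1 ∷ []))
    (app cut₀ (v2 ∷ add (get v1 zer) (get v1 zer) ∷ [])) v0
    (λ (n , i , _) t → it-inv (λ y → y ≤ n) (λ y _ → cut≤ n (y + y)) t (cut n 1) (cut≤ n 1))

  size₀ : Exp (arr ∷ []) nat (λ (X , _) → size# X)
  size₀ = sub (sum (len v0) (eqE (get v1 v0) (lit 1))) (lit 1)

  matrix₀ : Exp (arr ∷ nat ∷ []) arr (λ (X , n , _) → matrix X n)
  matrix₀ = tabu (mulE v1 v1) (eqE (get v1 (add (mulE (quoE v0 v2) (inc v2)) (remE v0 v2))) (lit 3))

  faults₀ : Exp (arr ∷ nat ∷ []) nat (λ (X , n , _) → faults# X n)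
  faults₀ = app cut₀ (v1 ∷ sum (sub (len v0) (inc (mulE v1 (inc v1))))
    (mulE (sub (get v1 (add (mulE v2 (inc v2)) v0)) (lit 2)) (app doubled₀ (v2 ∷ v0 ∷ []))) ∷ [])

  labels₀ : Exp (nat ∷ nat ∷ arr ∷ []) arr (λ (n , f , A , _) → labels n f A)
  labels₀ = conv (tabu (mulE v0 (inc (app labelLength₀ (v0 ∷ v1 ∷ []))))
    (app labelCode₀ (quoE v0 s ∷ remE v0 s ∷ v1 ∷ v2 ∷ v3 ∷ []))) (λ (n , f , A , _) → sym (labels-def n f A))
    where s : Exp (nat ∷ nat ∷ nat ∷ arr ∷ []) nat (λ (i , n , f , A , _) → suc (labelLength n f))
          s = inc (app labelLength₀ (v1 ∷ v2 ∷ []))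

  labeler₀ : Exp (arr ∷ []) arr (λ (X , _) → labels (size# X) (faults# X (size# X)) (matrix X (size# X)))
  labeler₀ = app labels₀ (size₀ ∷ app faults₀ (v0 ∷ size₀ ∷ []) ∷ app matrix₀ (v0 ∷ size₀ ∷ []) ∷ [])

  match₀ : Exp (nat ∷ nat ∷ nat ∷ nat ∷ arr ∷ arr ∷ []) nat (λ (i , v , n , f , A , Q , _) → Query.match n f A Q i v)
  match₀ = conv (iszE (sum s (iszE (eqE (get v6 (add (mulE v1 s′) v0)) (app labelCode₀ (v2 ∷ v0 ∷ v3 ∷ v4 ∷ v5 ∷ []))))))
    (λ (i , v , n , f , A , Q , _) → sym (Query.match-def n f A Q i v))
    where s : Exp (nat ∷ nat ∷ nat ∷ nat ∷ arr ∷ arr ∷ []) nat (λ (i , v , n , f , A , Q , _) → suc (labelLength n f))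
          s = inc (app labelLength₀ (v2 ∷ v3 ∷ []))
          s′ : Exp (nat ∷ nat ∷ nat ∷ nat ∷ nat ∷ arr ∷ arr ∷ []) nat (λ (r , i , v , n , f , A , Q , _) → suc (labelLength n f))
          s′ = inc (app labelLength₀ (v3 ∷ v4 ∷ []))

  words₀ : Exp (nat ∷ nat ∷ arr ∷ arr ∷ []) nat (λ (n , f , A , Q , _) → Query.words n f A Q)
  words₀ = quoE (len v3) (inc (app labelLength₀ (v0 ∷ v1 ∷ [])))

  alive₀ : Exp (nat ∷ nat ∷ arr ∷ arr ∷ []) arr (λ (n , f , A , Q , _) → Query.alive# n f A Q)
  alive₀ = conv (tabu v0 (iszE (sum (sub (app words₀ (v1 ∷ v2 ∷ v3 ∷ v4 ∷ [])) (lit 2))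
      (app match₀ (add (lit 2) v0 ∷ v1 ∷ v2 ∷ v3 ∷ v4 ∷ v5 ∷ [])))))
    (λ (n , f , A , Q , _) → sym (Query.alive#-def n f A Q))

  explains₀ : Exp (nat ∷ nat ∷ arr ∷ arr ∷ []) nat (λ (n , f , A , Q , _) → Query.explains n f A Q)
  explains₀ = mulE (leE (lit 2) w) (mulE (eqE (mulE w (inc (app labelLength₀ (v0 ∷ v1 ∷ [])))) (len v3)) (mulE (leE v1 v0)
    (mulE (iszE (sum w (iszE (sum v1 (app match₀ (v1 ∷ v0 ∷ v2 ∷ v3 ∷ v4 ∷ v5 ∷ []))))))
      (leE (sum v0 (iszE (get (app alive₀ (v1 ∷ v2 ∷ v3 ∷ v4 ∷ [])) v0))) v1))))
    where w : Exp (nat ∷ nat ∷ arr ∷ arr ∷ []) nat (λ (n , f , A , Q , _) → Query.words n f A Q)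
          w = app words₀ (v0 ∷ v1 ∷ v2 ∷ v3 ∷ [])

  connected₀ : Exp (nat ∷ nat ∷ arr ∷ arr ∷ []) nat (λ (n , f , A , Q , _) → Query.connected n f A Q)
  connected₀ = app both (v0 ∷ v1 ∷ v2 ∷ v3 ∷ app alive₀ (v0 ∷ v1 ∷ v2 ∷ v3 ∷ []) ∷ [])
    where
    both : Exp (nat ∷ nat ∷ arr ∷ arr ∷ arr ∷ []) nat (λ (n , f , A , Q , U , _) →
      Σ< n (λ s → Query.match n f A Q 0 s * (U ! s * Σ< n (λ t → Query.match n f A Q 1 t * (U ! t * reach n A U s ! t)))))
    both = sum v0 (mulE (app match₀ (zer ∷ v0 ∷ v1 ∷ v2 ∷ v3 ∷ v4 ∷ [])) (mulE (get v5 v0)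
      (sum v1 (mulE (app match₀ (lit 1 ∷ v0 ∷ v2 ∷ v3 ∷ v4 ∷ v5 ∷ [])) (mulE (get v6 v0) (get (app reach₀ (v1 ∷ v6 ∷ v2 ∷ v4 ∷ [])) v0))))))

  graph₀ : Exp (nat ∷ nat ∷ []) arr (λ (n , c , _) → graph n c)
  graph₀ = tabu (mulE v0 v0) (remE (shrE v2 v0) (lit 2))

  found₀ : Exp (nat ∷ arr ∷ []) nat (λ (m , Q , _) → found m Q)
  found₀ = conv (sum v0 (sum v1 (sum v2 (app explains₀ (v2 ∷ v1 ∷ app graph₀ (v2 ∷ v0 ∷ []) ∷ v4 ∷ []))))) (λ (m , Q , _) → sym (found-def m Q))

  answer₀ : Exp (nat ∷ arr ∷ []) nat (λ (m , Q , _) → answer m Q)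
  answer₀ = conv (sum v0 (sum v1 (sum v2 (mulE (app explains₀ (v2 ∷ v1 ∷ app graph₀ (v2 ∷ v0 ∷ []) ∷ v4 ∷ []))
    (app connected₀ (v2 ∷ v1 ∷ app graph₀ (v2 ∷ v0 ∷ []) ∷ v4 ∷ [])))))) (λ (m , Q , _) → sym (answer-def m Q))

-- Machines that evaluate an expression or search for a witness

module Evaluators where

  open import Defs hiding (sym)
  open WhilePrograms
  open Macros
  open Expressions
  open Arithmetic
  open HierarchyPrograms using (iszE)
  open Codes
  open import Data.Bool using (Bool; true; false)
  open import Data.Empty using (⊥-elim)
  open import Data.Fin using (zero; suc)
  open import Data.List using (List; []; _∷_; _++_; length)
  open import Data.Sum using (inj₁; inj₂)
  open import Data.Unit using (tt)
  open import Data.Vec using ([]; _∷_)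

  revSym : Stk → Stk → Stk
  revSym []      y = y
  revSym (a ∷ w) y = revSym w (a ∷ y)

  isSep : Symbol → Bool
  isSep sep = true
  isSep _   = false

  flipX : Prog
  flipX = while 0F noBlank (ifp 0F isSep (pop 0F ▹ push 2F sep) (ifp 0F isOne (pop 0F ▹ push 2F (bit true)) (pop 0F ▹ push 2F (bit false))))

  flipXB : ∀ w {r y} → NonBlank w → flipX ⊢ ⟪ w , r , y ⟫ ⇛ ⟪ [] , r , revSym w y ⟫ ≤ suc (length w * 6)
  flipXB [] [] = whFB refl
  flipXB (sep ∷ w) (_ ∷ nb) = relax (n≤1+n _) (whTB refl (ifTB refl (popB ▸ pushB)) (flipXB w nb))
  flipXB (bit true ∷ w) (_ ∷ nb) = whTB refl (ifFB refl (ifTB refl (popB ▸ pushB))) (flipXB w nb)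
  flipXB (bit false ∷ w) (_ ∷ nb) = whTB refl (ifFB refl (ifFB refl (popB ▸ pushB))) (flipXB w nb)
  flipXB (blank ∷ w) (() ∷ nb)

  flipE : Prog
  flipE = while 2F noBlank (ifp 2F isSep (pop 2F ▹ push 0F sep) (ifp 2F isOne (pop 2F ▹ push 0F (bit true)) (pop 2F ▹ push 0F (bit false))))

  flipEB : ∀ w {e r} → NonBlank w → flipE ⊢ ⟪ e , r , w ⟫ ⇛ ⟪ revSym w e , r , [] ⟫ ≤ suc (length w * 6)
  flipEB [] [] = whFB refl
  flipEB (sep ∷ w) (_ ∷ nb) = relax (n≤1+n _) (whTB refl (ifTB refl (popB ▸ pushB)) (flipEB w nb))
  flipEB (bit true ∷ w) (_ ∷ nb) = whTB refl (ifFB refl (ifTB refl (popB ▸ pushB))) (flipEB w nb)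
  flipEB (bit false ∷ w) (_ ∷ nb) = whTB refl (ifFB refl (ifFB refl (popB ▸ pushB))) (flipEB w nb)
  flipEB (blank ∷ w) (() ∷ nb)

  unary : ℕ → Prog
  unary zero    = push 0F (bit false)
  unary (suc v) = unary v ▹ push 0F (bit true)

  unaryB : ∀ v {l e r y} → unary v ⊢ ⟪ put (word arr l) e , r , y ⟫ ⇛ ⟪ put (word arr (v ∷ l)) e , r , y ⟫ ≤ 2 + v * 2
  unaryB zero = pushB
  unaryB (suc v) {l} = relax (≤-reflexive (+-comm (2 + v * 2) 2)) (unaryB v {l} ▸ pushB)

  pushCodes : Stk → List ℕ → List ℕ
  pushCodes []      l = l
  pushCodes (a ∷ w) l = pushCodes w (codeOf a ∷ l)

  encode : Prog
  encode = while 2F noBlank (ifp 2F isSep (pop 2F ▹ unary 1) (ifp 2F isOne (pop 2F ▹ unary 3) (pop 2F ▹ unary 2)))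

  encodeB : ∀ w {l r} → NonBlank w → encode ⊢ ⟪ put (word arr l) [] , r , w ⟫ ⇛ ⟪ put (word arr (pushCodes w l)) [] , r , [] ⟫ ≤ suc (length w * 12)
  encodeB [] [] = whFB refl
  encodeB (sep ∷ w) {l} (_ ∷ nb) = relax (s≤s (+-monoʳ-≤ 7 (m≤n+m _ 5))) (whTB refl (ifTB refl (popB ▸ unaryB 1 {l})) (encodeB w {1 ∷ l} nb))
  encodeB (bit true ∷ w) {l} (_ ∷ nb) = whTB refl (ifFB refl (ifTB refl (popB ▸ unaryB 3 {l}))) (encodeB w {3 ∷ l} nb)
  encodeB (bit false ∷ w) {l} (_ ∷ nb) = relax (s≤s (+-monoʳ-≤ 10 (m≤n+m _ 2))) (whTB refl (ifFB refl (ifFB refl (popB ▸ unaryB 2 {l}))) (encodeB w {2 ∷ l} nb))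
  encodeB (blank ∷ w) (() ∷ nb)

  pushCodes-rev : ∀ w y l → pushCodes (revSym w y) l ≡ pushCodes y (codes w ++ l)
  pushCodes-rev [] y l = refl
  pushCodes-rev (a ∷ w) y l = pushCodes-rev w (a ∷ y) l

  NonBlank-rev : ∀ {w y} → NonBlank w → NonBlank y → NonBlank (revSym w y)
  NonBlank-rev []       q = q
  NonBlank-rev (p ∷ ps) q = NonBlank-rev ps (p ∷ q)

  length-revSym : ∀ w y → length (revSym w y) ≡ length w + length y
  length-revSym []      y = refl
  length-revSym (a ∷ w) y = trans (length-revSym w (a ∷ y)) (+-suc (length w) (length y))

  length-revSym′ : ∀ w → length (revSym w []) ≡ length w
  length-revSym′ w = trans (length-revSym w []) (+-identityʳ (length w))

  revSym² : ∀ w y z → revSym (revSym w y) z ≡ revSym y (w ++ z)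
  revSym² []      y z = refl
  revSym² (a ∷ w) y z = revSym² w (a ∷ y) z

  ++-nil : ∀ {A : Set} (l : List A) → l ++ [] ≡ l
  ++-nil []      = refl
  ++-nil (x ∷ l) = cong (x ∷_) (++-nil l)

  -- The input is reversed first, because a list is built from its last element.
  readIn : Prog
  readIn = flipX ▹ push 0F sep ▹ encode

  readInB : ∀ w → NonBlank w → readIn ⊢ ⟪ w , [] , [] ⟫ ⇛ ⟪ enc (arr ∷ []) (codes w , tt) [] , [] , [] ⟫ ≤ suc (length w * 6) + (2 + suc (length w * 12))
  readInB w nb = to (cong (λ l → ⟪ put (word arr l) [] , [] , [] ⟫) (trans (pushCodes-rev w [] []) (++-nil (codes w))))
    (flipXB w nb ▸ pushB ▸ relax (≤-reflexive (cong (λ t → suc (t * 12)) (length-revSym′ w))) (encodeB (revSym w []) {l = []} (NonBlank-rev nb [])))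

  decodeR : Prog
  decodeR = while 1F isBit (pop 1F ▹ ifp 1F isOne (pop 1F ▹ ifp 1F isOne (pop 1F ▹ pop 1F ▹ push 2F (bit true)) (pop 1F ▹ push 2F (bit false))) (pop 1F ▹ push 2F sep))

  decodeRB : ∀ w {e y} → NonBlank w → decodeR ⊢ ⟪ e , put (word arr (codes w)) [] , y ⟫ ⇛ ⟪ e , sep ∷ [] , revSym w y ⟫ ≤ suc (length w * 9)
  decodeRB [] [] = whFB refl
  decodeRB (sep ∷ w) (_ ∷ nb) = relax (s≤s (+-monoʳ-≤ 6 (m≤n+m _ 3))) (whTB refl (popB ▸ ifFB refl (popB ▸ pushB)) (decodeRB w nb))
  decodeRB (bit true ∷ w) (_ ∷ nb) = whTB refl (popB ▸ ifTB refl (popB ▸ ifTB refl (popB ▸ popB ▸ pushB))) (decodeRB w nb)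
  decodeRB (bit false ∷ w) (_ ∷ nb) = relax (s≤s (+-monoʳ-≤ 8 (m≤n+m _ 1))) (whTB refl (popB ▸ ifTB refl (popB ▸ ifFB refl (popB ▸ pushB))) (decodeRB w nb))
  decodeRB (blank ∷ w) (() ∷ nb)

  writeOut : Prog
  writeOut = decodeR ▹ flipE

  writeOutB : ∀ w → NonBlank w → writeOut ⊢ ⟪ [] , put (word arr (codes w)) [] , [] ⟫ ⇛ ⟪ w , sep ∷ [] , [] ⟫ ≤ suc (length w * 9) + suc (length w * 6)
  writeOutB w nb = to (cong (λ l → ⟪ l , sep ∷ [] , [] ⟫) (trans (revSym² w [] []) (++-nil w)))
    (decodeRB w nb ▸ relax (≤-reflexive (cong (λ t → suc (t * 6)) (length-revSym′ w))) (flipEB (revSym w []) (NonBlank-rev nb [])))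

  size-codes : ∀ w → size arr (codes w) ≤ length w * 4
  size-codes [] = z≤n
  size-codes (a ∷ w) = ≤-trans (≤-reflexive (size-cons (codeOf a) (codes w))) (+-mono-≤ (s≤s (codeOf≤3 a)) (size-codes w))
    where codeOf≤3 : ∀ a → codeOf a ≤ 3
          codeOf≤3 blank       = z≤n
          codeOf≤3 sep         = s≤s z≤n
          codeOf≤3 (bit false) = s≤s (s≤s z≤n)
          codeOf≤3 (bit true)  = s≤s (s≤s (s≤s z≤n))

  length-map : ∀ w → length (codes w) ≡ length w
  length-map []      = refl
  length-map (a ∷ w) = cong suc (length-map w)

  -- This brings the bound `(2 + N) ^ d` into the form `k + N ^ k`: the summand `3 ^ d` covers
  -- `N ≤ 1`, and `2 + N ≤ N ^ 2` holds from 2 on.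
  poly≤pow : ∀ P N → ev P N ≤ 3 ^ degree P + 2 * degree P + N ^ (3 ^ degree P + 2 * degree P)
  poly≤pow P N = ≤-trans (ev≤pow P N) (go N)
    where
    d = degree P
    k = 3 ^ d + 2 * d
    go : ∀ N → (2 + N) ^ d ≤ k + N ^ k
    go 0 = ≤-trans (^-monoˡ-≤ d {2} {3} (n≤1+n 2)) (≤-trans (m≤m+n (3 ^ d) (2 * d)) (m≤m+n k _))
    go 1 = ≤-trans (m≤m+n (3 ^ d) (2 * d)) (m≤m+n k _)
    go N@(suc (suc N′)) = ≤-trans (^-monoˡ-≤ d 2+N≤) (≤-trans (≤-reflexive (^-*-assoc N 2 d)) (≤-trans (^-monoʳ-≤ N (m≤n+m (2 * d) (3 ^ d))) (m≤n+m (N ^ k) k)))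
      where 2+N≤ : 2 + N ≤ N ^ 2
            2+N≤ = ≤-trans (+-monoˡ-≤ N (s≤s (s≤s z≤n))) (≤-trans (≤-reflexive (cong (N +_) (sym (+-identityʳ N)))) (≤-trans (*-monoˡ-≤ N {2} {N} (s≤s (s≤s z≤n))) (≤-reflexive (cong (N *_) (sym (*-identityʳ N))))))

  module _ {F} (e : Exp (arr ∷ []) arr F) where

    evaluator : Prog
    evaluator = readIn ▹ prog e ▹ drop 0F ▹ writeOut

    private
      S O P : Poly
      -- A symbol takes at most four bits in the environment, since its code is at most 3. `S`
      -- bounds the environment, `O` the output and `P` the whole run.
      S = con 1 ⊕ idn ⊗ con 4
      O = V e ⊚ S
      P = (con 1 ⊕ idn ⊗ con 6 ⊕ (con 2 ⊕ (con 1 ⊕ idn ⊗ con 12))) ⊕ (T e ⊚ S ⊕ ((con 1 ⊕ S ⊗ con 2 ⊕ con 1) ⊕ ((con 1 ⊕ O ⊗ con 9) ⊕ (con 1 ⊕ O ⊗ con 6))))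

    evaluator-computes : ∃[ k ] (∀ xs ys → NonBlank xs → NonBlank ys → F (codes xs , tt) ≡ codes ys →
                                 Computes (machine evaluator) (k + length xs ^ k) xs ys)
    evaluator-computes = 3 ^ degree P + 2 * degree P , λ xs ys nx ny eqn → run′ xs ys nx ny eqn
      where
      run′ : ∀ xs ys → NonBlank xs → NonBlank ys → F (codes xs , tt) ≡ codes ys →
             Computes (machine evaluator) (3 ^ degree P + 2 * degree P + length xs ^ (3 ^ degree P + 2 * degree P)) xs ys
      run′ xs ys nx ny eqn = computes (_⊢_⇛_≤_.deriv d) refl ny (≤-trans (_⊢_⇛_≤_.bound d) (poly≤pow P (length xs)))
        where
        N = length xs
        γ = codes xs , tt
        env≤ : sizeE (arr ∷ []) γ ≤ ev S N
        env≤ = ≤-trans (≤-reflexive (+-identityʳ _)) (s≤s (size-codes xs))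
        out≤ : length ys ≤ ev O N
        out≤ = ≤-trans (≤-reflexive (sym (length-map ys))) (≤-trans (length≤size (codes ys))
          (≤-trans (≤-reflexive (cong (size arr) (sym eqn))) (≤-trans (val e γ) (ev-mono (V e) env≤))))
        d : evaluator ⊢ ⟪ xs , [] , [] ⟫ ⇛ ⟪ ys , sep ∷ [] , [] ⟫ ≤ ev P N
        d = readInB xs nx ▸ relax (ev-mono (T e) env≤) (to (cong (λ l → ⟪ enc (arr ∷ []) γ [] , put (word arr l) [] , [] ⟫) eqn) (correct e γ {[]} {[]})) ▸
            relax (+-monoˡ-≤ 1 (s≤s (*-monoˡ-≤ 2 (≤-trans (≤-trans (n≤1+n _) (≤-reflexive (sym (+-identityʳ _)))) env≤)))) (dropE (word arr (codes xs))) ▸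
            relax (+-mono-≤ (s≤s (*-monoˡ-≤ 9 out≤)) (s≤s (*-monoˡ-≤ 6 out≤))) (writeOutB ys ny)

  module _ {F G} (e : Exp (nat ∷ arr ∷ []) nat F) (e′ : Exp (nat ∷ arr ∷ []) nat G) where

    -- The bound `m` on top of the environment grows by one until `e` becomes positive, and then
    -- `e′` is evaluated for the same `m`. The search stops because some `K` is known to succeed.
    searcher : Prog
    searcher = readIn ▹ push 0F sep ▹ prog (iszE e) ▹ while 1F isOne (drop 1F ▹ push 0F (bit true) ▹ prog (iszE e)) ▹ drop 1F ▹
               prog e′ ▹ drop 0F ▹ drop 0F ▹ ifp 1F isOne (push 0F (bit true)) (push 0F (bit false))

    private
      at : ℕ → List ℕ → ℕ → St
      at m Q x = ⟪ enc (nat ∷ arr ∷ []) (m , Q , tt) [] , put (ones x []) [] , [] ⟫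

      loop : Prog
      loop = while 1F isOne (drop 1F ▹ push 0F (bit true) ▹ prog (iszE e))

      searchB : ∀ Q d m → 0 < F (m + d , Q , tt) → ∃[ m′ ] (0 < F (m′ , Q , tt) × ∃[ B ] (loop ⊢ at m Q (isz (F (m , Q , tt))) ⇛ at m′ Q 0 ≤ B))
      searchB Q d m h with 0<-dec (F (m , Q , tt))
      ... | inj₂ p = m , p , 1 , from (cong (at m Q) (isz-pos p)) (whFB refl)
        where isz-pos : ∀ {x} → 0 < x → isz x ≡ 0
              isz-pos (s≤s _) = refl
      searchB Q zero m h | inj₁ z = ⊥-elim (0<⇒≢0 h (trans (cong (λ t → F (t , Q , tt)) (+-identityʳ m)) z))
      searchB Q (suc d) m h | inj₁ z = let m′ , p , B , r = searchB Q d (suc m) (subst (λ t → 0 < F (t , Q , tt)) (+-suc m d) h)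
        in m′ , p , _ , from (cong (λ t → at m Q (isz t)) z) (whTB refl (dropR (true ∷ []) ▸ pushB ▸ correct (iszE e) (suc m , Q , tt) {[]} {[]}) r)

    searcher-computes : ∀ xs K → NonBlank xs → 0 < F (K , codes xs , tt) →
                        ∃[ time ] ∃[ m ] (0 < F (m , codes xs , tt) × Computes (machine searcher) time xs (bit (bool (G (m , codes xs , tt))) ∷ []))
    searcher-computes xs K nx h = finish (searchB Q K 0 h)
      where
      Q = codes xs
      reply : ∀ g → ∃[ B ] (ifp 1F isOne (push 0F (bit true)) (push 0F (bit false)) ⊢ ⟪ [] , put (ones g []) [] , [] ⟫ ⇛ ⟪ bit (bool g) ∷ [] , put (ones g []) [] , [] ⟫ ≤ B)
      reply zero    = _ , ifFB refl pushB
      reply (suc g) = _ , ifTB refl pushB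
      finish : ∃[ m′ ] (0 < F (m′ , Q , tt) × ∃[ B ] (loop ⊢ at 0 Q (isz (F (0 , Q , tt))) ⇛ at m′ Q 0 ≤ B)) →
               ∃[ time ] ∃[ m ] (0 < F (m , Q , tt) × Computes (machine searcher) time xs (bit (bool (G (m , Q , tt))) ∷ []))
      finish (m , p , B , r) = _⊢_⇛_≤_.time (proj₂ d) , m , p , computes {searcher} (_⊢_⇛_≤_.deriv (proj₂ d)) refl (refl ∷ []) ≤-refl
        where
        d : ∃[ B ] (searcher ⊢ ⟪ xs , [] , [] ⟫ ⇛ ⟪ bit (bool (G (m , Q , tt))) ∷ [] , put (ones (G (m , Q , tt)) []) [] , [] ⟫ ≤ B)
        d = _ , (readInB xs nx ▸ pushB {0F} {sep} ▸ correct (iszE e) (0 , Q , tt) {[]} {[]} ▸ r ▸ dropR [] ▸ correct e′ (m , Q , tt) {[]} {[]} ▸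
                 dropE (ones m []) ▸ dropE (word arr Q) ▸ proj₂ (reply (G (m , Q , tt))))

-- The labeling scheme for a given graph, and the theorem

open import Defs hiding (sym)
open WhilePrograms
open Macros
open Arithmetic
open Hierarchy
open Sizes
open LabelLayout
open Queries
open LabelLength
open Codes
open SchemePrograms
open Evaluators
open import Data.Bool using (Bool; true; false; T)
open import Data.Empty using (⊥-elim)
open import Data.Fin as Fin using (Fin; zero; suc; toℕ; fromℕ<)
open import Data.Fin.Properties using (toℕ<n; toℕ-fromℕ<; toℕ-injective)
open import Data.Fin.Subset using (Subset; ∣_∣; _∈_; _∉_; ∁)
open import Data.Fin.Subset.Properties using (x∈∁p⇒x∉p; x∉p⇒x∈∁p; ∣p∣≤n)
open import Data.List using (List; []; _∷_; _++_; length; tabulate)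
open import Data.List.Properties using (map-++; length-++; length-tabulate; concatMap-++)
import Data.List.Membership.Propositional as List
open import Data.List.Relation.Unary.All as All using (All; []; _∷_)
open import Data.Nat.Logarithm using (⌊log₂_⌋)
open import Data.Sum using ([_,_]′)
open import Data.Unit using (tt)
open import Data.Vec using ([]; _∷_; lookup)
open import Data.Vec.Properties using ([]=⇒lookup)
open import Function using (_⇔_; mk⇔; Equivalence)
open import Relation.Binary.Construct.Closure.ReflexiveTransitive using (Star; ε; _◅_; _◅◅_)
open import Relation.Nullary using (¬_)

label-inj : ∀ n f A u v → u < n → v < n → (∀ q → q < count# n f (blog n) → Label.num n f A u q ≡ Label.num n f A v q) → u ≡ v
label-inj n f A u v u< v< s = R.pos-inj u v u< v< lev≡ (trans (cmp≡ _ (proj₁ (R.lev-char u u<))) (cong (λ ℓ → cmpm n A ℓ v) lev≡)) (s 3 (s≤s (s≤s (s≤s (s≤s z≤n)))))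
  where
  module R = Rounds n A (blog n) (<2^blog n)
  lev≡ : levm n A (blog n) u ≡ levm n A (blog n) v
  lev≡ = s 2 (s≤s (s≤s (s≤s z≤n)))
  cmp≡ : ∀ ℓ → ℓ < blog n → cmpm n A ℓ u ≡ cmpm n A ℓ v
  cmp≡ ℓ l = trans (sym (Label.num-cmp n f A u ℓ l)) (trans (s (4 + ℓ) (≤-trans (+-monoʳ-< 4 l) (m≤m+n (4 + blog n) _))) (Label.num-cmp n f A v ℓ l))

-- A word belongs to at most one vertex of a graph; this recovers the fault set from a list that
-- does not name its owners.
match-inj : ∀ n f A Q i u v → f ≤ n → u < n → v < n → 0 < Query.match n f A Q i u → 0 < Query.match n f A Q i v → u ≡ v
match-inj n f A Q i u v f≤n u< v< mu mv = label-inj n f A u v u< v< (proj₂ (proj₂ (same-label n f A n f A u v f≤n f≤n u< v< refl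
  (proj₂ (code-agree (width n) (Label.num n f A u) (labelLength n f) (width n) (Label.num n f A v) (labelLength n f) (λ r → Q ! (i * suc (labelLength n f) + r))
    (Query.match⁻ n f A Q i u mu) (Query.match⁻ n f A Q i v mv))))))

module _ (n f k w : ℕ) (num : ℕ → ℕ → ℕ) (A : List ℕ) (ws : List (List Bool)) (len : All (λ w → length w ≡ k) ws) where

  private
    Q = codes (encodeWords ws)
    module W = Words n f k (λ v → Bits.code# w (num v) k) A Q

  at-match : ∀ {i} v → At ws i (labelWord k (Bits.bit# w (num v))) → 0 < W.match i v
  at-match {i} v a = W.match⁺ i v (λ r l → trans (trans (cong (λ q → q ! (i * suc k + r)) (sym (++-nil Q))) (words-! ws k [] len a l))
    (trans (cong (λ q → q ! r) (codes-word k (Bits.bit# w (num v)) (Bits.bit≤1 w (num v)))) (tab-! (Bits.code# w (num v) k) l)))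

  length-Q : length Q ≡ length ws * suc k + 0
  length-Q = trans (cong length (sym (++-nil Q))) (length-words ws k [] len)

  words≡ : W.words ≡ length ws
  words≡ = trans (cong (λ t → quo t (suc k)) length-Q) (quo-unique (length ws) 0 (suc k) (s≤s z≤n))

  words-total : W.words * W.stride ≡ length Q
  words-total = trans (cong (_* suc k) words≡) (trans (sym (+-identityʳ _)) (sym length-Q))

subset-count : ∀ {n} (F : Subset n) (h : ℕ → ℕ) → (∀ u → h (toℕ u) ≤ bitval (lookup F u)) → Σ< n h ≤ ∣ F ∣
subset-count [] h p = z≤n
subset-count {suc n} (b ∷ F) h p = ≤-trans (≤-reflexive (Σ-split 1 n h)) (≤-trans (+-mono-≤ (p zero) (subset-count F (λ i → h (suc i)) (λ u → p (suc u)))) (≤-reflexive (cons b)))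
  where cons : ∀ b → bitval b + ∣ F ∣ ≡ ∣ b ∷ F ∣
        cons true  = refl
        cons false = refl

-- The number under which a bit matrix occurs in the enumeration `graph`.
value : List ℕ → ℕ
value []      = 0
value (x ∷ l) = value l * 2 + x

value-bits : ∀ l i → (∀ j → l ! j ≤ 1) → i < length l → rem (shr (value l) i) 2 ≡ l ! i
value-bits (x ∷ l) zero    h _       = rem-unique (value l) x 2 (s≤s (h 0))
value-bits (x ∷ l) (suc i) h (s≤s p) = trans (cong (λ t → rem (shr t i) 2) (quo-unique (value l) x 2 (s≤s (h 0)))) (value-bits l i (λ j → h (suc j)) p)

graph-value : ∀ n g → (∀ i → g i ≤ 1) → graph n (value (tab (n * n) g)) ≡ tab (n * n) g
graph-value n g h = tab-cong (n * n) (λ i l → trans (value-bits (tab (n * n) g) i (tab-≤ (n * n) g 1 (λ i _ → h i)) (≤-trans l (≤-reflexive (sym (length-tab (n * n) g))))) (tab-! g l))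

NonBlank-words : ∀ ws → NonBlank (encodeWords ws)
NonBlank-words [] = []
NonBlank-words ([] ∷ ws) = refl ∷ NonBlank-words ws
NonBlank-words ((b ∷ w) ∷ ws) = refl ∷ NonBlank-words (w ∷ ws)

labels-codes : ∀ n f A → labels n f A ≡ codes (encodeLabeling {n} (λ v → labelWord (labelLength n f) (Label.bit# n f A (toℕ v))))
labels-codes n f A = trans (labels-def n f A) (sym (codes-words n (labelLength n f) (λ v → labelWord (labelLength n f) (Label.bit# n f A v)) (Label.labelCode n f A)
  (λ v → codes-word (labelLength n f) (Label.bit# n f A v) (Label.bit≤1 n f A v))))

bool⇔ : ∀ x → bool x ≡ true ⇔ 0 < x
bool⇔ zero    = mk⇔ (λ ()) (λ ())
bool⇔ (suc x) = mk⇔ (λ _ → s≤s z≤n) (λ _ → refl)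

module Scheme {n : ℕ} (G : Graph n) (f c : ℕ) (A : List ℕ) (f≤n : f ≤ n) (graph≡ : graph n c ≡ A)
              (A-adj : ∀ u v → A ! (toℕ u * n + toℕ v) ≡ bitval (adj G u v)) where

  L : Fin n → Label
  L v = labelWord (labelLength n f) (Label.bit# n f A (toℕ v))

  adj-T : ∀ u v → 0 < adjm n A (toℕ u) (toℕ v) → T (adj G u v)
  adj-T u v h = go (adj G u v) (adj G v u) (Graph.sym G u v) (subst (0 <_) (cong₂ _+_ (A-adj u v) (A-adj v u)) h)
    where go : ∀ a b → a ≡ b → 0 < bitval a + bitval b → T a
          go true  _     _ _ = tt
          go false false _ ()

  T-adj : ∀ u v → T (adj G u v) → 0 < adjm n A (toℕ u) (toℕ v)
  T-adj u v h = subst (0 <_) (sym (cong₂ _+_ (A-adj u v) (A-adj v u))) (go (adj G u v) h)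
    where go : ∀ a {x} → T a → 0 < bitval a + x
          go true _ = s≤s z≤n

  module _ (s t : Fin n) (F : Subset n) (few : ∣ F ∣ ≤ f) (lF : List Label) (pres : Presents lF L F) where

    ws : List Label
    ws = L s ∷ L t ∷ lF

    Q : List ℕ
    Q = codes (encodeWords ws)

    L-length : ∀ v → length (L v) ≡ labelLength n f
    L-length v = length-labelWord (labelLength n f) (Label.bit# n f A (toℕ v))

    fault-of : ∀ {l} → l List.∈ lF → ∃[ v ] (v ∈ F × L v ≡ l)
    fault-of {l} = Equivalence.to (pres l)

    lengths : All (λ w → length w ≡ labelLength n f) ws
    lengths = L-length s ∷ L-length t ∷ All.tabulate (λ {l} p → let v , _ , e = fault-of p in trans (cong length (sym e)) (L-length v))

    L-match : ∀ {i} v → At ws i (L v) → 0 < Query.match n f A Q i (toℕ v)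
    L-match v a = at-match n f (labelLength n f) (width n) (Label.num n f A) A ws lengths (toℕ v) a

    words-len : Query.words n f A Q ≡ length ws
    words-len = words≡ n f (labelLength n f) (width n) (Label.num n f A) A ws lengths

    U : List ℕ
    U = Query.alive# n f A Q

    dead : ∀ v → v ∈ F → ¬ (0 < U ! toℕ v)
    dead v v∈F h = 0<⇒≢0 {Query.match n f A Q (2 + proj₁ i) (toℕ v)} (L-match {2 + proj₁ i} v (there (there (proj₂ i)))) (proj₂ (Query.alive-≤ n f A Q (toℕ v) h) (proj₁ i)
        (≤-trans (At-< (proj₂ i)) (≤-reflexive (sym (cong (_∸ 2) words-len)))))
      where i : ∃[ i ] At lF i (L v)
            i = ∈-At (Equivalence.from (pres (L v)) (v , v∈F , refl))

    in-F : ∀ u → U ! toℕ u ≡ 0 → u ∈ F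
    in-F u e = go (Query.alive-≥ n f A Q (toℕ u) (toℕ<n u) e)
      where
      go : ∃[ i ] (i < Query.words n f A Q ∸ 2 × 0 < Query.match n f A Q (2 + i) (toℕ u)) → u ∈ F
      go (i , i< , m) = found-at (At-total lF i (≤-trans i< (≤-reflexive (cong (_∸ 2) words-len))))
        where
        found-at : ∃[ l ] At lF i l → u ∈ F
        found-at (l , a) = owner (fault-of (At-∈ a))
          where
          owner : ∃[ v ] (v ∈ F × L v ≡ l) → u ∈ F
          owner (v , v∈F , e) = subst (_∈ F) (toℕ-injective (match-inj n f A Q (2 + i) (toℕ v) (toℕ u) f≤n (toℕ<n v) (toℕ<n u)
            (L-match {2 + i} v (there (there (subst (At lF i) (sym e) a)))) m)) v∈F

    alive : ∀ u → u ∉ F → 0 < U ! toℕ u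
    alive u u∉F = [ (λ e → ⊥-elim (u∉F (in-F u e))) , (λ h → h) ]′ (0<-dec (U ! toℕ u))

    explained : Query.Explains n f A Q
    explained = record
      { 2≤words = ≤-trans (s≤s (s≤s z≤n)) (≤-reflexive (sym words-len))
      ; total = words-total n f (labelLength n f) (width n) (Label.num n f A) A ws lengths
      ; f≤n = f≤n
      ; matched = λ i l → matched i (At-total ws i (≤-trans l (≤-reflexive words-len)))
      ; few = ≤-trans (subset-count F (λ x → isz (U ! x)) member) few }
      where
      matched : ∀ i → ∃[ l ] At ws i l → ∃[ v ] (v < n × 0 < Query.match n f A Q i v)
      matched 0 (_ , a@here) = toℕ s , toℕ<n s , L-match {0} s a
      matched 1 (_ , a@(there here)) = toℕ t , toℕ<n t , L-match {1} t a
      matched (suc (suc i)) (l , there (there a)) = owner (fault-of (At-∈ a))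
        where
        owner : ∃[ v ] (v ∈ F × L v ≡ l) → ∃[ v ] (v < n × 0 < Query.match n f A Q (2 + i) v)
        owner (v , _ , e) = toℕ v , toℕ<n v , L-match {2 + i} v (there (there (subst (At lF i) (sym e) a)))
      isz-pos : ∀ {x} → 0 < x → isz x ≡ 0
      isz-pos (s≤s _) = refl
      member : ∀ u → isz (U ! toℕ u) ≤ bitval (lookup F u)
      member u = [ (λ e → ≤-trans (isz≤1 (U ! toℕ u)) (≤-reflexive (cong bitval (sym ([]=⇒lookup (in-F u e)))))) ,
                   (λ h → ≤-trans (≤-reflexive (isz-pos {U ! toℕ u} h)) z≤n) ]′ (0<-dec (U ! toℕ u))

    Edge : Fin n → Fin n → Set
    Edge = InducedEdge G (∁ F)

    not-F : ∀ u → 0 < U ! toℕ u → u ∈ ∁ F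
    not-F u h = x∉p⇒x∈∁p (λ u∈F → dead u u∈F h)

    walk⇒star : ∀ {y} u → u ∈ ∁ F → Walk n (adjm n A) (λ x → 0 < U ! x) (toℕ u) y → ∃[ v ] (toℕ v ≡ y × v ∈ ∁ F × Star Edge u v)
    walk⇒star u u∈ here = u , refl , u∈ , ε
    walk⇒star u u∈ (_▻_ {x} {z} w (y< , x< , a , p)) = step′ (walk⇒star u u∈ w)
      where
      v′ = fromℕ< x<
      x≡ : toℕ v′ ≡ x
      x≡ = toℕ-fromℕ< x<
      step′ : ∃[ v ] (toℕ v ≡ z × v ∈ ∁ F × Star Edge u v) → ∃[ v ] (toℕ v ≡ x × v ∈ ∁ F × Star Edge u v)
      step′ (v , refl , v∈ , st) = v′ , x≡ , v′∈ , st ◅◅ ((v∈ , v′∈ , adj-T v v′ (subst (λ q → 0 < adjm n A (toℕ v) q) (sym x≡) a)) ◅ ε)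
        where v′∈ : v′ ∈ ∁ F
              v′∈ = not-F v′ (subst (λ q → 0 < U ! q) (sym x≡) p)

    star⇒walk : ∀ {u v w : Fin n} → Walk n (adjm n A) (λ x → 0 < U ! x) (toℕ w) (toℕ u) → Star Edge u v → Walk n (adjm n A) (λ x → 0 < U ! x) (toℕ w) (toℕ v)
    star⇒walk wk ε = wk
    star⇒walk {u} wk (_◅_ {j = v} (_ , v∈ , a) st) = star⇒walk {v} (wk ▻ (toℕ<n u , toℕ<n v , T-adj u v a , alive v (x∈∁p⇒x∉p v∈))) st

    connected⇒ : 0 < Query.connected n f A Q → ConnectedAvoiding G F s t
    connected⇒ h = go (Query.connected⁻ n f A Q h)
      where
      go : ∃[ s ] ∃[ t ] (s < n × t < n × 0 < Query.match n f A Q 0 s × 0 < Query.match n f A Q 1 t × 0 < U ! s × 0 < U ! t × 0 < reach n A U s ! t) → ConnectedAvoiding G F s t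
      go (s′ , t′ , s< , t< , ms , mt , as , at , r) = s∈ , not-F t (subst (λ q → 0 < U ! q) t≡ at) , finish (walk⇒star s s∈ walk)
        where
        s≡ : s′ ≡ toℕ s
        s≡ = match-inj n f A Q 0 s′ (toℕ s) f≤n s< (toℕ<n s) ms (L-match {0} s here)
        t≡ : t′ ≡ toℕ t
        t≡ = match-inj n f A Q 1 t′ (toℕ t) f≤n t< (toℕ<n t) mt (L-match {1} t (there here))
        s∈ : s ∈ ∁ F
        s∈ = not-F s (subst (λ q → 0 < U ! q) s≡ as)
        walk : Walk n (adjm n A) (λ x → 0 < U ! x) (toℕ s) (toℕ t)
        walk = subst₂ (Walk n (adjm n A) (λ x → 0 < U ! x)) s≡ t≡ (proj₂ (reach-sound n A U s′ t′ r))
        finish : ∃[ v ] (toℕ v ≡ toℕ t × v ∈ ∁ F × Star Edge s v) → Star Edge s t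
        finish (v , e , _ , st) = subst (Star Edge s) (toℕ-injective e) st

    ⇒connected : ConnectedAvoiding G F s t → 0 < Query.connected n f A Q
    ⇒connected (s∈ , t∈ , st) = Query.connected⁺ n f A Q (toℕ s) (toℕ t) (toℕ<n s) (toℕ<n t) (L-match {0} s here) (L-match {1} t (there here))
      (alive s (x∈∁p⇒x∉p s∈)) (alive t (x∈∁p⇒x∉p t∈)) (reach-complete n A U (toℕ s) (toℕ<n s) (star⇒walk {s} {t} {s} here st))

    found-true : 0 < found (suc (n + f + c)) Q
    found-true = subst (0 <_) (sym (found-def (suc (n + f + c)) Q)) (Σ⁺ n (s≤s (≤-trans (m≤m+n n f) (m≤m+n (n + f) c))) (Σ⁺ f (s≤s (≤-trans (m≤n+m f n) (m≤m+n (n + f) c)))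
      (Σ⁺ c (s≤s (m≤n+m c (n + f))) (subst (λ A → 0 < Query.explains n f A Q) (sym graph≡) (Query.explains⁺ n f A Q explained)))))

    -- The search may stop before it reaches the true graph. It suffices that it has found some
    -- explanation, since all explanations agree with the true one.
    answer-correct : ∀ m → 0 < found m Q → bool (answer m Q) ≡ true ⇔ ConnectedAvoiding G F s t
    answer-correct m h = mk⇔ (λ e → connected⇒ (sound (Equivalence.to (bool⇔ (answer m Q)) e)))
                             (λ co → Equivalence.from (bool⇔ (answer m Q)) (complete (⇒connected co)))
      where
      Candidate : (ℕ → ℕ → List ℕ → ℕ) → Set
      Candidate P = ∃[ n′ ] (n′ < m × ∃[ f′ ] (f′ < m × ∃[ c′ ] (c′ < m × 0 < P n′ f′ (graph n′ c′))))
      triple : ∀ P → 0 < Σ< m (λ n → Σ< m (λ f → Σ< m (λ c → P n f (graph n c)))) → Candidate P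
      triple P h = let n′ , n< , h₁ = Σ⁻ m h ; f′ , f< , h₂ = Σ⁻ m h₁ ; c′ , c< , h₃ = Σ⁻ m h₂ in n′ , n< , f′ , f< , c′ , c< , h₃
      sound : 0 < answer m Q → 0 < Query.connected n f A Q
      sound h = go (triple (λ n f A → Query.explains n f A Q * Query.connected n f A Q) (subst (0 <_) (answer-def m Q) h))
        where
        go : Candidate (λ n f A → Query.explains n f A Q * Query.connected n f A Q) → 0 < Query.connected n f A Q
        go (n′ , _ , f′ , _ , c′ , _ , p) = consistent n f A n′ f′ (graph n′ c′) Q explained
          (Query.explains⁻ n′ f′ (graph n′ c′) Q (fst⁺ {Query.explains n′ f′ (graph n′ c′) Q} {Query.connected n′ f′ (graph n′ c′) Q} p))
          (snd⁺ (Query.explains n′ f′ (graph n′ c′) Q) {Query.connected n′ f′ (graph n′ c′) Q} p)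
      complete : 0 < Query.connected n f A Q → 0 < answer m Q
      complete co = go (triple (λ n f A → Query.explains n f A Q) (subst (0 <_) (found-def m Q) h))
        where
        go : Candidate (λ n f A → Query.explains n f A Q) → 0 < answer m Q
        go (n′ , n< , f′ , f< , c′ , c< , p) = subst (0 <_) (sym (answer-def m Q)) (Σ⁺ n′ n< (Σ⁺ f′ f< (Σ⁺ c′ c< (_&_ {Query.explains n′ f′ (graph n′ c′) Q} {Query.connected n′ f′ (graph n′ c′) Q} p
          (consistent n′ f′ (graph n′ c′) n f A Q (Query.explains⁻ n′ f′ (graph n′ c′) Q p) explained co)))))

module Instance {n : ℕ} (G : Graph n) (f : ℕ) where

  rows : List (List Bool)
  rows = tabulate (λ u → tabulate (adj G u))

  X rest : List ℕ
  X = codes (encodeInstance G f)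
  rest = codes (encodeWords (binary f ∷ []))

  X≡ : X ≡ codes (encodeWords rows) ++ rest
  X≡ = trans (cong codes (concatMap-++ encodeWord rows (binary f ∷ []))) (map-++ codeOf (encodeWords rows) (encodeWords (binary f ∷ [])))

  rest≡ : rest ≡ codes (encodeWord (binary f))
  rest≡ = cong codes (++-nil (encodeWord (binary f)))

  rows-length : All (λ w → length w ≡ n) rows
  rows-length = All-tabulate (λ u → length-tabulate (adj G u))
    where All-tabulate : ∀ {A : Set} {P : A → Set} {m} {h : Fin m → A} → (∀ u → P (h u)) → All P (tabulate h)
          All-tabulate {m = zero}  p = []
          All-tabulate {m = suc m} p = p zero ∷ All-tabulate (λ u → p (suc u))

  rows# : length rows ≡ n
  rows# = length-tabulate (λ u → tabulate (adj G u))

  size≡ : size# X ≡ n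
  size≡ = cong (_∸ 1) (trans (cong seps (sym (++-nil X))) (trans (seps-words (rows ++ binary f ∷ []) [])
    (trans (+-identityʳ _) (trans (length-++ rows) (trans (cong (_+ 1) rows#) (+-comm n 1))))))

  faults≡ : faults# X n ≡ n ⊓ f
  faults≡ = trans (cut-⊓ n _) (trans (cong (λ k → n ⊓ Σ< k (λ i → (X ! (n * suc n + i) ∸ 2) * doubled n i (cut n 1))) len)
    (trans (truncated n (binary f) 1 (λ i → X ! (n * suc n + i) ∸ 2) digit) (cong (n ⊓_) (trans (*-identityʳ _) (decimal-binary f)))))
    where
    len : length X ∸ suc (n * suc n) ≡ length (binary f)
    len = trans (cong (_∸ suc (n * suc n)) (trans (cong length X≡) (trans (length-words rows n rest rows-length)
      (trans (cong₂ (λ a b → a * suc n + b) rows# (trans (cong length rest≡) (length-codes (binary f)))) (+-suc (n * suc n) (length (binary f)))))))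
      (m+n∸m≡n (n * suc n) (length (binary f)))
    digit : ∀ {i x} → At (binary f) i x → X ! (n * suc n + i) ∸ 2 ≡ bitval x
    digit {i} a = cong (_∸ 2) (trans (cong₂ _!_ X≡ (cong (λ t → t * suc n + i) (sym rows#))) (trans (words-rest rows n rest rows-length i)
      (trans (cong (λ l → l ! i) rest≡) (word-! a))))

  cell : ℕ → ℕ
  cell i = eq (X ! (quo i n * suc n + rem i n)) 3

  matrix-adj : ∀ u v → matrix X n ! (toℕ u * n + toℕ v) ≡ bitval (adj G u v)
  matrix-adj u v = trans (tab-! cell (radix< (toℕ<n u) (toℕ<n v)))
    (trans (cong₂ (λ a b → eq (X ! (a * suc n + b)) 3) (quo-unique (toℕ u) (toℕ v) n (toℕ<n v)) (rem-unique (toℕ u) (toℕ v) n (toℕ<n v)))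
    (trans (cong (λ t → eq t 3) (trans (cong (λ l → l ! (toℕ u * suc n + toℕ v)) X≡)
      (trans (words-! rows n rest rows-length (At-tabulate (λ u → tabulate (adj G u)) u) (m<n⇒m<1+n (toℕ<n v))) (word-! (At-tabulate (adj G u) v)))))
      (is-one (adj G u v))))
    where is-one : ∀ b → eq (2 + bitval b) 3 ≡ bitval b
          is-one true  = refl
          is-one false = refl

opaque
  labelerMachine : ∃[ labeler ] ∃[ k ] (∀ xs ys → NonBlank xs → NonBlank ys →
                   labels (size# (codes xs)) (faults# (codes xs) (size# (codes xs))) (matrix (codes xs) (size# (codes xs))) ≡ codes ys →
                   Computes labeler (k + length xs ^ k) xs ys)
  labelerMachine = machine (evaluator labeler₀) , evaluator-computes labeler₀

  querierMachine : ∃[ querier ] (∀ xs K → NonBlank xs → 0 < found K (codes xs) →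
                   ∃[ time ] ∃[ m ] (0 < found m (codes xs) × Computes querier time xs (bit (bool (answer m (codes xs))) ∷ [])))
  querierMachine = machine (searcher found₀ answer₀) , searcher-computes found₀ answer₀

theorem1p2 : ∃[ labeler ] ∃[ querier ] ∃[ k ] ∃[ C ]
    ((n : ℕ) (G : Graph n) (f : ℕ) → 1 ≤ f →
    ∃[ L ]
    ( Computes labeler (k + length (encodeInstance G f) ^ k) (encodeInstance G f) (encodeLabeling L)
    × (2 ≤ n → (v : Fin n) → length (L v) ≤ C * (f ^ 7 * ⌊log₂ n ⌋ ^ 13))
    × ((s t : Fin n) (F : Subset n) → ∣ F ∣ ≤ f →
    (lF : List Label) → Presents lF L F →
    ∃[ time ] ∃[ answer ]
    ( Computes querier time (encodeQuery (L s) (L t) lF) (bit answer ∷ [])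
    × (answer ≡ true ⇔ ConnectedAvoiding G F s t)))))
theorem1p2 = labeler , querier , k , proj₁ labelLength-bounded , λ n G f 1≤f → L n G f , computed n G f , short n G f 1≤f , answered n G f
  where
  labeler querier : Machine
  labeler = proj₁ labelerMachine
  querier = proj₁ querierMachine
  k : ℕ
  k = proj₁ (proj₂ labelerMachine)
  module _ (n : ℕ) (G : Graph n) (f : ℕ) where
    module I = Instance G f
    f′ : ℕ
    -- No fault set has more than `n` elements, so this loses nothing; it keeps the parameters
    -- polynomial in `n` and lets them fit into the entries of a label.
    f′ = n ⊓ f
    A : List ℕ
    A = matrix I.X n
    module S = Scheme G f′ (value A) A (m⊓n≤m n f) (graph-value n I.cell (λ i → isz≤1 _)) I.matrix-adj
    L : Fin n → Label
    L = S.L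
    computed : Computes labeler (k + length (encodeInstance G f) ^ k) (encodeInstance G f) (encodeLabeling L)
    computed = proj₂ (proj₂ labelerMachine) (encodeInstance G f) (encodeLabeling L) (NonBlank-words (I.rows ++ binary f ∷ [])) (NonBlank-words (tabulate L))
      (trans (cong (λ m → labels m (faults# I.X m) (matrix I.X m)) I.size≡) (trans (cong (λ g → labels n g A) I.faults≡) (labels-codes n f′ A)))
    short : 1 ≤ f → 2 ≤ n → (v : Fin n) → length (L v) ≤ proj₁ labelLength-bounded * (f ^ 7 * ⌊log₂ n ⌋ ^ 13)
    short 1≤f 2≤n v = ≤-trans (≤-reflexive (length-labelWord (labelLength n f′) (Label.bit# n f′ A (toℕ v)))) (proj₂ labelLength-bounded n f′ f 1≤f (m⊓n≤n n f) 2≤n)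
    answered : (s t : Fin n) (F : Subset n) → ∣ F ∣ ≤ f → (lF : List Label) → Presents lF L F →
               ∃[ time ] ∃[ answer ] (Computes querier time (encodeQuery (L s) (L t) lF) (bit answer ∷ []) × (answer ≡ true ⇔ ConnectedAvoiding G F s t))
    answered s t F few lF pres = conclude (proj₂ querierMachine xs (suc (n + f′ + value A)) (NonBlank-words (L s ∷ L t ∷ lF)) (S.found-true s t F few′ lF pres))
      where
      xs : List Symbol
      xs = encodeQuery (L s) (L t) lF
      few′ : ∣ F ∣ ≤ f′
      few′ = ⊓-glb (∣p∣≤n F) few
      conclude : ∃[ time ] ∃[ m ] (0 < found m (codes xs) × Computes querier time xs (bit (bool (answer m (codes xs))) ∷ [])) →
                 ∃[ time ] ∃[ answer ] (Computes querier time xs (bit answer ∷ []) × (answer ≡ true ⇔ ConnectedAvoiding G F s t))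
      conclude (time , m , p , r) = time , bool (answer m (codes xs)) , r , S.answer-correct s t F few′ lF pres m p
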